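{- Let $p$ be a prime and $1\le k,n<p$ distinct integers, let $r=\gcd(k,n)$ and assume $r\le 0.5\sqrt n$. Let $$F_{k,n}(X,Y)=(X^n+Y^n-1)^{k/r}-(X^k+Y^k-1)^{n/r}\in\mathbb F_p[X,Y],\qquad N_{k,n}=\#\{(x,y)\in\mathbb F_p^2:\ F_{k,n}(x,y)=0\}.$$ Then $$N_{k,n}\ll \frac{k\sqrt n\,p}{r}+\left(\frac{kn}{r}\right)^{4/3}p^{2/3}.$$
   Context: $\mathbb F_p$ is the finite field with $p$ elements. The notation $U\ll V$ means $|U|\le cV$ for an absolute constant $c>0$. -}

module Defs where

open import Data.Nat using (ℕ; zero; suc; _+_; _*_; _∸_; _^_; _/_; _%_)
open import Data.Nat.Properties using (_≟_)
open import Data.Nat.GCD using (gcd)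
open import Data.List using (List; length; filter; cartesianProduct; upTo)
open import Data.Product using (_×_; _,_)
open import Relation.Binary.PropositionalEquality using (_≡_)
open import Relation.Nullary using (Dec)

-- Integer division with the convention  m ÷ 0 = 0  (only used with a nonzero divisor).
_÷_ : ℕ → ℕ → ℕ
m ÷ zero  = 0
m ÷ suc d = m / suc d

-- Reduction modulo p (convention: x mod 0 = x; only used for p prime).
_mod_ : ℕ → ℕ → ℕ
x mod zero  = x
x mod suc q = x % suc q

-- Residues of the two terms of F_{k,n}(x,y) in F_p, where x, y ∈ {0,…,p-1}
-- represent the elements of F_p and  -1  is represented by  p - 1.
--   F_{k,n}(X,Y) = (X^n + Y^n - 1)^(k/r) - (X^k + Y^k - 1)^(n/r),  r = gcd k n.
term₁ term₂ : (p k n x y : ℕ) → ℕ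
term₁ p k n x y = ((x ^ n + y ^ n + (p ∸ 1)) ^ (k ÷ gcd k n)) mod p
term₂ p k n x y = ((x ^ k + y ^ k + (p ∸ 1)) ^ (n ÷ gcd k n)) mod p

IsZero : (p k n : ℕ) → ℕ × ℕ → Set
IsZero p k n (x , y) = term₁ p k n x y ≡ term₂ p k n x y

isZero? : (p k n : ℕ) → (xy : ℕ × ℕ) → Dec (IsZero p k n xy)
isZero? p k n (x , y) = term₁ p k n x y ≟ term₂ p k n x y

N : (p k n : ℕ) → ℕ
N p k n = length (filter (isZero? p k n) (cartesianProduct (upTo p) (upTo p)))

{-# OPTIONS --safe #-}
module Submission where

-- By symmetry let k < n. Put d = kn/r; then F has degree at most d. A component of degree e has at most e p rational points, whence
-- N ≤ d p, and the task is to gain a factor m of the order of min(√n, (p/d)^{1/3}). Work with the irreducible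
-- factors G of F one at a time, and with the derivation D = G_Y ∂_X - G_X ∂_Y along G.
-- If deg G = e > m, Stepanov's method with an auxiliary polynomial Σ a_l f_l^p, the f_l running over monomials of
-- degree at most m, gives O(e p / m) points; a rank argument replaces the usual nonvanishing via Wronskians.
-- If e ≤ m, let U = X^n + Y^n - 1 and V = X^k + Y^k - 1. Differentiating U^(k/r) = V^(n/r) gives, on G, a linear
-- relation between X^n, Y^n and 1 whose coefficients have degree O(k + e). The contact of G with the line X = 0
-- bounds the divisibility by powers of X, so k = O(e) and G has O(e (k + e)) points, provided that G(0,Y) has at
-- least e/2 degrees between its lowest and its highest term.
-- The remaining factors have total degree O(k), since F(0,Y) has nonzero coefficients in degrees k and d - k; they
-- contribute O(k p) points, and k m = O(d) because r ≤ √n / 2.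

open import Level using (0ℓ)
open import Algebra.Core using (Op₁; Op₂)
open import Algebra.Bundles using (CommutativeRing)
open import Algebra.Structures using (IsCommutativeRing)
import Algebra.Properties.Ring as RingProperties
import Algebra.Solver.Ring as RingSolver
open import Algebra.Solver.Ring.AlmostCommutativeRing using (AlmostCommutativeRing; fromCommutativeRing; _-Raw-AlmostCommutative⟶_)
open import Data.Empty using (⊥; ⊥-elim)
open import Data.Fin as Fin using (Fin; zero; suc; toℕ; fromℕ<; _↑ˡ_; _↑ʳ_; splitAt; combine)
open import Data.Fin.Properties using (splitAt-↑ˡ; splitAt-↑ʳ; splitAt⁻¹-↑ˡ; splitAt⁻¹-↑ʳ; combine-surjective; toℕ<n; toℕ-fromℕ<; ¬∀⟶∃¬)
open import Data.Integer as ℤ using (ℤ)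
import Data.Integer.Properties as ℤ
open import Data.List using (List; []; _∷_; map; length; _++_; filter; upTo; tabulate; cartesianProduct)
open import Data.List.Properties using (≡-dec; length-map; length-++; length-upTo; length-tabulate; filter-notAll; length-filter)
open import Data.List.Membership.Propositional using (_∈_)
open import Data.List.Membership.Propositional.Properties using (∈-map⁺; ∈-++⁺ˡ; ∈-++⁺ʳ; ∈-upTo⁺; ∈-upTo⁻; ∈-filter⁺; ∈-filter⁻; ∈-cartesianProduct⁻)
open import Data.List.Relation.Unary.All as All using (All; []; _∷_)
open import Data.List.Relation.Unary.All.Properties using (map⁺; map⁻; ++⁻ˡ; ++⁻ʳ; tabulate⁻; all-filter; filter⁺)
open import Data.List.Relation.Unary.AllPairs using ([]; _∷_)
open import Data.List.Relation.Unary.Any as Any using (here; there)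
open import Data.List.Relation.Unary.Unique.Propositional using (Unique)
import Data.List.Relation.Unary.Unique.Propositional.Properties as Unique
open import Data.Maybe as Maybe using (Maybe)
open import Data.Nat as ℕ using (ℕ; zero; suc; z≤n; s≤s; _∸_)
open import Data.Nat.Base using (_!)
open import Data.Nat.Divisibility as ℕ∣ using (∣⇒≤; ∣m∣n⇒∣m+n; ∣m+n∣m⇒∣n; n∣m*n)
open import Data.Nat.Primality using (Prime)
import Data.Nat.Properties as ℕ
import Data.Nat.Solver as NatSolver
open import Data.Product using (∃; _×_; _,_; proj₁; proj₂)
open import Data.Sum using (_⊎_; inj₁; inj₂; [_,_]′)
open import Data.Unit using (tt)
open import Relation.Binary.Definitions using (DecidableEquality; Tri; tri<; tri≈; tri>)
open import Relation.Binary.PropositionalEquality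
open import Relation.Nullary using (¬_; Dec; yes; no)
open import Relation.Nullary.Decidable using (dec⇒maybe; map′; recompute; ¬¬-excluded-middle; decidable-stable; ¬?; _×-dec_)
open import Relation.Unary using (Decidable)

-- No valuations and no places of the function field of G are used. Upper bounds rest on one
-- inequality, `bezout`: polynomials that are independent modulo the ideal of G and Ψ number at most
-- deg G times deg Ψ, since a linear system with more unknowns than equations has a nonzero
-- solution. Multiplicities at points, and contact with the line X = 0, enter only through explicit
-- families that are independent modulo a larger space. Orders of vanishing are read off from
-- iterates of D. In characteristic p these are faithful only below order p, where the binomial
-- coefficients of Leibniz's rule are invertible; conditions such as e m < p come from this. The
-- obstacle in Stepanov's method is that Σ a_l f_l^p may vanish on the whole curve although the a_l
-- do not. The rank argument does not exclude this case; it shows that the a_l then vanish so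
-- strongly at the rational points that there are few points anyway. Divisibility and irreducibility
-- are never decided, so factorisations live under a double negation, which is removed only at
-- inequalities between natural numbers.

-- Commutative rings, an integer solver, and binomial sums.

record Ring : Set₁ where
  infixl 6 _+_ _-_
  infixl 7 _*_
  infix 8 -_
  infix 4 _≟_
  field
    Carrier           : Set
    _+_ _*_           : Op₂ Carrier
    -_                : Op₁ Carrier
    0# 1#             : Carrier
    isCommutativeRing : IsCommutativeRing _≡_ _+_ _*_ -_ 0# 1#
    _≟_               : DecidableEquality Carrier

  commutativeRing : CommutativeRing 0ℓ 0ℓ
  commutativeRing = record { isCommutativeRing = isCommutativeRing }

  open IsCommutativeRing isCommutativeRing public
    using (+-assoc; +-comm; +-identityˡ; +-identityʳ; *-assoc; *-comm; *-identityˡ; *-identityʳ;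
           distribˡ; distribʳ; zeroˡ; zeroʳ; -‿inverseˡ; -‿inverseʳ)
  open RingProperties (CommutativeRing.ring commutativeRing) public
    using (-‿distribˡ-*; -‿distribʳ-*; -0#≈0#; -‿involutive; -‿+-comm)

  _-_ : Op₂ Carrier
  x - y = x + (- y)

module ℕS = NatSolver.+-*-Solver

module RingTheory (R : Ring) where
  open import Data.Integer using (+_; -[1+_])
  open Ring R
  open ≡-Reasoning

  infixr 8 _^_

  nat : ℕ → Carrier
  nat zero    = 0#
  nat (suc n) = 1# + nat n

  _^_ : Carrier → ℕ → Carrier
  x ^ zero  = 1#
  x ^ suc n = x * x ^ n

  nat-+ : ∀ m n → nat (m ℕ.+ n) ≡ nat m + nat n
  nat-+ zero    n = sym (+-identityˡ _)
  nat-+ (suc m) n = trans (cong (λ z → 1# + z) (nat-+ m n)) (sym (+-assoc _ _ _))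

  nat-* : ∀ m n → nat (m ℕ.* n) ≡ nat m * nat n
  nat-* zero    n = sym (zeroˡ _)
  nat-* (suc m) n = begin
    nat (n ℕ.+ m ℕ.* n)        ≡⟨ nat-+ n (m ℕ.* n) ⟩
    nat n + nat (m ℕ.* n)      ≡⟨ cong (λ z → nat n + z) (nat-* m n) ⟩
    nat n + nat m * nat n      ≡⟨ cong (λ z → z + nat m * nat n) (sym (*-identityˡ _)) ⟩
    1# * nat n + nat m * nat n ≡⟨ sym (distribʳ _ _ _) ⟩
    (1# + nat m) * nat n       ∎

  nat-1 : nat 1 ≡ 1#
  nat-1 = +-identityʳ 1#

  private
    int : ℤ → Carrier
    int (+ n)    = nat n
    int -[1+ n ] = - nat (suc n)

    cancel : ∀ x y → (1# + x) - (1# + y) ≡ x - y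
    cancel x y = begin
      (1# + x) - (1# + y)       ≡⟨ cong₂ _+_ (+-comm 1# x) (sym (-‿+-comm 1# y)) ⟩
      (x + 1#) + (- 1# - y)     ≡⟨ +-assoc x 1# _ ⟩
      x + (1# + (- 1# - y))     ≡⟨ cong (λ z → x + z) (sym (+-assoc 1# (- 1#) _)) ⟩
      x + ((1# + - 1#) - y)     ≡⟨ cong (λ z → x + (z - y)) (-‿inverseʳ 1#) ⟩
      x + (0# - y)              ≡⟨ cong (λ z → x + z) (+-identityˡ _) ⟩
      x - y                     ∎

    int-⊖ : ∀ m n → int (m ℤ.⊖ n) ≡ nat m - nat n
    int-⊖ zero    zero    = sym (-‿inverseʳ 0#)
    int-⊖ zero    (suc n) = sym (+-identityˡ _)
    int-⊖ (suc m) zero    = sym (trans (cong (λ z → nat (suc m) + z) -0#≈0#) (+-identityʳ _))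
    int-⊖ (suc m) (suc n) = begin
      int (suc m ℤ.⊖ suc n)   ≡⟨ cong int (ℤ.[1+m]⊖[1+n]≡m⊖n m n) ⟩
      int (m ℤ.⊖ n)           ≡⟨ int-⊖ m n ⟩
      nat m - nat n           ≡⟨ sym (cancel _ _) ⟩
      nat (suc m) - nat (suc n) ∎

    int-+ : ∀ i j → int (i ℤ.+ j) ≡ int i + int j
    int-+ (+ m)    (+ n)    = nat-+ m n
    int-+ (+ m)    -[1+ n ] = int-⊖ m (suc n)
    int-+ -[1+ m ] (+ n)    = trans (int-⊖ n (suc m)) (+-comm _ _)
    int-+ -[1+ m ] -[1+ n ] = begin
      - nat (suc (suc (m ℕ.+ n)))     ≡⟨ cong (λ z → - nat z) (sym (ℕ.+-suc (suc m) n)) ⟩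
      - nat (suc m ℕ.+ suc n)         ≡⟨ cong -_ (nat-+ (suc m) (suc n)) ⟩
      - (nat (suc m) + nat (suc n))   ≡⟨ sym (-‿+-comm _ _) ⟩
      - nat (suc m) - nat (suc n)     ∎

    int-neg : ∀ i → int (ℤ.- i) ≡ - int i
    int-neg (+ zero)  = sym -0#≈0#
    int-neg (+ suc n) = refl
    int-neg -[1+ n ]  = sym (-‿involutive _)

    int-*-pos : ∀ m j → int (+ m ℤ.* j) ≡ nat m * int j
    int-*-pos m (+ n)    = trans (cong int (sym (ℤ.pos-* m n))) (nat-* m n)
    int-*-pos m -[1+ n ] = begin
      int (+ m ℤ.* -[1+ n ])       ≡⟨ cong int (sym (ℤ.neg-distribʳ-* (+ m) (+ suc n))) ⟩
      int (ℤ.- (+ m ℤ.* + suc n))  ≡⟨ int-neg (+ m ℤ.* + suc n) ⟩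
      - int (+ m ℤ.* + suc n)      ≡⟨ cong -_ (int-*-pos m (+ suc n)) ⟩
      - (nat m * nat (suc n))      ≡⟨ -‿distribʳ-* _ _ ⟩
      nat m * - nat (suc n)        ∎

    int-* : ∀ i j → int (i ℤ.* j) ≡ int i * int j
    int-* (+ m)    j = int-*-pos m j
    int-* -[1+ m ] j = begin
      int (-[1+ m ] ℤ.* j)         ≡⟨ cong int (sym (ℤ.neg-distribˡ-* (+ suc m) j)) ⟩
      int (ℤ.- (+ suc m ℤ.* j))    ≡⟨ int-neg (+ suc m ℤ.* j) ⟩
      - int (+ suc m ℤ.* j)        ≡⟨ cong -_ (int-*-pos (suc m) j) ⟩
      - (nat (suc m) * int j)      ≡⟨ -‿distribˡ-* _ _ ⟩
      - nat (suc m) * int j        ∎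

    almost : AlmostCommutativeRing 0ℓ 0ℓ
    almost = fromCommutativeRing commutativeRing

    -- int, with the values at 0, 1 and -1 made syntactically 0#, 1# and - 1#
    int′ : ℤ → Carrier
    int′ (+ 1)     = 1#
    int′ -[1+ 0 ]  = - 1#
    int′ i         = int i

    int′≡int : ∀ i → int′ i ≡ int i
    int′≡int (+ 0)             = refl
    int′≡int (+ 1)             = sym nat-1
    int′≡int (+ suc (suc n))   = refl
    int′≡int -[1+ 0 ]          = cong -_ (sym nat-1)
    int′≡int -[1+ suc n ]      = refl

    -- With coefficients in ℤ, where equality is decided, the solver cancels opposite terms in every
    -- ring, whatever its characteristic.
    fromℤ : CommutativeRing.rawRing ℤ.+-*-commutativeRing -Raw-AlmostCommutative⟶ almost
    fromℤ = record
      { ⟦_⟧ = int′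
      ; +-homo = λ i j → trans (int′≡int (i ℤ.+ j)) (trans (int-+ i j) (sym (cong₂ _+_ (int′≡int i) (int′≡int j))))
      ; *-homo = λ i j → trans (int′≡int (i ℤ.* j)) (trans (int-* i j) (sym (cong₂ _*_ (int′≡int i) (int′≡int j))))
      ; -‿homo = λ i → trans (int′≡int (ℤ.- i)) (trans (int-neg i) (sym (cong -_ (int′≡int i))))
      ; 0-homo = refl ; 1-homo = refl }

    int≟ : ∀ i j → Maybe (int′ i ≡ int′ j)
    int≟ i j = Maybe.map (cong int′) (dec⇒maybe (i ℤ.≟ j))

  module Solver where
    open RingSolver (CommutativeRing.rawRing ℤ.+-*-commutativeRing) almost fromℤ int≟ public
      using (solve; _:=_; _:+_; _:*_; _:-_; :-_; con)

  open Solver using (solve; _:=_; _:+_; _:*_; _:-_; :-_)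

  x-y≡0⇒x≡y : ∀ {x y} → x - y ≡ 0# → x ≡ y
  x-y≡0⇒x≡y {x} {y} e = begin
    x           ≡⟨ solve 2 (λ x y → x := (x :- y) :+ y) refl x y ⟩
    (x - y) + y ≡⟨ cong (λ z → z + y) e ⟩
    0# + y      ≡⟨ +-identityˡ y ⟩
    y           ∎

  x≡y⇒x-y≡0 : ∀ {x y} → x ≡ y → x - y ≡ 0#
  x≡y⇒x-y≡0 {x} refl = -‿inverseʳ x

  -x≡0⇒x≡0 : ∀ {x} → - x ≡ 0# → x ≡ 0#
  -x≡0⇒x≡0 {x} e = trans (sym (-‿involutive x)) (trans (cong -_ e) -0#≈0#)

  ^-+ : ∀ x m n → x ^ (m ℕ.+ n) ≡ x ^ m * x ^ n
  ^-+ x zero    n = sym (*-identityˡ _)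
  ^-+ x (suc m) n = trans (cong (λ z → x * z) (^-+ x m n)) (sym (*-assoc _ _ _))

  1^ : ∀ n → 1# ^ n ≡ 1#
  1^ zero    = refl
  1^ (suc n) = trans (*-identityˡ _) (1^ n)

  -- ad n f sums f i j over i + j = n
  ad : ℕ → (ℕ → ℕ → Carrier) → Carrier
  ad zero    f = f 0 0
  ad (suc n) f = f 0 (suc n) + ad n (λ i j → f (suc i) j)

  ad-cong : ∀ n {f g} → (∀ i j → i ℕ.+ j ≡ n → f i j ≡ g i j) → ad n f ≡ ad n g
  ad-cong zero    e = e 0 0 refl
  ad-cong (suc n) e = cong₂ _+_ (e 0 (suc n) refl) (ad-cong n (λ i j q → e (suc i) j (cong suc q)))

  ad-0 : ∀ n {f} → (∀ i j → i ℕ.+ j ≡ n → f i j ≡ 0#) → ad n f ≡ 0#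
  ad-0 zero    e = e 0 0 refl
  ad-0 (suc n) e = trans (cong₂ _+_ (e 0 (suc n) refl) (ad-0 n (λ i j q → e (suc i) j (cong suc q)))) (+-identityˡ 0#)

  ad-single : ∀ a b {f} → (∀ i j → i ℕ.+ j ≡ a ℕ.+ b → i ≢ a → f i j ≡ 0#) → ad (a ℕ.+ b) f ≡ f a b
  ad-single zero zero       e = refl
  ad-single zero (suc b) {f} e =
    trans (cong (λ z → f 0 (suc b) + z) (ad-0 b (λ i j q → e (suc i) j (cong suc q) (λ ())))) (+-identityʳ _)
  ad-single (suc a) b {f} e =
    trans (cong₂ _+_ (e 0 _ refl (λ ()))
                     (ad-single a b (λ i j q i≢a → e (suc i) j (cong suc q) (λ eq → i≢a (ℕ.suc-injective eq)))))
          (+-identityˡ _)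

  -- bs n f is the sum of f i j over i + j = n, weighted by the binomial coefficients
  bs : ℕ → (ℕ → ℕ → Carrier) → Carrier
  bs zero    f = f 0 0
  bs (suc n) f = bs n (λ i j → f (suc i) j) + bs n (λ i j → f i (suc j))

  bs-cong : ∀ n {f g} → (∀ i j → i ℕ.+ j ≡ n → f i j ≡ g i j) → bs n f ≡ bs n g
  bs-cong zero    e = e 0 0 refl
  bs-cong (suc n) e = cong₂ _+_ (bs-cong n (λ i j q → e (suc i) j (cong suc q)))
                                (bs-cong n (λ i j q → e i (suc j) (trans (ℕ.+-suc i j) (cong suc q))))

  bs-0 : ∀ n {f} → (∀ i j → i ℕ.+ j ≡ n → f i j ≡ 0#) → bs n f ≡ 0#
  bs-0 zero    e = e 0 0 refl
  bs-0 (suc n) e = trans (cong₂ _+_ (bs-0 n (λ i j q → e (suc i) j (cong suc q)))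
                                    (bs-0 n (λ i j q → e i (suc j) (trans (ℕ.+-suc i j) (cong suc q)))))
                         (+-identityˡ 0#)

  bs-+ : ∀ n (f g : ℕ → ℕ → Carrier) → bs n (λ i j → f i j + g i j) ≡ bs n f + bs n g
  bs-+ zero    f g = refl
  bs-+ (suc n) f g = trans (cong₂ _+_ (bs-+ n _ _) (bs-+ n _ _))
    (solve 4 (λ a b c d → (a :+ b) :+ (c :+ d) := (a :+ c) :+ (b :+ d)) refl _ _ _ _)

  bs-* : ∀ n c (f : ℕ → ℕ → Carrier) → bs n (λ i j → c * f i j) ≡ c * bs n f
  bs-* zero    c f = refl
  bs-* (suc n) c f = trans (cong₂ _+_ (bs-* n c _) (bs-* n c _)) (sym (distribˡ c _ _))

  -- β·binom(n+1,β) = (n+1)·binom(n,β-1), summed against f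
  bs-euler : ∀ n (f : ℕ → ℕ → Carrier) → bs (suc n) (λ i j → nat j * f i j) ≡ nat (suc n) * bs n (λ i j → f i (suc j))
  bs-euler zero f =
    solve 4 (λ u v w z → con (+ 0) :* u :+ v :* w := v :* w) refl (f 1 0) (nat 1) (f 0 1) 0#
    where open Solver using (con)
  bs-euler (suc n) f = begin
    bs (suc n) (λ i j → nat j * f (suc i) j) + bs (suc n) (λ i j → nat (suc j) * f i (suc j))
      ≡⟨ cong₂ _+_ (bs-euler n (λ i j → f (suc i) j))
          (trans (bs-cong (suc n) (λ i j _ → solve 3 (λ o a b → (o :+ a) :* b := o :* b :+ a :* b) refl 1# (nat j) (f i (suc j))))
          (trans (bs-+ (suc n) (λ i j → 1# * f i (suc j)) (λ i j → nat j * f i (suc j)))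
                 (cong₂ _+_ (bs-* (suc n) 1# (λ i j → f i (suc j))) (bs-euler n (λ i j → f i (suc j)))))) ⟩
    N * bs n (λ i j → f (suc i) (suc j)) + (1# * (A + B) + N * B)
      ≡⟨ solve 4 (λ o N A B → N :* A :+ (o :* (A :+ B) :+ N :* B) := (o :+ N) :* (A :+ B)) refl 1# N A B ⟩
    nat (suc (suc n)) * (A + B) ∎
    where
    N = nat (suc n)
    A = bs n (λ i j → f (suc i) (suc j))
    B = bs n (λ i j → f i (suc (suc j)))

  -- ch i j is the binomial coefficient (i + j choose i)
  ch : ℕ → ℕ → ℕ
  ch zero    j       = 1
  ch (suc i) zero    = 1
  ch (suc i) (suc j) = ch i (suc j) ℕ.+ ch (suc i) j

  -- Kept free of division so that it can be read modulo p: if `ch i j` were zero there, so would be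
  -- (i + j)!, which is impossible for i + j < p.
  ch-! : ∀ i j → ch i j ℕ.* (i ! ℕ.* j !) ≡ (i ℕ.+ j) !
  ch-! zero    j       = trans (ℕ.*-identityˡ _) (ℕ.*-identityˡ _)
  ch-! (suc i) zero    = trans (ℕ.*-identityˡ _) (trans (ℕ.*-identityʳ _) (cong _! (sym (ℕ.+-identityʳ (suc i)))))
  ch-! (suc i) (suc j) = begin
    (ch i (suc j) ℕ.+ ch (suc i) j) ℕ.* (suc i ! ℕ.* suc j !)
      ≡⟨ ℕS.solve 6 (λ a b I J i j → (a ℕS.:+ b) ℕS.:* ((I ℕS.:* i) ℕS.:* (J ℕS.:* j))
           ℕS.:= I ℕS.:* (a ℕS.:* (i ℕS.:* (J ℕS.:* j))) ℕS.:+ J ℕS.:* (b ℕS.:* ((I ℕS.:* i) ℕS.:* j))) refl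
           (ch i (suc j)) (ch (suc i) j) (suc i) (suc j) (i !) (j !) ⟩
    suc i ℕ.* (ch i (suc j) ℕ.* (i ! ℕ.* suc j !)) ℕ.+ suc j ℕ.* (ch (suc i) j ℕ.* (suc i ! ℕ.* j !))
      ≡⟨ cong₂ (λ u v → suc i ℕ.* u ℕ.+ suc j ℕ.* v) (trans (ch-! i (suc j)) (cong _! (ℕ.+-suc i j))) (ch-! (suc i) j) ⟩
    suc i ℕ.* suc (i ℕ.+ j) ! ℕ.+ suc j ℕ.* suc (i ℕ.+ j) !
      ≡⟨ sym (ℕ.*-distribʳ-+ (suc (i ℕ.+ j) !) (suc i) (suc j)) ⟩
    (suc i ℕ.+ suc j) ℕ.* suc (i ℕ.+ j) ! ≡⟨ cong (λ z → (suc i ℕ.+ suc j) ℕ.* z !) (sym (ℕ.+-suc i j)) ⟩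
    (suc i ℕ.+ suc j) ! ∎

  -- The weights of `bs` are implicit in its recursion; here they become explicit, for an
  -- antidiagonal with a single nonzero entry.
  bs-single : ∀ a b {f : ℕ → ℕ → Carrier} → (∀ i j → i ℕ.+ j ≡ a ℕ.+ b → i ≢ a → f i j ≡ 0#) →
    bs (a ℕ.+ b) f ≡ nat (ch a b) * f a b
  bs-single zero zero {f} z = sym (trans (cong (λ u → u * f 0 0) nat-1) (*-identityˡ _))
  bs-single zero (suc b) {f} z = trans (cong₂ _+_
      (bs-0 b (λ i j q → z (suc i) j (cong suc q) (λ ())))
      (bs-single zero b (λ i j q i≢0 → z i (suc j) (trans (ℕ.+-suc i j) (cong suc q)) i≢0)))
    (+-identityˡ _)
  bs-single (suc a) zero {f} z = trans (cong₂ _+_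
      (bs-single a zero (λ i j q i≢a → z (suc i) j (cong suc q) (λ e → i≢a (ℕ.suc-injective e))))
      (bs-0 (a ℕ.+ 0) (λ i j q → z i (suc j) (trans (ℕ.+-suc i j) (cong suc q))
         (λ e → ℕ.<-irrefl (trans (sym (trans q (ℕ.+-identityʳ a))) refl) (subst (λ u → a ℕ.< u ℕ.+ j) (sym e) (s≤s (ℕ.m≤m+n a j)))))))
    (trans (+-identityʳ _) (cong (λ u → nat u * f (suc a) 0) (ch-0 a)))
    where
    ch-0 : ∀ a → ch a 0 ≡ 1
    ch-0 zero    = refl
    ch-0 (suc a) = refl
  bs-single (suc a) (suc b) {f} z = begin
    bs (a ℕ.+ suc b) (λ i j → f (suc i) j) + bs (a ℕ.+ suc b) (λ i j → f i (suc j))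
      ≡⟨ cong₂ _+_ (bs-single a (suc b) (λ i j q i≢a → z (suc i) j (cong suc q) (λ e → i≢a (ℕ.suc-injective e))))
           (trans (cong (λ u → bs u (λ i j → f i (suc j))) (ℕ.+-suc a b))
             (bs-single (suc a) b (λ i j q i≢a → z i (suc j) (trans (ℕ.+-suc i j) (cong suc (trans q (sym (ℕ.+-suc a b))))) i≢a))) ⟩
    nat (ch a (suc b)) * f (suc a) (suc b) + nat (ch (suc a) b) * f (suc a) (suc b)
      ≡⟨ sym (distribʳ _ _ _) ⟩
    (nat (ch a (suc b)) + nat (ch (suc a) b)) * f (suc a) (suc b)
      ≡⟨ cong (λ u → u * f (suc a) (suc b)) (sym (nat-+ (ch a (suc b)) (ch (suc a) b))) ⟩
    nat (ch (suc a) (suc b)) * f (suc a) (suc b) ∎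

  bs-power : ∀ x n → (x + 1#) ^ n ≡ bs n (λ i j → x ^ i)
  bs-power x zero    = refl
  bs-power x (suc n) = begin
    (x + 1#) * (x + 1#) ^ n  ≡⟨ trans (distribʳ _ x 1#) (cong (λ u → x * (x + 1#) ^ n + u) (*-identityˡ _)) ⟩
    x * (x + 1#) ^ n + (x + 1#) ^ n ≡⟨ cong₂ (λ u v → x * u + v) (bs-power x n) (bs-power x n) ⟩
    x * bs n (λ i j → x ^ i) + bs n (λ i j → x ^ i) ≡⟨ cong (λ u → u + bs n (λ i j → x ^ i)) (sym (bs-* n x _)) ⟩
    bs n (λ i j → x ^ suc i) + bs n (λ i j → x ^ i) ∎

  sumF : ∀ n → (Fin n → Carrier) → Carrier
  sumF zero    f = 0#
  sumF (suc n) f = f zero + sumF n (λ i → f (suc i))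

  sumF-cong : ∀ n {f g : Fin n → Carrier} → (∀ i → f i ≡ g i) → sumF n f ≡ sumF n g
  sumF-cong zero    e = refl
  sumF-cong (suc n) e = cong₂ _+_ (e zero) (sumF-cong n (λ i → e (suc i)))

  sumF-0 : ∀ n {f : Fin n → Carrier} → (∀ i → f i ≡ 0#) → sumF n f ≡ 0#
  sumF-0 zero    e = refl
  sumF-0 (suc n) e = trans (cong₂ _+_ (e zero) (sumF-0 n (λ i → e (suc i)))) (+-identityˡ 0#)

  sumF-+ : ∀ n (f g : Fin n → Carrier) → sumF n (λ i → f i + g i) ≡ sumF n f + sumF n g
  sumF-+ zero    f g = sym (+-identityˡ 0#)
  sumF-+ (suc n) f g = trans (cong (λ z → f zero + g zero + z) (sumF-+ n _ _))
    (solve 4 (λ a b c d → (a :+ b) :+ (c :+ d) := (a :+ c) :+ (b :+ d)) refl _ _ _ _)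

  sumF-* : ∀ n c (f : Fin n → Carrier) → sumF n (λ i → c * f i) ≡ c * sumF n f
  sumF-* zero    c f = sym (zeroʳ c)
  sumF-* (suc n) c f = trans (cong (λ z → c * f zero + z) (sumF-* n c _)) (sym (distribˡ c _ _))

  sumF-split : ∀ m n (f : Fin (m ℕ.+ n) → Carrier) →
    sumF (m ℕ.+ n) f ≡ sumF m (λ i → f (i ↑ˡ n)) + sumF n (λ i → f (m ↑ʳ i))
  sumF-split zero    n f = sym (+-identityˡ _)
  sumF-split (suc m) n f = trans (cong (λ z → f zero + z) (sumF-split m n (λ i → f (suc i)))) (sym (+-assoc _ _ _))

  sumF-swap : ∀ m n (f : Fin m → Fin n → Carrier) → sumF m (λ i → sumF n (f i)) ≡ sumF n (λ j → sumF m (λ i → f i j))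
  sumF-swap zero    n f = sym (sumF-0 n (λ _ → refl))
  sumF-swap (suc m) n f = trans (cong (λ z → sumF n (f zero) + z) (sumF-swap m n (λ i → f (suc i)))) (sym (sumF-+ n _ _))

-- Univariate polynomials.

-- Polynomials over R: coefficient lists without trailing zeros, so that _≡_ is equality of polynomials.
module Polynomial (R : Ring) where
  private module R = Ring R
  open R using (Carrier; 0#; 1#; _+_; _*_; -_)
  open RingTheory R using (ad; ad-cong; nat; module Solver; -x≡0⇒x≡0)
  open Solver using (solve; _:=_; _:+_; _:*_; _:-_; :-_; con)
  open ≡-Reasoning

  private
    Raw : Set
    Raw = List Carrier

    infix 4 _≈_
    infixl 6 _⊕_
    infixl 7 _⊛_ _·_

    at : Raw → ℕ → Carrier
    at []      i       = 0#
    at (a ∷ f) zero    = a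
    at (a ∷ f) (suc i) = at f i

    _≈_ : Raw → Raw → Set
    f ≈ g = ∀ i → at f i ≡ at g i

    _⊕_ : Raw → Raw → Raw
    []      ⊕ g       = g
    (a ∷ f) ⊕ []      = a ∷ f
    (a ∷ f) ⊕ (b ∷ g) = (a + b) ∷ (f ⊕ g)

    _·_ : Carrier → Raw → Raw
    c · f = map (c *_) f

    _⊛_ : Raw → Raw → Raw
    []      ⊛ g = []
    (a ∷ f) ⊛ g = (a · g) ⊕ (0# ∷ (f ⊛ g))

    ⊖_ : Raw → Raw
    ⊖ f = map -_ f

    at-⊕ : ∀ f g i → at (f ⊕ g) i ≡ at f i + at g i
    at-⊕ []      g       i       = sym (R.+-identityˡ _)
    at-⊕ (a ∷ f) []      zero    = sym (R.+-identityʳ _)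
    at-⊕ (a ∷ f) []      (suc i) = sym (R.+-identityʳ _)
    at-⊕ (a ∷ f) (b ∷ g) zero    = refl
    at-⊕ (a ∷ f) (b ∷ g) (suc i) = at-⊕ f g i

    at-· : ∀ c f i → at (c · f) i ≡ c * at f i
    at-· c []      i       = sym (R.zeroʳ c)
    at-· c (a ∷ f) zero    = refl
    at-· c (a ∷ f) (suc i) = at-· c f i

    at-⊖ : ∀ f i → at (⊖ f) i ≡ - at f i
    at-⊖ []      i       = sym R.-0#≈0#
    at-⊖ (a ∷ f) zero    = refl
    at-⊖ (a ∷ f) (suc i) = at-⊖ f i

    at-⊛-0 : ∀ a f g → at ((a ∷ f) ⊛ g) 0 ≡ a * at g 0
    at-⊛-0 a f g = trans (at-⊕ (a · g) _ 0) (trans (R.+-identityʳ _) (at-· a g 0))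

    at-⊛-suc : ∀ a f g i → at ((a ∷ f) ⊛ g) (suc i) ≡ a * at g (suc i) + at (f ⊛ g) i
    at-⊛-suc a f g i = trans (at-⊕ (a · g) _ (suc i)) (cong (λ z → z + at (f ⊛ g) i) (at-· a g (suc i)))

    at-⊛ : ∀ f g n → at (f ⊛ g) n ≡ ad n (λ i j → at f i * at g j)
    at-⊛ []      g n       = sym (RingTheory.ad-0 R n (λ _ _ _ → R.zeroˡ _))
    at-⊛ (a ∷ f) g zero    = at-⊛-0 a f g
    at-⊛ (a ∷ f) g (suc n) = trans (at-⊛-suc a f g n) (cong (λ z → a * at g (suc n) + z) (at-⊛ f g n))

    ⊛-cong : ∀ f f′ g g′ → f ≈ f′ → g ≈ g′ → f ⊛ g ≈ f′ ⊛ g′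
    ⊛-cong f f′ g g′ p q n = trans (at-⊛ f g n)
      (trans (ad-cong n (λ i j _ → cong₂ _*_ (p i) (q j))) (sym (at-⊛ f′ g′ n)))

    ⊛-distribʳ : ∀ h f g → (f ⊕ g) ⊛ h ≈ (f ⊛ h) ⊕ (g ⊛ h)
    ⊛-distribʳ h []      g       i = refl
    ⊛-distribʳ h (a ∷ f) []      i = sym (trans (at-⊕ ((a ∷ f) ⊛ h) [] i) (R.+-identityʳ _))
    ⊛-distribʳ h (a ∷ f) (b ∷ g) zero = begin
      at (((a + b) ∷ (f ⊕ g)) ⊛ h) 0                  ≡⟨ at-⊛-0 (a + b) (f ⊕ g) h ⟩
      (a + b) * at h 0                                ≡⟨ R.distribʳ _ a b ⟩
      a * at h 0 + b * at h 0                         ≡⟨ sym (cong₂ _+_ (at-⊛-0 a f h) (at-⊛-0 b g h)) ⟩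
      at ((a ∷ f) ⊛ h) 0 + at ((b ∷ g) ⊛ h) 0         ≡⟨ sym (at-⊕ ((a ∷ f) ⊛ h) ((b ∷ g) ⊛ h) 0) ⟩
      _ ∎
    ⊛-distribʳ h (a ∷ f) (b ∷ g) (suc i) = begin
      _ ≡⟨ at-⊛-suc (a + b) (f ⊕ g) h i ⟩
      (a + b) * at h (suc i) + at ((f ⊕ g) ⊛ h) i
        ≡⟨ cong (λ z → (a + b) * at h (suc i) + z) (trans (⊛-distribʳ h f g i) (at-⊕ (f ⊛ h) (g ⊛ h) i)) ⟩
      (a + b) * at h (suc i) + (at (f ⊛ h) i + at (g ⊛ h) i)
        ≡⟨ solve 5 (λ a b c d e → (a :+ b) :* c :+ (d :+ e) := (a :* c :+ d) :+ (b :* c :+ e)) refl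
             a b (at h (suc i)) (at (f ⊛ h) i) (at (g ⊛ h) i) ⟩
      (a * at h (suc i) + at (f ⊛ h) i) + (b * at h (suc i) + at (g ⊛ h) i)
        ≡⟨ sym (cong₂ _+_ (at-⊛-suc a f h i) (at-⊛-suc b g h i)) ⟩
      at ((a ∷ f) ⊛ h) (suc i) + at ((b ∷ g) ⊛ h) (suc i)
        ≡⟨ sym (at-⊕ ((a ∷ f) ⊛ h) ((b ∷ g) ⊛ h) (suc i)) ⟩
      _ ∎

    ·-⊛ : ∀ c f g → (c · f) ⊛ g ≈ c · (f ⊛ g)
    ·-⊛ c []      g i       = refl
    ·-⊛ c (a ∷ f) g zero    = begin
      _                  ≡⟨ at-⊛-0 (c * a) (c · f) g ⟩
      c * a * at g 0     ≡⟨ R.*-assoc c a _ ⟩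
      c * (a * at g 0)   ≡⟨ cong (c *_) (sym (at-⊛-0 a f g)) ⟩
      _                  ≡⟨ sym (at-· c ((a ∷ f) ⊛ g) 0) ⟩
      _ ∎
    ·-⊛ c (a ∷ f) g (suc i) = begin
      _ ≡⟨ at-⊛-suc (c * a) (c · f) g i ⟩
      c * a * at g (suc i) + at ((c · f) ⊛ g) i
        ≡⟨ cong (λ z → c * a * at g (suc i) + z) (trans (·-⊛ c f g i) (at-· c (f ⊛ g) i)) ⟩
      c * a * at g (suc i) + c * at (f ⊛ g) i
        ≡⟨ solve 4 (λ c a x y → c :* a :* x :+ c :* y := c :* (a :* x :+ y)) refl c a (at g (suc i)) (at (f ⊛ g) i) ⟩
      c * (a * at g (suc i) + at (f ⊛ g) i) ≡⟨ cong (c *_) (sym (at-⊛-suc a f g i)) ⟩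
      _ ≡⟨ sym (at-· c ((a ∷ f) ⊛ g) (suc i)) ⟩
      _ ∎

    shift-⊛ : ∀ f g → (0# ∷ f) ⊛ g ≈ 0# ∷ (f ⊛ g)
    shift-⊛ f g zero    = trans (at-⊛-0 0# f g) (R.zeroˡ _)
    shift-⊛ f g (suc i) = trans (at-⊛-suc 0# f g i) (trans (cong (λ z → z + at (f ⊛ g) i) (R.zeroˡ _)) (R.+-identityˡ _))

    ⊛-zeroʳ : ∀ f → f ⊛ [] ≈ []
    ⊛-zeroʳ []      i       = refl
    ⊛-zeroʳ (a ∷ f) zero    = refl
    ⊛-zeroʳ (a ∷ f) (suc i) = ⊛-zeroʳ f i

    ⊛-assoc : ∀ f g h → (f ⊛ g) ⊛ h ≈ f ⊛ (g ⊛ h)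
    ⊛-assoc []      g h i = refl
    ⊛-assoc (a ∷ f) g h i = begin
      at (((a · g) ⊕ (0# ∷ (f ⊛ g))) ⊛ h) i
        ≡⟨ trans (⊛-distribʳ h (a · g) (0# ∷ (f ⊛ g)) i) (at-⊕ ((a · g) ⊛ h) ((0# ∷ (f ⊛ g)) ⊛ h) i) ⟩
      at ((a · g) ⊛ h) i + at ((0# ∷ (f ⊛ g)) ⊛ h) i
        ≡⟨ cong₂ _+_ (·-⊛ a g h i) (trans (shift-⊛ (f ⊛ g) h i) (tail i)) ⟩
      at (a · (g ⊛ h)) i + at (0# ∷ (f ⊛ (g ⊛ h))) i
        ≡⟨ sym (at-⊕ (a · (g ⊛ h)) (0# ∷ (f ⊛ (g ⊛ h))) i) ⟩
      _ ∎
      where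
      tail : (0# ∷ ((f ⊛ g) ⊛ h)) ≈ (0# ∷ (f ⊛ (g ⊛ h)))
      tail zero    = refl
      tail (suc i) = ⊛-assoc f g h i

    ⊛-cons : ∀ f b g → f ⊛ (b ∷ g) ≈ (b · f) ⊕ (0# ∷ (f ⊛ g))
    ⊛-cons []      b g zero    = refl
    ⊛-cons []      b g (suc i) = refl
    ⊛-cons (a ∷ f) b g zero    = trans (at-⊛-0 a f (b ∷ g))
      (trans (R.*-comm a b) (sym (R.+-identityʳ _)))
    ⊛-cons (a ∷ f) b g (suc i) = begin
      _ ≡⟨ at-⊛-suc a f (b ∷ g) i ⟩
      a * at g i + at (f ⊛ (b ∷ g)) i
        ≡⟨ cong (λ z → a * at g i + z) (trans (⊛-cons f b g i) (at-⊕ (b · f) (0# ∷ (f ⊛ g)) i)) ⟩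
      a * at g i + (at (b · f) i + at (0# ∷ (f ⊛ g)) i)
        ≡⟨ solve 3 (λ x y z → x :+ (y :+ z) := y :+ (x :+ z)) refl (a * at g i) (at (b · f) i) (at (0# ∷ (f ⊛ g)) i) ⟩
      at (b · f) i + (a * at g i + at (0# ∷ (f ⊛ g)) i) ≡⟨ cong (λ z → at (b · f) i + z) (step i) ⟩
      at (b · f) i + at ((a ∷ f) ⊛ g) i
        ≡⟨ sym (at-⊕ (b · f) ((a ∷ f) ⊛ g) i) ⟩
      _ ∎
      where
      step : ∀ i → a * at g i + at (0# ∷ (f ⊛ g)) i ≡ at ((a ∷ f) ⊛ g) i
      step i = trans (cong (λ z → z + at (0# ∷ (f ⊛ g)) i) (sym (at-· a g i))) (sym (at-⊕ (a · g) (0# ∷ (f ⊛ g)) i))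

    ⊛-comm : ∀ f g → f ⊛ g ≈ g ⊛ f
    ⊛-comm []      g i = sym (⊛-zeroʳ g i)
    ⊛-comm (a ∷ f) g i = begin
      _ ≡⟨ at-⊕ (a · g) (0# ∷ (f ⊛ g)) i ⟩
      at (a · g) i + at (0# ∷ (f ⊛ g)) i ≡⟨ cong (λ z → at (a · g) i + z) (tail i) ⟩
      at (a · g) i + at (0# ∷ (g ⊛ f)) i ≡⟨ sym (at-⊕ (a · g) (0# ∷ (g ⊛ f)) i) ⟩
      _ ≡⟨ sym (⊛-cons g a f i) ⟩
      _ ∎
      where
      tail : (0# ∷ (f ⊛ g)) ≈ (0# ∷ (g ⊛ f))
      tail zero    = refl
      tail (suc i) = ⊛-comm f g i

    -- A zero is dropped only when nothing follows it, which is exactly what excludes trailing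
    -- zeros.
    cons : Carrier → Raw → Raw
    cons a (b ∷ f) = a ∷ b ∷ f
    cons a []      with a R.≟ 0#
    ... | yes _ = []
    ... | no  _ = a ∷ []

    nf : Raw → Raw
    nf []      = []
    nf (a ∷ f) = cons a (nf f)

    at-cons : ∀ a f → cons a f ≈ a ∷ f
    at-cons a (b ∷ f) i = refl
    at-cons a []      i with a R.≟ 0#
    at-cons a []      i       | no  _ = refl
    at-cons a []      zero    | yes q = sym q
    at-cons a []      (suc i) | yes _ = refl

    at-nf : ∀ f → nf f ≈ f
    at-nf []      i       = refl
    at-nf (a ∷ f) zero    = at-cons a (nf f) 0
    at-nf (a ∷ f) (suc i) = trans (at-cons a (nf f) (suc i)) (at-nf f i)

    cons-0 : cons 0# [] ≡ []
    cons-0 with 0# R.≟ 0#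
    ... | yes _ = refl
    ... | no  q = ⊥-elim (q refl)

    nf-0 : ∀ f → (∀ i → at f i ≡ 0#) → nf f ≡ []
    nf-0 []      z = refl
    nf-0 (a ∷ f) z = trans (cong₂ cons (z 0) (nf-0 f (λ i → z (suc i)))) cons-0

    nf-cong : ∀ f g → f ≈ g → nf f ≡ nf g
    nf-cong []      g       e = sym (nf-0 g (λ i → sym (e i)))
    nf-cong (a ∷ f) []      e = nf-0 (a ∷ f) e
    nf-cong (a ∷ f) (b ∷ g) e = cong₂ cons (e 0) (nf-cong f g (λ i → e (suc i)))

    nf-idem : ∀ f → nf (nf f) ≡ nf f
    nf-idem f = nf-cong (nf f) f (at-nf f)

  -- Irrelevance of `normal` makes polynomials with the same list equal; the proof can be recovered
  -- by `recompute` because equality of lists is decidable.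
  record Poly : Set where
    no-eta-equality
    pattern
    constructor poly
    field
      list    : List Carrier
      .normal : nf list ≡ list

  private
    norm : Raw → Poly
    norm f = poly (nf f) (nf-idem f)

    poly-≡ : ∀ {f g : Poly} → Poly.list f ≡ Poly.list g → f ≡ g
    poly-≡ {poly _ _} {poly _ _} refl = refl

    _≟ᴸ_ : DecidableEquality Raw
    _≟ᴸ_ = ≡-dec R._≟_

    normal-list : ∀ f → nf (Poly.list f) ≡ Poly.list f
    normal-list (poly l q) = recompute (nf l ≟ᴸ l) q

  coef : Poly → ℕ → Carrier
  coef f = at (Poly.list f)

  ext : ∀ {f g} → (∀ i → coef f i ≡ coef g i) → f ≡ g
  ext {f} {g} e = poly-≡ (trans (sym (normal-list f)) (trans (nf-cong (Poly.list f) (Poly.list g) e) (normal-list g)))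

  private
    coef-norm : ∀ f i → coef (norm f) i ≡ at f i
    coef-norm f = at-nf f

  infixl 6 _+ᴾ_
  infixl 7 _*ᴾ_

  abstract
    _+ᴾ_ _*ᴾ_ : Poly → Poly → Poly
    f +ᴾ g = norm (Poly.list f ⊕ Poly.list g)
    f *ᴾ g = norm (Poly.list f ⊛ Poly.list g)

    -ᴾ_ : Poly → Poly
    -ᴾ f = norm (⊖ Poly.list f)

    C : Carrier → Poly
    C c = norm (c ∷ [])

    X : Poly
    X = norm (0# ∷ 1# ∷ [])

    0ᴾ : Poly
    0ᴾ = norm []

    coef-+ : ∀ f g i → coef (f +ᴾ g) i ≡ coef f i + coef g i
    coef-+ f g i = trans (coef-norm (Poly.list f ⊕ Poly.list g) i) (at-⊕ (Poly.list f) _ i)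

    coef-- : ∀ f i → coef (-ᴾ f) i ≡ - coef f i
    coef-- f i = trans (coef-norm (⊖ Poly.list f) i) (at-⊖ (Poly.list f) i)

    coef-* : ∀ f g n → coef (f *ᴾ g) n ≡ ad n (λ i j → coef f i * coef g j)
    coef-* f g n = trans (coef-norm (Poly.list f ⊛ Poly.list g) n) (at-⊛ (Poly.list f) _ n)

    coef-0 : ∀ i → coef 0ᴾ i ≡ 0#
    coef-0 i = refl

    coef-C-0 : ∀ c → coef (C c) 0 ≡ c
    coef-C-0 c = coef-norm (c ∷ []) 0

    coef-C-suc : ∀ c i → coef (C c) (suc i) ≡ 0#
    coef-C-suc c i = coef-norm (c ∷ []) (suc i)

    private
      coef-X : ∀ i → coef X i ≡ at (0# ∷ 1# ∷ []) i
      coef-X i = coef-norm (0# ∷ 1# ∷ []) i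

    coef-C* : ∀ c f i → coef (C c *ᴾ f) i ≡ c * coef f i
    coef-C* c f i = trans (coef-norm (Poly.list (C c) ⊛ Poly.list f) i)
      (trans (⊛-cong (Poly.list (C c)) (c ∷ []) (Poly.list f) (Poly.list f) (coef-norm (c ∷ [])) (λ _ → refl) i) (go i))
      where
      go : ∀ i → at ((c ∷ []) ⊛ Poly.list f) i ≡ c * coef f i
      go zero    = at-⊛-0 c [] (Poly.list f)
      go (suc i) = trans (at-⊛-suc c [] (Poly.list f) i) (R.+-identityʳ _)

    coef-X*-suc : ∀ f i → coef (X *ᴾ f) (suc i) ≡ coef f i
    coef-X*-suc f i = trans (coef-norm (Poly.list X ⊛ Poly.list f) (suc i))
      (trans (⊛-cong (Poly.list X) (0# ∷ 1# ∷ []) (Poly.list f) (Poly.list f) coef-X (λ _ → refl) (suc i))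
      (trans (shift-⊛ (1# ∷ []) (Poly.list f) (suc i)) (go i)))
      where
      go : ∀ i → at ((1# ∷ []) ⊛ Poly.list f) i ≡ coef f i
      go zero    = trans (at-⊛-0 1# [] (Poly.list f)) (R.*-identityˡ _)
      go (suc i) = trans (at-⊛-suc 1# [] (Poly.list f) i) (trans (R.+-identityʳ _) (R.*-identityˡ _))

    coef-X*-0 : ∀ f → coef (X *ᴾ f) 0 ≡ 0#
    coef-X*-0 f = trans (coef-norm (Poly.list X ⊛ Poly.list f) 0)
      (trans (⊛-cong (Poly.list X) (0# ∷ 1# ∷ []) (Poly.list f) (Poly.list f) coef-X (λ _ → refl) 0)
      (shift-⊛ (1# ∷ []) (Poly.list f) 0))

    tl : Poly → Poly
    tl f = norm (go (Poly.list f))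
      where
      go : Raw → Raw
      go []      = []
      go (a ∷ f) = f

    coef-tl : ∀ f i → coef (tl f) i ≡ coef f (suc i)
    coef-tl (poly []      _) i = refl
    coef-tl (poly (a ∷ f) _) i = coef-norm f i

    private
      raw-ring : ∀ (f g h : Poly) → (f *ᴾ g) *ᴾ h ≡ f *ᴾ (g *ᴾ h)
      raw-ring f g h = poly-≡ (nf-cong (nf (Poly.list f ⊛ Poly.list g) ⊛ Poly.list h) (Poly.list f ⊛ nf (Poly.list g ⊛ Poly.list h))
        (λ i → trans (⊛-cong (nf (Poly.list f ⊛ Poly.list g)) (Poly.list f ⊛ Poly.list g) (Poly.list h) (Poly.list h) (at-nf (Poly.list f ⊛ Poly.list g)) (λ _ → refl) i)
          (trans (⊛-assoc (Poly.list f) (Poly.list g) (Poly.list h) i)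
                 (sym (⊛-cong (Poly.list f) (Poly.list f) (nf (Poly.list g ⊛ Poly.list h)) (Poly.list g ⊛ Poly.list h) (λ _ → refl) (at-nf (Poly.list g ⊛ Poly.list h)) i)))))

      raw-comm : ∀ (f g : Poly) → f *ᴾ g ≡ g *ᴾ f
      raw-comm f g = poly-≡ (nf-cong (Poly.list f ⊛ Poly.list g) (Poly.list g ⊛ Poly.list f) (⊛-comm (Poly.list f) (Poly.list g)))

      raw-distribʳ : ∀ (h f g : Poly) → (f +ᴾ g) *ᴾ h ≡ (f *ᴾ h) +ᴾ (g *ᴾ h)
      raw-distribʳ h f g = ext λ i → begin
        coef ((f +ᴾ g) *ᴾ h) i
          ≡⟨ coef-norm (Poly.list (f +ᴾ g) ⊛ Poly.list h) i ⟩
        at (Poly.list (f +ᴾ g) ⊛ Poly.list h) i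
          ≡⟨ ⊛-cong (nf (Poly.list f ⊕ Poly.list g)) (Poly.list f ⊕ Poly.list g) (Poly.list h) (Poly.list h) (at-nf (Poly.list f ⊕ Poly.list g)) (λ _ → refl) i ⟩
        at ((Poly.list f ⊕ Poly.list g) ⊛ Poly.list h) i
          ≡⟨ ⊛-distribʳ (Poly.list h) (Poly.list f) (Poly.list g) i ⟩
        at ((Poly.list f ⊛ Poly.list h) ⊕ (Poly.list g ⊛ Poly.list h)) i
          ≡⟨ at-⊕ (Poly.list f ⊛ Poly.list h) (Poly.list g ⊛ Poly.list h) i ⟩
        at (Poly.list f ⊛ Poly.list h) i + at (Poly.list g ⊛ Poly.list h) i
          ≡⟨ sym (cong₂ _+_ (coef-norm (Poly.list f ⊛ Poly.list h) i) (coef-norm (Poly.list g ⊛ Poly.list h) i)) ⟩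
        coef (f *ᴾ h) i + coef (g *ᴾ h) i ≡⟨ sym (coef-+ (f *ᴾ h) (g *ᴾ h) i) ⟩
        _ ∎

    isCR : IsCommutativeRing _≡_ _+ᴾ_ _*ᴾ_ -ᴾ_ 0ᴾ (C 1#)
    isCR = record
      { isRing = record
        { +-isAbelianGroup = record
          { isGroup = record
            { isMonoid = record
              { isSemigroup = record
                { isMagma = record { isEquivalence = isEquivalence ; ∙-cong = cong₂ _+ᴾ_ }
                ; assoc = λ f g h → ext λ i → begin
                    coef ((f +ᴾ g) +ᴾ h) i            ≡⟨ trans (coef-+ (f +ᴾ g) h i) (cong (_+ coef h i) (coef-+ f g i)) ⟩
                    coef f i + coef g i + coef h i    ≡⟨ R.+-assoc _ _ _ ⟩
                    coef f i + (coef g i + coef h i)  ≡⟨ sym (trans (coef-+ f (g +ᴾ h) i) (cong (λ z → coef f i + z) (coef-+ g h i))) ⟩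
                    coef (f +ᴾ (g +ᴾ h)) i            ∎ }
              ; identity = idˡ , λ f → trans (comm f 0ᴾ) (idˡ f) }
            ; inverse = invˡ , λ f → trans (comm f (-ᴾ f)) (invˡ f)
            ; ⁻¹-cong = cong -ᴾ_ }
          ; comm = comm }
        ; *-cong = cong₂ _*ᴾ_
        ; *-assoc = raw-ring
        ; *-identity = oneˡ , λ f → trans (raw-comm f (C 1#)) (oneˡ f)
        ; distrib = (λ h f g → trans (raw-comm h (f +ᴾ g)) (trans (raw-distribʳ h f g) (cong₂ _+ᴾ_ (raw-comm f h) (raw-comm g h)))) , raw-distribʳ }
      ; *-comm = raw-comm }
      where
      comm : ∀ f g → f +ᴾ g ≡ g +ᴾ f
      comm f g = ext λ i → trans (coef-+ f g i) (trans (R.+-comm _ _) (sym (coef-+ g f i)))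
      idˡ : ∀ f → 0ᴾ +ᴾ f ≡ f
      idˡ f = ext λ i → trans (coef-+ 0ᴾ f i) (R.+-identityˡ _)
      invˡ : ∀ f → (-ᴾ f) +ᴾ f ≡ 0ᴾ
      invˡ f = ext λ i → trans (coef-+ (-ᴾ f) f i) (trans (cong (_+ coef f i) (coef-- f i)) (R.-‿inverseˡ _))
      oneˡ : ∀ f → C 1# *ᴾ f ≡ f
      oneˡ f = ext λ i → trans (coef-C* 1# f i) (R.*-identityˡ _)

  ring : Ring
  ring = record
    { Carrier = Poly ; _+_ = _+ᴾ_ ; _*_ = _*ᴾ_ ; -_ = -ᴾ_ ; 0# = 0ᴾ ; 1# = C 1#
    ; isCommutativeRing = isCR
    ; _≟_ = λ f g → map′ poly-≡ (cong Poly.list) (Poly.list f ≟ᴸ Poly.list g) }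

  abstract
    decompose : ∀ f → f ≡ C (coef f 0) +ᴾ X *ᴾ tl f
    decompose f = ext go
      where
      go : ∀ i → coef f i ≡ coef (C (coef f 0) +ᴾ X *ᴾ tl f) i
      go zero    = sym (trans (coef-+ (C (coef f 0)) (X *ᴾ tl f) 0)
        (trans (cong₂ _+_ (coef-C-0 (coef f 0)) (coef-X*-0 (tl f))) (R.+-identityʳ _)))
      go (suc i) = sym (trans (coef-+ (C (coef f 0)) (X *ᴾ tl f) (suc i))
        (trans (cong₂ _+_ (coef-C-suc (coef f 0) i) (trans (coef-X*-suc (tl f) i) (coef-tl f i))) (R.+-identityˡ _)))

  abstract
    -- Induction along Horner's form a + X f. The recursion runs on a bound for the degree, because
    -- `tl f` is renormalised and so not structurally smaller.
    elim : (P : Poly → Set) → P 0ᴾ → (∀ a f → P f → P (C a +ᴾ X *ᴾ f)) → ∀ f → P f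
    elim P p0 ps f = go (length (Poly.list f)) f ℕ.≤-refl
      where
      vanish : ∀ (l : Raw) {n} → length l ℕ.≤ n → ∀ i → n ℕ.≤ i → at l i ≡ 0#
      vanish []      q       i       r       = refl
      vanish (a ∷ l) (s≤s q) (suc i) (s≤s r) = vanish l q i r
      go′ : ∀ n f → (∀ i → n ℕ.≤ i → coef f i ≡ 0#) → P f
      go′ zero    f z = subst P (ext (λ i → trans (coef-0 i) (sym (z i z≤n)))) p0
      go′ (suc n) f z = subst P (sym (decompose f))
        (ps (coef f 0) (tl f) (go′ n (tl f) (λ i q → trans (coef-tl f i) (z (suc i) (s≤s q)))))
      go : ∀ n f → length (Poly.list f) ℕ.≤ n → P f
      go n f q = go′ n f (vanish (Poly.list f) q)

  abstract
    bounded : ∀ f → ∃ λ n → ∀ i → n ℕ.≤ i → coef f i ≡ 0#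
    bounded = elim (λ f → ∃ λ n → ∀ i → n ℕ.≤ i → coef f i ≡ 0#) (0 , λ i _ → coef-0 i)
      λ { a f (n , z) → suc n , λ { (suc i) (s≤s q) →
        trans (coef-+ (C a) (X *ᴾ f) (suc i))
          (trans (cong₂ _+_ (coef-C-suc a i) (trans (coef-X*-suc f i) (z i q))) (R.+-identityˡ 0#)) } }

  private
    step-list : ∀ a f → C a +ᴾ X *ᴾ f ≡ norm (a ∷ Poly.list f)
    step-list a f = ext go
      where
      go : ∀ i → coef (C a +ᴾ X *ᴾ f) i ≡ coef (norm (a ∷ Poly.list f)) i
      go zero    = trans (coef-+ (C a) (X *ᴾ f) 0) (trans (cong₂ _+_ (coef-C-0 a) (coef-X*-0 f))
        (trans (R.+-identityʳ a) (sym (coef-norm (a ∷ Poly.list f) 0))))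
      go (suc i) = trans (coef-+ (C a) (X *ᴾ f) (suc i)) (trans (cong₂ _+_ (coef-C-suc a i) (coef-X*-suc f i))
        (trans (R.+-identityˡ _) (sym (coef-norm (a ∷ Poly.list f) (suc i)))))

  -- The hypothesis `s-0` says that a zero coefficient on top of the zero polynomial changes
  -- nothing. Recursion on lists is then insensitive to trailing zeros, and `rec-step` holds without
  -- exception, also for a = 0 and f = 0.
  module Recursion {B : Set} (b₀ : B) (s : Carrier → Poly → B → B) (s-0 : s 0# 0ᴾ b₀ ≡ b₀) where
    private
      go : Raw → B
      go []      = b₀
      go (a ∷ l) = s a (norm l) (go l)

      norm-0 : ∀ l → nf l ≡ [] → norm l ≡ 0ᴾ
      norm-0 l e = ext (λ i → trans (cong (λ z → at z i) e) (sym (coef-0 i)))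

      go-cons : ∀ a l l′ → nf l ≡ l′ → go l′ ≡ go l → go (cons a l′) ≡ s a (norm l) (go l)
      go-cons a l (b ∷ l′) eq ih = cong₂ (s a)
        (ext λ i → trans (coef-norm (b ∷ l′) i) (cong (λ z → at z i) (sym eq))) ih
      go-cons a l []       eq ih with a R.≟ 0#
      ... | no  _    = cong₂ (s a) (trans (norm-0 [] refl) (sym (norm-0 l eq))) ih
      ... | yes refl = sym (trans (cong₂ (s 0#) (norm-0 l eq) (sym ih)) s-0)

      go-nf : ∀ l → go (nf l) ≡ go l
      go-nf []      = refl
      go-nf (a ∷ l) = go-cons a l (nf l) refl (go-nf l)

    abstract
      rec : Poly → B
      rec f = go (Poly.list f)

      rec-0 : rec 0ᴾ ≡ b₀
      rec-0 = trans (cong go (cong Poly.list zero≡)) refl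
        where
        zero≡ : 0ᴾ ≡ norm []
        zero≡ = ext coef-0

      rec-step : ∀ a f → rec (C a +ᴾ X *ᴾ f) ≡ s a f (rec f)
      rec-step a f = trans (cong (λ z → go (Poly.list z)) (step-list a f))
        (trans (go-nf (a ∷ Poly.list f)) (cong (λ z → s a z (go (Poly.list f))) (poly-≡ (normal-list f))))

  private module P = Ring ring

  C-+ : ∀ a b → C (a + b) ≡ C a +ᴾ C b
  C-+ a b = ext λ { zero → trans (coef-C-0 (a + b)) (sym (trans (coef-+ (C a) (C b) 0) (cong₂ _+_ (coef-C-0 a) (coef-C-0 b))))
                  ; (suc i) → trans (coef-C-suc (a + b) i) (sym (trans (coef-+ (C a) (C b) (suc i))
                      (trans (cong₂ _+_ (coef-C-suc a i) (coef-C-suc b i)) (R.+-identityˡ 0#)))) }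

  C-* : ∀ a b → C (a * b) ≡ C a *ᴾ C b
  C-* a b = ext λ { zero → trans (coef-C-0 (a * b)) (sym (trans (coef-C* a (C b) 0) (cong (a *_) (coef-C-0 b))))
                  ; (suc i) → trans (coef-C-suc (a * b) i) (sym (trans (coef-C* a (C b) (suc i))
                      (trans (cong (a *_) (coef-C-suc b i)) (R.zeroʳ a)))) }

  C-0 : C 0# ≡ 0ᴾ
  C-0 = ext λ { zero → trans (coef-C-0 0#) (sym (coef-0 0)) ; (suc i) → trans (coef-C-suc 0# i) (sym (coef-0 (suc i))) }

  C-inj : ∀ {a b} → C a ≡ C b → a ≡ b
  C-inj {a} {b} e = trans (sym (coef-C-0 a)) (trans (cong (λ z → coef z 0) e) (coef-C-0 b))

  step-C : ∀ a → C a ≡ C a +ᴾ X *ᴾ 0ᴾ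
  step-C a = sym (trans (cong (C a +ᴾ_) (P.zeroʳ X)) (P.+-identityʳ (C a)))

  step-X : X ≡ C 0# +ᴾ X *ᴾ C 1#
  step-X = sym (trans (cong₂ _+ᴾ_ C-0 (P.*-identityʳ X)) (P.+-identityˡ X))

-- Homomorphisms, evaluation and derivations.

record Hom (R S : Ring) : Set where
  private
    module R = Ring R
    module S = Ring S
  field
    ⟦_⟧  : R.Carrier → S.Carrier
    ⟦+⟧  : ∀ a b → ⟦ a R.+ b ⟧ ≡ ⟦ a ⟧ S.+ ⟦ b ⟧
    ⟦*⟧  : ∀ a b → ⟦ a R.* b ⟧ ≡ ⟦ a ⟧ S.* ⟦ b ⟧
    ⟦1⟧  : ⟦ R.1# ⟧ ≡ S.1#

  ⟦0⟧ : ⟦ R.0# ⟧ ≡ S.0#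
  ⟦0⟧ = begin
    ⟦ R.0# ⟧                                      ≡⟨ solve 1 (λ a → a := (a :+ a) :- a) refl ⟦ R.0# ⟧ ⟩
    (⟦ R.0# ⟧ S.+ ⟦ R.0# ⟧) S.- ⟦ R.0# ⟧        ≡⟨ cong (S._- ⟦ R.0# ⟧) (trans (sym (⟦+⟧ R.0# R.0#)) (cong ⟦_⟧ (R.+-identityˡ R.0#))) ⟩
    ⟦ R.0# ⟧ S.- ⟦ R.0# ⟧                        ≡⟨ S.-‿inverseʳ _ ⟩
    S.0#                                         ∎
    where
    open ≡-Reasoning
    open RingTheory.Solver S

  ⟦-⟧ : ∀ a → ⟦ R.- a ⟧ ≡ S.- ⟦ a ⟧
  ⟦-⟧ a = begin
    ⟦ R.- a ⟧                            ≡⟨ solve 2 (λ x y → x := (x :+ y) :- y) refl ⟦ R.- a ⟧ ⟦ a ⟧ ⟩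
    (⟦ R.- a ⟧ S.+ ⟦ a ⟧) S.- ⟦ a ⟧    ≡⟨ cong (S._- ⟦ a ⟧) (trans (sym (⟦+⟧ _ a)) (trans (cong ⟦_⟧ (R.-‿inverseˡ a)) ⟦0⟧)) ⟩
    S.0# S.- ⟦ a ⟧                      ≡⟨ S.+-identityˡ _ ⟩
    S.- ⟦ a ⟧                           ∎
    where
    open ≡-Reasoning
    open RingTheory.Solver S

  ⟦^⟧ : ∀ a n → ⟦ RingTheory._^_ R a n ⟧ ≡ RingTheory._^_ S ⟦ a ⟧ n
  ⟦^⟧ a zero    = ⟦1⟧
  ⟦^⟧ a (suc n) = trans (⟦*⟧ a _) (cong (⟦ a ⟧ S.*_) (⟦^⟧ a n))

  ⟦nat⟧ : ∀ n → ⟦ RingTheory.nat R n ⟧ ≡ RingTheory.nat S n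
  ⟦nat⟧ zero    = ⟦0⟧
  ⟦nat⟧ (suc n) = trans (⟦+⟧ _ _) (cong₂ S._+_ ⟦1⟧ (⟦nat⟧ n))

module Evaluation {R S : Ring} (h : Hom R S) (x : Ring.Carrier S) where
  private
    module R = Ring R
    module S = Ring S
  open Hom h
  open Polynomial R
  open RingTheory.Solver S
  open ≡-Reasoning
  open S using (_+_; _*_)

  private
    module Rec = Recursion S.0# (λ a _ v → ⟦ a ⟧ + x * v)
      (trans (cong₂ _+_ ⟦0⟧ (S.zeroʳ x)) (S.+-identityˡ S.0#))
    module P = Ring ring
    module PS = RingTheory.Solver ring

  ev : Poly → S.Carrier
  ev = Rec.rec

  ev-0 : ev 0ᴾ ≡ S.0#
  ev-0 = Rec.rec-0

  ev-step : ∀ a f → ev (C a +ᴾ X *ᴾ f) ≡ ⟦ a ⟧ + x * ev f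
  ev-step = Rec.rec-step

  ev-C : ∀ a → ev (C a) ≡ ⟦ a ⟧
  ev-C a = trans (cong ev (step-C a)) (trans (ev-step a 0ᴾ)
    (trans (cong (λ z → ⟦ a ⟧ + x * z) ev-0) (trans (cong (⟦ a ⟧ +_) (S.zeroʳ x)) (S.+-identityʳ _))))

  ev-X : ev X ≡ x
  ev-X = trans (cong ev step-X) (trans (ev-step R.0# (C R.1#))
    (trans (cong₂ (λ y z → y + x * z) ⟦0⟧ (trans (ev-C R.1#) ⟦1⟧)) (trans (S.+-identityˡ _) (S.*-identityʳ x))))

  ev-+ : ∀ f g → ev (f +ᴾ g) ≡ ev f + ev g
  ev-+ = elim (λ f → ∀ g → ev (f +ᴾ g) ≡ ev f + ev g)
    (λ g → trans (cong ev (P.+-identityˡ g)) (sym (trans (cong (_+ ev g) ev-0) (S.+-identityˡ _))))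
    (λ a f ih → elim (λ g → ev ((C a +ᴾ X *ᴾ f) +ᴾ g) ≡ ev (C a +ᴾ X *ᴾ f) + ev g)
      (trans (cong ev (P.+-identityʳ _)) (sym (trans (cong (ev (C a +ᴾ X *ᴾ f) +_) ev-0) (S.+-identityʳ _))))
      (λ b g _ → begin
        ev ((C a +ᴾ X *ᴾ f) +ᴾ (C b +ᴾ X *ᴾ g))
          ≡⟨ cong ev (trans (PS.solve 5 (λ a X f b g → (a PS.:+ X PS.:* f) PS.:+ (b PS.:+ X PS.:* g) PS.:= (a PS.:+ b) PS.:+ X PS.:* (f PS.:+ g)) refl (C a) X f (C b) g)
                            (cong (_+ᴾ X *ᴾ (f +ᴾ g)) (sym (C-+ a b)))) ⟩
        ev (C (a R.+ b) +ᴾ X *ᴾ (f +ᴾ g))      ≡⟨ ev-step _ _ ⟩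
        ⟦ a R.+ b ⟧ + x * ev (f +ᴾ g)          ≡⟨ cong₂ (λ y z → y + x * z) (⟦+⟧ a b) (ih g) ⟩
        (⟦ a ⟧ + ⟦ b ⟧) + x * (ev f + ev g)
          ≡⟨ solve 5 (λ a X f b g → (a :+ b) :+ X :* (f :+ g) := (a :+ X :* f) :+ (b :+ X :* g)) refl ⟦ a ⟧ x (ev f) ⟦ b ⟧ (ev g) ⟩
        (⟦ a ⟧ + x * ev f) + (⟦ b ⟧ + x * ev g) ≡⟨ sym (cong₂ _+_ (ev-step a f) (ev-step b g)) ⟩
        _ ∎))

  private
    ev-C* : ∀ c g → ev (C c *ᴾ g) ≡ ⟦ c ⟧ * ev g
    ev-C* c = elim (λ g → ev (C c *ᴾ g) ≡ ⟦ c ⟧ * ev g)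
      (trans (cong ev (P.zeroʳ _)) (trans ev-0 (sym (trans (cong (⟦ c ⟧ *_) ev-0) (S.zeroʳ _)))))
      (λ b g ih → begin
        ev (C c *ᴾ (C b +ᴾ X *ᴾ g))
          ≡⟨ cong ev (trans (PS.solve 4 (λ c b X g → c PS.:* (b PS.:+ X PS.:* g) PS.:= c PS.:* b PS.:+ X PS.:* (c PS.:* g)) refl (C c) (C b) X g)
               (cong (_+ᴾ X *ᴾ (C c *ᴾ g)) (sym (C-* c b)))) ⟩
        ev (C (c R.* b) +ᴾ X *ᴾ (C c *ᴾ g))     ≡⟨ ev-step _ _ ⟩
        ⟦ c R.* b ⟧ + x * ev (C c *ᴾ g)         ≡⟨ cong₂ (λ y z → y + x * z) (⟦*⟧ c b) ih ⟩
        ⟦ c ⟧ * ⟦ b ⟧ + x * (⟦ c ⟧ * ev g)      ≡⟨ solve 4 (λ c b X g → c :* b :+ X :* (c :* g) := c :* (b :+ X :* g)) refl ⟦ c ⟧ ⟦ b ⟧ x (ev g) ⟩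
        ⟦ c ⟧ * (⟦ b ⟧ + x * ev g)              ≡⟨ cong (⟦ c ⟧ *_) (sym (ev-step b g)) ⟩
        _ ∎)

    ev-X* : ∀ g → ev (X *ᴾ g) ≡ x * ev g
    ev-X* g = trans (cong ev (sym (trans (cong (_+ᴾ X *ᴾ g) C-0) (P.+-identityˡ _))))
      (trans (ev-step R.0# g) (trans (cong (_+ x * ev g) ⟦0⟧) (S.+-identityˡ _)))

  ev-* : ∀ f g → ev (f *ᴾ g) ≡ ev f * ev g
  ev-* = elim (λ f → ∀ g → ev (f *ᴾ g) ≡ ev f * ev g)
    (λ g → trans (cong ev (P.zeroˡ g)) (trans ev-0 (sym (trans (cong (_* ev g) ev-0) (S.zeroˡ _)))))
    (λ a f ih g → begin
      ev ((C a +ᴾ X *ᴾ f) *ᴾ g)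
        ≡⟨ cong ev (PS.solve 4 (λ a X f g → (a PS.:+ X PS.:* f) PS.:* g PS.:= a PS.:* g PS.:+ X PS.:* (f PS.:* g)) refl (C a) X f g) ⟩
      ev (C a *ᴾ g +ᴾ X *ᴾ (f *ᴾ g))   ≡⟨ ev-+ _ _ ⟩
      ev (C a *ᴾ g) + ev (X *ᴾ (f *ᴾ g)) ≡⟨ cong₂ _+_ (ev-C* a g) (trans (ev-X* (f *ᴾ g)) (cong (x *_) (ih g))) ⟩
      ⟦ a ⟧ * ev g + x * (ev f * ev g)  ≡⟨ solve 4 (λ a X f g → a :* g :+ X :* (f :* g) := (a :+ X :* f) :* g) refl ⟦ a ⟧ x (ev f) (ev g) ⟩
      (⟦ a ⟧ + x * ev f) * ev g         ≡⟨ cong (_* ev g) (sym (ev-step a f)) ⟩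
      _ ∎)

  hom : Hom ring S
  hom = record { ⟦_⟧ = ev ; ⟦+⟧ = ev-+ ; ⟦*⟧ = ev-* ; ⟦1⟧ = trans (ev-C R.1#) ⟦1⟧ }

record Derivation (R : Ring) : Set where
  private module R = Ring R
  field
    δ   : R.Carrier → R.Carrier
    δ-+ : ∀ a b → δ (a R.+ b) ≡ δ a R.+ δ b
    δ-* : ∀ a b → δ (a R.* b) ≡ δ a R.* b R.+ a R.* δ b

  δ-0 : δ R.0# ≡ R.0#
  δ-0 = begin
    δ R.0#                          ≡⟨ cong δ (sym (R.zeroʳ R.0#)) ⟩
    δ (R.0# R.* R.0#)               ≡⟨ δ-* R.0# R.0# ⟩
    δ R.0# R.* R.0# R.+ R.0# R.* δ R.0# ≡⟨ cong₂ R._+_ (R.zeroʳ _) (R.zeroˡ _) ⟩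
    R.0# R.+ R.0#                   ≡⟨ R.+-identityˡ _ ⟩
    R.0#                            ∎
    where open ≡-Reasoning

-- The extension of a derivation δ of R to R[X] with X ↦ v.
module Extend {R : Ring} (d : Derivation R) (v : Polynomial.Poly R) where
  private module R = Ring R
  open Derivation d
  open Polynomial R
  open ≡-Reasoning

  private
    module P = Ring ring
    open RingTheory.Solver ring
    module Rec = Recursion 0ᴾ (λ a f w → (C (δ a) +ᴾ v *ᴾ f) +ᴾ X *ᴾ w)
      (begin
        (C (δ R.0#) +ᴾ v *ᴾ 0ᴾ) +ᴾ X *ᴾ 0ᴾ ≡⟨ cong (λ z → (C z +ᴾ v *ᴾ 0ᴾ) +ᴾ X *ᴾ 0ᴾ) δ-0 ⟩
        (C R.0# +ᴾ v *ᴾ 0ᴾ) +ᴾ X *ᴾ 0ᴾ ≡⟨ cong₂ _+ᴾ_ (cong₂ _+ᴾ_ C-0 (P.zeroʳ v)) (P.zeroʳ X) ⟩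
        (0ᴾ +ᴾ 0ᴾ) +ᴾ 0ᴾ ≡⟨ trans (P.+-identityʳ _) (P.+-identityʳ _) ⟩
        0ᴾ ∎)

  D : Poly → Poly
  D = Rec.rec

  D-0 : D 0ᴾ ≡ 0ᴾ
  D-0 = Rec.rec-0

  D-step : ∀ a f → D (C a +ᴾ X *ᴾ f) ≡ (C (δ a) +ᴾ v *ᴾ f) +ᴾ X *ᴾ D f
  D-step = Rec.rec-step

  D-C : ∀ a → D (C a) ≡ C (δ a)
  D-C a = begin
    D (C a)                                ≡⟨ cong D (step-C a) ⟩
    D (C a +ᴾ X *ᴾ 0ᴾ)                     ≡⟨ D-step a 0ᴾ ⟩
    (C (δ a) +ᴾ v *ᴾ 0ᴾ) +ᴾ X *ᴾ D 0ᴾ     ≡⟨ cong₂ (λ y z → (C (δ a) +ᴾ y) +ᴾ z) (P.zeroʳ v) (trans (cong (X *ᴾ_) D-0) (P.zeroʳ X)) ⟩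
    (C (δ a) +ᴾ 0ᴾ) +ᴾ 0ᴾ                 ≡⟨ trans (P.+-identityʳ _) (P.+-identityʳ _) ⟩
    C (δ a)                                ∎

  private
    D-X* : ∀ f → D (X *ᴾ f) ≡ v *ᴾ f +ᴾ X *ᴾ D f
    D-X* f = begin
      D (X *ᴾ f)                             ≡⟨ cong D (sym (trans (cong (_+ᴾ X *ᴾ f) C-0) (P.+-identityˡ _))) ⟩
      D (C R.0# +ᴾ X *ᴾ f)                   ≡⟨ D-step R.0# f ⟩
      (C (δ R.0#) +ᴾ v *ᴾ f) +ᴾ X *ᴾ D f    ≡⟨ cong (λ z → (z +ᴾ v *ᴾ f) +ᴾ X *ᴾ D f) (trans (cong C δ-0) C-0) ⟩
      (0ᴾ +ᴾ v *ᴾ f) +ᴾ X *ᴾ D f             ≡⟨ cong (_+ᴾ X *ᴾ D f) (P.+-identityˡ _) ⟩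
      v *ᴾ f +ᴾ X *ᴾ D f                     ∎

  D-+ : ∀ f g → D (f +ᴾ g) ≡ D f +ᴾ D g
  D-+ = elim (λ f → ∀ g → D (f +ᴾ g) ≡ D f +ᴾ D g)
    (λ g → trans (cong D (P.+-identityˡ g)) (sym (trans (cong (_+ᴾ D g) D-0) (P.+-identityˡ _))))
    (λ a f ih → elim (λ g → D ((C a +ᴾ X *ᴾ f) +ᴾ g) ≡ D (C a +ᴾ X *ᴾ f) +ᴾ D g)
      (trans (cong D (P.+-identityʳ _)) (sym (trans (cong (D (C a +ᴾ X *ᴾ f) +ᴾ_) D-0) (P.+-identityʳ _))))
      (λ b g _ → begin
        D ((C a +ᴾ X *ᴾ f) +ᴾ (C b +ᴾ X *ᴾ g))
          ≡⟨ cong D (trans (solve 5 (λ a X f b g → (a :+ X :* f) :+ (b :+ X :* g) := (a :+ b) :+ X :* (f :+ g)) refl (C a) X f (C b) g)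
                            (cong (_+ᴾ X *ᴾ (f +ᴾ g)) (sym (C-+ a b)))) ⟩
        D (C (a R.+ b) +ᴾ X *ᴾ (f +ᴾ g))      ≡⟨ D-step _ _ ⟩
        (C (δ (a R.+ b)) +ᴾ v *ᴾ (f +ᴾ g)) +ᴾ X *ᴾ D (f +ᴾ g)
          ≡⟨ cong₂ (λ y z → (y +ᴾ v *ᴾ (f +ᴾ g)) +ᴾ X *ᴾ z) (trans (cong C (δ-+ a b)) (C-+ (δ a) (δ b))) (ih g) ⟩
        ((C (δ a) +ᴾ C (δ b)) +ᴾ v *ᴾ (f +ᴾ g)) +ᴾ X *ᴾ (D f +ᴾ D g)
          ≡⟨ solve 8 (λ a b v f g X F G → ((a :+ b) :+ v :* (f :+ g)) :+ X :* (F :+ G) := ((a :+ v :* f) :+ X :* F) :+ ((b :+ v :* g) :+ X :* G))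
               refl (C (δ a)) (C (δ b)) v f g X (D f) (D g) ⟩
        _ ≡⟨ sym (cong₂ _+ᴾ_ (D-step a f) (D-step b g)) ⟩
        _ ∎))

  private
    D-C* : ∀ c g → D (C c *ᴾ g) ≡ C (δ c) *ᴾ g +ᴾ C c *ᴾ D g
    D-C* c = elim (λ g → D (C c *ᴾ g) ≡ C (δ c) *ᴾ g +ᴾ C c *ᴾ D g)
      (trans (cong D (P.zeroʳ _)) (trans D-0 (sym (trans (cong₂ _+ᴾ_ (P.zeroʳ _) (trans (cong (C c *ᴾ_) D-0) (P.zeroʳ _))) (P.+-identityˡ _)))))
      (λ b g ih → begin
        D (C c *ᴾ (C b +ᴾ X *ᴾ g))
          ≡⟨ cong D (trans (solve 4 (λ c b X g → c :* (b :+ X :* g) := c :* b :+ X :* (c :* g)) refl (C c) (C b) X g)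
               (cong (_+ᴾ X *ᴾ (C c *ᴾ g)) (sym (C-* c b)))) ⟩
        D (C (c R.* b) +ᴾ X *ᴾ (C c *ᴾ g))     ≡⟨ D-step _ _ ⟩
        (C (δ (c R.* b)) +ᴾ v *ᴾ (C c *ᴾ g)) +ᴾ X *ᴾ D (C c *ᴾ g)
          ≡⟨ cong₂ (λ y z → (y +ᴾ v *ᴾ (C c *ᴾ g)) +ᴾ X *ᴾ z)
               (trans (cong C (δ-* c b)) (trans (C-+ _ _) (cong₂ _+ᴾ_ (C-* _ _) (C-* _ _)))) ih ⟩
        ((C (δ c) *ᴾ C b +ᴾ C c *ᴾ C (δ b)) +ᴾ v *ᴾ (C c *ᴾ g)) +ᴾ X *ᴾ (C (δ c) *ᴾ g +ᴾ C c *ᴾ D g)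
          ≡⟨ solve 8 (λ c′ b c b′ v g X G → ((c′ :* b :+ c :* b′) :+ v :* (c :* g)) :+ X :* (c′ :* g :+ c :* G)
               := c′ :* (b :+ X :* g) :+ c :* ((b′ :+ v :* g) :+ X :* G)) refl (C (δ c)) (C b) (C c) (C (δ b)) v g X (D g) ⟩
        C (δ c) *ᴾ (C b +ᴾ X *ᴾ g) +ᴾ C c *ᴾ ((C (δ b) +ᴾ v *ᴾ g) +ᴾ X *ᴾ D g)
          ≡⟨ cong (λ z → C (δ c) *ᴾ (C b +ᴾ X *ᴾ g) +ᴾ C c *ᴾ z) (sym (D-step b g)) ⟩
        _ ∎)

  D-* : ∀ f g → D (f *ᴾ g) ≡ D f *ᴾ g +ᴾ f *ᴾ D g
  D-* = elim (λ f → ∀ g → D (f *ᴾ g) ≡ D f *ᴾ g +ᴾ f *ᴾ D g)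
    (λ g → trans (cong D (P.zeroˡ g)) (trans D-0 (sym (trans (cong₂ _+ᴾ_ (trans (cong (_*ᴾ g) D-0) (P.zeroˡ g)) (P.zeroˡ _)) (P.+-identityˡ _)))))
    (λ a f ih g → begin
      D ((C a +ᴾ X *ᴾ f) *ᴾ g)
        ≡⟨ cong D (solve 4 (λ a X f g → (a :+ X :* f) :* g := a :* g :+ X :* (f :* g)) refl (C a) X f g) ⟩
      D (C a *ᴾ g +ᴾ X *ᴾ (f *ᴾ g))   ≡⟨ D-+ _ _ ⟩
      D (C a *ᴾ g) +ᴾ D (X *ᴾ (f *ᴾ g))
        ≡⟨ cong₂ _+ᴾ_ (D-C* a g) (trans (D-X* (f *ᴾ g)) (cong (λ z → v *ᴾ (f *ᴾ g) +ᴾ X *ᴾ z) (ih g))) ⟩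
      (C (δ a) *ᴾ g +ᴾ C a *ᴾ D g) +ᴾ (v *ᴾ (f *ᴾ g) +ᴾ X *ᴾ (D f *ᴾ g +ᴾ f *ᴾ D g))
        ≡⟨ solve 8 (λ a′ a v X f g F G → (a′ :* g :+ a :* G) :+ (v :* (f :* g) :+ X :* (F :* g :+ f :* G))
             := ((a′ :+ v :* f) :+ X :* F) :* g :+ (a :+ X :* f) :* G) refl (C (δ a)) (C a) v X f g (D f) (D g) ⟩
      ((C (δ a) +ᴾ v *ᴾ f) +ᴾ X *ᴾ D f) *ᴾ g +ᴾ (C a +ᴾ X *ᴾ f) *ᴾ D g
        ≡⟨ cong (λ z → z *ᴾ g +ᴾ (C a +ᴾ X *ᴾ f) *ᴾ D g) (sym (D-step a f)) ⟩
      _ ∎)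

  D-X : D X ≡ v
  D-X = begin
    D X                         ≡⟨ cong D step-X ⟩
    D (C R.0# +ᴾ X *ᴾ C R.1#)  ≡⟨ D-step R.0# (C R.1#) ⟩
    (C (δ R.0#) +ᴾ v *ᴾ C R.1#) +ᴾ X *ᴾ D (C R.1#) ≡⟨ cong₂ (λ y z → (y +ᴾ v *ᴾ C R.1#) +ᴾ X *ᴾ z) (trans (cong C δ-0) C-0) D-1 ⟩
    (0ᴾ +ᴾ v *ᴾ C R.1#) +ᴾ X *ᴾ 0ᴾ ≡⟨ trans (cong ((0ᴾ +ᴾ v *ᴾ C R.1#) +ᴾ_) (P.zeroʳ X)) (trans (P.+-identityʳ _) (trans (P.+-identityˡ _) (P.*-identityʳ v))) ⟩
    v ∎
    where
    D-1 : D (C R.1#) ≡ 0ᴾ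
    D-1 = begin
      D (C R.1#) ≡⟨ D-C R.1# ⟩
      C (δ R.1#) ≡⟨ cong C δ-1 ⟩
      C R.0# ≡⟨ C-0 ⟩
      0ᴾ ∎
      where
      module RS = RingTheory.Solver R
      δ-1 : δ R.1# ≡ R.0#
      δ-1 = begin
        δ R.1# ≡⟨ RS.solve 1 (λ a → a RS.:= (a RS.:* RS.con (ℤ.+ 1) RS.:+ RS.con (ℤ.+ 1) RS.:* a) RS.:- a) refl (δ R.1#) ⟩
        (δ R.1# R.* R.1# R.+ R.1# R.* δ R.1#) R.- δ R.1# ≡⟨ cong (λ z → z R.- δ R.1#) (trans (sym (δ-* R.1# R.1#)) (cong δ (R.*-identityˡ R.1#))) ⟩
        δ R.1# R.- δ R.1# ≡⟨ R.-‿inverseʳ _ ⟩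
        R.0# ∎

  derivation : Derivation ring
  derivation = record { δ = D ; δ-+ = D-+ ; δ-* = D-* }

-- Fields with a prime number of elements.

-- `index` and `nat-index` express that every element is a multiple of 1. This gives Fermat's
-- theorem by induction along `nat`, and it bounds the number of values of a coordinate by p.
record PrimeField : Set₁ where
  field
    F : Ring
    p : ℕ
  open Ring F public
  open RingTheory F public
  field
    1<p     : 1 ℕ.< p
    1≢0     : 1# ≢ 0#
    inverse : ∀ x → x ≢ 0# → ∃ λ y → x * y ≡ 1#
    nat-p   : nat p ≡ 0#
    nat≢0   : ∀ n → 0 ℕ.< n → n ℕ.< p → nat n ≢ 0#
    index     : Carrier → ℕ
    index<p   : ∀ x → index x ℕ.< p
    nat-index : ∀ x → nat (index x) ≡ x

  *-cancel : ∀ {x y} → x ≢ 0# → x * y ≡ 0# → y ≡ 0#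
  *-cancel {x} {y} x≢0 e with inverse x x≢0
  ... | z , xz = begin
    y            ≡⟨ sym (*-identityˡ y) ⟩
    1# * y       ≡⟨ cong (_* y) (sym xz) ⟩
    x * z * y    ≡⟨ solve 3 (λ x z y → x :* z :* y := z :* (x :* y)) refl x z y ⟩
    z * (x * y)  ≡⟨ cong (z *_) e ⟩
    z * 0#       ≡⟨ zeroʳ z ⟩
    0#           ∎
    where
    open ≡-Reasoning
    open Solver

  *-≢0 : ∀ {x y} → x ≢ 0# → y ≢ 0# → x * y ≢ 0#
  *-≢0 x≢0 y≢0 e = y≢0 (*-cancel x≢0 e)

  ^-≢0 : ∀ {x} n → x ≢ 0# → x ^ n ≢ 0#
  ^-≢0 zero    x≢0 = 1≢0
  ^-≢0 (suc n) x≢0 = *-≢0 x≢0 (^-≢0 n x≢0)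

  !-≢0 : ∀ n → n ℕ.< p → nat (n ℕ.!) ≢ 0#
  !-≢0 zero    _   = λ e → 1≢0 (trans (sym nat-1) e)
  !-≢0 (suc n) n<p = λ e → *-≢0 (nat≢0 (suc n) (s≤s z≤n) n<p) (!-≢0 n (ℕ.<-trans (ℕ.n<1+n n) n<p))
    (trans (sym (nat-* (suc n) (n ℕ.!))) e)

  ch-≢0 : ∀ i j → i ℕ.+ j ℕ.< p → nat (ch i j) ≢ 0#
  ch-≢0 i j q e = !-≢0 (i ℕ.+ j) q (trans (cong nat (sym (ch-! i j)))
    (trans (nat-* (ch i j) _) (trans (cong (_* nat (i ℕ.! ℕ.* j ℕ.!)) e) (zeroˡ _))))

  nat-<⇒≢ : ∀ {m n} → m ℕ.< n → n ℕ.< p → nat m ≢ nat n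
  nat-<⇒≢ {m} {n} m<n n<p e = nat≢0 (n ∸ m) (ℕ.m<n⇒0<n∸m m<n) (ℕ.≤-<-trans (ℕ.m∸n≤m n m) n<p)
    (begin
      nat (n ∸ m)                   ≡⟨ solve 2 (λ a b → a := (b :+ a) :- b) refl (nat (n ∸ m)) (nat m) ⟩
      nat m + nat (n ∸ m) - nat m   ≡⟨ cong (_- nat m) (trans (sym (nat-+ m (n ∸ m))) (cong nat (ℕ.m+[n∸m]≡n (ℕ.<⇒≤ m<n)))) ⟩
      nat n - nat m                 ≡⟨ x≡y⇒x-y≡0 (sym e) ⟩
      0#                            ∎)
    where
    open ≡-Reasoning
    open Solver

  nat-inj : ∀ {m n} → m ℕ.< p → n ℕ.< p → nat m ≡ nat n → m ≡ n
  nat-inj {m} {n} m<p n<p e with ℕ.<-cmp m n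
  ... | tri≈ _ q _   = q
  ... | tri< m<n _ _ = ⊥-elim (nat-<⇒≢ m<n n<p e)
  ... | tri> _ _ n<m = ⊥-elim (nat-<⇒≢ n<m m<p (sym e))

  -- The middle terms of (x + 1)^p have the form j·(f i j / j), so they vanish by Euler's identity for bs.
  fermat-step : ∀ x → (x + 1#) ^ p ≡ x ^ p + 1#
  fermat-step x = at-suc p refl
   where
   at-suc : ∀ n → p ≡ n → (x + 1#) ^ n ≡ x ^ n + 1#
   at-suc zero    eq = ⊥-elim (ℕ.n≮0 (subst (1 ℕ.<_) eq 1<p))
   at-suc (suc q) eq = begin
    (x + 1#) ^ suc q    ≡⟨ bs-power x (suc q) ⟩
    bs (suc q) (λ i j → x ^ i)
      ≡⟨ bs-cong (suc q) (λ i j e → split i j e) ⟩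
    bs (suc q) (λ i j → (u i j + v i j) + nat j * w i j)
      ≡⟨ trans (bs-+ (suc q) (λ i j → u i j + v i j) (λ i j → nat j * w i j)) (cong₂ _+_ (bs-+ (suc q) u v) (bs-euler q w)) ⟩
    (bs (suc q) u + bs (suc q) v) + nat (suc q) * bs q (λ i j → w i (suc j))
      ≡⟨ cong₂ _+_ (cong₂ _+_ bs-u bs-v) (trans (cong (_* bs q (λ i j → w i (suc j))) (subst (λ z → nat z ≡ 0#) eq nat-p)) (zeroˡ _)) ⟩
    (x ^ suc q + 1#) + 0# ≡⟨ +-identityʳ _ ⟩
    x ^ suc q + 1# ∎
    where
    open ≡-Reasoning
    u v w : ℕ → ℕ → Carrier
    u i zero    = x ^ i
    u i (suc j) = 0#
    v zero    zero    = 0#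
    v zero    (suc j) = 1#
    v (suc i) j       = 0#
    w (suc i) (suc j) with nat (suc j) ≟ 0#
    ... | yes _ = 0#
    ... | no n  = proj₁ (inverse _ n) * x ^ suc i
    w _ _ = 0#
    split : ∀ i j → i ℕ.+ j ≡ suc q → x ^ i ≡ (u i j + v i j) + nat j * w i j
    split zero zero ()
    split (suc i) zero e = sym (trans (cong₂ _+_ (+-identityʳ _) (zeroˡ _)) (+-identityʳ _))
    split zero (suc j) e = sym (trans (cong₂ _+_ (+-identityˡ _) (zeroʳ _)) (+-identityʳ _))
    split (suc i) (suc j) e with nat (suc j) ≟ 0#
    ... | yes z = ⊥-elim (nat≢0 (suc j) (s≤s z≤n) (subst (suc j ℕ.<_) (sym eq) (ℕ.≤-trans (s≤s (ℕ.m≤n+m (suc j) i)) (ℕ.≤-reflexive e))) z)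
    ... | no n  = sym (begin
      (0# + 0#) + nat (suc j) * (proj₁ (inverse _ n) * x ^ suc i)
        ≡⟨ cong₂ _+_ (+-identityˡ _) (sym (*-assoc _ _ _)) ⟩
      0# + nat (suc j) * proj₁ (inverse _ n) * x ^ suc i
        ≡⟨ trans (+-identityˡ _) (cong (_* x ^ suc i) (proj₂ (inverse _ n))) ⟩
      1# * x ^ suc i ≡⟨ *-identityˡ _ ⟩
      x ^ suc i ∎)
    bs-u : bs (suc q) u ≡ x ^ suc q
    bs-u = begin
      bs (suc q) u         ≡⟨ cong (λ z → bs z u) (sym (ℕ.+-identityʳ (suc q))) ⟩
      bs (suc q ℕ.+ 0) u   ≡⟨ bs-single (suc q) 0 {u} (λ { i zero e i≢ → ⊥-elim (i≢ (trans (sym (ℕ.+-identityʳ i)) (trans e (ℕ.+-identityʳ _)))) ; i (suc j) _ _ → refl }) ⟩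
      nat 1 * x ^ suc q ≡⟨ trans (cong (_* x ^ suc q) nat-1) (*-identityˡ _) ⟩
      x ^ suc q            ∎
    bs-v : bs (suc q) v ≡ 1#
    bs-v = begin
      bs (0 ℕ.+ suc q) v   ≡⟨ bs-single 0 (suc q) {v} (λ { zero j e i≢ → ⊥-elim (i≢ refl) ; (suc i) j _ _ → refl }) ⟩
      nat 1 * 1#       ≡⟨ trans (*-identityʳ _) nat-1 ⟩
      1#                   ∎

  private
    fermat-nat : ∀ n → nat n ^ p ≡ nat n
    fermat-nat zero    = go p 1<p
      where
      go : ∀ m → 1 ℕ.< m → 0# ^ m ≡ 0#
      go (suc m) _ = zeroˡ _
    fermat-nat (suc n) = begin
      (1# + nat n) ^ p   ≡⟨ cong (_^ p) (+-comm _ _) ⟩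
      (nat n + 1#) ^ p   ≡⟨ fermat-step (nat n) ⟩
      nat n ^ p + 1#     ≡⟨ cong (_+ 1#) (fermat-nat n) ⟩
      nat n + 1#           ≡⟨ +-comm _ _ ⟩
      1# + nat n           ∎
      where open ≡-Reasoning

  fermat : ∀ x → x ^ p ≡ x
  fermat x = subst (λ z → z ^ p ≡ z) (nat-index x) (fermat-nat (index x))

  index-inj : ∀ {x y} → index x ≡ index y → x ≡ y
  index-inj {x} {y} e = trans (sym (nat-index x)) (trans (cong nat e) (nat-index y))

-- The residues modulo p.

module Residues (p : ℕ) (pr : Prime p) where
  open import Data.Nat using (_%_; NonZero)
  open import Data.Nat.DivMod
  open import Data.Nat.Divisibility using (_∣_; ∣⇒≤; n∣m*n)
  open import Data.Nat.Coprimality using (prime⇒coprime; coprime-Bézout)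
  open import Data.Nat.GCD using (module Bézout)
  open import Data.Nat.Primality using (prime⇒nonZero; prime⇒nonTrivial)

  private instance
    p≢0 : NonZero p
    p≢0 = prime⇒nonZero pr

  private
    0%p : 0 % p ≡ 0
    0%p = m<n⇒m%n≡m (ℕ.>-nonZero⁻¹ p)

  record Residue : Set where
    no-eta-equality
    pattern
    constructor residue
    field
      val      : ℕ
      .reduced : val % p ≡ val
  open Residue public

  mk : ℕ → Residue
  mk n = residue (n % p) (m%n%n≡m%n n p)

  residue-≡ : ∀ {x y : Residue} → val x ≡ val y → x ≡ y
  residue-≡ {residue _ _} {residue _ _} refl = refl

  mk-val : ∀ x → mk (val x) ≡ x
  mk-val (residue v r) = residue-≡ (recompute (v % p ℕ.≟ v) r)

  mk-≡ : ∀ {a b} → a % p ≡ b % p → mk a ≡ mk b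
  mk-≡ = residue-≡

  private
    infixl 6 _⊕_
    infixl 7 _⊛_
    _⊕_ _⊛_ : Residue → Residue → Residue
    x ⊕ y = mk (val x ℕ.+ val y)
    x ⊛ y = mk (val x ℕ.* val y)
    ⊖_ : Residue → Residue
    ⊖ x = mk ((p ∸ 1) ℕ.* val x)

    l+ : ∀ a b → mk (val (mk a) ℕ.+ b) ≡ mk (a ℕ.+ b)
    l+ a b = mk-≡ (trans (%-distribˡ-+ (a % p) b p)
      (trans (cong (λ z → (z ℕ.+ b % p) % p) (m%n%n≡m%n a p)) (sym (%-distribˡ-+ a b p))))

    r+ : ∀ a b → mk (a ℕ.+ val (mk b)) ≡ mk (a ℕ.+ b)
    r+ a b = trans (cong mk (ℕ.+-comm a (b % p))) (trans (l+ b a) (cong mk (ℕ.+-comm b a)))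

    l* : ∀ a b → mk (val (mk a) ℕ.* b) ≡ mk (a ℕ.* b)
    l* a b = mk-≡ (trans (%-distribˡ-* (a % p) b p)
      (trans (cong (λ z → (z ℕ.* (b % p)) % p) (m%n%n≡m%n a p)) (sym (%-distribˡ-* a b p))))

    r* : ∀ a b → mk (a ℕ.* val (mk b)) ≡ mk (a ℕ.* b)
    r* a b = trans (cong mk (ℕ.*-comm a (b % p))) (trans (l* b a) (cong mk (ℕ.*-comm b a)))

    comm+ : ∀ x y → x ⊕ y ≡ y ⊕ x
    comm+ x y = cong mk (ℕ.+-comm (val x) (val y))

    comm* : ∀ x y → x ⊛ y ≡ y ⊛ x
    comm* x y = cong mk (ℕ.*-comm (val x) (val y))

    id+ : ∀ x → mk 0 ⊕ x ≡ x
    id+ x = trans (l+ 0 (val x)) (mk-val x)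

    id* : ∀ x → mk 1 ⊛ x ≡ x
    id* x = trans (l* 1 (val x)) (trans (cong mk (ℕ.*-identityˡ (val x))) (mk-val x))

    inv+ : ∀ x → ⊖ x ⊕ x ≡ mk 0
    inv+ x = begin
      mk (val (mk ((p ∸ 1) ℕ.* val x)) ℕ.+ val x)  ≡⟨ l+ _ _ ⟩
      mk ((p ∸ 1) ℕ.* val x ℕ.+ val x)             ≡⟨ cong mk (ℕ.+-comm ((p ∸ 1) ℕ.* val x) (val x)) ⟩
      mk (suc (p ∸ 1) ℕ.* val x)                   ≡⟨ cong (λ z → mk (z ℕ.* val x)) (ℕ.m+[n∸m]≡n {1} (ℕ.>-nonZero⁻¹ p)) ⟩
      mk (p ℕ.* val x)                             ≡⟨ cong mk (ℕ.*-comm p (val x)) ⟩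
      mk (val x ℕ.* p)                             ≡⟨ mk-≡ (trans (m*n%n≡0 (val x) p) (sym (0%p))) ⟩
      mk 0                                         ∎
      where open ≡-Reasoning

    distr : ∀ x y z → (y ⊕ z) ⊛ x ≡ y ⊛ x ⊕ z ⊛ x
    distr x y z = begin
      mk (val (y ⊕ z) ℕ.* val x)                       ≡⟨ l* _ _ ⟩
      mk ((val y ℕ.+ val z) ℕ.* val x)                 ≡⟨ cong mk (ℕ.*-distribʳ-+ (val x) (val y) (val z)) ⟩
      mk (val y ℕ.* val x ℕ.+ val z ℕ.* val x)         ≡⟨ sym (trans (l+ _ _) (r+ _ _)) ⟩
      y ⊛ x ⊕ z ⊛ x                                    ∎
      where open ≡-Reasoning

  isCR : IsCommutativeRing _≡_ _⊕_ _⊛_ ⊖_ (mk 0) (mk 1)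
  isCR = record
    { isRing = record
      { +-isAbelianGroup = record
        { isGroup = record
          { isMonoid = record
            { isSemigroup = record
              { isMagma = record { isEquivalence = isEquivalence ; ∙-cong = cong₂ _⊕_ }
              ; assoc = λ x y z → trans (l+ _ _) (trans (cong mk (ℕ.+-assoc (val x) (val y) (val z))) (sym (r+ _ _))) }
            ; identity = id+ , λ x → trans (comm+ x (mk 0)) (id+ x) }
          ; inverse = inv+ , λ x → trans (comm+ x (⊖ x)) (inv+ x)
          ; ⁻¹-cong = cong ⊖_ }
        ; comm = comm+ }
      ; *-cong = cong₂ _⊛_
      ; *-assoc = λ x y z → trans (l* _ _) (trans (cong mk (ℕ.*-assoc (val x) (val y) (val z))) (sym (r* (val x) (val y ℕ.* val z))))
      ; *-identity = id* , λ x → trans (comm* x (mk 1)) (id* x)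
      ; distrib = (λ x y z → trans (comm* x (y ⊕ z)) (trans (distr x y z) (cong₂ _⊕_ (comm* y x) (comm* z x)))) , distr }
    ; *-comm = comm* }

  ring : Ring
  ring = record
    { Carrier = Residue ; _+_ = _⊕_ ; _*_ = _⊛_ ; -_ = ⊖_ ; 0# = mk 0 ; 1# = mk 1
    ; isCommutativeRing = isCR
    ; _≟_ = λ x y → map′ residue-≡ (cong val) (val x ℕ.≟ val y) }

  private
    module R = Ring ring
    module T = RingTheory ring

  mk-+ : ∀ a b → mk (a ℕ.+ b) ≡ mk a R.+ mk b
  mk-+ a b = sym (trans (l+ a _) (r+ a b))

  mk-* : ∀ a b → mk (a ℕ.* b) ≡ mk a R.* mk b
  mk-* a b = sym (trans (l* a _) (r* a b))

  nat-mk : ∀ n → T.nat n ≡ mk n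
  nat-mk zero    = refl
  nat-mk (suc n) = trans (cong (mk 1 R.+_) (nat-mk n)) (sym (mk-+ 1 n))

  1<p : 1 ℕ.< p
  1<p = ℕ.nonTrivial⇒n>1 p {{prime⇒nonTrivial pr}}

  mk≢0 : ∀ n → 0 ℕ.< n → n ℕ.< p → mk n ≢ mk 0
  mk≢0 n 0<n n<p e = ℕ.<-irrefl (sym (trans (sym (m<n⇒m%n≡m n<p)) (trans (cong val e) (0%p)))) 0<n

  inverse : ∀ x → x ≢ mk 0 → ∃ λ y → x R.* y ≡ mk 1
  inverse x x≢0 = nonzero (val x) refl
   where
   nonzero : ∀ v → val x ≡ v → ∃ λ y → x R.* y ≡ mk 1
   nonzero zero    eq = ⊥-elim (x≢0 (residue-≡ (trans eq (sym 0%p))))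
   nonzero (suc v) eq = go (coprime-Bézout (prime⇒coprime pr v<p))
    where
    v<p : suc v ℕ.< p
    v<p = subst (ℕ._< p) (trans (cong val (mk-val x)) eq) (m%n<n (val x) p)
    x≡ : mk (suc v) ≡ x
    x≡ = trans (cong mk (sym eq)) (mk-val x)
    open ≡-Reasoning
    open T.Solver
    kill : ∀ a → mk (a ℕ.* p) ≡ mk 0
    kill a = mk-≡ (trans (m*n%n≡0 a p) (sym (0%p)))
    go : Bézout.Identity 1 p (suc v) → ∃ λ y → x R.* y ≡ mk 1
    go (Bézout.-+ a b e) = mk b , (begin
      x R.* mk b             ≡⟨ cong (R._* mk b) (sym x≡) ⟩
      mk (suc v) R.* mk b    ≡⟨ R.*-comm (mk (suc v)) (mk b) ⟩
      mk b R.* mk (suc v)    ≡⟨ sym (mk-* b (suc v)) ⟩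
      mk (b ℕ.* suc v)       ≡⟨ cong mk (sym e) ⟩
      mk (1 ℕ.+ a ℕ.* p)     ≡⟨ mk-+ 1 _ ⟩
      mk 1 R.+ mk (a ℕ.* p)  ≡⟨ cong (mk 1 R.+_) (kill a) ⟩
      mk 1 R.+ mk 0          ≡⟨ R.+-identityʳ (mk 1) ⟩
      mk 1                   ∎)
    go (Bézout.+- a b e) = (R.- mk b) , (begin
      x R.* (R.- mk b)          ≡⟨ cong (R._* (R.- mk b)) (sym x≡) ⟩
      mk (suc v) R.* (R.- mk b) ≡⟨ solve 3 (λ o v b → v :* (:- b) := o :- (o :+ b :* v)) refl (mk 1) (mk (suc v)) (mk b) ⟩
      mk 1 R.- (mk 1 R.+ mk b R.* mk (suc v)) ≡⟨ cong (λ z → mk 1 R.- (mk 1 R.+ z)) (sym (mk-* b (suc v))) ⟩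
      mk 1 R.- (mk 1 R.+ mk (b ℕ.* suc v)) ≡⟨ cong (λ z → mk 1 R.- z) (trans (sym (mk-+ 1 (b ℕ.* suc v))) (trans (cong mk e) (kill a))) ⟩
      mk 1 R.- mk 0             ≡⟨ trans (cong (mk 1 R.+_) R.-0#≈0#) (R.+-identityʳ (mk 1)) ⟩
      mk 1                      ∎)

  nat-p : T.nat p ≡ mk 0
  nat-p = trans (nat-mk p) (mk-≡ (trans (n%n≡0 p) (sym (0%p))))

  val<p : ∀ x → val x ℕ.< p
  val<p x = subst (ℕ._< p) (cong val (mk-val x)) (m%n<n (val x) p)

  primeField : PrimeField
  primeField = record
    { F = ring ; p = p ; 1<p = 1<p ; 1≢0 = mk≢0 1 (s≤s z≤n) 1<p ; inverse = inverse ; nat-p = nat-p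
    ; nat≢0 = λ n 0<n n<p e → mk≢0 n 0<n n<p (trans (sym (nat-mk n)) e)
    ; index = val ; index<p = val<p ; nat-index = λ x → trans (nat-mk (val x)) (mk-val x) }

-- Systems of linear equations.

module LinearAlgebra (K : PrimeField) where
  open PrimeField K
  open Solver

  Vector : ℕ → Set
  Vector n = Fin n → Carrier

  -- Vectors are functions, and pointwise equal functions need not be equal; hence `ap-≗` is part of
  -- the data.
  record Functional (n : ℕ) : Set where
    field
      app   : Vector n → Carrier
      ap-≗  : ∀ {x y} → (∀ i → x i ≡ y i) → app x ≡ app y
      ap-+  : ∀ x y → app (λ i → x i + y i) ≡ app x + app y
      ap-*  : ∀ c x → app (λ i → c * x i) ≡ c * app x
  open Functional public

  private
    -- The last component stands in for a permutation: what holds for the pivot and for the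
    -- remaining functionals holds for the whole list.
    Pivot : ∀ {n} → List (Functional n) → Vector n → Set₁
    Pivot {n} fs e = ∃ λ f → ∃ λ gs → app f e ≢ 0# × length fs ≡ suc (length gs) ×
      (∀ {P : Functional n → Set} → P f → All P gs → All P fs)

    pivot : ∀ {n} (fs : List (Functional n)) e → All (λ f → app f e ≡ 0#) fs ⊎ Pivot fs e
    pivot []       e = inj₁ []
    pivot (f ∷ fs) e with app f e ≟ 0#
    ... | no  z = inj₂ (f , fs , z , refl , _∷_)
    ... | yes z with pivot fs e
    ...   | inj₁ zs = inj₁ (z ∷ zs)
    ...   | inj₂ (g , gs , nz , len , put) = inj₂ (g , f ∷ gs , nz , cong suc len , λ { q (r ∷ rs) → r ∷ put q rs })

    unit : ∀ {n} → Vector (suc n)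
    unit zero    = 1#
    unit (suc i) = 0#

    pad : ∀ {n} → Vector n → Vector (suc n)
    pad x zero    = 0#
    pad x (suc i) = x i

    -- x ↦ c·(0,x) - f(0,x)·e₀ parametrises the kernel of f, where c = f(e₀)
    lift : ∀ {n} → Functional (suc n) → Vector n → Vector (suc n)
    lift f x i = app f unit * pad x i - app f (pad x) * unit i

    pad-+ : ∀ {n} (x y : Vector n) i → pad (λ i → x i + y i) i ≡ pad x i + pad y i
    pad-+ x y zero    = sym (+-identityˡ 0#)
    pad-+ x y (suc i) = refl

    pad-* : ∀ {n} c (x : Vector n) i → pad (λ i → c * x i) i ≡ c * pad x i
    pad-* c x zero    = sym (zeroʳ c)
    pad-* c x (suc i) = refl

    pad-≗ : ∀ {n} {x y : Vector n} → (∀ i → x i ≡ y i) → ∀ i → pad x i ≡ pad y i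
    pad-≗ e zero    = refl
    pad-≗ e (suc i) = e i

    pull : ∀ {n} → Functional (suc n) → Functional (suc n) → Functional n
    pull f g = record
      { app  = λ x → app g (lift f x)
      ; ap-≗ = λ e → ap-≗ g (λ i → cong₂ (λ u v → app f unit * u - v * unit i) (pad-≗ e i) (ap-≗ f (pad-≗ e)))
      ; ap-+ = λ x y → trans (ap-≗ g (λ i → trans
          (cong₂ (λ u v → app f unit * u - v * unit i) (pad-+ x y i) (trans (ap-≗ f (pad-+ x y)) (ap-+ f (pad x) (pad y))))
          (solve 6 (λ c u v a b e → c :* (u :+ v) :- (a :+ b) :* e := (c :* u :- a :* e) :+ (c :* v :- b :* e)) refl
             (app f unit) (pad x i) (pad y i) (app f (pad x)) (app f (pad y)) (unit i))))
          (ap-+ g _ _)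
      ; ap-* = λ c x → trans (ap-≗ g (λ i → trans
          (cong₂ (λ u v → app f unit * u - v * unit i) (pad-* c x i) (trans (ap-≗ f (pad-* c x)) (ap-* f c (pad x))))
          (solve 5 (λ d c u a e → d :* (c :* u) :- (c :* a) :* e := c :* (d :* u :- a :* e)) refl
             (app f unit) c (pad x i) (app f (pad x)) (unit i))))
          (ap-* g c _) }

    pull-self : ∀ {n} (f : Functional (suc n)) x → app f (lift f x) ≡ 0#
    pull-self f x = trans (ap-≗ f (λ i → solve 4 (λ c u a e → c :* u :- a :* e := c :* u :+ (:- a) :* e) refl
                             (app f unit) (pad x i) (app f (pad x)) (unit i)))
      (trans (ap-+ f _ _) (trans (cong₂ _+_ (ap-* f _ _) (ap-* f _ _))
      (solve 2 (λ c a → c :* a :+ (:- a) :* c := con (ℤ.+ 0)) refl (app f unit) (app f (pad x)))))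

  -- Elimination of one coordinate. If every functional kills the first basis vector, that vector is
  -- a solution. Otherwise one functional that does not kill it is removed and the others are pulled
  -- back to its kernel, which lowers both numbers by one.
  kernel : ∀ n (fs : List (Functional n)) → length fs ℕ.< n →
    ∃ λ (x : Vector n) → (∃ λ i → x i ≢ 0#) × All (λ f → app f x ≡ 0#) fs
  kernel (suc n) fs lt with pivot fs unit
  ... | inj₁ zs = unit , (zero , 1≢0) , zs
  ... | inj₂ (f , gs , nz , len , put) with kernel n (map (pull f) gs)
                                         (subst (ℕ._< n) (sym (length-map (pull f) gs)) (ℕ.≤-pred (subst (ℕ._< suc n) len lt)))
  -- Coordinate `suc i` of the lifted vector is `app f unit * x i`, because `unit` is zero there.
  ...   | x , (i , xi) , zs = lift f x , (suc i , λ e → *-≢0 nz xi (trans (cancel _ _) e)) , put (pull-self f x) (map⁻ zs)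
    where
    cancel : ∀ a b → a ≡ a - b * 0#
    cancel = solve 2 (λ a b → a := a :- b :* con (ℤ.+ 0)) refl

homSum : ∀ {R S : Ring} (h : Hom R S) n f →
  Hom.⟦_⟧ h (RingTheory.sumF R n f) ≡ RingTheory.sumF S n (λ i → Hom.⟦_⟧ h (f i))
homSum h zero    f = Hom.⟦0⟧ h
homSum {S = S} h (suc n) f = trans (Hom.⟦+⟧ h _ _) (cong (λ z → Ring._+_ S (Hom.⟦_⟧ h (f zero)) z) (homSum h n (λ i → f (suc i))))

derSum : ∀ {R : Ring} (d : Derivation R) n f →
  Derivation.δ d (RingTheory.sumF R n f) ≡ RingTheory.sumF R n (λ i → Derivation.δ d (f i))
derSum d zero    f = Derivation.δ-0 d
derSum {R} d (suc n) f = trans (Derivation.δ-+ d _ _) (cong (λ z → Ring._+_ R (Derivation.δ d (f zero)) z) (derSum d n (λ i → f (suc i))))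

-- number of monomials of degree < n in two variables
tri : ℕ → ℕ
tri zero    = 0
tri (suc n) = suc n ℕ.+ tri n

-- The mixed term a b is the source of Bézout's number: it is what survives when dimensions of
-- spaces of polynomials are compared.
tri-+ : ∀ a b → tri (a ℕ.+ b) ≡ tri a ℕ.+ tri b ℕ.+ a ℕ.* b
tri-+ zero    b = sym (ℕ.+-identityʳ (tri b))
tri-+ (suc a) b = begin
  suc (a ℕ.+ b) ℕ.+ tri (a ℕ.+ b)                        ≡⟨ cong (suc (a ℕ.+ b) ℕ.+_) (tri-+ a b) ⟩
  suc (a ℕ.+ b) ℕ.+ (tri a ℕ.+ tri b ℕ.+ a ℕ.* b)
    ≡⟨ ℕS.solve 4 (λ a b t u → (ℕS.con 1 ℕS.:+ (a ℕS.:+ b)) ℕS.:+ (t ℕS.:+ u ℕS.:+ a ℕS.:* b)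
         ℕS.:= (ℕS.con 1 ℕS.:+ a ℕS.:+ t) ℕS.:+ u ℕS.:+ (b ℕS.:+ a ℕS.:* b)) refl a b (tri a) (tri b) ⟩
  suc a ℕ.+ tri a ℕ.+ tri b ℕ.+ (b ℕ.+ a ℕ.* b)          ∎
  where open ≡-Reasoning

-- Used for the degree of a product: in every term one of the two factors lies beyond its bound. The
-- asymmetry between `suc n` and `m` matches the strict convention of `Deg`.
pair-≤ : ∀ {n m} i j i′ j′ {a b} → i ℕ.+ i′ ≡ a → j ℕ.+ j′ ≡ b → n ℕ.+ m ℕ.≤ a ℕ.+ b →
  suc n ℕ.≤ i ℕ.+ j ⊎ m ℕ.≤ i′ ℕ.+ j′
pair-≤ {n} {m} i j i′ j′ refl refl q with suc n ℕ.≤? i ℕ.+ j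
... | yes r = inj₁ r
... | no  r = inj₂ (ℕ.+-cancelˡ-≤ n m (i′ ℕ.+ j′) (begin
  n ℕ.+ m ≤⟨ q ⟩
  (i ℕ.+ i′) ℕ.+ (j ℕ.+ j′)
    ≡⟨ ℕS.solve 4 (λ i i′ j j′ → (i ℕS.:+ i′) ℕS.:+ (j ℕS.:+ j′) ℕS.:= (i ℕS.:+ j) ℕS.:+ (i′ ℕS.:+ j′)) refl i i′ j j′ ⟩
  (i ℕ.+ j) ℕ.+ (i′ ℕ.+ j′) ≤⟨ ℕ.+-monoˡ-≤ _ (ℕ.≤-pred (ℕ.≰⇒> r)) ⟩
  n ℕ.+ (i′ ℕ.+ j′) ∎))
  where open ℕ.≤-Reasoning

-- Polynomials in two variables, built as F[X][Y].

module PlanePolynomials (K : PrimeField) where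
  private
    module F where
      open PrimeField K public
  open F using (F; p)

  module U  = Polynomial F
  module V  = Polynomial U.ring
  module FX = Ring U.ring
  open Ring V.ring public
  open RingTheory V.ring public
  open ≡-Reasoning

  A : Set
  A = Carrier

  private
    zeroDerivation : ∀ {R} → Derivation R
    zeroDerivation {R} = record
      { δ = λ _ → 0R ; δ-+ = λ _ _ → sym (Ring.+-identityˡ R 0R)
      ; δ-* = λ a b → sym (trans (cong₂ (Ring._+_ R) (Ring.zeroˡ R b) (Ring.zeroʳ R a)) (Ring.+-identityˡ R 0R)) }
      where 0R = Ring.0# R

  κ : F.Carrier → A
  κ c = V.C (U.C c)

  X Y : A
  X = V.C U.X
  Y = V.X

  cf : A → ℕ → ℕ → F.Carrier
  cf f a b = U.coef (V.coef f b) a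

  cf-ext : ∀ {f g} → (∀ a b → cf f a b ≡ cf g a b) → f ≡ g
  cf-ext e = V.ext (λ b → U.ext (λ a → e a b))

  cf-+ : ∀ f g a b → cf (f + g) a b ≡ cf f a b F.+ cf g a b
  cf-+ f g a b = trans (cong (λ z → U.coef z a) (V.coef-+ f g b)) (U.coef-+ _ _ a)

  cf-- : ∀ f a b → cf (- f) a b ≡ F.- cf f a b
  cf-- f a b = trans (cong (λ z → U.coef z a) (V.coef-- f b)) (U.coef-- _ a)

  cf-0 : ∀ a b → cf 0# a b ≡ F.0#
  cf-0 a b = trans (cong (λ z → U.coef z a) (V.coef-0 b)) (U.coef-0 a)

  cf-κ* : ∀ c f a b → cf (κ c * f) a b ≡ c F.* cf f a b
  cf-κ* c f a b = trans (cong (λ z → U.coef z a) (V.coef-C* (U.C c) f b)) (U.coef-C* c _ a)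

  cf-X*-suc : ∀ f a b → cf (X * f) (suc a) b ≡ cf f a b
  cf-X*-suc f a b = trans (cong (λ z → U.coef z (suc a)) (V.coef-C* U.X f b)) (U.coef-X*-suc _ a)

  cf-X*-0 : ∀ f b → cf (X * f) 0 b ≡ F.0#
  cf-X*-0 f b = trans (cong (λ z → U.coef z 0) (V.coef-C* U.X f b)) (U.coef-X*-0 _)

  cf-Y*-suc : ∀ f a b → cf (Y * f) a (suc b) ≡ cf f a b
  cf-Y*-suc f a b = cong (λ z → U.coef z a) (V.coef-X*-suc f b)

  cf-Y*-0 : ∀ f a → cf (Y * f) a 0 ≡ F.0#
  cf-Y*-0 f a = trans (cong (λ z → U.coef z a) (V.coef-X*-0 f)) (U.coef-0 a)

  cf-C-suc : ∀ g a b → cf (V.C g) a (suc b) ≡ F.0#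
  cf-C-suc g a b = trans (cong (λ z → U.coef z a) (V.coef-C-suc g b)) (U.coef-0 a)

  coefAd : ∀ n (h : ℕ → ℕ → FX.Carrier) a → U.coef (RingTheory.ad U.ring n h) a ≡ F.ad n (λ i j → U.coef (h i j) a)
  coefAd zero    h a = refl
  coefAd (suc n) h a = trans (U.coef-+ _ _ a) (cong (λ z → U.coef (h 0 (suc n)) a F.+ z) (coefAd n _ a))

  cf-* : ∀ f g a b → cf (f * g) a b ≡ F.ad b (λ j j′ → F.ad a (λ i i′ → cf f i j F.* cf g i′ j′))
  cf-* f g a b = trans (cong (λ z → U.coef z a) (V.coef-* f g b))
    (trans (coefAd b _ a) (F.ad-cong b (λ j j′ _ → U.coef-* _ _ a)))

  κ-+ : ∀ a b → κ (a F.+ b) ≡ κ a + κ b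
  κ-+ a b = trans (cong V.C (U.C-+ a b)) (V.C-+ _ _)

  κ-* : ∀ a b → κ (a F.* b) ≡ κ a * κ b
  κ-* a b = trans (cong V.C (U.C-* a b)) (V.C-* _ _)

  κ-0 : κ F.0# ≡ 0#
  κ-0 = trans (cong V.C U.C-0) V.C-0

  κhom : Hom F V.ring
  κhom = record { ⟦_⟧ = κ ; ⟦+⟧ = κ-+ ; ⟦*⟧ = κ-* ; ⟦1⟧ = refl }

  κ-inj : ∀ {a b} → κ a ≡ κ b → a ≡ b
  κ-inj e = U.C-inj (V.C-inj e)

  cf-κ-0 : ∀ c → cf (κ c) 0 0 ≡ c
  cf-κ-0 c = trans (cong (λ z → U.coef z 0) (V.coef-C-0 (U.C c))) (U.coef-C-0 c)

  cf-κ : ∀ c a b → 1 ℕ.≤ a ℕ.+ b → cf (κ c) a b ≡ F.0#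
  cf-κ c zero    (suc b) q = cf-C-suc (U.C c) 0 b
  cf-κ c (suc a) zero    q = trans (cong (λ z → U.coef z (suc a)) (V.coef-C-0 (U.C c))) (U.coef-C-suc c a)
  cf-κ c (suc a) (suc b) q = cf-C-suc (U.C c) (suc a) b

  cf-bounded : ∀ f → ∃ λ n → ∀ a b → n ℕ.≤ a ℕ.+ b → cf f a b ≡ F.0#
  cf-bounded = V.elim (λ f → ∃ λ n → ∀ a b → n ℕ.≤ a ℕ.+ b → cf f a b ≡ F.0#) (0 , λ a b _ → cf-0 a b) step
    where
    step : ∀ g f → (∃ λ n → ∀ a b → n ℕ.≤ a ℕ.+ b → cf f a b ≡ F.0#) →
      ∃ λ n → ∀ a b → n ℕ.≤ a ℕ.+ b → cf (V.C g + Y * f) a b ≡ F.0#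
    step g f (n , d) with U.bounded g
    ... | m , z = suc (m ℕ.⊔ n) , λ a b q → trans (cf-+ (V.C g) (Y * f) a b) (trans (cong₂ F._+_ (e a b q) (e′ a b q)) (F.+-identityˡ _))
      where
      e : ∀ a b → suc (m ℕ.⊔ n) ℕ.≤ a ℕ.+ b → cf (V.C g) a b ≡ F.0#
      e a zero    q = trans (cong (λ z → U.coef z a) (V.coef-C-0 g))
        (z a (ℕ.≤-trans (ℕ.m≤m⊔n m n) (ℕ.≤-trans (ℕ.n≤1+n _) (subst (suc (m ℕ.⊔ n) ℕ.≤_) (ℕ.+-identityʳ a) q))))
      e a (suc b) q = cf-C-suc g a b
      e′ : ∀ a b → suc (m ℕ.⊔ n) ℕ.≤ a ℕ.+ b → cf (Y * f) a b ≡ F.0#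
      e′ a zero    q = cf-Y*-0 f a
      e′ a (suc b) q = trans (cf-Y*-suc f a b) (d a b (ℕ.≤-trans (ℕ.m≤n⊔m m n) (ℕ.≤-pred (subst (suc (m ℕ.⊔ n) ℕ.≤_) (ℕ.+-suc a b) q))))


  private
    idHom : Hom F F
    idHom = record { ⟦_⟧ = λ x → x ; ⟦+⟧ = λ _ _ → refl ; ⟦*⟧ = λ _ _ → refl ; ⟦1⟧ = refl }

    module E₁ (x : F.Carrier) = Evaluation idHom x
    module E₂ (x y : F.Carrier) = Evaluation (E₁.hom x) y

  Point : Set
  Point = F.Carrier × F.Carrier

  evHom : Point → Hom V.ring F
  evHom (x , y) = E₂.hom x y

  ev : Point → A → F.Carrier
  ev P = Hom.⟦_⟧ (evHom P)

  ev-κ : ∀ P c → ev P (κ c) ≡ c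
  ev-κ (x , y) c = trans (E₂.ev-C x y (U.C c)) (E₁.ev-C x c)

  ev-X : ∀ P → ev P X ≡ proj₁ P
  ev-X (x , y) = trans (E₂.ev-C x y U.X) (E₁.ev-X x)

  ev-Y : ∀ P → ev P Y ≡ proj₂ P
  ev-Y (x , y) = E₂.ev-X x y


  private
    -- For X: d/dX on F[X], then extended by Y ↦ 0. For Y: the zero derivation of F[X], extended by
    -- Y ↦ 1.
    module dX₁ = Extend {F} zeroDerivation FX.1#
    module dX  = Extend {U.ring} dX₁.derivation V.0ᴾ
    module dY  = Extend {U.ring} zeroDerivation (V.C FX.1#)

    -- Stated over any ring because it serves twice: over F for the rows under `∂X`, and over F[X]
    -- for `∂Y`.
    coef-d : ∀ {R : Ring} (let module P = Polynomial R) f i →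
      P.coef (Extend.D {R} zeroDerivation (P.C (Ring.1# R)) f) i ≡ Ring._*_ R (RingTheory.nat R (suc i)) (P.coef f (suc i))
    coef-d {R} = P.elim (λ f → ∀ i → P.coef (E.D f) i ≡ R.nat (suc i) R.* P.coef f (suc i))
      (λ i → trans (cong (λ z → P.coef z i) E.D-0) (trans (P.coef-0 i) (sym (trans (cong (R.nat (suc i) R.*_) (P.coef-0 (suc i))) (R.zeroʳ _)))))
      step
      where
      module P = Polynomial R
      module E = Extend {R} zeroDerivation (P.C (Ring.1# R))
      module R where
        open Ring R public
        open RingTheory R public
      step : ∀ a f → (∀ i → P.coef (E.D f) i ≡ R.nat (suc i) R.* P.coef f (suc i)) →
        ∀ i → P.coef (E.D (P.C a P.+ᴾ P.X P.*ᴾ f)) i ≡ R.nat (suc i) R.* P.coef (P.C a P.+ᴾ P.X P.*ᴾ f) (suc i)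
      step a f ih i = begin
        P.coef (E.D (P.C a P.+ᴾ P.X P.*ᴾ f)) i
          ≡⟨ cong (λ z → P.coef z i) (E.D-step a f) ⟩
        P.coef ((P.C R.0# P.+ᴾ P.C R.1# P.*ᴾ f) P.+ᴾ P.X P.*ᴾ E.D f) i
          ≡⟨ trans (P.coef-+ _ _ i) (cong (λ z → z R.+ P.coef (P.X P.*ᴾ E.D f) i)
               (trans (cong (λ z → P.coef z i) (trans (cong₂ P._+ᴾ_ P.C-0 (Ring.*-identityˡ P.ring f)) (Ring.+-identityˡ P.ring f))) refl)) ⟩
        P.coef f i R.+ P.coef (P.X P.*ᴾ E.D f) i ≡⟨ go i ⟩
        R.nat (suc i) R.* P.coef f i
          ≡⟨ cong (R.nat (suc i) R.*_) (sym (trans (P.coef-+ _ _ (suc i)) (trans (cong₂ R._+_ (P.coef-C-suc a i) (P.coef-X*-suc f i)) (R.+-identityˡ _)))) ⟩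
        _ ∎
        where
        go : ∀ i → P.coef f i R.+ P.coef (P.X P.*ᴾ E.D f) i ≡ R.nat (suc i) R.* P.coef f i
        go zero    = trans (cong (P.coef f 0 R.+_) (P.coef-X*-0 _)) (trans (R.+-identityʳ _)
          (sym (trans (cong (R._* P.coef f 0) R.nat-1) (R.*-identityˡ _))))
        go (suc i) = trans (cong (P.coef f (suc i) R.+_) (trans (P.coef-X*-suc _ i) (ih i)))
          (R.Solver.solve 2 (λ c n → c R.Solver.:+ n R.Solver.:* c R.Solver.:= (R.Solver.con (ℤ.+ 1) R.Solver.:+ n) R.Solver.:* c) refl (P.coef f (suc i)) (R.nat (suc i)))

  ∂X ∂Y : Derivation V.ring
  ∂X = dX.derivation
  ∂Y = dY.derivation

  private
    ∂x ∂y : A → A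
    ∂x = Derivation.δ ∂X
    ∂y = Derivation.δ ∂Y

  cf-∂X : ∀ f a b → cf (∂x f) a b ≡ F.nat (suc a) F.* cf f (suc a) b
  cf-∂X f a b = trans (cong (λ z → U.coef z a) (go f b)) (coef-d {F} (V.coef f b) a)
    where
    go : ∀ f b → V.coef (∂x f) b ≡ dX₁.D (V.coef f b)
    go = V.elim (λ f → ∀ b → V.coef (∂x f) b ≡ dX₁.D (V.coef f b))
      (λ b → trans (cong (λ z → V.coef z b) dX.D-0) (trans (V.coef-0 b) (sym (trans (cong dX₁.D (V.coef-0 b)) dX₁.D-0))))
      (λ g f ih b → begin
        V.coef (∂x (V.C g + Y * f)) b ≡⟨ cong (λ z → V.coef z b) (dX.D-step g f) ⟩
        V.coef ((V.C (dX₁.D g) + V.0ᴾ * f) + Y * ∂x f) b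
          ≡⟨ cong (λ z → V.coef (z + Y * ∂x f) b) (trans (cong (V.C (dX₁.D g) +_) (zeroˡ f)) (+-identityʳ _)) ⟩
        V.coef (V.C (dX₁.D g) + Y * ∂x f) b ≡⟨ V.coef-+ _ _ b ⟩
        V.coef (V.C (dX₁.D g)) b FX.+ V.coef (Y * ∂x f) b ≡⟨ rows g f ih b ⟩
        dX₁.D (V.coef (V.C g) b) FX.+ dX₁.D (V.coef (Y * f) b) ≡⟨ sym (dX₁.D-+ _ _) ⟩
        dX₁.D (V.coef (V.C g) b FX.+ V.coef (Y * f) b) ≡⟨ cong dX₁.D (sym (V.coef-+ _ _ b)) ⟩
        dX₁.D (V.coef (V.C g + Y * f) b) ∎)
      where
      rows : ∀ g f → (∀ b → V.coef (∂x f) b ≡ dX₁.D (V.coef f b)) → ∀ b →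
        V.coef (V.C (dX₁.D g)) b FX.+ V.coef (Y * ∂x f) b ≡ dX₁.D (V.coef (V.C g) b) FX.+ dX₁.D (V.coef (Y * f) b)
      rows g f ih zero    = cong₂ FX._+_ (trans (V.coef-C-0 _) (cong dX₁.D (sym (V.coef-C-0 g))))
        (trans (V.coef-X*-0 _) (sym (trans (cong dX₁.D (V.coef-X*-0 f)) dX₁.D-0)))
      rows g f ih (suc b) = cong₂ FX._+_ (trans (V.coef-C-suc _ b) (sym (trans (cong dX₁.D (V.coef-C-suc g b)) dX₁.D-0)))
        (trans (V.coef-X*-suc _ b) (trans (ih b) (cong dX₁.D (sym (V.coef-X*-suc f b)))))

  cf-∂Y : ∀ f a b → cf (∂y f) a b ≡ F.nat (suc b) F.* cf f a (suc b)
  cf-∂Y f a b = trans (cong (λ z → U.coef z a) (coef-d {U.ring} f b))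
    (trans (cong (λ z → U.coef (z FX.* V.coef f (suc b)) a) (sym (Hom.⟦nat⟧ Chom (suc b)))) (U.coef-C* (F.nat (suc b)) _ a))
    where
    Chom : Hom F U.ring
    Chom = record { ⟦_⟧ = U.C ; ⟦+⟧ = U.C-+ ; ⟦*⟧ = U.C-* ; ⟦1⟧ = refl }

  ∂X-X : ∂x X ≡ 1#
  ∂X-X = trans (dX.D-C U.X) (cong V.C dX₁.D-X)

  ∂X-Y : ∂x Y ≡ 0#
  ∂X-Y = dX.D-X

  ∂Y-X : ∂y X ≡ 0#
  ∂Y-X = trans (dY.D-C U.X) V.C-0

  ∂Y-Y : ∂y Y ≡ 1#
  ∂Y-Y = dY.D-X

  ∂X-κ : ∀ c → ∂x (κ c) ≡ 0#
  ∂X-κ c = trans (dX.D-C (U.C c)) (trans (cong V.C (trans (dX₁.D-C c) U.C-0)) V.C-0)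

  ∂Y-κ : ∀ c → ∂y (κ c) ≡ 0#
  ∂Y-κ c = trans (dY.D-C (U.C c)) V.C-0

-- Double negation, least witnesses and divisibility.

infixl 1 _>>=_
_>>=_ : {P Q : Set} → ¬ ¬ P → (P → ¬ ¬ Q) → ¬ ¬ Q
(p >>= f) ¬q = p (λ x → f x ¬q)

return : {P : Set} → P → ¬ ¬ P
return x ¬x = ¬x x

-- `P` is not assumed decidable, so a least witness exists only classically. It replaces Euclid's
-- algorithm below: generators of ideals and irreducible divisors are chosen of least degree.
least : (P : ℕ → Set) → ∃ P → ¬ ¬ (∃ λ n → P n × (∀ m → m ℕ.< n → ¬ P m))
least P (n , pn) none = go n n ℕ.≤-refl pn
  where
  go : ∀ b n → n ℕ.≤ b → ¬ P n
  go zero    .0 z≤n pn = none (0 , pn , λ _ ())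
  go (suc b) n  q   pn = none (n , pn , λ m m<n → go b m (ℕ.≤-pred (ℕ.≤-trans m<n q)))

module Divisibility (R : Ring) where
  open Ring R
  open RingTheory R
  open Solver
  open ≡-Reasoning

  infix 4 _∣_
  _∣_ : Carrier → Carrier → Set
  a ∣ b = ∃ λ c → b ≡ a * c

  Unit : Carrier → Set
  Unit a = ∃ λ b → a * b ≡ 1#

  -- The last component refutes a pair of nonunit factors instead of naming the unit, since being a
  -- unit is not decided.
  Irreducible : Carrier → Set
  Irreducible a = a ≢ 0# × ¬ Unit a × (∀ b c → a ≡ b * c → ¬ Unit b → ¬ Unit c → ⊥)

  ∣-+ : ∀ {a b c} → a ∣ b → a ∣ c → a ∣ b + c
  ∣-+ {a} (x , p) (y , q) = x + y , trans (cong₂ _+_ p q) (sym (distribˡ a x y))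

  ∣-*ʳ : ∀ {a b} c → a ∣ b → a ∣ b * c
  ∣-*ʳ {a} c (x , p) = x * c , trans (cong (_* c) p) (*-assoc a x c)

  ∣-*ˡ : ∀ {a b} c → a ∣ b → a ∣ c * b
  ∣-*ˡ {a} {b} c d = subst (a ∣_) (*-comm b c) (∣-*ʳ c d)

  ∣-neg : ∀ {a b} → a ∣ b → a ∣ - b
  ∣-neg {a} (x , p) = - x , trans (cong -_ p) (-‿distribʳ-* a x)

  ∣-0 : ∀ {a} → a ∣ 0#
  ∣-0 {a} = 0# , sym (zeroʳ a)

  ∣-refl : ∀ {a} → a ∣ a
  ∣-refl {a} = 1# , sym (*-identityʳ a)

  ∣-trans : ∀ {a b c} → a ∣ b → b ∣ c → a ∣ c
  ∣-trans {a} (x , p) (y , q) = x * y , trans q (trans (cong (_* y) p) (*-assoc a x y))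

  ∣-unit : ∀ {a b u} → Unit u → a ∣ u * b → a ∣ b
  ∣-unit {a} {b} {u} (v , uv) (x , p) = v * x , (begin
    b             ≡⟨ sym (*-identityˡ b) ⟩
    1# * b        ≡⟨ cong (_* b) (sym uv) ⟩
    u * v * b     ≡⟨ solve 3 (λ u v b → u :* v :* b := v :* (u :* b)) refl u v b ⟩
    v * (u * b)   ≡⟨ cong (v *_) p ⟩
    v * (a * x)   ≡⟨ solve 3 (λ v a x → v :* (a :* x) := a :* (v :* x)) refl v a x ⟩
    a * (v * x)   ∎)

-- Degree and pseudo-division over an integral domain.

module Domain (R : Ring) (≢0-* : ∀ {a b} → a ≢ Ring.0# R → b ≢ Ring.0# R → Ring._*_ R a b ≢ Ring.0# R) where
  private
    module R where
      open Ring R public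
      open RingTheory R public
  open Polynomial R
  open Ring ring
  open RingTheory ring
  open Solver
  open ≡-Reasoning

  Below : ℕ → Poly → Set
  Below n f = ∀ i → n ℕ.≤ i → coef f i ≡ R.0#

  record HasDeg (f : Poly) (n : ℕ) : Set where
    constructor hasDeg
    field
      lead  : coef f n ≢ R.0#
      above : Below (suc n) f
  open HasDeg public

  private
   degree′ : ∀ f → f ≢ 0# → ∃ (HasDeg f)
   degree′ f f≢0 = go (proj₁ (bounded f)) (proj₂ (bounded f))
     where
     go : ∀ n → Below n f → ∃ (HasDeg f)
     go zero    z = ⊥-elim (f≢0 (ext (λ i → trans (z i z≤n) (sym (coef-0 i)))))
     go (suc n) z with coef f n R.≟ R.0#
     ... | no  c = n , hasDeg c z
     ... | yes c = go n (λ i n≤i → [ z i , (λ { refl → c }) ]′ (ℕ.m≤n⇒m<n∨m≡n n≤i))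

  abstract
    degree : ∀ f → f ≢ 0# → ∃ (HasDeg f)
    degree = degree′

  HasDeg-≢0 : ∀ {f n} → HasDeg f n → f ≢ 0#
  HasDeg-≢0 {n = n} d e = lead d (trans (cong (λ z → coef z n) e) (coef-0 n))

  HasDeg-* : ∀ {f g m n} → HasDeg f m → HasDeg g n → HasDeg (f * g) (m ℕ.+ n)
  HasDeg-* {f} {g} {m} {n} d e = hasDeg
    (λ z → ≢0-* (lead d) (lead e) (trans (sym (R.ad-single m n {λ i j → coef f i R.* coef g j} same)) (trans (sym (coef-* f g (m ℕ.+ n))) z)))
    (λ k q → trans (coef-* f g k) (R.ad-0 k (λ i j r → beyond i j (subst (m ℕ.+ n ℕ.<_) (sym r) q))))
    where
    left : ∀ i j → m ℕ.< i → coef f i R.* coef g j ≡ R.0#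
    left i j q = trans (cong (λ z → z R.* coef g j) (above d i q)) (R.zeroˡ _)
    right : ∀ i j → n ℕ.< j → coef f i R.* coef g j ≡ R.0#
    right i j q = trans (cong (λ z → coef f i R.* z) (above e j q)) (R.zeroʳ _)
    same : ∀ i j → i ℕ.+ j ≡ m ℕ.+ n → i ≢ m → coef f i R.* coef g j ≡ R.0#
    same i j q i≢m with ℕ.<-cmp i m
    ... | tri> _ _ m<i = left i j m<i
    ... | tri≈ _ i≡m _ = ⊥-elim (i≢m i≡m)
    ... | tri< i<m _ _ = right i j (ℕ.≰⇒> (λ j≤n → ℕ.<-irrefl q (ℕ.+-mono-<-≤ i<m j≤n)))
    beyond : ∀ i j → m ℕ.+ n ℕ.< i ℕ.+ j → coef f i R.* coef g j ≡ R.0#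
    beyond i j q with m ℕ.<? i
    ... | yes m<i = left i j m<i
    ... | no  m≮i = right i j (ℕ.≰⇒> (λ j≤n → ℕ.<⇒≱ q (ℕ.+-mono-≤ (ℕ.≮⇒≥ m≮i) j≤n)))

  *-≢0 : ∀ {f g} → f ≢ 0# → g ≢ 0# → f * g ≢ 0#
  *-≢0 {f} {g} f≢0 g≢0 = HasDeg-≢0 (HasDeg-* (proj₂ (degree f f≢0)) (proj₂ (degree g g≢0)))

  *-cancel : ∀ {f g h} → f ≢ 0# → f * g ≡ f * h → g ≡ h
  *-cancel {f} {g} {h} f≢0 e with (g - h) ≟ 0#
  ... | yes z = x-y≡0⇒x≡y z
  ... | no nz = ⊥-elim (*-≢0 f≢0 nz (trans (solve 3 (λ f g h → f :* (g :- h) := f :* g :- f :* h) refl f g h) (x≡y⇒x-y≡0 e)))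

  HasDeg-unique : ∀ {f m n} → HasDeg f m → HasDeg f n → m ≡ n
  HasDeg-unique {f} {m} {n} d e with ℕ.<-cmp m n
  ... | tri≈ _ q _ = q
  ... | tri< m<n _ _ = ⊥-elim (lead e (above d n m<n))
  ... | tri> _ _ n<m = ⊥-elim (lead d (above e m n<m))

  coef-X^* : ∀ k f i → coef (X ^ k * f) (k ℕ.+ i) ≡ coef f i
  coef-X^* zero    f i = cong (λ z → coef z i) (*-identityˡ f)
  coef-X^* (suc k) f i = trans (cong (λ z → coef z (suc (k ℕ.+ i))) (*-assoc X (X ^ k) f))
    (trans (coef-X*-suc (X ^ k * f) (k ℕ.+ i)) (coef-X^* k f i))

  -- The leading coefficient of `g` need not be invertible, so `f` is first multiplied by a power of
  -- it.
  Division : Poly → Poly → ℕ → Set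
  Division f g n = ∃ λ k → ∃ λ q → ∃ λ r → C (coef g n R.^ k) * f ≡ q * g + r × Below n r

  private
   pseudoDivide′ : ∀ {g n} → HasDeg g n → ∀ f → Division f g n
   pseudoDivide′ {g} {n} dg f = go (proj₁ (bounded f)) f (proj₂ (bounded f))
     where
     c = coef g n
     go : ∀ N f → Below N f → Division f g n
     go zero f z = 0 , 0# , f , solve 2 (λ f g → con (ℤ.+ 1) :* f := con (ℤ.+ 0) :* g :+ f) refl f g , λ i _ → z i z≤n
     go (suc N) f z with n ℕ.≤? N
     ... | no  n≰N = 0 , 0# , f , solve 2 (λ f g → con (ℤ.+ 1) :* f := con (ℤ.+ 0) :* g :+ f) refl f g
                   , λ i n≤i → z i (ℕ.≤-trans (ℕ.≰⇒> n≰N) n≤i)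
     ... | yes n≤N with go N (C c * f - C (coef f N) * (X ^ (N ∸ n) * g)) below
       where
       a = coef f N
       s = N ∸ n
       c-f : ∀ i → coef (C c * f - C a * (X ^ s * g)) i ≡ c R.* coef f i R.- a R.* coef (X ^ s * g) i
       c-f i = trans (coef-+ _ _ i) (cong₂ R._+_ (coef-C* c f i) (trans (coef-- _ i) (cong R.-_ (coef-C* a _ i))))
       below : Below N (C c * f - C a * (X ^ s * g))
       below i N≤i with ℕ.m≤n⇒m<n∨m≡n N≤i
       ... | inj₂ refl = trans (c-f N) (trans (cong (λ u → c R.* a R.- a R.* u)
               (trans (cong (coef (X ^ s * g)) (sym (ℕ.m∸n+n≡m n≤N))) (coef-X^* s g n)))
               (R.Solver.solve 2 (λ c a → c R.Solver.:* a R.Solver.:- a R.Solver.:* c R.Solver.:= R.Solver.con (ℤ.+ 0)) refl c a))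
       ... | inj₁ N<i  = trans (c-f i) (trans (cong₂ (λ u v → c R.* u R.- a R.* v) (z i N<i)
               (trans (cong (coef (X ^ s * g)) (sym (trans (cong (s ℕ.+_) refl) (ℕ.m+[n∸m]≡n s≤i))))
                 (trans (coef-X^* s g (i ∸ s)) (above dg (i ∸ s) n<i∸s))))
               (R.Solver.solve 2 (λ c a → c R.Solver.:* R.Solver.con (ℤ.+ 0) R.Solver.:- a R.Solver.:* R.Solver.con (ℤ.+ 0) R.Solver.:= R.Solver.con (ℤ.+ 0)) refl c a))
         where
         s≤i : s ℕ.≤ i
         s≤i = ℕ.≤-trans (ℕ.m∸n≤m N n) (ℕ.<⇒≤ N<i)
         n<i∸s : suc n ℕ.≤ i ∸ s
         n<i∸s = ℕ.m+n≤o⇒m≤o∸n (suc n) (subst (ℕ._≤ i) (cong suc (sym (trans (ℕ.+-comm n s) (ℕ.m∸n+n≡m n≤N)))) N<i)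
     ...   | k , q , r , e , zr = suc k , q + C (c R.^ k) * C (coef f N) * X ^ (N ∸ n) , r , (begin
         C (c R.* c R.^ k) * f ≡⟨ cong (_* f) (C-* c _) ⟩
         C c * C (c R.^ k) * f
           ≡⟨ solve 6 (λ c ck f a x g → c :* ck :* f := ck :* (c :* f :- a :* (x :* g)) :+ ck :* a :* x :* g) refl
                (C c) (C (c R.^ k)) f (C (coef f N)) (X ^ (N ∸ n)) g ⟩
         C (c R.^ k) * (C c * f - C (coef f N) * (X ^ (N ∸ n) * g)) + C (c R.^ k) * C (coef f N) * X ^ (N ∸ n) * g
           ≡⟨ cong (_+ C (c R.^ k) * C (coef f N) * X ^ (N ∸ n) * g) e ⟩
         q * g + r + C (c R.^ k) * C (coef f N) * X ^ (N ∸ n) * g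
           ≡⟨ solve 4 (λ q g r t → q :* g :+ r :+ t :* g := (q :+ t) :* g :+ r) refl q g r (C (c R.^ k) * C (coef f N) * X ^ (N ∸ n)) ⟩
         (q + C (c R.^ k) * C (coef f N) * X ^ (N ∸ n)) * g + r ∎) , zr

  abstract
    pseudoDivide : ∀ {g n} → HasDeg g n → ∀ f → Division f g n
    pseudoDivide = pseudoDivide′

-- Gauss's lemma and primality of irreducible polynomials.

module GaussLemma (K : PrimeField) where
  private module F = PrimeField K
  open PlanePolynomials K
  open Divisibility V.ring public
  private
    module DX = Divisibility U.ring
    module D₁ = Domain F.F F.*-≢0
    module D₂ = Domain U.ring D₁.*-≢0
    module UT = RingTheory U.ring
  open ≡-Reasoning

  *-≢0 : ∀ {f g} → f ≢ 0# → g ≢ 0# → f * g ≢ 0#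
  *-≢0 = D₂.*-≢0

  *-cancel : ∀ {f g h} → f ≢ 0# → f * g ≡ f * h → g ≡ h
  *-cancel = D₂.*-cancel

  private
    abstract
      unit-C : ∀ c → c ≢ F.0# → DX.Unit (U.C c)
      unit-C c c≢0 with F.inverse c c≢0
      ... | d , e = U.C d , trans (sym (U.C-* c d)) (cong U.C e)

    unit-deg0 : ∀ {f} → D₁.HasDeg f 0 → DX.Unit f
    unit-deg0 {f} d = subst DX.Unit (sym f≡) (unit-C _ (D₁.lead d))
      where
      f≡ : f ≡ U.C (U.coef f 0)
      f≡ = U.ext (λ { zero → sym (U.coef-C-0 _) ; (suc i) → trans (D₁.above d (suc i) (s≤s z≤n)) (sym (U.coef-C-suc _ i)) })

    nonunit-deg : ∀ {f n} → D₁.HasDeg f n → ¬ DX.Unit f → 0 ℕ.< n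
    nonunit-deg {n = zero}  d nu = ⊥-elim (nu (unit-deg0 d))
    nonunit-deg {n = suc n} d nu = s≤s z≤n

    unit-lift : ∀ {c} → DX.Unit c → Unit (V.C c)
    unit-lift {c} (d , e) = V.C d , trans (sym (V.C-* c d)) (cong V.C e)

    -- Among the nonzero g with π dividing g b, one of least degree divides all the others, in
    -- particular π and a. Since π = q′ g is irreducible, either q′ is a unit, and then π divides a,
    -- or g is a unit, and then π divides b.
    euclid : ∀ π a b → DX.Irreducible π → π DX.∣ a FX.* b → ¬ π DX.∣ a → ¬ ¬ (π DX.∣ b)
    euclid π a b (π≢0 , nu , irr) πab πa =
      least (λ n → ∃ λ g → D₁.HasDeg g n × π DX.∣ g FX.* b)
        (proj₁ dπ , π , proj₂ dπ , DX.∣-*ʳ b DX.∣-refl) >>= λ { (n , (g , dg , gb) , min) → step n g dg gb min }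
      where
      dπ = D₁.degree π π≢0
      step : ∀ n g → D₁.HasDeg g n → π DX.∣ g FX.* b →
        (∀ m → m ℕ.< n → ¬ (∃ λ g → D₁.HasDeg g m × π DX.∣ g FX.* b)) → ¬ ¬ (π DX.∣ b)
      step n g dg gb min ¬πb = irr q′ g π≡ (λ u → πa (π∣a u)) (λ u → ¬πb (DX.∣-unit u gb))
        where
        divides : ∀ f → π DX.∣ f FX.* b → ∃ λ q → f ≡ q FX.* g
        divides f fb = zero-or-not (D₁.pseudoDivide dg f)
          where
          zero-or-not : D₁.Division f g n → ∃ λ q → f ≡ q FX.* g
          zero-or-not (k , q , r , e , zr) = exact (r FX.≟ FX.0#)
            where
            open UT.Solver
            ck = U.C (U.coef g n F.^ k)
            cu = unit-C (U.coef g n F.^ k) (F.^-≢0 k (D₁.lead dg))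
            rb : π DX.∣ r FX.* b
            rb = subst (π DX.∣_) (begin
              ck FX.* (f FX.* b) FX.+ FX.- (q FX.* (g FX.* b)) ≡⟨ solve 5 (λ c f b q g → c :* (f :* b) :- q :* (g :* b) := (c :* f :- q :* g) :* b) refl ck f b q g ⟩
              (ck FX.* f FX.- q FX.* g) FX.* b ≡⟨ cong (λ z → (z FX.- q FX.* g) FX.* b) e ⟩
              (q FX.* g FX.+ r FX.- q FX.* g) FX.* b ≡⟨ solve 4 (λ q g r b → (q :* g :+ r :- q :* g) :* b := r :* b) refl q g r b ⟩
              r FX.* b ∎) (DX.∣-+ (DX.∣-*ˡ ck fb) (DX.∣-neg (DX.∣-*ˡ q gb)))
            exact : Dec (r ≡ FX.0#) → ∃ λ q → f ≡ q FX.* g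
            exact (yes r≡0) = proj₁ cu FX.* q , (begin
              f                                        ≡⟨ sym (FX.*-identityˡ f) ⟩
              FX.1# FX.* f                             ≡⟨ cong (FX._* f) (sym (proj₂ cu)) ⟩
              ck FX.* proj₁ cu FX.* f                  ≡⟨ solve 3 (λ a b c → a :* b :* c := b :* (a :* c)) refl ck (proj₁ cu) f ⟩
              proj₁ cu FX.* (ck FX.* f)                ≡⟨ cong (proj₁ cu FX.*_) (trans e (trans (cong (q FX.* g FX.+_) r≡0) (FX.+-identityʳ _))) ⟩
              proj₁ cu FX.* (q FX.* g)                 ≡⟨ sym (FX.*-assoc _ q g) ⟩
              proj₁ cu FX.* q FX.* g                   ∎)
            exact (no r≢0) = ⊥-elim (min (proj₁ dr) (ℕ.≰⇒> (λ n≤ → D₁.lead (proj₂ dr) (zr _ n≤))) (r , proj₂ dr , rb))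
              where dr = D₁.degree r r≢0
        q′ = proj₁ (divides π (DX.∣-*ʳ b DX.∣-refl))
        π≡ : π ≡ q′ FX.* g
        π≡ = proj₂ (divides π (DX.∣-*ʳ b DX.∣-refl))
        π∣g : DX.Unit q′ → π DX.∣ g
        π∣g u = DX.∣-unit u (subst (π DX.∣_) π≡ DX.∣-refl)
        π∣a : DX.Unit q′ → π DX.∣ a
        π∣a u = subst (π DX.∣_) (sym (proj₂ (divides a πab))) (DX.∣-*ˡ (proj₁ (divides a πab)) (π∣g u))

    content : ∀ π f → (∀ i → ¬ ¬ (π DX.∣ V.coef f i)) → ¬ ¬ (V.C π ∣ f)
    content π = V.elim (λ f → (∀ i → ¬ ¬ (π DX.∣ V.coef f i)) → ¬ ¬ (V.C π ∣ f))
      (λ _ → return ∣-0)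
      (λ a f ih h → h 0 >>= λ π∣a → ih (λ i → subst (λ z → ¬ ¬ (π DX.∣ z)) (c-suc a f i) (h (suc i))) >>= λ d →
        return (∣-+ (subst (V.C π ∣_) (cong V.C (c-0 a f)) (lift π∣a)) (∣-*ˡ Y d)))
      where
      lift : ∀ {a} → π DX.∣ a → V.C π ∣ V.C a
      lift (c , e) = V.C c , trans (cong V.C e) (V.C-* π c)
      c-0 : ∀ a f → V.coef (V.C a + Y * f) 0 ≡ a
      c-0 a f = trans (V.coef-+ _ _ 0) (trans (cong₂ FX._+_ (V.coef-C-0 a) (V.coef-X*-0 f)) (FX.+-identityʳ a))
      c-suc : ∀ a f i → V.coef (V.C a + Y * f) (suc i) ≡ V.coef f i
      c-suc a f i = trans (V.coef-+ _ _ (suc i)) (trans (cong₂ FX._+_ (V.coef-C-suc a i) (V.coef-X*-suc f i)) (FX.+-identityˡ _))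

    module _ (π : FX.Carrier) where
      I : FX.Carrier → Set
      I u = ¬ ¬ (π DX.∣ u)

      I-+ : ∀ {u v} → I u → I v → I (u FX.+ v)
      I-+ p q = p >>= λ x → q >>= λ y → return (DX.∣-+ x y)

      ad-∣ : ∀ n h → (∀ i j → i ℕ.+ j ≡ n → I (h i j)) → I (UT.ad n h)
      ad-∣ zero    h z = z 0 0 refl
      ad-∣ (suc n) h z = I-+ (z 0 (suc n) refl) (ad-∣ n _ (λ i j q → z (suc i) j (cong suc q)))

      ad-∣-single : ∀ a b h → (∀ i j → i ℕ.+ j ≡ a ℕ.+ b → i ≢ a → I (h i j)) → I (UT.ad (a ℕ.+ b) h FX.- h a b)
      ad-∣-single zero zero    h z = return (subst (π DX.∣_) (sym (FX.-‿inverseʳ _)) DX.∣-0)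
      ad-∣-single zero (suc b) h z = subst I (solve 2 (λ s t → t := (s :+ t) :- s) refl (h 0 (suc b)) _)
          (ad-∣ b (λ i j → h (suc i) j) (λ i j q → z (suc i) j (cong suc q) (λ ())))
        where open UT.Solver
      ad-∣-single (suc a) b h z = subst I (solve 3 (λ x s t → x :+ (s :- t) := (x :+ s) :- t) refl (h 0 (suc (a ℕ.+ b))) _ _)
          (I-+ (z 0 _ refl (λ ())) (ad-∣-single a b (λ i j → h (suc i) j)
            (λ i j q i≢a → z (suc i) j (cong suc q) (λ e → i≢a (ℕ.suc-injective e)))))
        where open UT.Solver

    -- Let i and j be the first positions where π does not divide the coefficient of `f`,
    -- respectively `g`. In coefficient i + j of the product all other terms are divisible by π,
    -- hence so is this one, against `euclid`.
    gauss : ∀ π f g → DX.Irreducible π → V.C π ∣ f * g → ¬ (V.C π ∣ f) → ¬ ¬ (V.C π ∣ g)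
    gauss π f g irr (h , e) ¬f ¬g =
      (content π f >>=′ ¬f) λ { (i , ¬fi) → (content π g >>=′ ¬g) λ { (j , ¬gj) →
        least (λ i → ¬ (π DX.∣ V.coef f i)) (i , ¬fi) λ { (i , ¬fi , minf) →
        least (λ j → ¬ (π DX.∣ V.coef g j)) (j , ¬gj) λ { (j , ¬gj , ming) →
          (subst (I π) (UT.Solver.solve 2 (λ s t → s UT.Solver.:- (s UT.Solver.:- t) UT.Solver.:= t) refl (UT.ad (i ℕ.+ j) (prod)) (prod i j))
            (I-+ π (total (i ℕ.+ j)) (λ n → ad-∣-single π i j prod (others i j minf ming) (λ d → n (DX.∣-neg d)))))
          (λ d → euclid π (V.coef f i) (V.coef g j) irr d ¬fi ¬gj) } } } }
      where
      infixl 1 _>>=′_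
      _>>=′_ : ∀ {P : ℕ → Set} {Q : Set} → ((∀ i → ¬ ¬ P i) → ¬ ¬ Q) → ¬ Q → ¬ ¬ (∃ λ i → ¬ P i)
      (c >>=′ ¬q) none = c (λ i ¬pi → none (i , ¬pi)) ¬q
      prod : ℕ → ℕ → FX.Carrier
      prod i j = V.coef f i FX.* V.coef g j
      total : ∀ n → I π (UT.ad n prod)
      total n = return (V.coef h n , trans (sym (V.coef-* f g n)) (trans (cong (λ z → V.coef z n) e) (V.coef-C* π h n)))
      others : ∀ i j → (∀ m → m ℕ.< i → ¬ ¬ (π DX.∣ V.coef f m)) → (∀ m → m ℕ.< j → ¬ ¬ (π DX.∣ V.coef g m)) →
        ∀ i′ j′ → i′ ℕ.+ j′ ≡ i ℕ.+ j → i′ ≢ i → I π (prod i′ j′)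
      others i j mf mg i′ j′ q ne with ℕ.<-cmp i′ i
      ... | tri< lt _ _ = mf i′ lt >>= λ d → return (DX.∣-*ʳ _ d)
      ... | tri≈ _ eq _ = ⊥-elim (ne eq)
      ... | tri> _ _ gt = mg j′ (ℕ.≰⇒> (λ j≤ → ℕ.<-irrefl (sym q) (ℕ.+-mono-<-≤ gt j≤))) >>= λ d → return (DX.∣-*ˡ _ d)

    -- A divisor of least positive degree is irreducible.
    factor : ∀ c n → D₁.HasDeg c n → 0 ℕ.< n → ¬ ¬ (∃ λ π → DX.Irreducible π × π DX.∣ c)
    factor c n dc 0<n =
      least (λ n → ∃ λ π → D₁.HasDeg π n × 0 ℕ.< n × π DX.∣ c) (n , c , dc , 0<n , DX.∣-refl)
        >>= λ { (m , (π , dπ , 0<m , d) , min) → return (π , (D₁.HasDeg-≢0 dπ , notUnit m π dπ 0<m , irr m π dπ d min) , d) }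
      where
      notUnit : ∀ m π → D₁.HasDeg π m → 0 ℕ.< m → ¬ DX.Unit π
      notUnit m π dπ 0<m (v , e) = ℕ.<-irrefl (sym (ℕ.m+n≡0⇒m≡0 m (D₁.HasDeg-unique (subst (λ z → D₁.HasDeg z (m ℕ.+ proj₁ dv)) e (D₁.HasDeg-* dπ (proj₂ dv))) d1))) 0<m
        where
        v≢0 : v ≢ FX.0#
        v≢0 z = F.1≢0 (U.C-inj (trans (sym e) (trans (cong (π FX.*_) z) (trans (FX.zeroʳ π) (sym U.C-0)))))
        dv = D₁.degree v v≢0
        d1 : D₁.HasDeg FX.1# 0
        d1 = D₁.hasDeg (λ z → F.1≢0 (trans (sym (U.coef-C-0 F.1#)) z)) (λ { (suc i) _ → U.coef-C-suc F.1# i })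
      irr : ∀ m π → D₁.HasDeg π m → π DX.∣ c → (∀ m′ → m′ ℕ.< m → ¬ (∃ λ π → D₁.HasDeg π m′ × 0 ℕ.< m′ × π DX.∣ c)) →
        ∀ a b → π ≡ a FX.* b → ¬ DX.Unit a → ¬ DX.Unit b → ⊥
      irr m π dπ d min a b refl ua ub = min (proj₁ da) (ℕ.≤-trans (ℕ.m<m+n (proj₁ da) (nonunit-deg (proj₂ db) ub)) (ℕ.≤-reflexive sum)) (a , proj₂ da , nonunit-deg (proj₂ da) ua , DX.∣-trans (b , refl) d)
        where
        a≢0 : a ≢ FX.0#
        a≢0 z = D₁.HasDeg-≢0 dπ (trans (cong (FX._* b) z) (FX.zeroˡ b))
        b≢0 : b ≢ FX.0#
        b≢0 z = D₁.HasDeg-≢0 dπ (trans (cong (a FX.*_) z) (FX.zeroʳ a))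
        da = D₁.degree a a≢0
        db = D₁.degree b b≢0
        sum : proj₁ da ℕ.+ proj₁ db ≡ m
        sum = D₁.HasDeg-unique (D₁.HasDeg-* (proj₂ da) (proj₂ db)) dπ

    Split : FX.Carrier → A → A → A → Set
    Split c H q w = ∃ λ c₁ → ∃ λ c₂ → ∃ λ q₀ → ∃ λ w₀ →
      c ≡ c₁ FX.* c₂ × q ≡ V.C c₁ * q₀ × w ≡ V.C c₂ * w₀ × H ≡ q₀ * w₀

    -- The irreducible factors of `c` are removed one at a time, and `gauss` assigns each of them to
    -- `q` or to `w`. This replaces the passage to the field of fractions of F[X].
    split : ∀ N c n → n ℕ.≤ N → D₁.HasDeg c n → ∀ H q w → V.C c * H ≡ q * w → ¬ ¬ Split c H q w
    split N c zero n≤N dc H q w e = return (c , FX.1# , V.C (proj₁ u) * q , w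
        , sym (FX.*-identityʳ c)
        , sym (trans (sym (*-assoc _ _ _)) (trans (cong (_* q) (proj₂ (unit-lift u))) (*-identityˡ q)))
        , sym (*-identityˡ w)
        , (begin
            H                            ≡⟨ sym (*-identityˡ H) ⟩
            1# * H                       ≡⟨ cong (_* H) (sym (proj₂ (unit-lift u))) ⟩
            V.C c * V.C (proj₁ u) * H    ≡⟨ solve 3 (λ a b c → a :* b :* c := b :* (a :* c)) refl (V.C c) (V.C (proj₁ u)) H ⟩
            V.C (proj₁ u) * (V.C c * H)  ≡⟨ cong (V.C (proj₁ u) *_) e ⟩
            V.C (proj₁ u) * (q * w)      ≡⟨ sym (*-assoc _ q w) ⟩
            V.C (proj₁ u) * q * w        ∎))
      where
      open Solver
      u = unit-deg0 dc
    split (suc N) c (suc n) (s≤s n≤N) dc H q w e = factor c (suc n) dc (s≤s z≤n) >>= λ { (π , irr , (c′ , refl)) →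
      ¬¬-excluded-middle {A = V.C π ∣ q} >>= λ
        { (yes (q′ , refl)) → next π c′ irr dc H q′ w (begin
              V.C π * (V.C c′ * H)     ≡⟨ trans (sym (*-assoc _ _ H)) (cong (_* H) (sym (V.C-* π c′))) ⟩
              V.C (π FX.* c′) * H      ≡⟨ e ⟩
              V.C π * q′ * w           ≡⟨ *-assoc _ q′ w ⟩
              V.C π * (q′ * w)         ∎)
            >>= λ { (c₁ , c₂ , q₀ , w₀ , ec , eq , ew , eH) → return (π FX.* c₁ , c₂ , q₀ , w₀
              , trans (cong (π FX.*_) ec) (sym (FX.*-assoc π c₁ c₂))
              , trans (cong (V.C π *_) eq) (trans (sym (*-assoc _ _ q₀)) (cong (_* q₀) (sym (V.C-* π c₁))))
              , ew , eH) }
        ; (no ¬q) → gauss π q w irr (V.C c′ * H , trans (sym e) (trans (cong (_* H) (V.C-* π c′)) (*-assoc _ _ H))) ¬q >>= λ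
          { (w′ , refl) → next π c′ irr dc H q w′ (begin
              V.C π * (V.C c′ * H)     ≡⟨ trans (sym (*-assoc _ _ H)) (cong (_* H) (sym (V.C-* π c′))) ⟩
              V.C (π FX.* c′) * H      ≡⟨ e ⟩
              q * (V.C π * w′)         ≡⟨ Solver.solve 3 (λ a b c → a Solver.:* (b Solver.:* c) Solver.:= b Solver.:* (a Solver.:* c)) refl q (V.C π) w′ ⟩
              V.C π * (q * w′)         ∎)
            >>= λ { (c₁ , c₂ , q₀ , w₀ , ec , eq , ew , eH) → return (c₁ , π FX.* c₂ , q₀ , w₀
              , trans (cong (π FX.*_) ec) (UT.Solver.solve 3 (λ a b c → a UT.Solver.:* (b UT.Solver.:* c) UT.Solver.:= b UT.Solver.:* (a UT.Solver.:* c)) refl π c₁ c₂)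
              , eq
              , trans (cong (V.C π *_) ew) (trans (sym (*-assoc _ _ w₀)) (cong (_* w₀) (sym (V.C-* π c₂))))
              , eH) } } } }
      where
      next : ∀ π c′ → DX.Irreducible π → D₁.HasDeg (π FX.* c′) (suc n) → ∀ H q w → V.C π * (V.C c′ * H) ≡ V.C π * (q * w) → ¬ ¬ Split c′ H q w
      next π c′ (π≢0 , nu , _) dc H q w e = split N c′ (proj₁ dc′) small (proj₂ dc′) H q w
        (*-cancel (λ z → π≢0 (V.C-inj (trans z (sym V.C-0)))) e)
        where
        c′≢0 : c′ ≢ FX.0#
        c′≢0 z = D₁.HasDeg-≢0 dc (trans (cong (π FX.*_) z) (FX.zeroʳ π))
        dc′ = D₁.degree c′ c′≢0
        dπ = D₁.degree π π≢0
        sum : proj₁ dπ ℕ.+ proj₁ dc′ ≡ suc n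
        sum = D₁.HasDeg-unique (D₁.HasDeg-* (proj₂ dπ) (proj₂ dc′)) dc
        small : proj₁ dc′ ℕ.≤ N
        small = ℕ.≤-trans (ℕ.≤-pred (ℕ.≤-trans (ℕ.m<n+m (proj₁ dc′) (nonunit-deg (proj₂ dπ) nu)) (ℕ.≤-reflexive sum))) n≤N

    split′ : ∀ c → c ≢ FX.0# → ∀ H q w → V.C c * H ≡ q * w → ¬ ¬ Split c H q w
    split′ c c≢0 H q w e = split (proj₁ (D₁.degree c c≢0)) c _ ℕ.≤-refl (proj₂ (D₁.degree c c≢0)) H q w e

  -- The Euclidean argument in F(X)[Y] with denominators cleared. If `G` involves Y, an element `w`
  -- of least Y-degree in the ideal of `u` and `G` divides both of them up to factors from F[X], and
  -- `split` turns this into G = q₀ w₀. If q₀ is a unit, G divides u; if w₀ is a unit, G divides v.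
  prime : ∀ G u v → Irreducible G → G ∣ u * v → ¬ (G ∣ u) → ¬ ¬ (G ∣ v)
  prime G u v (G≢0 , nu , irr) Guv ¬u ¬v = ¬¬-excluded-middle {A = ∃ λ g → G ≡ V.C g} λ
    { (yes (g , refl)) → gauss g u v (g≢0 g G≢0 , (λ w → nu (unit-lift w)) , irr₁ g irr) Guv ¬u ¬v
    ; (no nc) → least (λ n → ∃ λ w → D₂.HasDeg w n × Ideal w) (proj₁ dG , G , proj₂ dG , (0# , 1# , eG))
        λ { (n , (w , dw , iw) , min) → step nc n w dw iw min } }
    where
    open Solver
    dG = D₂.degree G G≢0
    g≢0 : ∀ g → V.C g ≢ 0# → g ≢ FX.0#
    g≢0 g n z = n (trans (cong V.C z) V.C-0)
    unit-lower : ∀ {a} → Unit (V.C a) → DX.Unit a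
    unit-lower {a} (b , e) = V.coef b 0 , trans (sym (V.coef-C* a b 0)) (trans (cong (λ z → V.coef z 0) e) (V.coef-C-0 FX.1#))
    irr₁ : ∀ g → (∀ b c → V.C g ≡ b * c → ¬ Unit b → ¬ Unit c → ⊥) → ∀ a b → g ≡ a FX.* b → ¬ DX.Unit a → ¬ DX.Unit b → ⊥
    irr₁ g irr a b e ua ub = irr (V.C a) (V.C b) (trans (cong V.C e) (V.C-* a b)) (λ x → ua (unit-lower x)) (λ x → ub (unit-lower x))
    Ideal : A → Set
    Ideal w = ∃ λ α → ∃ λ β → w ≡ α * u + β * G
    eG : G ≡ 0# * u + 1# * G
    eG = solve 2 (λ u G → G := con (ℤ.+ 0) :* u :+ con (ℤ.+ 1) :* G) refl u G
    eu : u ≡ 1# * u + 0# * G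
    eu = solve 2 (λ u G → u := con (ℤ.+ 1) :* u :+ con (ℤ.+ 0) :* G) refl u G
    -- `split` writes G as c₁ G₀ with c₁ from F[X]. If c₁ is a unit, G divides h; if G₀ is a unit, G
    -- would itself lie in F[X].
    cancel-C : ¬ (∃ λ g → G ≡ V.C g) → ∀ c → c ≢ FX.0# → ∀ h → G ∣ V.C c * h → ¬ ¬ (G ∣ h)
    cancel-C nc c c≢0 h (k , e) ¬h = split′ c c≢0 h G k e λ { (c₁ , c₂ , G₀ , k₀ , _ , eG , _ , eh) →
      irr (V.C c₁) G₀ eG
        (λ { (d , cd) → ¬h (d * k₀ , trans eh (begin
            G₀ * k₀                   ≡⟨ sym (*-identityˡ _) ⟩
            1# * (G₀ * k₀)            ≡⟨ cong (_* (G₀ * k₀)) (sym cd) ⟩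
            V.C c₁ * d * (G₀ * k₀)    ≡⟨ solve 4 (λ a b c d → a :* b :* (c :* d) := (a :* c) :* (b :* d)) refl (V.C c₁) d G₀ k₀ ⟩
            V.C c₁ * G₀ * (d * k₀)    ≡⟨ cong (_* (d * k₀)) (sym eG) ⟩
            G * (d * k₀)              ∎)) })
        (λ U₀ → ¬¬-excluded-middle {A = ∃ λ g → G₀ ≡ V.C g} λ
          { (yes (g , e₀)) → nc (c₁ FX.* g , trans eG (trans (cong (V.C c₁ *_) e₀) (sym (V.C-* c₁ g))))
          ; (no n) → n (V.coef G₀ 0 , unit-const G₀ U₀) }) }
      where
      unit-const : ∀ f → Unit f → f ≡ V.C (V.coef f 0)
      unit-const f (g , e) = V.ext (λ { zero → sym (V.coef-C-0 _) ; (suc i) → trans (D₂.above df (suc i) (s≤s z≤n)) (sym (V.coef-C-suc _ i)) })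
        where
        one≢0 : 1# ≢ 0#
        one≢0 z = F.1≢0 (κ-inj (trans z (sym κ-0)))
        f≢0 : f ≢ 0#
        f≢0 z = one≢0 (trans (sym e) (trans (cong (_* g) z) (zeroˡ g)))
        g≢0′ : g ≢ 0#
        g≢0′ z = one≢0 (trans (sym e) (trans (cong (f *_) z) (zeroʳ f)))
        d1 : D₂.HasDeg 1# 0
        d1 = D₂.hasDeg (λ z → F.1≢0 (U.C-inj (trans (sym (V.coef-C-0 FX.1#)) (trans z (sym U.C-0))))) (λ { (suc i) _ → V.coef-C-suc FX.1# i })
        df₀ = D₂.degree f f≢0
        dg₀ = D₂.degree g g≢0′
        df : D₂.HasDeg f 0
        df = subst (D₂.HasDeg f) (ℕ.m+n≡0⇒m≡0 (proj₁ df₀) (D₂.HasDeg-unique (subst (λ z → D₂.HasDeg z (proj₁ df₀ ℕ.+ proj₁ dg₀)) e (D₂.HasDeg-* (proj₂ df₀) (proj₂ dg₀))) d1)) (proj₂ df₀)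
    step : ¬ (∃ λ g → G ≡ V.C g) → ∀ n w → D₂.HasDeg w n → Ideal w →
      (∀ m → m ℕ.< n → ¬ (∃ λ w → D₂.HasDeg w m × Ideal w)) → ⊥
    step nc n w dw (α , β , ew) min = split′ ckG ckG≢0 G qG w (proj₂ dG′)
        λ { (c₁ , c₂ , q₀ , w₀ , _ , _ , ew₀ , eG₀) → irr q₀ w₀ eG₀
          (λ { (d , qd) → cancel-C nc cku cku≢0 u (subst (G ∣_) (sym (proj₂ du)) (∣-*ˡ qu (subst (G ∣_) (sym ew₀) (∣-*ˡ (V.C c₂) (d , (begin
              w₀            ≡⟨ sym (*-identityˡ w₀) ⟩
              1# * w₀       ≡⟨ cong (_* w₀) (sym qd) ⟩
              q₀ * d * w₀   ≡⟨ solve 3 (λ a b c → a :* b :* c := (a :* c) :* b) refl q₀ d w₀ ⟩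
              q₀ * w₀ * d   ≡⟨ cong (_* d) (sym eG₀) ⟩
              G * d         ∎)))))) ¬u })
          (λ { (d , wd) → cancel-C nc c₂ (c₂≢0 c₂ w₀ ew₀) v (subst (G ∣_) (begin
              d * (α * (u * v) + β * G * v) ≡⟨ solve 6 (λ d α u v β G → d :* (α :* (u :* v) :+ β :* G :* v) := d :* ((α :* u :+ β :* G) :* v)) refl d α u v β G ⟩
              d * ((α * u + β * G) * v) ≡⟨ cong (λ z → d * (z * v)) (trans (sym ew) ew₀) ⟩
              d * (V.C c₂ * w₀ * v) ≡⟨ solve 4 (λ d c w v → d :* (c :* w :* v) := (w :* d) :* (c :* v)) refl d (V.C c₂) w₀ v ⟩
              w₀ * d * (V.C c₂ * v) ≡⟨ trans (cong (_* (V.C c₂ * v)) wd) (*-identityˡ _) ⟩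
              V.C c₂ * v ∎)
              (∣-*ˡ d (∣-+ (∣-*ˡ α Guv) (∣-*ʳ v (∣-*ˡ β ∣-refl))))) ¬v }) }
      where
      c = V.coef w n
      divides : ∀ f → Ideal f → ∃ λ k → ∃ λ q → V.C (UT._^_ c k) * f ≡ q * w
      divides f (α′ , β′ , ef) = zero-or-not (D₂.pseudoDivide dw f)
        where
        zero-or-not : D₂.Division f w n → ∃ λ k → ∃ λ q → V.C (UT._^_ c k) * f ≡ q * w
        zero-or-not (k , q , r , e , zr) = exact (r ≟ 0#)
          where
          ck = V.C (UT._^_ c k)
          er : r ≡ (ck * α′ - q * α) * u + (ck * β′ - q * β) * G
          er = begin
            r ≡⟨ solve 3 (λ q w r → r := (q :* w :+ r) :- q :* w) refl q w r ⟩
            (q * w + r) - q * w ≡⟨ cong₂ (λ s t → s - q * t) (trans (sym e) (cong (ck *_) ef)) ew ⟩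
            ck * (α′ * u + β′ * G) - q * (α * u + β * G)
              ≡⟨ solve 8 (λ c a b q a′ b′ u G → c :* (a :* u :+ b :* G) :- q :* (a′ :* u :+ b′ :* G) := (c :* a :- q :* a′) :* u :+ (c :* b :- q :* b′) :* G) refl ck α′ β′ q α β u G ⟩
            (ck * α′ - q * α) * u + (ck * β′ - q * β) * G ∎
          exact : Dec (r ≡ 0#) → ∃ λ k → ∃ λ q → V.C (UT._^_ c k) * f ≡ q * w
          exact (yes r≡0) = k , q , trans e (trans (cong (q * w +_) r≡0) (+-identityʳ _))
          exact (no r≢0)  = ⊥-elim (min (proj₁ dr) (ℕ.≰⇒> (λ n≤ → D₂.lead (proj₂ dr) (zr _ n≤)))
            (r , proj₂ dr , ck * α′ - q * α , ck * β′ - q * β , er))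
            where dr = D₂.degree r r≢0
      powers : ∀ k → UT._^_ c k ≢ FX.0#
      powers zero    z = F.1≢0 (U.C-inj (trans z (sym U.C-0)))
      powers (suc k) = D₁.*-≢0 (D₂.lead dw) (powers k)
      dG′ = proj₂ (divides G (0# , 1# , eG))
      ckG = UT._^_ c (proj₁ (divides G (0# , 1# , eG)))
      qG = proj₁ dG′
      ckG≢0 = powers (proj₁ (divides G (0# , 1# , eG)))
      du = proj₂ (divides u (1# , 0# , eu))
      cku = UT._^_ c (proj₁ (divides u (1# , 0# , eu)))
      qu = proj₁ du
      cku≢0 = powers (proj₁ (divides u (1# , 0# , eu)))
      c₂≢0 : ∀ c₂ w₀ → w ≡ V.C c₂ * w₀ → c₂ ≢ FX.0#
      c₂≢0 c₂ w₀ e z = D₂.HasDeg-≢0 dw (trans e (trans (cong (_* w₀) (trans (cong V.C z) V.C-0)) (zeroˡ w₀)))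

-- An interface to F[X,Y], total degree and monomials.

record Plane (K : PrimeField) : Set₁ where
  private module F = PrimeField K
  field
    ringA : Ring
  open Ring ringA public
  open RingTheory ringA public
  field
    κhom  : Hom F.F ringA
    X Y   : Carrier
    cf    : Carrier → ℕ → ℕ → F.Carrier
  κ : F.Carrier → Carrier
  κ = Hom.⟦_⟧ κhom
  Point : Set
  Point = F.Carrier × F.Carrier
  field
    κ-inj     : ∀ {a b} → κ a ≡ κ b → a ≡ b
    cf-ext    : ∀ {f g} → (∀ a b → cf f a b ≡ cf g a b) → f ≡ g
    cf-+      : ∀ f g a b → cf (f + g) a b ≡ cf f a b F.+ cf g a b
    cf--      : ∀ f a b → cf (- f) a b ≡ F.- cf f a b
    cf-0      : ∀ a b → cf 0# a b ≡ F.0#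
    cf-*      : ∀ f g a b → cf (f * g) a b ≡ F.ad b (λ j j′ → F.ad a (λ i i′ → cf f i j F.* cf g i′ j′))
    cf-κ-0    : ∀ c → cf (κ c) 0 0 ≡ c
    cf-κ      : ∀ c a b → 1 ℕ.≤ a ℕ.+ b → cf (κ c) a b ≡ F.0#
    cf-κ*     : ∀ c f a b → cf (κ c * f) a b ≡ c F.* cf f a b
    cf-X*-suc : ∀ f a b → cf (X * f) (suc a) b ≡ cf f a b
    cf-X*-0   : ∀ f b → cf (X * f) 0 b ≡ F.0#
    cf-Y*-suc : ∀ f a b → cf (Y * f) a (suc b) ≡ cf f a b
    cf-Y*-0   : ∀ f a → cf (Y * f) a 0 ≡ F.0#
    cf-bounded : ∀ f → ∃ λ n → ∀ a b → n ℕ.≤ a ℕ.+ b → cf f a b ≡ F.0#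
    evHom     : Point → Hom ringA F.F
    ev-κ      : ∀ P c → Hom.⟦_⟧ (evHom P) (κ c) ≡ c
    ev-X      : ∀ P → Hom.⟦_⟧ (evHom P) X ≡ proj₁ P
    ev-Y      : ∀ P → Hom.⟦_⟧ (evHom P) Y ≡ proj₂ P
    ∂X ∂Y     : Derivation ringA
    cf-∂X     : ∀ f a b → cf (Derivation.δ ∂X f) a b ≡ F.nat (suc a) F.* cf f (suc a) b
    cf-∂Y     : ∀ f a b → cf (Derivation.δ ∂Y f) a b ≡ F.nat (suc b) F.* cf f a (suc b)
    ∂X-X      : Derivation.δ ∂X X ≡ 1#
    ∂X-Y      : Derivation.δ ∂X Y ≡ 0#
    ∂Y-X      : Derivation.δ ∂Y X ≡ 0#
    ∂Y-Y      : Derivation.δ ∂Y Y ≡ 1#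
    ∂X-κ      : ∀ c → Derivation.δ ∂X (κ c) ≡ 0#
    ∂Y-κ      : ∀ c → Derivation.δ ∂Y (κ c) ≡ 0#
    *-≢0      : ∀ {f g} → f ≢ 0# → g ≢ 0# → f * g ≢ 0#
    prime     : ∀ G u v → Divisibility.Irreducible ringA G → Divisibility._∣_ ringA G (u * v) →
                ¬ Divisibility._∣_ ringA G u → ¬ ¬ Divisibility._∣_ ringA G v

module PlaneTheory (K : PrimeField) (P : Plane K) where
  private module F = PrimeField K
  open F using (p)
  open Plane P public
  open Divisibility ringA public
  open Hom κhom public using () renaming (⟦+⟧ to κ-+; ⟦*⟧ to κ-*; ⟦0⟧ to κ-0; ⟦1⟧ to κ-1; ⟦-⟧ to κ--)
  open ≡-Reasoning

  A : Set
  A = Carrier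

  ev : Point → A → F.Carrier
  ev Q = Hom.⟦_⟧ (evHom Q)

  ∂x ∂y : A → A
  ∂x = Derivation.δ ∂X
  ∂y = Derivation.δ ∂Y

  nat-κ : ∀ n → κ (F.nat n) ≡ nat n
  nat-κ = Hom.⟦nat⟧ κhom

  -- The inequality is strict: Deg n f says deg f < n.
  record Deg (n : ℕ) (f : A) : Set where
    constructor deg
    field cf≡0 : ∀ a b → n ℕ.≤ a ℕ.+ b → cf f a b ≡ F.0#
  open Deg public

  Deg-mono : ∀ {m n f} → m ℕ.≤ n → Deg m f → Deg n f
  Deg-mono m≤n d .cf≡0 a b q = cf≡0 d a b (ℕ.≤-trans m≤n q)

  Deg-+ : ∀ {n f g} → Deg n f → Deg n g → Deg n (f + g)
  Deg-+ {f = f} {g} d e .cf≡0 a b q = trans (cf-+ f g a b) (trans (cong₂ F._+_ (cf≡0 d a b q) (cf≡0 e a b q)) (F.+-identityˡ _))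

  Deg-- : ∀ {n f} → Deg n f → Deg n (- f)
  Deg-- {f = f} d .cf≡0 a b q = trans (cf-- f a b) (trans (cong F.-_ (cf≡0 d a b q)) F.-0#≈0#)

  Deg-0 : ∀ {n} → Deg n 0#
  Deg-0 .cf≡0 a b _ = cf-0 a b

  Deg-sum : ∀ {n} m {f : Fin m → A} → (∀ i → Deg n (f i)) → Deg n (sumF m f)
  Deg-sum zero    d = Deg-0
  Deg-sum (suc m) d = Deg-+ (d zero) (Deg-sum m (λ i → d (suc i)))

  Deg-κ : ∀ c → Deg 1 (κ c)
  Deg-κ c .cf≡0 = cf-κ c

  Deg-* : ∀ {n m f g} → Deg (suc n) f → Deg m g → Deg (n ℕ.+ m) (f * g)
  Deg-* {n} {m} {f} {g} d e .cf≡0 a b q = trans (cf-* f g a b)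
    (F.ad-0 b (λ j j′ jq → F.ad-0 a (λ i i′ iq →
      [ (λ r → trans (cong (λ z → z F.* cf g i′ j′) (cf≡0 d i j r)) (F.zeroˡ _))
      , (λ r → trans (cong (λ z → cf f i j F.* z) (cf≡0 e i′ j′ r)) (F.zeroʳ _)) ]′ (pair-≤ {n} {m} i j i′ j′ iq jq q))))

  Deg-κ* : ∀ {n f} c → Deg n f → Deg n (κ c * f)
  Deg-κ* c d = Deg-* (Deg-κ c) d

  Deg-1 : Deg 1 1#
  Deg-1 = subst (Deg 1) κ-1 (Deg-κ F.1#)

  Deg-X : Deg 2 X
  Deg-X = subst (Deg 2) (*-identityʳ X) d
    where
    d : Deg 2 (X * 1#)
    d .cf≡0 zero    b q = cf-X*-0 1# b
    d .cf≡0 (suc a) b q = trans (cf-X*-suc 1# a b) (cf≡0 Deg-1 a b (ℕ.≤-pred q))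

  Deg-Y : Deg 2 Y
  Deg-Y = subst (Deg 2) (*-identityʳ Y) d
    where
    d : Deg 2 (Y * 1#)
    d .cf≡0 a zero    q = cf-Y*-0 1# a
    d .cf≡0 a (suc b) q = trans (cf-Y*-suc 1# a b) (cf≡0 Deg-1 a b (ℕ.≤-pred (subst (2 ℕ.≤_) (ℕ.+-suc a b) q)))

  Deg-nat : ∀ m → Deg 1 (nat m)
  Deg-nat m = subst (Deg 1) (nat-κ m) (Deg-κ (F.nat m))

  Deg≤ : ℕ → A → Set
  Deg≤ n f = Deg (suc n) f

  Deg≤-* : ∀ {n m f g} → Deg≤ n f → Deg≤ m g → Deg≤ (n ℕ.+ m) (f * g)
  Deg≤-* {n} {m} {f} {g} d e = subst (λ z → Deg z (f * g)) (ℕ.+-suc n m) (Deg-* d e)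

  Deg≤-^ : ∀ {n f} k → Deg≤ n f → Deg≤ (k ℕ.* n) (f ^ k)
  Deg≤-^ zero    d = Deg-1
  Deg≤-^ (suc k) d = Deg≤-* d (Deg≤-^ k d)

  Deg-exists : ∀ f → ∃ λ n → Deg n f
  Deg-exists f = proj₁ (cf-bounded f) , deg (proj₂ (cf-bounded f))

  Deg-∂X : ∀ {n f} → Deg (suc n) f → Deg n (∂x f)
  Deg-∂X {n} {f} d .cf≡0 a b q = trans (cf-∂X f a b) (trans (cong (F.nat (suc a) F.*_) (cf≡0 d (suc a) b (s≤s q))) (F.zeroʳ _))

  Deg-∂Y : ∀ {n f} → Deg (suc n) f → Deg n (∂y f)
  Deg-∂Y {n} {f} d .cf≡0 a b q = trans (cf-∂Y f a b) (trans (cong (F.nat (suc b) F.*_)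
    (cf≡0 d a (suc b) (subst (suc n ℕ.≤_) (sym (ℕ.+-suc a b)) (s≤s q)))) (F.zeroʳ _))

  -- mon n enumerates the monomials of degree < n
  mon : ∀ n → Fin (tri n) → A
  mon (suc n) j = [ (λ a → X ^ toℕ a) , (λ i → Y * mon n i) ]′ (splitAt (suc n) j)

  poly : ∀ n → (Fin (tri n) → F.Carrier) → A
  poly n x = sumF (tri n) (λ j → κ (x j) * mon n j)

  private
    row : ∀ n → (Fin n → F.Carrier) → A
    row n x = sumF n (λ a → κ (x a) * X ^ toℕ a)

    poly-suc : ∀ n x → poly (suc n) x ≡ row (suc n) (λ a → x (a ↑ˡ tri n)) + Y * poly n (λ j → x (suc n ↑ʳ j))
    poly-suc n x = trans (sumF-split (suc n) (tri n) (λ j → κ (x j) * mon (suc n) j))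
      (cong₂ _+_
        (sumF-cong (suc n) (λ a → cong (λ z → κ (x (a ↑ˡ tri n)) * [ (λ a → X ^ toℕ a) , (λ i → Y * mon n i) ]′ z) (splitAt-↑ˡ (suc n) a (tri n))))
        (trans (sumF-cong (tri n) (λ j → trans (cong (λ z → κ (x (suc n ↑ʳ j)) * [ (λ a → X ^ toℕ a) , (λ i → Y * mon n i) ]′ z) (splitAt-↑ʳ (suc n) (tri n) j))
                  (Solver.solve 3 (λ a b c → a Solver.:* (b Solver.:* c) Solver.:= b Solver.:* (a Solver.:* c)) refl (κ (x (suc n ↑ʳ j))) Y (mon n j))))
               (sumF-* (tri n) Y _)))

    row-suc : ∀ n x → row (suc n) x ≡ κ (x zero) + X * row n (λ a → x (suc a))
    row-suc n x = cong₂ _+_ (*-identityʳ _) (trans (sumF-cong n (λ a →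
      Solver.solve 3 (λ a b c → a Solver.:* (b Solver.:* c) Solver.:= b Solver.:* (a Solver.:* c)) refl (κ (x (suc a))) X (X ^ toℕ a))) (sumF-* n X _))

    cf-row : ∀ n x a → cf (row n x) (toℕ a) 0 ≡ x a
    cf-row (suc n) x zero    = trans (cong (λ z → cf z 0 0) (row-suc n x))
      (trans (cf-+ _ _ 0 0) (trans (cong₂ F._+_ (cf-κ-0 (x zero)) (cf-X*-0 _ 0)) (F.+-identityʳ _)))
    cf-row (suc n) x (suc a) = trans (cong (λ z → cf z (suc (toℕ a)) 0) (row-suc n x))
      (trans (cf-+ _ _ (suc (toℕ a)) 0) (trans (cong₂ F._+_ (cf≡0 (Deg-κ (x zero)) (suc (toℕ a)) 0 (s≤s z≤n)) (trans (cf-X*-suc _ (toℕ a) 0) (cf-row n _ a))) (F.+-identityˡ _)))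

    cf-row-suc : ∀ n x a b → cf (row n x) a (suc b) ≡ F.0#
    cf-row-suc zero    x a b = cf-0 a (suc b)
    cf-row-suc (suc n) x a b = trans (cong (λ z → cf z a (suc b)) (row-suc n x))
      (trans (cf-+ _ _ a (suc b)) (trans (cong₂ F._+_ (cf-κ (x zero) a (suc b) (ℕ.≤-trans (s≤s z≤n) (ℕ.m≤n+m (suc b) a))) (go a)) (F.+-identityˡ _)))
      where
      go : ∀ a → cf (X * row n (λ a → x (suc a))) a (suc b) ≡ F.0#
      go zero    = cf-X*-0 _ (suc b)
      go (suc a) = trans (cf-X*-suc _ a (suc b)) (cf-row-suc n _ a b)

  -- Closes the dimension counts: a solution whose polynomials are all zero is the zero vector of
  -- unknowns.
  poly-inj : ∀ n x → poly n x ≡ 0# → ∀ j → x j ≡ F.0#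
  poly-inj (suc n) x e j = go (splitAt (suc n) j) refl
    where
    z : ∀ a b → cf (row (suc n) (λ a → x (a ↑ˡ tri n))) a b F.+ cf (Y * poly n (λ j → x (suc n ↑ʳ j))) a b ≡ F.0#
    z a b = trans (sym (cf-+ _ _ a b)) (trans (cong (λ u → cf u a b) (trans (sym (poly-suc n x)) e)) (cf-0 a b))
    tail≡0 : poly n (λ j → x (suc n ↑ʳ j)) ≡ 0#
    tail≡0 = cf-ext (λ a b → trans (sym (trans (cong₂ F._+_ (cf-row-suc (suc n) (λ a → x (a ↑ˡ tri n)) a b) (cf-Y*-suc _ a b)) (F.+-identityˡ _)))
      (trans (z a (suc b)) (sym (cf-0 a b))))
    go : ∀ s → splitAt (suc n) j ≡ s → x j ≡ F.0#
    go (inj₁ a) q = trans (cong x (sym (splitAt⁻¹-↑ˡ q)))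
      (trans (sym (cf-row (suc n) (λ a → x (a ↑ˡ tri n)) a)) (trans (sym (trans (cong (λ u → cf (row (suc n) (λ a → x (a ↑ˡ tri n))) (toℕ a) 0 F.+ u) (cf-Y*-0 _ (toℕ a))) (F.+-identityʳ _)))
        (z (toℕ a) 0)))
    go (inj₂ i) q = trans (cong x (sym (splitAt⁻¹-↑ʳ q))) (poly-inj n _ tail≡0 i)

  Deg-mon : ∀ n j → Deg n (mon n j)
  Deg-mon (suc n) j with splitAt (suc n) j
  ... | inj₁ a = Deg-mono (s≤s (ℕ.≤-trans (ℕ.≤-reflexive (ℕ.*-identityʳ (toℕ a))) (ℕ.≤-pred (toℕ<n a)))) (Deg≤-^ (toℕ a) Deg-X)
  ... | inj₂ i = Deg-* Deg-Y (Deg-mon n i)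

  Deg-poly : ∀ n x → Deg n (poly n x)
  Deg-poly n x = Deg-sum (tri n) (λ j → Deg-κ* (x j) (Deg-mon n j))

  exponents : ℕ → List (ℕ × ℕ)
  exponents zero    = []
  exponents (suc n) = map (_, 0) (upTo (suc n)) ++ map (λ (a , b) → a , suc b) (exponents n)

  length-exponents : ∀ n → length (exponents n) ≡ tri n
  length-exponents zero    = refl
  length-exponents (suc n) = trans (length-++ (map (_, 0) (upTo (suc n))))
    (cong₂ ℕ._+_ (trans (length-map (_, 0) (upTo (suc n))) (length-upTo (suc n))) (trans (length-map _ (exponents n)) (length-exponents n)))

  ∈-exponents : ∀ n a b → a ℕ.+ b ℕ.< n → (a , b) ∈ exponents n
  ∈-exponents (suc n) a zero    q = ∈-++⁺ˡ (∈-map⁺ (_, 0) (∈-upTo⁺ (subst (ℕ._< suc n) (ℕ.+-identityʳ a) q)))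
  ∈-exponents (suc n) a (suc b) q = ∈-++⁺ʳ (map (_, 0) (upTo (suc n)))
    (∈-map⁺ (λ (a , b) → a , suc b) (∈-exponents n a b (ℕ.≤-pred (subst (ℕ._< suc n) (ℕ.+-suc a b) q))))

plane : ∀ K → Plane K
plane K = record
  { ringA = V.ring ; κhom = κhom ; X = X ; Y = Y ; cf = cf
  ; κ-inj = κ-inj ; cf-ext = cf-ext ; cf-+ = cf-+ ; cf-- = cf-- ; cf-0 = cf-0 ; cf-* = cf-*
  ; cf-κ-0 = cf-κ-0 ; cf-κ = cf-κ ; cf-κ* = cf-κ* ; cf-X*-suc = cf-X*-suc ; cf-X*-0 = cf-X*-0
  ; cf-Y*-suc = cf-Y*-suc ; cf-Y*-0 = cf-Y*-0 ; cf-bounded = cf-bounded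
  ; evHom = evHom ; ev-κ = ev-κ ; ev-X = ev-X ; ev-Y = ev-Y
  ; ∂X = ∂X ; ∂Y = ∂Y ; cf-∂X = cf-∂X ; cf-∂Y = cf-∂Y
  ; ∂X-X = ∂X-X ; ∂X-Y = ∂X-Y ; ∂Y-X = ∂Y-X ; ∂Y-Y = ∂Y-Y ; ∂X-κ = ∂X-κ ; ∂Y-κ = ∂Y-κ
  ; *-≢0 = GaussLemma.*-≢0 K ; prime = GaussLemma.prime K }
  where open PlanePolynomials K

-- Leading monomials and their multiplicativity.

module LeadingMonomials (K : PrimeField) (P : Plane K) where
  private module F = PrimeField K
  open PlaneTheory K P

  -- X^α Y^β is the leading monomial of f: of maximal total degree, and then of maximal degree in Y
  record LM (f : A) (α β : ℕ) : Set where
    constructor lm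
    field
      lm-≢0  : cf f α β ≢ F.0#
      lm-deg : Deg≤ (α ℕ.+ β) f
      lm-top : ∀ a b → a ℕ.+ b ≡ α ℕ.+ β → β ℕ.< b → cf f a b ≡ F.0#
  open LM public

  LM-exists : ∀ f → f ≢ 0# → ∃ λ α → ∃ λ β → LM f α β
  LM-exists f f≢0 = search (proj₁ (Deg-exists f)) (proj₂ (Deg-exists f))
    where
    Result = ∃ λ α → ∃ λ β → LM f α β
    row : ∀ D → Deg≤ D f → ∀ t → t ℕ.≤ suc D → (∀ a b → a ℕ.+ b ≡ D → t ℕ.≤ b → cf f a b ≡ F.0#) →
      Result ⊎ (∀ a b → a ℕ.+ b ≡ D → cf f a b ≡ F.0#)
    row D d zero    t≤ z = inj₂ (λ a b q → z a b q z≤n)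
    row D d (suc t) t≤ z = test (cf f (D ∸ t) t F.≟ F.0#)
      where
      D≡ : (D ∸ t) ℕ.+ t ≡ D
      D≡ = ℕ.m∸n+n≡m (ℕ.≤-pred t≤)
      test : Dec (cf f (D ∸ t) t ≡ F.0#) → Result ⊎ (∀ a b → a ℕ.+ b ≡ D → cf f a b ≡ F.0#)
      test (no  n) = inj₁ (D ∸ t , t , lm n (subst (λ u → Deg≤ u f) (sym D≡) d) (λ a b q → z a b (trans q D≡)))
      test (yes y) = row D d t (ℕ.≤-trans (ℕ.n≤1+n t) t≤) (λ a b q t≤b → [ z a b q , (λ { refl →
        trans (cong (λ u → cf f u t) (ℕ.+-cancelʳ-≡ t a (D ∸ t) (trans q (sym D≡)))) y }) ]′ (ℕ.m≤n⇒m<n∨m≡n t≤b))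
    search : ∀ n → Deg n f → Result
    search zero    d = ⊥-elim (f≢0 (cf-ext (λ a b → trans (cf≡0 d a b z≤n) (sym (cf-0 a b)))))
    search (suc D) d = [ (λ r → r) , (λ z → search D (deg (λ a b q →
        [ cf≡0 d a b , (λ e → z a b (sym e)) ]′ (ℕ.m≤n⇒m<n∨m≡n q)))) ]′
      (row D d (suc D) ℕ.≤-refl (λ a b q r → ⊥-elim (ℕ.<-irrefl refl (ℕ.≤-trans r (ℕ.≤-trans (ℕ.m≤n+m b a) (ℕ.≤-reflexive q))))))

  module _ {f g α β α′ β′} (F₁ : LM f α β) (G₁ : LM g α′ β′) where
    private
      e e′ : ℕ
      e  = α ℕ.+ β
      e′ = α′ ℕ.+ β′

      term : ∀ i j i′ j′ → (i ℕ.+ j) ℕ.+ (i′ ℕ.+ j′) ≡ e ℕ.+ e′ →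
        (i ℕ.+ j ≡ e → i′ ℕ.+ j′ ≡ e′ → j ℕ.≤ β → j′ ℕ.≤ β′ → ⊥) → cf f i j F.* cf g i′ j′ ≡ F.0#
      term i j i′ j′ s no-way with ℕ.<-cmp (i ℕ.+ j) e
      ... | tri> _ _ gt = trans (cong (F._* cf g i′ j′) (cf≡0 (lm-deg F₁) i j gt)) (F.zeroˡ _)
      ... | tri< lt _ _ = trans (cong (cf f i j F.*_) (cf≡0 (lm-deg G₁) i′ j′ (ℕ.≰⇒> (λ le → ℕ.<-irrefl s (ℕ.+-mono-<-≤ lt le))))) (F.zeroʳ _)
      ... | tri≈ _ eq _ with β ℕ.<? j | β′ ℕ.<? j′
      ...   | yes q | _ = trans (cong (F._* cf g i′ j′) (lm-top F₁ i j eq q)) (F.zeroˡ _)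
      ...   | no _ | yes q = trans (cong (cf f i j F.*_) (lm-top G₁ i′ j′ eq′ q)) (F.zeroʳ _)
        where
        eq′ : i′ ℕ.+ j′ ≡ e′
        eq′ = ℕ.+-cancelˡ-≡ e _ _ (trans (cong (ℕ._+ (i′ ℕ.+ j′)) (sym eq)) s)
      ...   | no q | no q′ = ⊥-elim (no-way eq (ℕ.+-cancelˡ-≡ e _ _ (trans (cong (ℕ._+ (i′ ℕ.+ j′)) (sym eq)) s)) (ℕ.≮⇒≥ q) (ℕ.≮⇒≥ q′))

      swap : ∀ i j i′ j′ → (i ℕ.+ j) ℕ.+ (i′ ℕ.+ j′) ≡ (i ℕ.+ i′) ℕ.+ (j ℕ.+ j′)
      swap = ℕS.solve 4 (λ i j i′ j′ → (i ℕS.:+ j) ℕS.:+ (i′ ℕS.:+ j′) ℕS.:= (i ℕS.:+ i′) ℕS.:+ (j ℕS.:+ j′)) refl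

    -- Only the two leading monomials can meet here: total degrees add up, and among terms of top
    -- degree the exponents of Y add up.
    LM-*-cf : cf (f * g) (α ℕ.+ α′) (β ℕ.+ β′) ≡ cf f α β F.* cf g α′ β′
    LM-*-cf = trans (cf-* f g _ _)
      (trans (F.ad-single β β′ {λ j j′ → F.ad (α ℕ.+ α′) (λ i i′ → cf f i j F.* cf g i′ j′)}
                (λ j j′ q j≢β → F.ad-0 (α ℕ.+ α′) (λ i i′ r → term i j i′ j′ (sum i j i′ j′ r q)
                  (λ _ _ j≤β j′≤β′ → j≢β (ℕ.≤-antisym j≤β (ℕ.≮⇒≥ (λ j<β → ℕ.<-irrefl q (ℕ.+-mono-<-≤ j<β j′≤β′))))))))
             (F.ad-single α α′ {λ i i′ → cf f i β F.* cf g i′ β′}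
                (λ i i′ r i≢α → term i β i′ β′ (sum i β i′ β′ r refl) (λ u _ _ _ → i≢α (ℕ.+-cancelʳ-≡ β i α u)))))
      where
      sum : ∀ i j i′ j′ → i ℕ.+ i′ ≡ α ℕ.+ α′ → j ℕ.+ j′ ≡ β ℕ.+ β′ → (i ℕ.+ j) ℕ.+ (i′ ℕ.+ j′) ≡ e ℕ.+ e′
      sum i j i′ j′ r q = trans (swap i j i′ j′) (trans (cong₂ ℕ._+_ r q) (sym (swap α β α′ β′)))

    LM-* : LM (f * g) (α ℕ.+ α′) (β ℕ.+ β′)
    LM-* = lm (λ z → F.*-≢0 (lm-≢0 F₁) (lm-≢0 G₁) (trans (sym LM-*-cf) z))
      (subst (λ z → Deg≤ z (f * g)) (swap α β α′ β′) (Deg≤-* (lm-deg F₁) (lm-deg G₁)))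
      (λ a b s q → trans (cf-* f g a b) (F.ad-0 b (λ j j′ jq → F.ad-0 a (λ i i′ iq → term i j i′ j′
        (trans (swap i j i′ j′) (trans (cong₂ ℕ._+_ iq jq) (trans s (sym (swap α β α′ β′)))))
        (λ _ _ j≤ j′≤ → ℕ.<⇒≱ (subst (β ℕ.+ β′ ℕ.<_) (sym jq) q) (ℕ.+-mono-≤ j≤ j′≤))))))

-- Linear systems whose unknowns are coefficients of polynomials.

module LinearMaps (K : PrimeField) (P : Plane K) where
  private module F = PrimeField K
  open PlaneTheory K P
  open LinearAlgebra K public
  open Solver

  record LinearMap (n : ℕ) : Set where
    field
      fn    : Vector n → A
      fn-≗  : ∀ {x y} → (∀ i → x i ≡ y i) → fn x ≡ fn y
      fn-+  : ∀ x y → fn (λ i → x i F.+ y i) ≡ fn x + fn y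
      fn-*  : ∀ c x → fn (λ i → c F.* x i) ≡ κ c * fn x
  open LinearMap public

  comb : ∀ n → (Fin n → A) → Vector n → A
  comb n E x = sumF n (λ i → κ (x i) * E i)

  combination : ∀ n → (Fin n → A) → LinearMap n
  combination n E = record
    { fn   = comb n E
    ; fn-≗ = λ e → sumF-cong n (λ i → cong (λ z → κ z * E i) (e i))
    ; fn-+ = λ x y → trans (sumF-cong n (λ i → trans (cong (_* E i) (κ-+ _ _)) (distribʳ _ _ _))) (sumF-+ n _ _)
    ; fn-* = λ c x → trans (sumF-cong n (λ i → trans (cong (_* E i) (κ-* _ _)) (*-assoc _ _ _))) (sumF-* n (κ c) _) }

  _⊞_ : ∀ {n} → LinearMap n → LinearMap n → LinearMap n
  L ⊞ M = record
    { fn   = λ x → fn L x + fn M x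
    ; fn-≗ = λ e → cong₂ _+_ (fn-≗ L e) (fn-≗ M e)
    ; fn-+ = λ x y → trans (cong₂ _+_ (fn-+ L x y) (fn-+ M x y))
               (solve 4 (λ a b c d → (a :+ b) :+ (c :+ d) := (a :+ c) :+ (b :+ d)) refl (fn L x) (fn L y) (fn M x) (fn M y))
    ; fn-* = λ c x → trans (cong₂ _+_ (fn-* L c x) (fn-* M c x)) (sym (distribˡ _ _ _)) }

  _⊠_ : ∀ {n} → A → LinearMap n → LinearMap n
  u ⊠ L = record
    { fn   = λ x → u * fn L x
    ; fn-≗ = λ e → cong (u *_) (fn-≗ L e)
    ; fn-+ = λ x y → trans (cong (u *_) (fn-+ L x y)) (distribˡ _ _ _)
    ; fn-* = λ c x → trans (cong (u *_) (fn-* L c x)) (solve 3 (λ a b c → a :* (b :* c) := b :* (a :* c)) refl u (κ c) (fn L x)) }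

  zeroMap : ∀ {n} → LinearMap n
  zeroMap = record { fn = λ _ → 0# ; fn-≗ = λ _ → refl ; fn-+ = λ _ _ → sym (+-identityˡ 0#) ; fn-* = λ c _ → sym (zeroʳ (κ c)) }

  sumMap : ∀ {n} m → (Fin m → LinearMap n) → LinearMap n
  sumMap zero    L = zeroMap
  sumMap (suc m) L = L zero ⊞ sumMap m (λ i → L (suc i))

  fn-sumMap : ∀ {n} m (L : Fin m → LinearMap n) x → fn (sumMap m L) x ≡ sumF m (λ i → fn (L i) x)
  fn-sumMap zero    L x = refl
  fn-sumMap (suc m) L x = cong (λ z → fn (L zero) x + z) (fn-sumMap m (λ i → L (suc i)) x)

  -- Selects, from one long vector of unknowns, the block that encodes a single polynomial.
  reindex : ∀ {m n} → (Fin m → Fin n) → LinearMap m → LinearMap n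
  reindex ρ L = record
    { fn   = λ x → fn L (λ i → x (ρ i))
    ; fn-≗ = λ e → fn-≗ L (λ i → e (ρ i))
    ; fn-+ = λ x y → fn-+ L _ _
    ; fn-* = λ c x → fn-* L c _ }

  coefficient : ∀ {n} → LinearMap n → ℕ × ℕ → Functional n
  coefficient L (a , b) = record
    { app  = λ x → cf (fn L x) a b
    ; ap-≗ = λ e → cong (λ z → cf z a b) (fn-≗ L e)
    ; ap-+ = λ x y → trans (cong (λ z → cf z a b) (fn-+ L x y)) (cf-+ _ _ a b)
    ; ap-* = λ c x → trans (cong (λ z → cf z a b) (fn-* L c x)) (cf-κ* c _ a b) }

  coefficients-0 : ∀ n f → Deg n f → All (λ (a , b) → cf f a b ≡ F.0#) (exponents n) → f ≡ 0#
  coefficients-0 n f d z = cf-ext (λ a b → trans (go a b (n ℕ.≤? a ℕ.+ b)) (sym (cf-0 a b)))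
    where
    go : ∀ a b → Dec (n ℕ.≤ a ℕ.+ b) → cf f a b ≡ F.0#
    go a b (yes q) = cf≡0 d a b q
    go a b (no q)  = All.lookup z (∈-exponents n a b (ℕ.≰⇒> q))

  Deg-bound : ∀ n (E : Fin n → A) → ∃ λ N → ∀ i → Deg N (E i)
  Deg-bound zero    E = 0 , λ ()
  Deg-bound (suc n) E with Deg-exists (E zero) | Deg-bound n (λ i → E (suc i))
  ... | a , d | b , e = a ℕ.⊔ b , λ { zero → Deg-mono (ℕ.m≤m⊔n a b) d ; (suc i) → Deg-mono (ℕ.m≤n⊔m a b) (e i) }

  Deg-comb : ∀ {N} n {E : Fin n → A} → (∀ i → Deg N (E i)) → ∀ x → Deg N (comb n E x)
  Deg-comb n d x = Deg-sum n (λ i → Deg-κ* (x i) (d i))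

  comb-0 : ∀ n E x → (∀ i → x i ≡ F.0#) → comb n E x ≡ 0#
  comb-0 n E x z = sumF-0 n (λ i → trans (cong (λ u → κ u * E i) (z i)) (trans (cong (_* E i) κ-0) (zeroˡ _)))

-- Bézout's inequality on an irreducible curve.

module Curve (K : PrimeField) (P : Plane K) (G : Plane.Carrier P) (irr : Divisibility.Irreducible (Plane.ringA P) G)
  (α β : ℕ) (lmG : LeadingMonomials.LM K P G α β) where
  private module F = PrimeField K
  open PlaneTheory K P
  open LeadingMonomials K P
  open LinearMaps K P
  open Solver

  e : ℕ
  e = α ℕ.+ β

  -- u vanishes on the curve (double negation makes membership stable)
  InG : A → Set
  InG u = ¬ ¬ (G ∣ u)

  InG-+ : ∀ {u v} → InG u → InG v → InG (u + v)
  InG-+ p q = p >>= λ x → q >>= λ y → return (∣-+ x y)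

  InG-neg : ∀ {u} → InG u → InG (- u)
  InG-neg p = p >>= λ x → return (∣-neg x)

  InG-- : ∀ {u v} → InG u → InG v → InG (u - v)
  InG-- p q = InG-+ p (InG-neg q)

  InG-*ʳ : ∀ {u} v → InG u → InG (u * v)
  InG-*ʳ v p = p >>= λ x → return (∣-*ʳ v x)

  InG-*ˡ : ∀ {u} v → InG u → InG (v * u)
  InG-*ˡ v p = p >>= λ x → return (∣-*ˡ v x)

  InG-0 : InG 0#
  InG-0 = return ∣-0

  InG-G : InG G
  InG-G = return ∣-refl

  InG-prime : ∀ {u v} → InG (u * v) → ¬ InG u → InG v
  InG-prime {u} {v} p ¬u = p >>= λ d → prime G u v irr d (λ x → ¬u (return x))

  InG-*-≢ : ∀ {u v} → ¬ InG u → ¬ InG v → ¬ InG (u * v)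
  InG-*-≢ ¬u ¬v p = ¬v (InG-prime p ¬u)

  G≢0 : G ≢ 0#
  G≢0 = proj₁ irr

  -- The leading monomial of a nonzero multiple of `G` is divisible by X^α Y^β. Requiring zeros at
  -- all multiples of X^α Y^β is therefore a linear way of choosing representatives modulo `G`.
  normal-form : ∀ v → InG v → (∀ i j → cf v (α ℕ.+ i) (β ℕ.+ j) ≡ F.0#) → v ≡ 0#
  normal-form v iv z = decidable-stable (v ≟ 0#) (iv >>= λ { (h , refl) → nonzero h (h ≟ 0#) z })
    where
    nonzero : ∀ h → Dec (h ≡ 0#) → (∀ i j → cf (G * h) (α ℕ.+ i) (β ℕ.+ j) ≡ F.0#) → ¬ ¬ (G * h ≡ 0#)
    nonzero h (yes q) z = return (trans (cong (G *_) q) (zeroʳ G))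
    nonzero h (no q)  z with LM-exists h q
    ... | i , j , l = ⊥-elim (F.*-≢0 (lm-≢0 lmG) (lm-≢0 l) (trans (sym (LM-*-cf lmG l)) (z i j)))

  InG-Deg : ∀ v → InG v → Deg e v → v ≡ 0#
  InG-Deg v iv d = normal-form v iv (λ i j → cf≡0 d _ _
    (ℕ.+-mono-≤ (ℕ.m≤m+n α i) (ℕ.m≤m+n β j)))

  private
    -- The system c + Ψ v + G u = 0, with c in the span of `E` and v in normal form modulo `G`, has
    -- only the zero solution: c vanishes by independence, then Ψ v lies in the ideal of `G`, so v
    -- does because the ideal is prime, so v = 0 and u = 0. Hence there are at most as many unknowns
    -- as equations.
    bezout′ : ∀ δ Ψ → ¬ InG Ψ → Deg≤ δ Ψ → ∀ k (E : Fin k → A) →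
      (∀ c v → InG (comb k E c - Ψ * v) → ∀ i → c i ≡ F.0#) → k ℕ.≤ e ℕ.* δ
    bezout′ δ Ψ ¬Ψ dΨ k E indep = ℕ.≮⇒≥ contra
      where
      -- All `E i` have degree below `a`. Degrees below a + e for v and below a + δ for u put all
      -- three summands below a + e + δ.
      a : ℕ
      a = proj₁ (Deg-bound k E)
      s t n : ℕ
      s = tri (a ℕ.+ e)
      t = tri (a ℕ.+ δ)
      n = k ℕ.+ (s ℕ.+ t)
      c-part : LinearMap n
      c-part = reindex (_↑ˡ (s ℕ.+ t)) (combination k E)
      v-part : LinearMap n
      v-part = reindex (λ i → k ↑ʳ (i ↑ˡ t)) (combination s (mon (a ℕ.+ e)))
      u-part : LinearMap n
      u-part = reindex (λ i → k ↑ʳ (s ↑ʳ i)) (combination t (mon (a ℕ.+ δ)))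
      total : LinearMap n
      total = c-part ⊞ ((Ψ ⊠ v-part) ⊞ (G ⊠ u-part))
      shift : ℕ × ℕ → ℕ × ℕ
      shift (i , j) = α ℕ.+ i , β ℕ.+ j
      fs : List (Functional n)
      fs = map (coefficient total) (exponents (a ℕ.+ (e ℕ.+ δ))) ++ map (λ ij → coefficient v-part (shift ij)) (exponents a)
      len : length fs ≡ tri (a ℕ.+ (e ℕ.+ δ)) ℕ.+ tri a
      len = trans (length-++ (map (coefficient total) (exponents (a ℕ.+ (e ℕ.+ δ)))))
        (cong₂ ℕ._+_ (trans (length-map _ (exponents (a ℕ.+ (e ℕ.+ δ)))) (length-exponents (a ℕ.+ (e ℕ.+ δ))))
                     (trans (length-map _ (exponents a)) (length-exponents a)))
      -- The equations outnumber the coefficients of v and u by exactly e δ, so k > e δ leaves a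
      -- surplus of unknowns.
      count : tri (a ℕ.+ (e ℕ.+ δ)) ℕ.+ tri a ≡ e ℕ.* δ ℕ.+ (s ℕ.+ t)
      count = trans (cong (ℕ._+ tri a) (trans (tri-+ a (e ℕ.+ δ)) (cong (λ z → tri a ℕ.+ z ℕ.+ a ℕ.* (e ℕ.+ δ)) (tri-+ e δ))))
        (trans (ℕS.solve 6 (λ A E D a e d → A ℕS.:+ (E ℕS.:+ D ℕS.:+ e ℕS.:* d) ℕS.:+ a ℕS.:* (e ℕS.:+ d) ℕS.:+ A
                  ℕS.:= e ℕS.:* d ℕS.:+ ((A ℕS.:+ E ℕS.:+ a ℕS.:* e) ℕS.:+ (A ℕS.:+ D ℕS.:+ a ℕS.:* d))) refl (tri a) (tri e) (tri δ) a e δ)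
               (sym (cong₂ (λ u v → e ℕ.* δ ℕ.+ (u ℕ.+ v)) (tri-+ a e) (tri-+ a δ))))
      contra : e ℕ.* δ ℕ.< k → ⊥
      contra lt = finish (kernel n fs (subst (ℕ._< n) (sym (trans len count)) (ℕ.+-monoˡ-< (s ℕ.+ t) lt)))
       where
       finish : (∃ λ (x : Vector n) → (∃ λ i → x i ≢ F.0#) × All (λ f → app f x ≡ F.0#) fs) → ⊥
       finish (x , (i , xi≢0) , zs) = xi≢0 (all-zero i)
        where
        c v u : A
        c = fn c-part x
        v = fn v-part x
        u = fn u-part x
        sum≡0 : c + (Ψ * v + G * u) ≡ 0#
        sum≡0 = coefficients-0 (a ℕ.+ (e ℕ.+ δ)) _
          (Deg-+ (Deg-mono (ℕ.m≤m+n a (e ℕ.+ δ)) (Deg-comb k (proj₂ (Deg-bound k E)) _))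
            (Deg-+ (subst (λ z → Deg z (Ψ * v)) (ℕS.solve 3 (λ d a e → d ℕS.:+ (a ℕS.:+ e) ℕS.:= a ℕS.:+ (e ℕS.:+ d)) refl δ a e)
                      (Deg-* dΨ (Deg-poly (a ℕ.+ e) _)))
                   (subst (λ z → Deg z (G * u)) (ℕS.solve 3 (λ d a e → e ℕS.:+ (a ℕS.:+ d) ℕS.:= a ℕS.:+ (e ℕS.:+ d)) refl δ a e)
                      (Deg-* (lm-deg lmG) (Deg-poly (a ℕ.+ δ) _)))))
          (map⁻ (++⁻ˡ (map (coefficient total) (exponents (a ℕ.+ (e ℕ.+ δ)))) zs))
        c-zero : ∀ i → x (i ↑ˡ (s ℕ.+ t)) ≡ F.0#
        c-zero = indep _ (- v) (subst InG (begin
            - (u * G) ≡⟨ solve 4 (λ c p u g → :- (u :* g) := (c :+ p) :- (c :+ (p :+ g :* u))) refl c (Ψ * v) u G ⟩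
            (c + Ψ * v) - (c + (Ψ * v + G * u)) ≡⟨ cong (λ z → (c + Ψ * v) - z) sum≡0 ⟩
            (c + Ψ * v) - 0# ≡⟨ solve 3 (λ c p v → (c :+ p :* v) :- con (ℤ.+ 0) := c :- p :* (:- v)) refl c Ψ v ⟩
            c - Ψ * - v ∎) (InG-neg (InG-*ˡ u InG-G)))
          where open ≡-Reasoning
        c≡0 : c ≡ 0#
        c≡0 = comb-0 k E _ c-zero
        Ψv : Ψ * v ≡ - (G * u)
        Ψv = x-y≡0⇒x≡y (begin
            Ψ * v - - (G * u)            ≡⟨ solve 3 (λ c p q → p :- (:- q) := (c :+ (p :+ q)) :- c) refl c (Ψ * v) (G * u) ⟩
            (c + (Ψ * v + G * u)) - c    ≡⟨ cong₂ _-_ sum≡0 c≡0 ⟩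
            0# - 0#                      ≡⟨ -‿inverseʳ 0# ⟩
            0#                           ∎)
          where open ≡-Reasoning
        v≡0 : v ≡ 0#
        v≡0 = normal-form v (InG-prime (subst InG (sym Ψv) (InG-neg (InG-*ʳ u InG-G))) ¬Ψ) nf
          where
          nf : ∀ i j → cf v (α ℕ.+ i) (β ℕ.+ j) ≡ F.0#
          nf i j = go (a ℕ.≤? i ℕ.+ j)
           where
           go : Dec (a ℕ.≤ i ℕ.+ j) → cf v (α ℕ.+ i) (β ℕ.+ j) ≡ F.0#
           go (no q)  = All.lookup (map⁻ (++⁻ʳ (map (coefficient total) (exponents (a ℕ.+ (e ℕ.+ δ)))) zs)) (∈-exponents a i j (ℕ.≰⇒> q))
           go (yes q) = cf≡0 (Deg-poly (a ℕ.+ e) _) _ _ (ℕ.≤-trans (ℕ.+-monoˡ-≤ e q)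
                  (ℕ.≤-reflexive (ℕS.solve 4 (λ i j a b → (i ℕS.:+ j) ℕS.:+ (a ℕS.:+ b) ℕS.:= (a ℕS.:+ i) ℕS.:+ (b ℕS.:+ j)) refl i j α β)))
        u≡0 : u ≡ 0#
        u≡0 = cancel (u ≟ 0#)
          where
          cancel : Dec (u ≡ 0#) → u ≡ 0#
          cancel (yes q) = q
          cancel (no q)  = ⊥-elim (*-≢0 G≢0 q (-x≡0⇒x≡0 (trans (sym Ψv) (trans (cong (Ψ *_) v≡0) (zeroʳ Ψ)))))
        all-zero : ∀ i → x i ≡ F.0#
        all-zero i = outer (splitAt k i) refl
          where
          inner : ∀ j z → splitAt s j ≡ z → x (k ↑ʳ j) ≡ F.0#
          inner j (inj₁ j′) r = trans (cong (λ z → x (k ↑ʳ z)) (sym (splitAt⁻¹-↑ˡ r))) (poly-inj (a ℕ.+ e) _ v≡0 j′)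
          inner j (inj₂ j′) r = trans (cong (λ z → x (k ↑ʳ z)) (sym (splitAt⁻¹-↑ʳ r))) (poly-inj (a ℕ.+ δ) _ u≡0 j′)
          outer : ∀ z → splitAt k i ≡ z → x i ≡ F.0#
          outer (inj₁ j) q = trans (cong x (sym (splitAt⁻¹-↑ˡ q))) (c-zero j)
          outer (inj₂ j) q = trans (cong x (sym (splitAt⁻¹-↑ʳ q))) (inner j (splitAt s j) refl)

  abstract
    bezout : ∀ δ Ψ → ¬ InG Ψ → Deg≤ δ Ψ → ∀ k (E : Fin k → A) →
      (∀ c v → InG (comb k E c - Ψ * v) → ∀ i → c i ≡ F.0#) → k ℕ.≤ e ℕ.* δ
    bezout = bezout′

homBs : ∀ {R S : Ring} (h : Hom R S) n f →
  Hom.⟦_⟧ h (RingTheory.bs R n f) ≡ RingTheory.bs S n (λ i j → Hom.⟦_⟧ h (f i j))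
homBs h zero    f = refl
homBs {S = S} h (suc n) f = trans (Hom.⟦+⟧ h _ _) (cong₂ (Ring._+_ S) (homBs h n _) (homBs h n _))

-- Families that are independent modulo a subspace.

module Independence (K : PrimeField) (P : Plane K) where
  private module F = PrimeField K
  open PlaneTheory K P
  open LinearMaps K P
  open Solver

  record Subspace (I : A → Set) : Set where
    field
      I-+ : ∀ {f g} → I f → I g → I (f + g)
      I-* : ∀ c {f} → I f → I (κ c * f)

    I-- : ∀ {f g} → I (f + g) → I f → I g
    I-- {f} {g} i j = subst I (trans (cong (λ z → (f + g) + z * f) (trans (κ-- F.1#) (cong -_ κ-1)))
      (solve 2 (λ f g → (f :+ g) :+ (:- con (ℤ.+ 1)) :* f := g) refl f g)) (I-+ i (I-* (F.- F.1#) j))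
  open Subspace public

  Independent : (A → Set) → ∀ n → (Fin n → A) → Set
  Independent I n E = ∀ c → I (comb n E c) → ∀ i → c i ≡ F.0#

  infixr 5 _◂_
  _◂_ : ∀ {n} → A → (Fin n → A) → Fin (suc n) → A
  (f ◂ E) zero    = f
  (f ◂ E) (suc i) = E i

  -- Triangularity along I ⊆ J: modulo `J` the new element disappears and the old coefficients must
  -- vanish; what is left modulo `I` is a multiple of `f` alone.
  extend : ∀ {I J : A → Set} {n E f} → Subspace J → (∀ {g} → I g → J g) → Independent J n E → J f →
    (∀ c → I (κ c * f) → c ≡ F.0#) → Independent I (suc n) (f ◂ E)
  extend {I} {J} {n} {E} {f} SJ I⊆J indep Jf nz c Ic = λ { zero → nz (c zero) head ; (suc i) → tail i }
    where
    tail : ∀ i → c (suc i) ≡ F.0#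
    tail = indep (λ i → c (suc i)) (I-- SJ (I⊆J Ic) (I-* SJ (c zero) Jf))
    head : I (κ (c zero) * f)
    head = subst I (trans (cong (λ z → κ (c zero) * f + z) (comb-0 n E _ tail)) (+-identityʳ _)) Ic

  infixr 5 _⧺_
  _⧺_ : ∀ {m n} → (Fin m → A) → (Fin n → A) → Fin (m ℕ.+ n) → A
  _⧺_ {m} E E′ i = [ E , E′ ]′ (splitAt m i)

  comb-⧺ : ∀ m n (E : Fin m → A) (E′ : Fin n → A) c →
    comb (m ℕ.+ n) (E ⧺ E′) c ≡ comb m E (λ i → c (i ↑ˡ n)) + comb n E′ (λ i → c (m ↑ʳ i))
  comb-⧺ m n E E′ c = trans (sumF-split m n (λ i → κ (c i) * (E ⧺ E′) i)) (cong₂ _+_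
    (sumF-cong m (λ i → cong (λ z → κ (c (i ↑ˡ n)) * [ E , E′ ]′ z) (splitAt-↑ˡ m i n)))
    (sumF-cong n (λ i → cong (λ z → κ (c (m ↑ʳ i)) * [ E , E′ ]′ z) (splitAt-↑ʳ m n i))))

  append : ∀ {I J : A → Set} {m n} (E : Fin m → A) (E′ : Fin n → A) → Subspace J → (∀ {g} → I g → J g) → Independent J n E′ →
    (∀ c → J (comb m E c)) → Independent I m E → Independent I (m ℕ.+ n) (E ⧺ E′)
  append {I} {J} {m} {n} E E′ SJ I⊆J indep′ JE indep c Ic i = go (splitAt m i) refl
    where
    Ic′ : I (comb m E (λ i → c (i ↑ˡ n)) + comb n E′ (λ i → c (m ↑ʳ i)))
    Ic′ = subst I (comb-⧺ m n E E′ c) Ic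
    right : ∀ i → c (m ↑ʳ i) ≡ F.0#
    right = indep′ _ (I-- SJ (I⊆J Ic′) (JE _))
    left : ∀ i → c (i ↑ˡ n) ≡ F.0#
    left = indep _ (subst I (trans (cong (λ z → comb m E (λ i → c (i ↑ˡ n)) + z) (comb-0 n E′ _ right)) (+-identityʳ _)) Ic′)
    go : ∀ z → splitAt m i ≡ z → c i ≡ F.0#
    go (inj₁ j) q = trans (cong c (sym (splitAt⁻¹-↑ˡ q))) (left j)
    go (inj₂ j) q = trans (cong c (sym (splitAt⁻¹-↑ʳ q))) (right j)

-- The derivation along the curve, and orders of vanishing at its points.

module Points (K : PrimeField) (P : Plane K) (G : Plane.Carrier P) (irr : Divisibility.Irreducible (Plane.ringA P) G)
  (α β : ℕ) (lmG : LeadingMonomials.LM K P G α β) where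
  private module F = PrimeField K
  open F using (p)
  open PlaneTheory K P
  open LinearMaps K P
  open Curve K P G irr α β lmG public
  open Independence K P
  open Solver
  open Derivation ∂X using () renaming (δ-+ to ∂x-+; δ-* to ∂x-*)
  open Derivation ∂Y using () renaming (δ-+ to ∂y-+; δ-* to ∂y-*)

  -- The Hamiltonian vector field of `G`. It kills `G`, hence preserves its ideal, and it is zero at
  -- a point of the curve precisely when both partial derivatives of `G` are.
  D : A → A
  D u = ∂y G * ∂x u - ∂x G * ∂y u

  D-+ : ∀ f g → D (f + g) ≡ D f + D g
  D-+ f g = trans (cong₂ (λ u v → ∂y G * u - ∂x G * v) (∂x-+ f g) (∂y-+ f g))
    (solve 6 (λ a b f g f′ g′ → a :* (f :+ g) :- b :* (f′ :+ g′) := (a :* f :- b :* f′) :+ (a :* g :- b :* g′)) refl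
      (∂y G) (∂x G) (∂x f) (∂x g) (∂y f) (∂y g))

  D-* : ∀ f g → D (f * g) ≡ D f * g + f * D g
  D-* f g = trans (cong₂ (λ u v → ∂y G * u - ∂x G * v) (∂x-* f g) (∂y-* f g))
    (solve 8 (λ a b f g fx gx fy gy → a :* (fx :* g :+ f :* gx) :- b :* (fy :* g :+ f :* gy)
       := (a :* fx :- b :* fy) :* g :+ f :* (a :* gx :- b :* gy)) refl
      (∂y G) (∂x G) f g (∂x f) (∂x g) (∂y f) (∂y g))

  derivation : Derivation ringA
  derivation = record { δ = D ; δ-+ = D-+ ; δ-* = D-* }

  D-G : D G ≡ 0#
  D-G = solve 2 (λ a b → a :* b :- b :* a := con (ℤ.+ 0)) refl (∂y G) (∂x G)

  D-κ : ∀ c → D (κ c) ≡ 0#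
  D-κ c = trans (cong₂ (λ u v → ∂y G * u - ∂x G * v) (∂X-κ c) (∂Y-κ c))
    (solve 2 (λ a b → a :* con (ℤ.+ 0) :- b :* con (ℤ.+ 0) := con (ℤ.+ 0)) refl (∂y G) (∂x G))

  D-κ* : ∀ c f → D (κ c * f) ≡ κ c * D f
  D-κ* c f = trans (D-* (κ c) f) (trans (cong (λ z → z * f + κ c * D f) (D-κ c))
    (solve 2 (λ f g → con (ℤ.+ 0) :* f :+ g := g) refl f (κ c * D f)))

  D-^ : ∀ u n → D (u ^ suc n) ≡ nat (suc n) * (u ^ n * D u)
  D-^ u zero    = trans (cong D (*-identityʳ u)) (sym (trans (cong (_* (1# * D u)) nat-1) (trans (*-identityˡ _) (*-identityˡ _))))
  D-^ u (suc n) = trans (D-* u (u ^ suc n)) (trans (cong (λ z → D u * (u * u ^ n) + u * z) (D-^ u n))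
    (solve 4 (λ d u w n → d :* (u :* w) :+ u :* (n :* (w :* d)) := (con (ℤ.+ 1) :+ n) :* ((u :* w) :* d)) refl (D u) u (u ^ n) (nat (suc n))))

  D-X : D X ≡ ∂y G
  D-X = trans (cong₂ (λ u v → ∂y G * u - ∂x G * v) ∂X-X ∂Y-X)
    (solve 2 (λ a b → a :* con (ℤ.+ 1) :- b :* con (ℤ.+ 0) := a) refl (∂y G) (∂x G))

  D-Y : D Y ≡ - ∂x G
  D-Y = trans (cong₂ (λ u v → ∂y G * u - ∂x G * v) ∂X-Y ∂Y-Y)
    (solve 2 (λ a b → a :* con (ℤ.+ 0) :- b :* con (ℤ.+ 1) := :- b) refl (∂y G) (∂x G))

  D-0 : D 0# ≡ 0#
  D-0 = Derivation.δ-0 derivation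

  D-neg : ∀ f → D (- f) ≡ - D f
  D-neg f = x-y≡0⇒x≡y (trans (solve 2 (λ a b → a :- (:- b) := a :+ b) refl (D (- f)) (D f))
    (trans (sym (D-+ (- f) f)) (trans (cong D (-‿inverseˡ f)) D-0)))

  D-G* : ∀ h → D (G * h) ≡ G * D h
  D-G* h = trans (D-* G h) (trans (cong (λ z → z * h + G * D h) D-G)
    (solve 2 (λ f g → con (ℤ.+ 0) :* f :+ g := g) refl h (G * D h)))

  InG-D : ∀ {u} → InG u → InG (D u)
  InG-D iu = iu >>= λ { (h , q) → return (D h , trans (cong D q) (D-G* h)) }

  Deg-D : ∀ {n f} → Deg≤ n f → Deg≤ (e ℕ.+ n) (D f)
  Deg-D {n} {f} d = Deg-+ (Deg≤-* (Deg-mono (ℕ.n≤1+n e) (Deg-∂Y (lm-deg lmG))) d₁) (Deg-- (Deg≤-* (Deg-mono (ℕ.n≤1+n e) (Deg-∂X (lm-deg lmG))) d₂))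
    where
    open LeadingMonomials K P using (lm-deg)
    d₁ : Deg (suc n) (∂x f)
    d₁ = Deg-mono (ℕ.n≤1+n n) (Deg-∂X d)
    d₂ : Deg (suc n) (∂y f)
    d₂ = Deg-mono (ℕ.n≤1+n n) (Deg-∂Y d)

  Dⁿ : ℕ → A → A
  Dⁿ zero    f = f
  Dⁿ (suc i) f = Dⁿ i (D f)

  Dⁿ-+ : ∀ i f g → Dⁿ i (f + g) ≡ Dⁿ i f + Dⁿ i g
  Dⁿ-+ zero    f g = refl
  Dⁿ-+ (suc i) f g = trans (cong (Dⁿ i) (D-+ f g)) (Dⁿ-+ i _ _)

  Dⁿ-κ* : ∀ i c f → Dⁿ i (κ c * f) ≡ κ c * Dⁿ i f
  Dⁿ-κ* zero    c f = refl
  Dⁿ-κ* (suc i) c f = trans (cong (Dⁿ i) (D-κ* c f)) (Dⁿ-κ* i c _)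

  Dⁿ-G* : ∀ i h → Dⁿ i (G * h) ≡ G * Dⁿ i h
  Dⁿ-G* zero    h = refl
  Dⁿ-G* (suc i) h = trans (cong (Dⁿ i) (D-G* h)) (Dⁿ-G* i _)

  Dⁿ-suc : ∀ i f → Dⁿ (suc i) f ≡ D (Dⁿ i f)
  Dⁿ-suc zero    f = refl
  Dⁿ-suc (suc i) f = Dⁿ-suc i (D f)

  -- Leibniz's rule for any double sequence on which D acts as it does on products. Besides `Dⁿ-*`
  -- it also serves the sums `S` of Stepanov's method.
  Dⁿ-bs : ∀ n (s : ℕ → ℕ → A) → (∀ i j → D (s i j) ≡ s (suc i) j + s i (suc j)) → Dⁿ n (s 0 0) ≡ bs n s
  Dⁿ-bs zero    s h = refl
  Dⁿ-bs (suc n) s h = trans (cong (Dⁿ n) (h 0 0)) (trans (Dⁿ-+ n _ _)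
    (cong₂ _+_ (Dⁿ-bs n (λ i j → s (suc i) j) (λ i j → h (suc i) j)) (Dⁿ-bs n (λ i j → s i (suc j)) (λ i j → h i (suc j)))))

  Dⁿ-* : ∀ n f g → Dⁿ n (f * g) ≡ bs n (λ i j → Dⁿ i f * Dⁿ j g)
  Dⁿ-* n f g = Dⁿ-bs n (λ i j → Dⁿ i f * Dⁿ j g)
    (λ i j → trans (D-* _ _) (cong₂ (λ u v → u * Dⁿ j g + Dⁿ i f * v) (sym (Dⁿ-suc i f)) (sym (Dⁿ-suc j g))))

  Deg-Dⁿ : ∀ i {n f} → Deg≤ n f → Deg≤ (i ℕ.* e ℕ.+ n) (Dⁿ i f)
  Deg-Dⁿ zero    d = d
  Deg-Dⁿ (suc i) {n} {f} d = subst (λ z → Deg≤ z (Dⁿ (suc i) f))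
    (ℕS.solve 3 (λ i e n → i ℕS.:* e ℕS.:+ (e ℕS.:+ n) ℕS.:= (e ℕS.:+ i ℕS.:* e) ℕS.:+ n) refl i e n) (Deg-Dⁿ i (Deg-D d))

  module EV (Q : Point) where
    open Hom (evHom Q) public using () renaming (⟦+⟧ to ev-+; ⟦*⟧ to ev-*; ⟦0⟧ to ev-0; ⟦1⟧ to ev-1; ⟦-⟧ to ev--; ⟦^⟧ to ev-^)

  θ : Point → ℕ → A → F.Carrier
  θ Q i f = ev Q (Dⁿ i f)

  θ-+ : ∀ Q i f g → θ Q i (f + g) ≡ θ Q i f F.+ θ Q i g
  θ-+ Q i f g = trans (cong (ev Q) (Dⁿ-+ i f g)) (EV.ev-+ Q _ _)

  θ-κ* : ∀ Q i c f → θ Q i (κ c * f) ≡ c F.* θ Q i f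
  θ-κ* Q i c f = trans (cong (ev Q) (Dⁿ-κ* i c f)) (trans (EV.ev-* Q _ _) (cong (F._* θ Q i f) (ev-κ Q c)))

  θ-* : ∀ Q n f g → θ Q n (f * g) ≡ F.bs n (λ i j → θ Q i f F.* θ Q j g)
  θ-* Q n f g = trans (cong (ev Q) (Dⁿ-* n f g)) (trans (homBs (evHom Q) n _) (F.bs-cong n (λ i j _ → EV.ev-* Q _ _)))

  OnG : Point → Set
  OnG Q = ev Q G ≡ F.0#

  θ-InG : ∀ {Q u} i → OnG Q → InG u → θ Q i u ≡ F.0#
  θ-InG {Q} {u} i on iu = decidable-stable (θ Q i u F.≟ F.0#)
    (iu >>= λ { (h , q) → return (trans (cong (θ Q i) q) (trans (cong (ev Q) (Dⁿ-G* i h))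
      (trans (EV.ev-* Q _ _) (trans (cong (F._* ev Q (Dⁿ i h)) on) (F.zeroˡ _))))) })

  Ord : Point → ℕ → A → Set
  Ord Q k f = ∀ i → i ℕ.< k → θ Q i f ≡ F.0#

  Ord-+ : ∀ {Q k f g} → Ord Q k f → Ord Q k g → Ord Q k (f + g)
  Ord-+ {Q} a b i q = trans (θ-+ Q i _ _) (trans (cong₂ F._+_ (a i q) (b i q)) (F.+-identityˡ _))

  Ord-κ* : ∀ {Q k} c {f} → Ord Q k f → Ord Q k (κ c * f)
  Ord-κ* {Q} c a i q = trans (θ-κ* Q i c _) (trans (cong (c F.*_) (a i q)) (F.zeroʳ c))

  Ord-* : ∀ {Q a b f g} → Ord Q a f → Ord Q b g → Ord Q (a ℕ.+ b) (f * g)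
  Ord-* {Q} {a} {b} {f} {g} of og n q = trans (θ-* Q n f g) (F.bs-0 n term)
    where
    term : ∀ i j → i ℕ.+ j ≡ n → θ Q i f F.* θ Q j g ≡ F.0#
    term i j refl with i ℕ.<? a
    ... | yes i<a = trans (cong (F._* θ Q j g) (of i i<a)) (F.zeroˡ _)
    ... | no  i≮a = trans (cong (θ Q i f F.*_) (og j (ℕ.≰⇒> (λ b≤j → ℕ.<⇒≱ q (ℕ.+-mono-≤ (ℕ.≮⇒≥ i≮a) b≤j))))) (F.zeroʳ _)

  Ord-*ʳ : ∀ {Q a f} g → Ord Q a f → Ord Q a (f * g)
  Ord-*ʳ {Q} {a} {f} g of = subst (λ z → Ord Q z (f * g)) (ℕ.+-identityʳ a) (Ord-* {b = 0} of (λ _ ()))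

  -- A single term of Leibniz's rule survives. Its binomial coefficient is invertible for a + b < p,
  -- which makes exact orders additive in that range.
  θ-exact : ∀ {Q a b f g} → Ord Q a f → Ord Q b g → θ Q (a ℕ.+ b) (f * g) ≡ F.nat (F.ch a b) F.* (θ Q a f F.* θ Q b g)
  θ-exact {Q} {a} {b} {f} {g} of og = trans (θ-* Q (a ℕ.+ b) f g) (F.bs-single a b term)
    where
    term : ∀ i j → i ℕ.+ j ≡ a ℕ.+ b → i ≢ a → θ Q i f F.* θ Q j g ≡ F.0#
    term i j q ne with ℕ.<-cmp i a
    ... | tri< lt _ _ = trans (cong (F._* θ Q j g) (of i lt)) (F.zeroˡ _)
    ... | tri≈ _ eq _ = ⊥-elim (ne eq)
    ... | tri> _ _ gt = trans (cong (θ Q i f F.*_) (og j (ℕ.≰⇒> (λ b≤j → ℕ.<-irrefl (sym q) (ℕ.+-mono-<-≤ gt b≤j))))) (F.zeroʳ _)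

  -- Local functions of each exact order below `k` are available. Order 0 costs nothing, even at a
  -- singular point; at a nonsingular point the powers of a local parameter reach all orders below
  -- p.
  Reach : Point → ℕ → Set
  Reach Q k = ∀ i → i ℕ.< k → ∃ λ w → Ord Q i w × θ Q i w ≢ F.0#

  reach-1 : ∀ Q → Reach Q 1
  reach-1 Q zero (s≤s _) = 1# , (λ _ ()) , λ z → F.1≢0 (trans (sym (EV.ev-1 Q)) z)

  Nonsingular : Point → Set
  Nonsingular Q = ∃ λ u → ev Q u ≡ F.0# × ev Q (D u) ≢ F.0#

  reach : ∀ Q → Nonsingular Q → Reach Q p
  reach Q (u , u0 , Du) i i<p = u ^ i , go i i<p
    where
    ord1 : Ord Q 1 u
    ord1 zero (s≤s _) = u0
    go : ∀ i → i ℕ.< p → Ord Q i (u ^ i) × θ Q i (u ^ i) ≢ F.0#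
    go zero    _   = (λ _ ()) , λ z → F.1≢0 (trans (sym (EV.ev-1 Q)) z)
    go (suc i) i<p = Ord-* {a = 1} {b = i} ord1 (proj₁ ih) ,
      λ z → F.*-≢0 (F.ch-≢0 1 i i<p) (F.*-≢0 Du (proj₂ ih)) (trans (sym (θ-exact {a = 1} {b = i} ord1 (proj₁ ih))) z)
      where ih = go i (ℕ.<-trans (ℕ.n<1+n i) i<p)

  line : ∀ (Q R : Point) → Q ≢ R → ∃ λ ℓ → ev Q ℓ ≡ F.0# × ev R ℓ ≢ F.0#
  line (x , y) (x′ , y′) ne with x F.≟ x′ | y F.≟ y′
  ... | yes refl | yes refl = ⊥-elim (ne refl)
  ... | no  x≢   | _ = X - κ x , trans (evl (x , y)) (F.-‿inverseʳ x) , λ z → x≢ (sym (F.x-y≡0⇒x≡y (trans (sym (evl (x′ , y′))) z)))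
    where
    evl : ∀ Q → ev Q (X - κ x) ≡ proj₁ Q F.- x
    evl Q = trans (EV.ev-+ Q _ _) (cong₂ F._+_ (ev-X Q) (trans (EV.ev-- Q _) (cong F.-_ (ev-κ Q x))))
  ... | yes _    | no y≢ = Y - κ y , trans (evl (x , y)) (F.-‿inverseʳ y) , λ z → y≢ (sym (F.x-y≡0⇒x≡y (trans (sym (evl (x′ , y′))) z)))
    where
    evl : ∀ Q → ev Q (Y - κ y) ≡ proj₂ Q F.- y
    evl Q = trans (EV.ev-+ Q _ _) (cong₂ F._+_ (ev-Y Q) (trans (EV.ev-- Q _) (cong F.-_ (ev-κ Q y))))

  module _ (k : ℕ) (k≤p : k ℕ.≤ p) where
    private
      Vanish : List Point → A → Set
      Vanish Qs f = ∀ {Q} → Q ∈ Qs → Ord Q k f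

      -- A product of k-th powers of lines, one through each point of `Qs`, all of them missing `R`.
      separate : ∀ R Qs → All (R ≢_) Qs → ∃ λ h → Vanish Qs h × ev R h ≢ F.0#
      separate R []       []       = 1# , (λ ()) , λ z → F.1≢0 (trans (sym (EV.ev-1 R)) z)
      separate R (Q ∷ Qs) (q ∷ qs) = ℓ ^ k * h , van , λ z → F.*-≢0 (F.^-≢0 k (proj₂ (proj₂ L))) (proj₂ (proj₂ rec)) (trans (sym (trans (EV.ev-* R _ _) (cong (F._* ev R h) (EV.ev-^ R ℓ k)))) z)
        where
        L = line Q R (λ eq → q (sym eq))
        ℓ = proj₁ L
        rec = separate R Qs qs
        h = proj₁ rec
        ord-ℓ : ∀ n → Ord Q n (ℓ ^ n)
        ord-ℓ zero    _ ()
        ord-ℓ (suc n) = Ord-* {a = 1} {b = n} (λ { zero (s≤s _) → proj₁ (proj₂ L) }) (ord-ℓ n)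
        van : Vanish (Q ∷ Qs) (ℓ ^ k * h)
        van (here refl) = Ord-*ʳ h (ord-ℓ k)
        van {R′} (there i) = subst (Ord R′ k) (*-comm h (ℓ ^ k)) (Ord-*ʳ (ℓ ^ k) (proj₁ (proj₂ rec) i))

      -- For each point R take the products w h, where w has exact order i < k at R and h comes from
      -- `separate`. They are triangular in i at R and vanish to order k at the points treated
      -- before.
      family : ∀ Qs → Unique Qs → All (λ Q → Reach Q k) Qs → ∃ λ (E : Fin (length Qs ℕ.* k) → A) → Independent (Vanish Qs) _ E
      family []       []         []       = (λ ()) , λ _ _ ()
      family (R ∷ Qs) (new ∷ uQ) (r ∷ rs) = proj₁ (grow k ℕ.≤-refl) , λ c v → proj₂ (grow k ℕ.≤-refl) c ((λ i → v (there i)) , v (here refl))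
        where
        old = family Qs uQ rs
        sep = separate R Qs new
        h = proj₁ sep
        -- The filtration by the order at R, within the functions that vanish to order k at the
        -- remaining points; each of its k steps contributes one element.
        Jₒ : ℕ → A → Set
        Jₒ i f = (∀ {Q} → Q ∈ Qs → Ord Q k f) × Ord R i f
        SJ : ∀ i → Subspace (Jₒ i)
        SJ i = record { I-+ = λ (a , b) (a′ , b′) → (λ q → Ord-+ (a q) (a′ q)) , Ord-+ b b′ ; I-* = λ c (a , b) → (λ q → Ord-κ* c (a q)) , Ord-κ* c b }
        grow : ∀ i → i ℕ.≤ k → ∃ λ (E : Fin (i ℕ.+ length Qs ℕ.* k) → A) → Independent (Jₒ i) _ E
        grow zero    _   = proj₁ old , λ c (v , _) → proj₂ old c v
        grow (suc i) i<k = (w * h) ◂ proj₁ ih , extend {I = Jₒ (suc i)} (SJ i) (λ (a , b) → a , λ j q → b j (ℕ.<-trans q (ℕ.n<1+n i)))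
            (proj₂ ih) ((λ {Q} q → subst (Ord Q k) (*-comm h w) (Ord-*ʳ w (proj₁ (proj₂ sep) q))) , Ord-*ʳ h (proj₁ (proj₂ (r i i<k))))
            (λ c (_ , b) → zero-coefficient c (b i (ℕ.n<1+n i)))
          where
          ih = grow i (ℕ.<⇒≤ i<k)
          w = proj₁ (r i i<k)
          θ≢0 : θ R i (w * h) ≢ F.0#
          θ≢0 z = F.*-≢0 (F.ch-≢0 i 0 (subst (ℕ._< p) (sym (ℕ.+-identityʳ i)) (ℕ.≤-trans i<k k≤p)))
            (F.*-≢0 (proj₂ (proj₂ (r i i<k))) (proj₂ (proj₂ sep)))
            (trans (sym (θ-exact {a = i} {b = 0} (proj₁ (proj₂ (r i i<k))) (λ _ ()))) (trans (cong (λ u → θ R u (w * h)) (ℕ.+-identityʳ i)) z))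
          zero-coefficient : ∀ c → θ R i (κ c * (w * h)) ≡ F.0# → c ≡ F.0#
          zero-coefficient c z = F.*-cancel θ≢0 (trans (F.*-comm _ c) (trans (sym (θ-κ* R i c (w * h))) z))

    -- The ideal of `G` and `Ψ` consists of functions that vanish to order `k` at all these points.
    -- A family independent modulo such functions is thus independent modulo the ideal, and `bezout`
    -- bounds its size.
    vanishing-bound : ∀ Qs → Unique Qs → All OnG Qs → All (λ Q → Reach Q k) Qs → ∀ δ Ψ → ¬ InG Ψ → Deg≤ δ Ψ →
      All (λ Q → Ord Q k Ψ) Qs → length Qs ℕ.* k ℕ.≤ e ℕ.* δ
    vanishing-bound Qs uQ on rs δ Ψ ¬Ψ dΨ van = bezout δ Ψ ¬Ψ dΨ _ (proj₁ fam) (λ c v ic → proj₂ fam c (λ {Q} q i i<k → (begin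
        θ Q i (comb _ (proj₁ fam) c)
          ≡⟨ cong (θ Q i) (solve 2 (λ a b → a := (a :- b) :+ b) refl (comb _ (proj₁ fam) c) (Ψ * v)) ⟩
        θ Q i ((comb _ (proj₁ fam) c - Ψ * v) + Ψ * v) ≡⟨ θ-+ Q i _ _ ⟩
        θ Q i (comb _ (proj₁ fam) c - Ψ * v) F.+ θ Q i (Ψ * v)
          ≡⟨ cong₂ F._+_ (θ-InG i (All.lookup on q) ic) (Ord-*ʳ v (All.lookup van q) i i<k) ⟩
        F.0# F.+ F.0# ≡⟨ F.+-identityˡ _ ⟩
        F.0# ∎)))
      where
      open ≡-Reasoning
      fam = family Qs uQ rs

-- A rank argument for matrices with vanishing binomial moments.

module RankLemma (K : PrimeField) where
  open PrimeField K
  open LinearAlgebra K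
  open Solver
  open ≡-Reasoning

  fall : ℕ → ℕ → Carrier
  fall zero    b       = 1#
  fall (suc i) zero    = 0#
  fall (suc i) (suc b) = nat (suc b) * fall i b

  fall-suc : ∀ i b → fall (suc i) b ≡ fall i b * (nat b - nat i)
  fall-suc zero    zero    = solve 0 (con (ℤ.+ 0) := con (ℤ.+ 1) :* (con (ℤ.+ 0) :- con (ℤ.+ 0))) refl
  fall-suc (suc i) zero    = sym (zeroˡ _)
  fall-suc zero    (suc b) = solve 1 (λ n → n :* con (ℤ.+ 1) := con (ℤ.+ 1) :* (n :- con (ℤ.+ 0))) refl (nat (suc b))
  fall-suc (suc i) (suc b) = trans (cong (nat (suc b) *_) (fall-suc i b))
    (solve 4 (λ o b i f → (o :+ b) :* (f :* (b :- i)) := (o :+ b) :* f :* ((o :+ b) :- (o :+ i))) refl 1# (nat b) (nat i) (fall i b))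

  -- The weight binom(w, b) times the falling factorial of b is a multiple of binom(w - i, b - i),
  -- so the sum reduces to a moment of the table shifted by i.
  bs-fall : ∀ i w (g : ℕ → ℕ → Carrier) → (∀ c → bs c (λ a b → g a (i ℕ.+ b)) ≡ 0#) → bs w (λ a b → fall i b * g a b) ≡ 0#
  bs-fall zero    w       g z = trans (bs-* w 1# g) (trans (cong (1# *_) (z w)) (zeroʳ 1#))
  bs-fall (suc i) zero    g z = zeroˡ _
  bs-fall (suc i) (suc w) g z = begin
    bs (suc w) (λ a b → fall (suc i) b * g a b)   ≡⟨ bs-cong (suc w) (λ a b _ → pull a b) ⟩
    bs (suc w) (λ a b → nat b * f a b)            ≡⟨ bs-euler w f ⟩
    nat (suc w) * bs w (λ a b → f a (suc b))      ≡⟨ cong (nat (suc w) *_) (bs-fall i w (λ a b → g a (suc b)) z) ⟩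
    nat (suc w) * 0#                              ≡⟨ zeroʳ _ ⟩
    0#                                            ∎
    where
    f : ℕ → ℕ → Carrier
    f a zero    = 0#
    f a (suc b) = fall i b * g a (suc b)
    pull : ∀ a b → fall (suc i) b * g a b ≡ nat b * f a b
    pull a zero    = trans (zeroˡ _) (sym (zeroˡ _))
    pull a (suc b) = *-assoc _ _ _

  prod : List ℕ → ℕ → Carrier
  prod []      z = 1#
  prod (l ∷ L) z = (nat z - nat l) * prod L z

  prod-0 : ∀ {L z} → z ∈ L → prod L z ≡ 0#
  prod-0 {l ∷ L} (here refl) = trans (cong (_* prod L l) (-‿inverseʳ _)) (zeroˡ _)
  prod-0 {l ∷ L} (there i)   = trans (cong (_ *_) (prod-0 i)) (zeroʳ _)

  prod-≢0 : ∀ L z → z ℕ.< p → All (ℕ._< p) L → All (λ l → l ≢ z) L → prod L z ≢ 0#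
  prod-≢0 []      z z<p []       []       = 1≢0
  prod-≢0 (l ∷ L) z z<p (q ∷ qs) (n ∷ ns) = *-≢0 (λ e → n (sym (nat-inj z<p q (x-y≡0⇒x≡y e)))) (prod-≢0 L z z<p qs ns)

  -- Writing b - l as (b - i) + (i - l) expands the product in falling factorials. With i = 0 it
  -- follows that a product of fewer than `M` linear factors in b is orthogonal to every
  -- antidiagonal.
  bs-prod : ∀ M w (g : ℕ → ℕ → Carrier) → (∀ i → i ℕ.< M → ∀ c → bs c (λ a b → g a (i ℕ.+ b)) ≡ 0#) →
    ∀ L i → i ℕ.+ length L ℕ.< M → bs w (λ a b → fall i b * prod L b * g a b) ≡ 0#
  bs-prod M w g z []      i q = trans (bs-cong w (λ a b _ → cong (_* g a b) (*-identityʳ (fall i b)))) (bs-fall i w g (z i (subst (ℕ._< M) (ℕ.+-identityʳ i) q)))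
  bs-prod M w g z (l ∷ L) i q = begin
    bs w (λ a b → fall i b * ((nat b - nat l) * prod L b) * g a b)
      ≡⟨ bs-cong w (λ a b _ → trans
           (solve 6 (λ f b l i P g → f :* ((b :- l) :* P) :* g := f :* (b :- i) :* P :* g :+ (i :- l) :* (f :* P :* g)) refl
              (fall i b) (nat b) (nat l) (nat i) (prod L b) (g a b))
           (cong (λ y → y * prod L b * g a b + (nat i - nat l) * (fall i b * prod L b * g a b)) (sym (fall-suc i b)))) ⟩
    bs w (λ a b → fall (suc i) b * prod L b * g a b + (nat i - nat l) * (fall i b * prod L b * g a b))
      ≡⟨ bs-+ w (λ a b → fall (suc i) b * prod L b * g a b) (λ a b → (nat i - nat l) * (fall i b * prod L b * g a b)) ⟩
    bs w (λ a b → fall (suc i) b * prod L b * g a b) + bs w (λ a b → (nat i - nat l) * (fall i b * prod L b * g a b))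
      ≡⟨ cong₂ _+_ (bs-prod M w g z L (suc i) (subst (ℕ._< M) (ℕ.+-suc i (length L)) q))
           (trans (bs-* w (nat i - nat l) (λ a b → fall i b * prod L b * g a b))
             (cong ((nat i - nat l) *_) (bs-prod M w g z L i (ℕ.<-trans (ℕ.+-monoʳ-< i (ℕ.n<1+n (length L))) q)))) ⟩
    0# + (nat i - nat l) * 0# ≡⟨ trans (+-identityˡ _) (zeroʳ _) ⟩
    0# ∎

  -- If a matrix s of rank at most M, with zero first column, vanishes to order M along the diagonal, then the
  -- lowest nonzero antidiagonal of s would have at most M nonzero entries but satisfy M moment conditions.
  module _ (M : ℕ) (u t : ℕ → Fin (suc M) → Carrier) (t₀ : t 0 zero ≡ 1#) where
    private
      s : ℕ → ℕ → Carrier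
      s a b = sumF (suc M) (λ j → u a j * t b j)

    module _ (column : ∀ a → s a 0 ≡ 0#) (moments : ∀ i → i ℕ.< M → ∀ c → bs c (λ a b → s a (i ℕ.+ b)) ≡ 0#) where
      private
        module Diagonal (w : ℕ) (w<p : w ℕ.< p) (ih : ∀ a b → a ℕ.+ b ℕ.< w → s a b ≡ 0#) where
          -- `rows` are the rows before `n` with a nonzero entry on the antidiagonal `w`, and `cols`
          -- the columns of these entries. Everything before this antidiagonal vanishes, so the
          -- selected rows form a triangular system and are independent.
          record Jumps (n : ℕ) : Set where
            field
              q        : ℕ
              rows     : Fin q → ℕ
              rows<    : ∀ i → rows i ℕ.< n
              indep    : ∀ (c : Fin q → Carrier) → (∀ j → sumF q (λ i → c i * u (rows i) j) ≡ 0#) → ∀ i → c i ≡ 0#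
              cols     : List ℕ
              len      : length cols ≡ q
              cols≤    : All (ℕ._≤ w) cols
              complete : ∀ a b → a ℕ.< n → a ℕ.+ b ≡ w → s a b ≢ 0# → b ∈ cols
          open Jumps

          jumps : ∀ n → n ℕ.≤ suc w → Jumps n
          jumps zero    _   = record { q = 0 ; rows = λ () ; rows< = λ () ; indep = λ _ _ () ; cols = [] ; len = refl ; cols≤ = [] ; complete = λ _ _ () }
          jumps (suc n) n≤w = decide (s n b₀ ≟ 0#)
            where
            b₀ = w ∸ n
            n+b₀ : n ℕ.+ b₀ ≡ w
            n+b₀ = ℕ.m+[n∸m]≡n (ℕ.≤-pred n≤w)
            old = jumps n (ℕ.≤-trans (ℕ.n≤1+n n) n≤w)
            b≡ : ∀ {b} → n ℕ.+ b ≡ w → b ≡ b₀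
            b≡ {b} e = ℕ.+-cancelˡ-≡ n b b₀ (trans e (sym n+b₀))
            decide : Dec (s n b₀ ≡ 0#) → Jumps (suc n)
            decide (yes z) = record
              { q = q old ; rows = rows old ; rows< = λ i → ℕ.<-trans (rows< old i) (ℕ.n<1+n n) ; indep = indep old
              ; cols = cols old ; len = len old ; cols≤ = cols≤ old
              ; complete = λ a b a<n e nz → [ (λ lt → complete old a b lt e nz)
                  , (λ { refl → ⊥-elim (nz (trans (cong (s a) (b≡ e)) z)) }) ]′ (ℕ.m≤n⇒m<n∨m≡n (ℕ.≤-pred a<n)) }
            decide (no nz₀) = record
              { q = suc (q old) ; rows = rows′ ; rows< = rows′<
              ; indep = indep′
              ; cols = b₀ ∷ cols old ; len = cong suc (len old) ; cols≤ = ℕ.m∸n≤m w n ∷ cols≤ old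
              ; complete = λ a b a<n e nz → [ (λ lt → there (complete old a b lt e nz))
                  , (λ { refl → here (b≡ e) }) ]′ (ℕ.m≤n⇒m<n∨m≡n (ℕ.≤-pred a<n)) }
              where
              rows′ : Fin (suc (q old)) → ℕ
              rows′ zero    = n
              rows′ (suc i) = rows old i
              rows′< : ∀ i → rows′ i ℕ.< suc n
              rows′< zero    = ℕ.n<1+n n
              rows′< (suc i) = ℕ.<-trans (rows< old i) (ℕ.n<1+n n)
              indep′ : ∀ (c : Fin (suc (q old)) → Carrier) → (∀ j → sumF (suc (q old)) (λ i → c i * u (rows′ i) j) ≡ 0#) → ∀ i → c i ≡ 0#
              indep′ c z = λ { zero → c₀≡0 ; (suc i) → indep old (λ i → c (suc i)) rest i }
                where
                weighted : sumF (suc (q old)) (λ i → c i * s (rows′ i) b₀) ≡ 0#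
                weighted = begin
                  sumF (suc (q old)) (λ i → c i * s (rows′ i) b₀)
                    ≡⟨ sumF-cong (suc (q old)) (λ i → sym (sumF-* (suc M) (c i) (λ j → u (rows′ i) j * t b₀ j))) ⟩
                  sumF (suc (q old)) (λ i → sumF (suc M) (λ j → c i * (u (rows′ i) j * t b₀ j)))
                    ≡⟨ sumF-swap (suc (q old)) (suc M) (λ i j → c i * (u (rows′ i) j * t b₀ j)) ⟩
                  sumF (suc M) (λ j → sumF (suc (q old)) (λ i → c i * (u (rows′ i) j * t b₀ j)))
                    ≡⟨ sumF-0 (suc M) (λ j → begin
                         sumF (suc (q old)) (λ i → c i * (u (rows′ i) j * t b₀ j))
                           ≡⟨ sumF-cong (suc (q old)) (λ i → solve 3 (λ a b c → a :* (b :* c) := c :* (a :* b)) refl (c i) (u (rows′ i) j) (t b₀ j)) ⟩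
                         sumF (suc (q old)) (λ i → t b₀ j * (c i * u (rows′ i) j)) ≡⟨ sumF-* (suc (q old)) (t b₀ j) (λ i → c i * u (rows′ i) j) ⟩
                         t b₀ j * sumF (suc (q old)) (λ i → c i * u (rows′ i) j) ≡⟨ cong (t b₀ j *_) (z j) ⟩
                         t b₀ j * 0# ≡⟨ zeroʳ _ ⟩
                         0# ∎) ⟩
                  0# ∎
                -- In column w - n the earlier rows have entries before the antidiagonal, which are
                -- zero; only the new row contributes.
                c₀≡0 : c zero ≡ 0#
                c₀≡0 = *-cancel nz₀ (begin
                  s n b₀ * c zero ≡⟨ *-comm _ _ ⟩
                  c zero * s n b₀ ≡⟨ sym (+-identityʳ _) ⟩
                  c zero * s n b₀ + 0# ≡⟨ cong (c zero * s n b₀ +_) (sym (sumF-0 (q old) (λ i →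
                     trans (cong (c (suc i) *_) (ih (rows old i) b₀ (subst (rows old i ℕ.+ b₀ ℕ.<_) n+b₀ (ℕ.+-monoˡ-< b₀ (rows< old i))))) (zeroʳ _)))) ⟩
                  sumF (suc (q old)) (λ i → c i * s (rows′ i) b₀) ≡⟨ weighted ⟩
                  0# ∎)
                rest : ∀ j → sumF (q old) (λ i → c (suc i) * u (rows old i) j) ≡ 0#
                rest j = begin
                  R ≡⟨ solve 2 (λ r x → r := con (ℤ.+ 0) :* x :+ r) refl R (u n j) ⟩
                  0# * u n j + R ≡⟨ cong (λ y → y * u n j + R) (sym c₀≡0) ⟩
                  c zero * u n j + R ≡⟨ z j ⟩
                  0# ∎
                  where R = sumF (q old) (λ i → c (suc i) * u (rows old i) j)

          J₀ : Jumps (suc w)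
          J₀ = jumps (suc w) ℕ.≤-refl

          -- The rows have M + 1 coordinates. The zero first column together with `t 0 zero ≡ 1#`
          -- expresses coordinate `zero` through the others, so only M functionals are imposed.
          q≤M : q J₀ ℕ.≤ M
          q≤M = ℕ.≮⇒≥ λ M<q → contradict (kernel (q J₀) (tabulate column-functional) (subst (ℕ._< q J₀) (sym (length-tabulate column-functional)) M<q))
            where
            column-functional : Fin M → Functional (q J₀)
            column-functional j = record
              { app  = λ c → sumF (q J₀) (λ i → c i * u (rows J₀ i) (suc j))
              ; ap-≗ = λ e → sumF-cong (q J₀) (λ i → cong (_* u (rows J₀ i) (suc j)) (e i))
              ; ap-+ = λ x y → trans (sumF-cong (q J₀) (λ i → distribʳ _ _ _)) (sumF-+ (q J₀) _ _)
              ; ap-* = λ c x → trans (sumF-cong (q J₀) (λ i → *-assoc _ _ _)) (sumF-* (q J₀) c _) }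
            contradict : (∃ λ (c : Vector (q J₀)) → (∃ λ i → c i ≢ 0#) × All (λ f → app f c ≡ 0#) (tabulate column-functional)) → ⊥
            contradict (c , (i , ci) , zs) = ci (indep J₀ c all i)
              where
              tails : ∀ j → sumF (q J₀) (λ i → c i * u (rows J₀ i) (suc j)) ≡ 0#
              tails j = tabulate⁻ zs j
              all : ∀ j → sumF (q J₀) (λ i → c i * u (rows J₀ i) j) ≡ 0#
              all (suc j) = tails j
              all zero    = begin
                sumF (q J₀) (λ i → c i * u (rows J₀ i) zero) ≡⟨ sumF-cong (q J₀) (λ i → cong (c i *_) (first (rows J₀ i))) ⟩
                sumF (q J₀) (λ i → c i * - sumF M (λ j → u (rows J₀ i) (suc j) * t 0 (suc j)))
                  ≡⟨ sumF-cong (q J₀) (λ i → trans (solve 2 (λ a b → a :* (:- b) := (:- con (ℤ.+ 1)) :* (a :* b)) refl (c i) _)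
                       (cong (- 1# *_) (sym (sumF-* M (c i) _)))) ⟩
                sumF (q J₀) (λ i → - 1# * sumF M (λ j → c i * (u (rows J₀ i) (suc j) * t 0 (suc j)))) ≡⟨ sumF-* (q J₀) (- 1#) _ ⟩
                - 1# * sumF (q J₀) (λ i → sumF M (λ j → c i * (u (rows J₀ i) (suc j) * t 0 (suc j)))) ≡⟨ cong (- 1# *_) (sumF-swap (q J₀) M _) ⟩
                - 1# * sumF M (λ j → sumF (q J₀) (λ i → c i * (u (rows J₀ i) (suc j) * t 0 (suc j))))
                  ≡⟨ cong (- 1# *_) (sumF-0 M (λ j → trans (sumF-cong (q J₀) (λ i →
                       solve 3 (λ a b c → a :* (b :* c) := c :* (a :* b)) refl (c i) (u (rows J₀ i) (suc j)) (t 0 (suc j))))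
                       (trans (sumF-* (q J₀) (t 0 (suc j)) _) (trans (cong (t 0 (suc j) *_) (tails j)) (zeroʳ _))))) ⟩
                - 1# * 0# ≡⟨ zeroʳ _ ⟩
                0# ∎
                where
                first : ∀ a → u a zero ≡ - sumF M (λ j → u a (suc j) * t 0 (suc j))
                first a = x-y≡0⇒x≡y (begin
                  u a zero - - S ≡⟨ solve 2 (λ x y → x :- (:- y) := x :* con (ℤ.+ 1) :+ y) refl (u a zero) S ⟩
                  u a zero * 1# + S ≡⟨ cong (λ y → u a zero * y + S) (sym t₀) ⟩
                  u a zero * t 0 zero + S ≡⟨ column a ⟩
                  0# ∎)
                  where S = sumF M (λ j → u a (suc j) * t 0 (suc j))

          diagonal : ∀ a b → a ℕ.+ b ≡ w → s a b ≡ 0#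
          diagonal a₀ b₀ refl = decide (s a₀ b₀ ≟ 0#)
            where
            decide : Dec (s a₀ b₀ ≡ 0#) → s a₀ b₀ ≡ 0#
            decide (yes z) = z
            -- Without b₀ fewer than M columns remain. The product of linear factors over them
            -- annihilates every other nonzero entry of the antidiagonal, so its moment, which is
            -- zero, is a nonzero multiple of `s a₀ b₀`.
            decide (no nz) = ⊥-elim (*-≢0 (ch-≢0 a₀ b₀ w<p) (*-≢0 (*-≢0 1≢0 (prod-≢0 L b₀ (ℕ.≤-<-trans (ℕ.m≤n+m b₀ a₀) w<p) L<p L≢)) nz)
                (trans (sym (bs-single a₀ b₀ {λ a b → fall 0 b * prod L b * s a b} others)) (bs-prod M (a₀ ℕ.+ b₀) s moments L 0 L<M)))
              where
              b∈ : b₀ ∈ cols J₀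
              b∈ = complete J₀ a₀ b₀ (s≤s (ℕ.m≤m+n a₀ b₀)) refl nz
              L = filter (λ b → ¬? (b ℕ.≟ b₀)) (cols J₀)
              L<M : length L ℕ.< M
              L<M = ℕ.<-≤-trans (filter-notAll (λ b → ¬? (b ℕ.≟ b₀)) (cols J₀) (Any.map (λ { refl n → n refl }) b∈)) (subst (ℕ._≤ M) (sym (len J₀)) q≤M)
              L<p : All (ℕ._< p) L
              L<p = All.tabulate (λ i → ℕ.≤-<-trans (All.lookup (cols≤ J₀) (proj₁ (∈-filter⁻ (λ b → ¬? (b ℕ.≟ b₀)) i))) w<p)
              L≢ : All (λ l → l ≢ b₀) L
              L≢ = All.tabulate (λ i → proj₂ (∈-filter⁻ (λ b → ¬? (b ℕ.≟ b₀)) {xs = cols J₀} i))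
              others : ∀ a b → a ℕ.+ b ≡ a₀ ℕ.+ b₀ → a ≢ a₀ → fall 0 b * prod L b * s a b ≡ 0#
              others a b e ne = test (s a b ≟ 0#)
                where
                test : Dec (s a b ≡ 0#) → fall 0 b * prod L b * s a b ≡ 0#
                test (yes z) = trans (cong (fall 0 b * prod L b *_) z) (zeroʳ _)
                test (no z)  = trans (cong (λ y → fall 0 b * y * s a b) (prod-0 (∈-filter⁺ (λ b → ¬? (b ℕ.≟ b₀))
                    (complete J₀ a b (s≤s (ℕ.≤-trans (ℕ.m≤m+n a b) (ℕ.≤-reflexive e))) e z)
                    (λ { refl → ne (ℕ.+-cancelʳ-≡ b a a₀ e) }))))
                  (trans (cong (_* s a b) (zeroʳ _)) (zeroˡ _))

        all-zero : ∀ w → w ℕ.≤ p → ∀ a b → a ℕ.+ b ℕ.< w → s a b ≡ 0#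
        all-zero (suc w) w<p a b q = [ all-zero w (ℕ.<⇒≤ w<p) a b , Diagonal.diagonal w w<p (all-zero w (ℕ.<⇒≤ w<p)) a b ]′ (ℕ.m≤n⇒m<n∨m≡n (ℕ.≤-pred q))

      abstract
        rank-lemma : ∀ a b → a ℕ.+ b ℕ.< p → sumF (suc M) (λ j → u a j * t b j) ≡ 0#
        rank-lemma = all-zero p ℕ.≤-refl

-- Stepanov's method for components of degree above m.

private
  blocks : ∀ {X : Set} k → (Fin k → List X) → List X
  blocks zero    g = []
  blocks (suc k) g = g zero ++ blocks k (λ i → g (suc i))

  blocks-length : ∀ {X : Set} k (g : Fin k → List X) L → (∀ i → length (g i) ≡ L) → length (blocks k g) ≡ k ℕ.* L
  blocks-length zero    g L h = refl
  blocks-length (suc k) g L h = trans (length-++ (g zero)) (cong₂ ℕ._+_ (h zero) (blocks-length k _ L (λ i → h (suc i))))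

  blocks-All : ∀ {X : Set} {Q : X → Set} k (g : Fin k → List X) → All Q (blocks k g) → ∀ i → All Q (g i)
  blocks-All (suc k) g z zero    = ++⁻ˡ (g zero) z
  blocks-All (suc k) g z (suc i) = blocks-All k (λ i → g (suc i)) (++⁻ʳ (g zero) z) i

module Stepanov (K : PrimeField) (P : Plane K) (G : Plane.Carrier P) (irr : Divisibility.Irreducible (Plane.ringA P) G)
  (α β : ℕ) (lmG : LeadingMonomials.LM K P G α β) (m : ℕ) (m<e : m ℕ.< α ℕ.+ β) where
  private module F = PrimeField K
  open F using (p)
  open PlaneTheory K P
  open LeadingMonomials K P
  open LinearMaps K P
  open Points K P G irr α β lmG
  open RankLemma K using (rank-lemma)
  open Solver
  open ≡-Reasoning

  -- M + 1 is the number of monomials of degree at most m, and B bounds the degrees of their first M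
  -- derivatives. With a₀ = M B the mixed terms of the dimension count cancel, and a surplus of
  -- `tri e` unknowns remains.
  M B a₀ : ℕ
  M  = m ℕ.+ tri m
  B  = m ℕ.+ M ℕ.* e
  a₀ = M ℕ.* B

  private
    f : Fin (suc M) → A
    f = mon (suc m)

    Deg-f : ∀ j → Deg≤ m (f j)
    Deg-f = Deg-mon (suc m)

    f-zero : f zero ≡ 1#
    f-zero = refl

  -- The derivatives fall on the known `f j`, so the equations involve only multiplications of the
  -- unknown `a j`. Leibniz's rule later moves the derivatives to the `a j`, where the vanishing of
  -- Ψ needs them.
  Auxiliary : Set
  Auxiliary = ∃ λ (a : Fin (suc M) → A) → (∀ j → Deg (a₀ ℕ.+ e) (a j)) × (∃ λ j → ¬ InG (a j)) ×
    (∀ i → i ℕ.< M → InG (sumF (suc M) (λ j → a j * Dⁿ i (f j))))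

  private
    s t n : ℕ
    s = tri (a₀ ℕ.+ e)
    t = tri (B ℕ.+ a₀)
    n = suc M ℕ.* s ℕ.+ M ℕ.* t

    a-part : Fin (suc M) → LinearMap n
    a-part j = reindex (λ i → combine j i ↑ˡ (M ℕ.* t)) (combination s (mon (a₀ ℕ.+ e)))

    q-part : Fin M → LinearMap n
    q-part i = reindex (λ l → (suc M ℕ.* s) ↑ʳ combine i l) (combination t (mon (B ℕ.+ a₀)))

    equation : Fin M → LinearMap n
    equation i = sumMap (suc M) (λ j → Dⁿ (toℕ i) (f j) ⊠ a-part j) ⊞ (G ⊠ q-part i)

    shift : ℕ × ℕ → ℕ × ℕ
    shift (i , j) = α ℕ.+ i , β ℕ.+ j

    N′ : ℕ
    N′ = B ℕ.+ a₀ ℕ.+ e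

    normal-form-functionals : Fin (suc M) → List (Functional n)
    normal-form-functionals j = map (λ ij → coefficient (a-part j) (shift ij)) (exponents a₀)

    equation-functionals : Fin M → List (Functional n)
    equation-functionals i = map (coefficient (equation i)) (exponents N′)

    fs₁ fs₂ : List (Functional n)
    fs₁ = blocks (suc M) normal-form-functionals
    fs₂ = blocks M equation-functionals

    len : length (fs₁ ++ fs₂) ≡ suc M ℕ.* tri a₀ ℕ.+ M ℕ.* tri N′
    len = trans (length-++ fs₁) (cong₂ ℕ._+_
      (blocks-length (suc M) normal-form-functionals (tri a₀) (λ j → trans (length-map _ (exponents a₀)) (length-exponents a₀)))
      (blocks-length M equation-functionals (tri N′) (λ i → trans (length-map _ (exponents N′)) (length-exponents N′))))

    0<e : 0 ℕ.< e
    0<e = ℕ.≤-trans (s≤s z≤n) m<e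

    0<tri : ∀ k → 0 ℕ.< k → 0 ℕ.< tri k
    0<tri (suc k) _ = s≤s z≤n

    count : suc (suc M ℕ.* tri a₀ ℕ.+ M ℕ.* tri N′) ℕ.≤ n
    count = ℕ.≤-trans (ℕ.≤-trans (ℕ.≤-reflexive (cong suc lhs)) (ℕ.+-monoˡ-≤ _ (0<tri e 0<e))) (ℕ.≤-reflexive (sym rhs))
      where
      C = suc M ℕ.* tri a₀ ℕ.+ M ℕ.* (t ℕ.+ tri e ℕ.+ (B ℕ.+ a₀) ℕ.* e)
      lhs : suc M ℕ.* tri a₀ ℕ.+ M ℕ.* tri N′ ≡ C
      lhs = cong (λ z → suc M ℕ.* tri a₀ ℕ.+ M ℕ.* z) (tri-+ (B ℕ.+ a₀) e)
      rhs : n ≡ tri e ℕ.+ C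
      rhs = trans (cong (λ z → suc M ℕ.* z ℕ.+ M ℕ.* t) (tri-+ a₀ e))
        (ℕS.solve 6 (λ M B e A E T → (ℕS.con 1 ℕS.:+ M) ℕS.:* (A ℕS.:+ E ℕS.:+ (M ℕS.:* B) ℕS.:* e) ℕS.:+ M ℕS.:* T
           ℕS.:= E ℕS.:+ ((ℕS.con 1 ℕS.:+ M) ℕS.:* A ℕS.:+ M ℕS.:* (T ℕS.:+ E ℕS.:+ (B ℕS.:+ M ℕS.:* B) ℕS.:* e))) refl
           M B e (tri a₀) (tri e) t)

    Deg-Df : ∀ i j → i ℕ.< M → Deg≤ B (Dⁿ i (f j))
    Deg-Df i j i<M = Deg-mono (s≤s (ℕ.≤-trans (ℕ.+-monoˡ-≤ m (ℕ.*-monoˡ-≤ e (ℕ.<⇒≤ i<M))) (ℕ.≤-reflexive (ℕ.+-comm (M ℕ.* e) m)))) (Deg-Dⁿ i (Deg-f j))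

    auxiliary′ : Auxiliary
    auxiliary′ = finish (kernel n (fs₁ ++ fs₂) (subst (ℕ._< n) (sym len) count))
      where
      finish : (∃ λ (x : Vector n) → (∃ λ i → x i ≢ F.0#) × All (λ f → app f x ≡ F.0#) (fs₁ ++ fs₂)) → Auxiliary
      finish (x , (i₀ , x≢0) , zs) = a , Da , (proj₁ nonzero , λ ia → proj₂ nonzero (normal-form _ ia (nf (proj₁ nonzero)))) , eqs
        where
        a : Fin (suc M) → A
        a j = fn (a-part j) x
        q : Fin M → A
        q i = fn (q-part i) x
        Da : ∀ j → Deg (a₀ ℕ.+ e) (a j)
        Da j = Deg-poly (a₀ ℕ.+ e) _
        nf : ∀ j i k → cf (a j) (α ℕ.+ i) (β ℕ.+ k) ≡ F.0#
        nf j i k = go (a₀ ℕ.≤? i ℕ.+ k)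
          where
          go : Dec (a₀ ℕ.≤ i ℕ.+ k) → cf (a j) (α ℕ.+ i) (β ℕ.+ k) ≡ F.0#
          go (no r)  = All.lookup (map⁻ (blocks-All (suc M) normal-form-functionals (++⁻ˡ fs₁ zs) j)) (∈-exponents a₀ i k (ℕ.≰⇒> r))
          go (yes r) = cf≡0 (Da j) _ _ (ℕ.≤-trans (ℕ.+-monoˡ-≤ e r)
                  (ℕ.≤-reflexive (ℕS.solve 4 (λ i j a b → (i ℕS.:+ j) ℕS.:+ (a ℕS.:+ b) ℕS.:= (a ℕS.:+ i) ℕS.:+ (b ℕS.:+ j)) refl i k α β)))
        eq₀ : ∀ i → sumF (suc M) (λ j → Dⁿ (toℕ i) (f j) * a j) + G * q i ≡ 0#
        eq₀ i = trans (cong (_+ G * q i) (sym (fn-sumMap (suc M) (λ j → Dⁿ (toℕ i) (f j) ⊠ a-part j) x)))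
          (coefficients-0 N′ _
            (Deg-+ (subst (Deg N′) (sym (fn-sumMap (suc M) (λ j → Dⁿ (toℕ i) (f j) ⊠ a-part j) x))
                     (Deg-sum (suc M) (λ j → subst (λ z → Deg z (Dⁿ (toℕ i) (f j) * a j)) (sym (ℕ.+-assoc B a₀ e)) (Deg-* (Deg-Df (toℕ i) j (toℕ<n i)) (Da j)))))
                   (subst (λ z → Deg z (G * q i)) (ℕ.+-comm e (B ℕ.+ a₀)) (Deg-* (lm-deg lmG) (Deg-poly (B ℕ.+ a₀) _))))
            (map⁻ (blocks-All M equation-functionals (++⁻ʳ fs₁ zs) i)))
        eqs : ∀ i → i ℕ.< M → InG (sumF (suc M) (λ j → a j * Dⁿ i (f j)))
        eqs i i<M = return (- q i′ , (begin
            sumF (suc M) (λ j → a j * Dⁿ i (f j)) ≡⟨ sumF-cong (suc M) {λ j → a j * Dⁿ i (f j)} {λ j → Dⁿ (toℕ i′) (f j) * a j} (λ j → trans (*-comm _ _) (cong (λ z → Dⁿ z (f j) * a j) (sym (toℕ-fromℕ< i<M)))) ⟩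
            S ≡⟨ solve 2 (λ s g → s := (s :+ g) :- g) refl S (G * q i′) ⟩
            (S + G * q i′) - G * q i′ ≡⟨ cong (_- G * q i′) (eq₀ i′) ⟩
            0# - G * q i′ ≡⟨ solve 2 (λ g q → con (ℤ.+ 0) :- g :* q := g :* (:- q)) refl G (q i′) ⟩
            G * - q i′ ∎))
          where
          i′ = fromℕ< i<M
          S = sumF (suc M) (λ j → Dⁿ (toℕ i′) (f j) * a j)
        all-zero : (∀ j → a j ≡ 0#) → ⊥
        all-zero z = x≢0 (outer (splitAt (suc M ℕ.* s) i₀) refl)
          where
          q≡0 : ∀ i → q i ≡ 0#
          q≡0 i = cancel (q i ≟ 0#)
            where
            cancel : Dec (q i ≡ 0#) → q i ≡ 0#
            cancel (yes y) = y
            cancel (no y)  = ⊥-elim (*-≢0 G≢0 y (trans (sym (trans (cong (_+ G * q i) (sumF-0 (suc M) {λ j → Dⁿ (toℕ i) (f j) * a j} (λ j → trans (cong (Dⁿ (toℕ i) (f j) *_) (z j)) (zeroʳ _)))) (+-identityˡ _))) (eq₀ i)))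
          outer : ∀ w → splitAt (suc M ℕ.* s) i₀ ≡ w → x i₀ ≡ F.0#
          outer (inj₁ k) r = left (combine-surjective {suc M} {s} k)
            where
            left : (∃ λ j → ∃ λ l → combine j l ≡ k) → x i₀ ≡ F.0#
            left (j , l , ck) = trans (cong x (trans (sym (splitAt⁻¹-↑ˡ r)) (cong (_↑ˡ (M ℕ.* t)) (sym ck)))) (poly-inj (a₀ ℕ.+ e) _ (z j) l)
          outer (inj₂ k) r = right (combine-surjective {M} {t} k)
            where
            right : (∃ λ i → ∃ λ l → combine i l ≡ k) → x i₀ ≡ F.0#
            right (i , l , ck) = trans (cong x (trans (sym (splitAt⁻¹-↑ʳ r)) (cong ((suc M ℕ.* s) ↑ʳ_) (sym ck)))) (poly-inj (B ℕ.+ a₀) _ (q≡0 i) l)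
        nonzero : ∃ λ j → a j ≢ 0#
        nonzero = ¬∀⟶∃¬ (suc M) (λ j → a j ≡ 0#) (λ j → a j ≟ 0#) all-zero

  abstract
    auxiliary : Auxiliary
    auxiliary = auxiliary′

  private
    a : Fin (suc M) → A
    a = proj₁ auxiliary

    S : ℕ → ℕ → A
    S i j = sumF (suc M) (λ l → Dⁿ i (a l) * Dⁿ j (f l))

    D-S : ∀ i j → D (S i j) ≡ S (suc i) j + S i (suc j)
    D-S i j = trans (derSum derivation (suc M) (λ l → Dⁿ i (a l) * Dⁿ j (f l))) (trans (sumF-cong (suc M) {λ l → D (Dⁿ i (a l) * Dⁿ j (f l))} (λ l → trans (D-* _ _)
      (cong₂ (λ u v → u * Dⁿ j (f l) + Dⁿ i (a l) * v) (sym (Dⁿ-suc i (a l))) (sym (Dⁿ-suc j (f l)))))) (sumF-+ (suc M) (λ l → Dⁿ (suc i) (a l) * Dⁿ j (f l)) (λ l → Dⁿ i (a l) * Dⁿ (suc j) (f l))))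

    -- The ideal of `G` is stable under D, and `D-S` trades a derivative of `f l` for one of `a l`
    -- at the cost of raising i + j by one.
    InG-S : ∀ i j → i ℕ.+ j ℕ.< M → InG (S i j)
    InG-S zero    j q = proj₂ (proj₂ (proj₂ auxiliary)) j q
    InG-S (suc i) j q = subst InG (trans (cong (_- S i (suc j)) (D-S i j)) (solve 2 (λ a b → (a :+ b) :- b := a) refl (S (suc i) j) (S i (suc j))))
      (InG-- (InG-D (InG-S i j (ℕ.<-trans (ℕ.n<1+n _) q))) (InG-S i (suc j) (subst (ℕ._< M) (sym (ℕ.+-suc i j)) q)))

    D-^p : ∀ u → D (u ^ p) ≡ 0#
    D-^p u = go p refl
      where
      go : ∀ n → p ≡ n → D (u ^ n) ≡ 0#
      go zero    q = ⊥-elim (ℕ.n≮0 (subst (1 ℕ.<_) q F.1<p))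
      go (suc n) q = trans (D-^ u n) (trans (cong (_* (u ^ n * D u)) (trans (sym (nat-κ (suc n))) (trans (cong κ (subst (λ z → F.nat z ≡ F.0#) q F.nat-p)) κ-0))) (zeroˡ _))

    Ψ : A
    Ψ = sumF (suc M) (λ l → a l * f l ^ p)

    Dⁿ-Ψ : ∀ i → Dⁿ i Ψ ≡ sumF (suc M) (λ l → Dⁿ i (a l) * f l ^ p)
    Dⁿ-Ψ zero    = refl
    Dⁿ-Ψ (suc i) = trans (Dⁿ-suc i Ψ) (trans (cong D (Dⁿ-Ψ i)) (trans (derSum derivation (suc M) (λ l → Dⁿ i (a l) * f l ^ p))
      (sumF-cong (suc M) {λ l → D (Dⁿ i (a l) * f l ^ p)} {λ l → Dⁿ (suc i) (a l) * f l ^ p} (λ l → trans (D-* _ _) (trans (cong₂ (λ u v → u * f l ^ p + Dⁿ i (a l) * v) (sym (Dⁿ-suc i (a l))) (D-^p (f l)))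
        (solve 2 (λ x y → x :+ y :* con (ℤ.+ 0) := x) refl (Dⁿ (suc i) (a l) * f l ^ p) (Dⁿ i (a l))))))))

    Deg-Ψ : Deg≤ (p ℕ.* m ℕ.+ (a₀ ℕ.+ e)) Ψ
    Deg-Ψ = Deg-mono (ℕ.n≤1+n _) (Deg-sum (suc M) (λ l → subst (Deg _) (*-comm _ _) (Deg-* (Deg≤-^ p (Deg-f l)) (proj₁ (proj₂ auxiliary) l))))

    ev-S : ∀ Q i j → ev Q (S i j) ≡ F.sumF (suc M) (λ l → θ Q i (a l) F.* θ Q j (f l))
    ev-S Q i j = trans (homSum (evHom Q) (suc M) (λ l → Dⁿ i (a l) * Dⁿ j (f l))) (F.sumF-cong (suc M) {λ l → ev Q (Dⁿ i (a l) * Dⁿ j (f l))} (λ l → EV.ev-* Q _ _))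

    -- D kills p-th powers, and f^p = f at a rational point by Fermat's theorem; so the derivatives
    -- of Ψ take the same values there as sums without p-th powers.
    θ-Ψ : ∀ Q i → θ Q i Ψ ≡ ev Q (S i 0)
    θ-Ψ Q i = trans (cong (ev Q) (Dⁿ-Ψ i)) (trans (homSum (evHom Q) (suc M) (λ l → Dⁿ i (a l) * f l ^ p)) (trans (F.sumF-cong (suc M) {λ l → ev Q (Dⁿ i (a l) * f l ^ p)} {λ l → θ Q i (a l) F.* ev Q (f l)} (λ l →
      trans (EV.ev-* Q _ _) (cong (θ Q i (a l) F.*_) (trans (EV.ev-^ Q (f l) p) (F.fermat _))))) (sym (ev-S Q i 0))))

    Ord-Ψ : ∀ Q → OnG Q → Ord Q M Ψ
    Ord-Ψ Q on i i<M = trans (θ-Ψ Q i) (θ-InG 0 on (InG-S i 0 (subst (ℕ._< M) (sym (ℕ.+-identityʳ i)) i<M)))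

    module Degenerate (Ψ∈ : InG Ψ) (Q : Point) (on : OnG Q) (ns : Nonsingular Q) (em<p : e ℕ.* m ℕ.< p) where
      -- The first column consists of the derivatives of Ψ, zero on the curve by assumption. The
      -- moments are values of D^c applied to `S 0 i`, which lies in the ideal for i < M.
      vanishing : ∀ i j → i ℕ.+ j ℕ.< p → ev Q (S i j) ≡ F.0#
      vanishing i j q = trans (ev-S Q i j) (rank-lemma M (λ i l → θ Q i (a l)) (λ j l → θ Q j (f l))
        (trans (cong (ev Q) f-zero) (EV.ev-1 Q))
        (λ i → trans (sym (ev-S Q i 0)) (trans (sym (θ-Ψ Q i)) (θ-InG i on Ψ∈)))
        (λ i i<M c → trans (F.bs-cong c (λ k l _ → sym (ev-S Q k (i ℕ.+ l)))) (trans (sym (homBs (evHom Q) c (λ k l → S k (i ℕ.+ l))))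
          (trans (cong (ev Q) (sym (Dⁿ-bs c (λ k l → S k (i ℕ.+ l)) (λ k l → trans (D-S k (i ℕ.+ l)) (cong (λ z → S (suc k) (i ℕ.+ l) + S k z) (sym (ℕ.+-suc i l)))))))
            (trans (cong (λ z → ev Q (Dⁿ c (S 0 z))) (ℕ.+-identityʳ i)) (θ-InG c on (InG-S 0 i i<M))))))
        i j q)

      g : ℕ → A
      g i = comb (suc M) f (λ l → θ Q i (a l))

      θ-g : ∀ i j → θ Q j (g i) ≡ ev Q (S i j)
      θ-g i j = trans (homSum-θ (suc M) (λ l → κ (θ Q i (a l)) * f l)) (trans (F.sumF-cong (suc M) {λ l → θ Q j (κ (θ Q i (a l)) * f l)} {λ l → θ Q i (a l) F.* θ Q j (f l)} (λ l → θ-κ* Q j (θ Q i (a l)) (f l))) (sym (ev-S Q i j)))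
        where
        homSum-θ : ∀ n (h : Fin n → A) → θ Q j (sumF n h) ≡ F.sumF n (λ l → θ Q j (h l))
        homSum-θ zero    h = trans (cong (θ Q j) (sym (zeroˡ G))) (trans (cong (θ Q j) (*-comm 0# G)) (θ-InG j on (return (0# , refl))))
        homSum-θ (suc n) h = trans (θ-+ Q j _ _) (cong (θ Q j (h zero) F.+_) (homSum-θ n (λ l → h (suc l))))

      -- For fixed i, `g i` has degree at most m and constant coefficients. It vanishes at Q to an
      -- order above e m, hence on the curve, and m < e then makes it the zero polynomial.
      coefficients-vanish : ∀ i → i ℕ.+ e ℕ.* m ℕ.< p → ∀ l → θ Q i (a l) ≡ F.0#
      coefficients-vanish i q = poly-inj (suc m) (λ l → θ Q i (a l)) (InG-Deg (g i) in-G (Deg-mono m<e (Deg-comb (suc M) Deg-f (λ l → θ Q i (a l)))))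
        where
        in-G : InG (g i)
        in-G ¬g = ℕ.<-irrefl refl (subst (ℕ._≤ e ℕ.* m) (ℕ.*-identityˡ (suc (e ℕ.* m)))
          (vanishing-bound (suc (e ℕ.* m)) em<p (Q ∷ []) ([] ∷ []) (on ∷ [])
            ((λ j j<k → reach Q ns j (ℕ.≤-trans j<k em<p)) ∷ []) m (g i) (λ x → x ¬g) (Deg-comb (suc M) Deg-f (λ l → θ Q i (a l)))
            ((λ j j<k → trans (θ-g i j) (vanishing i j (ℕ.≤-<-trans (ℕ.+-monoʳ-≤ i (ℕ.≤-pred j<k)) q))) ∷ [])))

  -- Σ a_l f_l^p is an auxiliary function vanishing to order M at the rational points; if it vanishes on the whole
  -- curve, the rank lemma makes the a_l vanish to order p - e m there.
  stepanov : ∀ Qs → Unique Qs → All OnG Qs → All Nonsingular Qs → M ℕ.≤ p → e ℕ.* m ℕ.< p →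
    ¬ ¬ (length Qs ℕ.* M ℕ.≤ e ℕ.* (p ℕ.* m ℕ.+ (a₀ ℕ.+ e)) ⊎ length Qs ℕ.* (p ∸ e ℕ.* m) ℕ.≤ e ℕ.* (a₀ ℕ.+ e))
  stepanov Qs uQ on ns M≤p em<p = ¬¬-excluded-middle {A = InG Ψ} >>= λ
    { (no ¬Ψ) → return (inj₁ (vanishing-bound M M≤p Qs uQ on (All.map (λ {Q} n i i<M → reach Q n i (ℕ.≤-trans i<M M≤p)) ns) _ Ψ ¬Ψ Deg-Ψ (All.map (λ {Q} o → Ord-Ψ Q o) on)))
    ; (yes Ψ∈) → return (inj₂ (vanishing-bound (p ∸ e ℕ.* m) (ℕ.m∸n≤m p (e ℕ.* m)) Qs uQ on
        (All.map (λ {Q} n i i<k → reach Q n i (ℕ.≤-trans i<k (ℕ.m∸n≤m p (e ℕ.* m)))) ns) (a₀ ℕ.+ e) (a j) ¬aj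
        (Deg-mono (ℕ.n≤1+n _) (proj₁ (proj₂ auxiliary) j))
        (All.zipWith (λ {Q} (o , n) i i<k → Degenerate.coefficients-vanish Ψ∈ Q o n em<p i (ℕ.m≤o∸n⇒m+n≤o (suc i) (ℕ.<⇒≤ em<p) i<k) j) (on , ns)))) }
    where
    j = proj₁ (proj₁ (proj₂ (proj₂ auxiliary)))
    ¬aj = proj₂ (proj₁ (proj₂ (proj₂ auxiliary)))

-- Restriction to the line X = 0.

module Widths (K : PrimeField) (P : Plane K) where
  private module F = PrimeField K
  open PlaneTheory K P

  -- the restriction of f to the line X = 0 has its lowest term in degree o and its highest in degree o + w
  record Width (f : A) (o w : ℕ) : Set where
    constructor width
    field
      low   : cf f 0 o ≢ F.0#
      below : ∀ b → b ℕ.< o → cf f 0 b ≡ F.0#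
      high  : cf f 0 (o ℕ.+ w) ≢ F.0#
      above : ∀ b → o ℕ.+ w ℕ.< b → cf f 0 b ≡ F.0#
  open Width public

  Width-exists : ∀ f → (∀ b → cf f 0 b ≡ F.0#) ⊎ (∃ λ o → ∃ λ w → Width f o w)
  Width-exists f = combine′ (lowest (proj₁ (Deg-exists f)) 0 (λ _ ()) (λ b q → cf≡0 (proj₂ (Deg-exists f)) 0 b (subst (ℕ._≤ b) (ℕ.+-identityʳ _) q)))
                            (highest (proj₁ (Deg-exists f)) (λ b q → cf≡0 (proj₂ (Deg-exists f)) 0 b q))
    where
    z : ℕ → F.Carrier
    z b = cf f 0 b
    Zero Low High : Set
    Zero = ∀ b → z b ≡ F.0#
    Low  = ∃ λ o → z o ≢ F.0# × (∀ b → b ℕ.< o → z b ≡ F.0#)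
    High = ∃ λ h → z h ≢ F.0# × (∀ b → h ℕ.< b → z b ≡ F.0#)
    lowest : ∀ k i → (∀ b → b ℕ.< i → z b ≡ F.0#) → (∀ b → k ℕ.+ i ℕ.≤ b → z b ≡ F.0#) → Zero ⊎ Low
    lowest zero    i lo hi = inj₁ (λ b → [ lo b , hi b ]′ (ℕ.<-≤-connex b i))
    lowest (suc k) i lo hi with z i F.≟ F.0#
    ... | no nz = inj₂ (i , nz , lo)
    ... | yes q = lowest k (suc i) (λ b b<si → [ lo b , (λ { refl → q }) ]′ (ℕ.m≤n⇒m<n∨m≡n (ℕ.≤-pred b<si)))
                    (λ b r → hi b (subst (ℕ._≤ b) (ℕ.+-suc k i) r))
    highest : ∀ k → (∀ b → k ℕ.≤ b → z b ≡ F.0#) → Zero ⊎ High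
    highest zero    hi = inj₁ (λ b → hi b z≤n)
    highest (suc k) hi with z k F.≟ F.0#
    ... | no nz = inj₂ (k , nz , hi)
    ... | yes q = highest k (λ b k≤b → [ hi b , (λ { refl → q }) ]′ (ℕ.m≤n⇒m<n∨m≡n k≤b))
    combine′ : Zero ⊎ Low → Zero ⊎ High → Zero ⊎ (∃ λ o → ∃ λ w → Width f o w)
    combine′ (inj₁ a) _ = inj₁ a
    combine′ _ (inj₁ a) = inj₁ a
    combine′ (inj₂ (o , nz , lo)) (inj₂ (h , nzh , hi)) = inj₂ (o , h ∸ o , width nz lo
        (λ q → nzh (trans (cong z (sym o+)) q)) (λ b q → hi b (subst (ℕ._< b) o+ q)))
      where
      o+ : o ℕ.+ (h ∸ o) ≡ h
      o+ = ℕ.m+[n∸m]≡n (ℕ.≮⇒≥ (λ h<o → nzh (lo h h<o)))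

  cf-*-line : ∀ f g b → cf (f * g) 0 b ≡ F.ad b (λ j j′ → cf f 0 j F.* cf g 0 j′)
  cf-*-line f g b = cf-* f g 0 b

  -- Lowest and highest terms of the restrictions multiply over a field. This additivity allows the
  -- poor bound for narrow factors to be charged against the width of the whole polynomial.
  Width-* : ∀ {f g o w o′ w′} → Width f o w → Width g o′ w′ → Width (f * g) (o ℕ.+ o′) (w ℕ.+ w′)
  Width-* {f} {g} {o} {w} {o′} {w′} a b = width
    (λ q → F.*-≢0 (low a) (low b) (trans (sym lowest) q))
    (λ c q → trans (cf-*-line f g c) (F.ad-0 c (λ i j r → small i j (subst (ℕ._< o ℕ.+ o′) (sym r) q))))
    (λ q → F.*-≢0 (high a) (high b) (trans (sym highest) (trans (cong (cf (f * g) 0) shuffle) q)))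
    (λ c q → trans (cf-*-line f g c) (F.ad-0 c (λ i j r → big i j (subst (ℕ._< i ℕ.+ j) (sym shuffle) (subst (o ℕ.+ o′ ℕ.+ (w ℕ.+ w′) ℕ.<_) (sym r) q)))))
    where
    shuffle : (o ℕ.+ w) ℕ.+ (o′ ℕ.+ w′) ≡ o ℕ.+ o′ ℕ.+ (w ℕ.+ w′)
    shuffle = ℕS.solve 4 (λ a b c d → (a ℕS.:+ b) ℕS.:+ (c ℕS.:+ d) ℕS.:= a ℕS.:+ c ℕS.:+ (b ℕS.:+ d)) refl o w o′ w′
    left0 : ∀ i j → cf f 0 i ≡ F.0# → cf f 0 i F.* cf g 0 j ≡ F.0#
    left0 i j q = trans (cong (F._* cf g 0 j) q) (F.zeroˡ _)
    right0 : ∀ i j → cf g 0 j ≡ F.0# → cf f 0 i F.* cf g 0 j ≡ F.0#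
    right0 i j q = trans (cong (cf f 0 i F.*_) q) (F.zeroʳ _)
    small : ∀ i j → i ℕ.+ j ℕ.< o ℕ.+ o′ → cf f 0 i F.* cf g 0 j ≡ F.0#
    small i j q with i ℕ.<? o
    ... | yes r = left0 i j (below a i r)
    ... | no r  = right0 i j (below b j (ℕ.≰⇒> (λ o′≤j → ℕ.<⇒≱ q (ℕ.+-mono-≤ (ℕ.≮⇒≥ r) o′≤j))))
    big : ∀ i j → (o ℕ.+ w) ℕ.+ (o′ ℕ.+ w′) ℕ.< i ℕ.+ j → cf f 0 i F.* cf g 0 j ≡ F.0#
    big i j q with o ℕ.+ w ℕ.<? i
    ... | yes r = left0 i j (above a i r)
    ... | no r  = right0 i j (above b j (ℕ.≰⇒> (λ j≤ → ℕ.<⇒≱ q (ℕ.+-mono-≤ (ℕ.≮⇒≥ r) j≤))))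
    lowest : cf (f * g) 0 (o ℕ.+ o′) ≡ cf f 0 o F.* cf g 0 o′
    lowest = trans (cf-*-line f g _) (F.ad-single o o′ {λ i j → cf f 0 i F.* cf g 0 j} term)
      where
      term : ∀ i j → i ℕ.+ j ≡ o ℕ.+ o′ → i ≢ o → cf f 0 i F.* cf g 0 j ≡ F.0#
      term i j q ne with ℕ.<-cmp i o
      ... | tri< lt _ _ = left0 i j (below a i lt)
      ... | tri≈ _ eq _ = ⊥-elim (ne eq)
      ... | tri> _ _ gt = right0 i j (below b j (ℕ.≰⇒> (λ le → ℕ.<-irrefl (sym q) (ℕ.+-mono-<-≤ gt le))))
    highest : cf (f * g) 0 ((o ℕ.+ w) ℕ.+ (o′ ℕ.+ w′)) ≡ cf f 0 (o ℕ.+ w) F.* cf g 0 (o′ ℕ.+ w′)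
    highest = trans (cf-*-line f g _) (F.ad-single (o ℕ.+ w) (o′ ℕ.+ w′) {λ i j → cf f 0 i F.* cf g 0 j} term)
      where
      term : ∀ i j → i ℕ.+ j ≡ (o ℕ.+ w) ℕ.+ (o′ ℕ.+ w′) → i ≢ o ℕ.+ w → cf f 0 i F.* cf g 0 j ≡ F.0#
      term i j q ne with ℕ.<-cmp i (o ℕ.+ w)
      ... | tri> _ _ gt = left0 i j (above a i gt)
      ... | tri≈ _ eq _ = ⊥-elim (ne eq)
      ... | tri< lt _ _ = right0 i j (above b j (ℕ.≰⇒> (λ le → ℕ.<-irrefl q (ℕ.+-mono-<-≤ lt le))))

  cf-Y^* : ∀ N f b → cf (Y ^ N * f) 0 (N ℕ.+ b) ≡ cf f 0 b
  cf-Y^* zero    f b = cong (λ z → cf z 0 b) (*-identityˡ f)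
  cf-Y^* (suc N) f b = trans (cong (λ z → cf z 0 (suc (N ℕ.+ b))) (*-assoc Y (Y ^ N) f)) (trans (cf-Y*-suc _ 0 (N ℕ.+ b)) (cf-Y^* N f b))

  cf-Y^*-below : ∀ N f b → b ℕ.< N → cf (Y ^ N * f) 0 b ≡ F.0#
  cf-Y^*-below (suc N) f zero    q       = trans (cong (λ z → cf z 0 0) (*-assoc Y (Y ^ N) f)) (cf-Y*-0 _ 0)
  cf-Y^*-below (suc N) f (suc b) (s≤s q) = trans (cong (λ z → cf z 0 (suc b)) (*-assoc Y (Y ^ N) f)) (trans (cf-Y*-suc _ 0 b) (cf-Y^*-below N f b q))

  Width-unique : ∀ {f o w o′ w′} → Width f o w → Width f o′ w′ → w′ ℕ.≤ w
  Width-unique {o = o} {w} {o′} {w′} a b = ℕ.+-cancelˡ-≤ o _ _ (ℕ.≤-trans (ℕ.+-monoˡ-≤ w′ o≤o′) h′≤h)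
    where
    o≤o′ : o ℕ.≤ o′
    o≤o′ = ℕ.≮⇒≥ (λ q → low b (below a o′ q))
    h′≤h : o′ ℕ.+ w′ ℕ.≤ o ℕ.+ w
    h′≤h = ℕ.≮⇒≥ (λ q → high b (above a _ q))

-- Contact of a component with the line X = 0.

module LineContact (K : PrimeField) (P : Plane K) (G : Plane.Carrier P) (irr : Divisibility.Irreducible (Plane.ringA P) G)
  (α β : ℕ) (lmG : LeadingMonomials.LM K P G α β) where
  private module F = PrimeField K
  open PlaneTheory K P
  open LinearMaps K P
  open Points K P G irr α β lmG
  open Independence K P
  open Widths K P
  open Solver
  open ≡-Reasoning

  -- f lies in X^i R[1/Y], where R is the coordinate ring of the curve
  InX : ℕ → A → Set
  InX i f = ∃ λ N → ∃ λ q → InG (Y ^ N * f - X ^ i * q)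

  private
    InX-subspace : ∀ i → Subspace (InX i)
    InX-subspace i = record
      { I-+ = λ { {f} {g} (N , q , a) (N′ , q′ , b) → N ℕ.+ N′ , Y ^ N′ * q + Y ^ N * q′ , subst InG
          (trans (solve 7 (λ y y′ x f g q q′ → y′ :* (y :* f :- x :* q) :+ y :* (y′ :* g :- x :* q′) := (y :* y′) :* (f :+ g) :- x :* (y′ :* q :+ y :* q′)) refl (Y ^ N) (Y ^ N′) (X ^ i) f g q q′)
            (cong (λ z → z * (f + g) - X ^ i * (Y ^ N′ * q + Y ^ N * q′)) (sym (^-+ Y N N′))))
          (InG-+ (InG-*ˡ (Y ^ N′) a) (InG-*ˡ (Y ^ N) b)) }
      ; I-* = λ { c {f} (N , q , a) → N , κ c * q , subst InG
          (solve 5 (λ c y f x q → c :* (y :* f :- x :* q) := y :* (c :* f) :- x :* (c :* q)) refl (κ c) (Y ^ N) f (X ^ i) q) (InG-*ˡ (κ c) a) } }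

    InX-suc : ∀ i {f} → InX (suc i) f → InX i f
    InX-suc i {f} (N , q , a) = N , X * q , subst InG
      (solve 4 (λ u x xi q → u :- x :* xi :* q := u :- xi :* (x :* q)) refl (Y ^ N * f) X (X ^ i) q) a

    row : ∀ w → (Fin w → F.Carrier) → A
    row w c = comb w (λ j → Y ^ toℕ j) c

    row-suc : ∀ w c → row (suc w) c ≡ κ (c zero) + Y * row w (λ j → c (suc j))
    row-suc w c = cong₂ _+_ (*-identityʳ _) (trans (sumF-cong w (λ j →
      solve 3 (λ a b c → a :* (b :* c) := b :* (a :* c)) refl (κ (c (suc j))) Y (Y ^ toℕ j))) (sumF-* w Y _))

    cf-row : ∀ w c j → cf (row w c) 0 (toℕ j) ≡ c j
    cf-row (suc w) c zero    = trans (cong (λ z → cf z 0 0) (row-suc w c)) (trans (cf-+ _ _ 0 0)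
      (trans (cong₂ F._+_ (cf-κ-0 (c zero)) (cf-Y*-0 _ 0)) (F.+-identityʳ _)))
    cf-row (suc w) c (suc j) = trans (cong (λ z → cf z 0 (suc (toℕ j))) (row-suc w c)) (trans (cf-+ _ _ 0 _)
      (trans (cong₂ F._+_ (cf-κ (c zero) 0 (suc (toℕ j)) (s≤s z≤n)) (trans (cf-Y*-suc _ 0 (toℕ j)) (cf-row w _ j))) (F.+-identityˡ _)))

    cf-row-above : ∀ w c b → w ℕ.≤ b → cf (row w c) 0 b ≡ F.0#
    cf-row-above zero    c b       q       = cf-0 0 b
    cf-row-above (suc w) c (suc b) (s≤s q) = trans (cong (λ z → cf z 0 (suc b)) (row-suc w c)) (trans (cf-+ _ _ 0 _)
      (trans (cong₂ F._+_ (cf-κ (c zero) 0 (suc b) (s≤s z≤n)) (trans (cf-Y*-suc _ 0 b) (cf-row-above w _ b q))) (F.+-identityˡ _)))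

  module _ (¬X : ¬ InG X) {o w : ℕ} (W : Width G o w) where
    private
      ¬X^ : ∀ i → ¬ InG (X ^ i)
      ¬X^ zero    in1 = in1 (λ d → unit-contra d)
        where
        unit-contra : ¬ (G ∣ 1#)
        unit-contra (h , q) = proj₁ (proj₂ irr) (h , sym q)
      ¬X^ (suc i) = InG-*-≢ ¬X (¬X^ i)

      -- On the line X = 0 the hypothesis becomes Y^N row(Y) = G(0,Y) h(0,Y). If h(0,Y) is nonzero,
      -- the right side spans at least w degrees, whereas the left side spans fewer than w.
      row-zero : ∀ c N q → InG (Y ^ N * row w c - X * q) → ∀ j → c j ≡ F.0#
      row-zero c N q ig j = decidable-stable (c j F.≟ F.0#) (ig >>= λ { (h , eq) → return (go h eq) })
        where
        go : ∀ h → Y ^ N * row w c - X * q ≡ G * h → c j ≡ F.0#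
        go h eq = [ (λ z → trans (sym (cf-row w c j)) (trans (sym (cf-Y^* N _ (toℕ j))) (trans (on-line _) (gh-zero z _)))) , (λ (o′ , w′ , W′) → ⊥-elim (wide o′ w′ (Width-* W W′))) ]′ (Width-exists h)
          where
          on-line : ∀ b → cf (Y ^ N * row w c) 0 b ≡ cf (G * h) 0 b
          on-line b = begin
            cf (Y ^ N * row w c) 0 b
              ≡⟨ cong (λ z → cf z 0 b) (solve 2 (λ u v → u := (u :- v) :+ v) refl (Y ^ N * row w c) (X * q)) ⟩
            cf ((Y ^ N * row w c - X * q) + X * q) 0 b ≡⟨ trans (cf-+ _ _ 0 b) (cong₂ F._+_ (cong (λ z → cf z 0 b) eq) (cf-X*-0 q b)) ⟩
            cf (G * h) 0 b F.+ F.0# ≡⟨ F.+-identityʳ _ ⟩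
            cf (G * h) 0 b ∎
          gh-zero : (∀ b → cf h 0 b ≡ F.0#) → ∀ b → cf (G * h) 0 b ≡ F.0#
          gh-zero z b = trans (cf-*-line G h b) (F.ad-0 b (λ i j _ → trans (cong (cf G 0 i F.*_) (z j)) (F.zeroʳ _)))
          wide : ∀ o′ w′ → Width (G * h) (o ℕ.+ o′) (w ℕ.+ w′) → ⊥
          wide o′ w′ V = low V (trans (sym (on-line _)) (cf-Y^*-below N _ _ (ℕ.+-cancelʳ-< w _ _ (ℕ.≤-<-trans
              (ℕ.≤-trans (ℕ.+-monoʳ-≤ (o ℕ.+ o′) (ℕ.m≤m+n w w′)) ℕ.≤-refl) top<))))
            where
            top : ℕ
            top = o ℕ.+ o′ ℕ.+ (w ℕ.+ w′)
            top< : top ℕ.< N ℕ.+ w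
            top< = ℕ.≰⇒> (λ le → high V (trans (sym (on-line top)) (trans (cong (cf (Y ^ N * row w c) 0) (sym (ℕ.m+[n∸m]≡n (ℕ.≤-trans (ℕ.m≤m+n N w) le))))
              (trans (cf-Y^* N _ (top ∸ N)) (cf-row-above w c (top ∸ N) (ℕ.m+n≤o⇒m≤o∸n w (subst (ℕ._≤ top) (ℕ.+-comm N w) le)))))))

      block : ℕ → Fin w → A
      block i j = X ^ i * Y ^ toℕ j

      comb-block : ∀ i c → comb w (block i) c ≡ X ^ i * row w c
      comb-block i c = trans (sumF-cong w (λ j → solve 3 (λ a b c → a :* (b :* c) := b :* (a :* c)) refl (κ (c j)) (X ^ i) (Y ^ toℕ j))) (sumF-* w (X ^ i) _)

      -- The monomials X^i Y^j with i < k and j < w: each power of X contributes w classes modulo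
      -- the next power.
      family : ∀ k → ∃ λ (E : Fin (k ℕ.* w) → A) → Independent (InX k) _ E
      family zero    = (λ ()) , λ _ _ ()
      family (suc k) = block k ⧺ proj₁ (family k) , append (block k) (proj₁ (family k)) (InX-subspace k) (InX-suc k) (proj₂ (family k))
        (λ c → 0 , row w c , subst InG (sym (trans (cong (λ z → 1# * z - X ^ k * row w c) (comb-block k c)) (solve 1 (λ u → con (ℤ.+ 1) :* u :- u := con (ℤ.+ 0)) refl (X ^ k * row w c)))) InG-0)
        (λ c (N , q , ig) → row-zero c N q (InG-prime {X ^ k} (subst InG (trans (cong (λ z → Y ^ N * z - X * X ^ k * q) (comb-block k c))
            (solve 5 (λ y xk r x q → y :* (xk :* r) :- x :* xk :* q := xk :* (y :* r :- x :* q)) refl (Y ^ N) (X ^ k) (row w c) X q)) ig) (¬X^ k)))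

    -- Inverting Y discards the origin; the rest of the intersection with the line X = 0 has length
    -- w. A function divisible by X^k there counts k w zeros, against Bézout's number e δ.
    divisibility-bound : ∀ k δ ω → ¬ InG ω → Deg≤ δ ω → InX k ω → k ℕ.* w ℕ.≤ e ℕ.* δ
    divisibility-bound k δ ω ¬ω dω (N , q , ig) = bezout δ ω ¬ω dω _ (proj₁ (family k)) (λ c v ic → proj₂ (family k) c
      (N , q * v , subst InG (solve 6 (λ y c ω v x q → y :* (c :- ω :* v) :+ v :* (y :* ω :- x :* q) := y :* c :- x :* (q :* v)) refl
          (Y ^ N) (comb _ (proj₁ (family k)) c) ω v (X ^ k) q)
        (InG-+ (InG-*ˡ (Y ^ N) ic) (InG-*ˡ v ig))))

-- The differential relations on a component of low degree.

module FermatPolynomials (K : PrimeField) (P : Plane K) where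
  open PlaneTheory K P

  power-sum : ℕ → A
  power-sum k = X ^ k + Y ^ k - 1#

  fermat-difference : (k n k′ n′ : ℕ) → A
  fermat-difference k n k′ n′ = power-sum n ^ k′ - power-sum k ^ n′

  -- The excluded points lie on five curves of degree at most max(k, 1) and number O(k p). A
  -- component with one good point lies on none of these curves, so the five polynomials may be
  -- cancelled modulo its ideal.
  record Good (k : ℕ) (Q : Point) : Set where
    field
      x≢0     : proj₁ Q ≢ PrimeField.0# K
      y≢0     : proj₂ Q ≢ PrimeField.0# K
      V≢0     : ev Q (power-sum k) ≢ PrimeField.0# K
      y^k≢1   : ev Q (Y ^ k - 1#) ≢ PrimeField.0# K
      x^k+y^k : ev Q (X ^ k + Y ^ k) ≢ PrimeField.0# K

-- A component G of the curve power-sum n ^ k′ = power-sum k ^ n′; here k = k₁ + 1 and n = k + h.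
module Component (K : PrimeField) (P : Plane K) (G : Plane.Carrier P) (irr : Divisibility.Irreducible (Plane.ringA P) G)
  (α β : ℕ) (lmG : LeadingMonomials.LM K P G α β) (k₁ h₁ k″ n″ : ℕ) where
  private module F = PrimeField K
  open F using (p)
  open PlaneTheory K P
  open LeadingMonomials K P using (lm-deg)
  open Points K P G irr α β lmG
  open FermatPolynomials K P
  open Widths K P
  open LineContact K P G irr α β lmG
  open Solver
  open ≡-Reasoning

  k h n k′ n′ : ℕ
  k  = suc k₁
  h  = suc h₁
  n  = suc (k₁ ℕ.+ h)
  k′ = suc k″
  n′ = suc n″

  open Good

  module _ (k′n≡n′k : k′ ℕ.* n ≡ n′ ℕ.* k) (d<p : k′ ℕ.* n ℕ.< p) (n<p : n ℕ.< p) (G∣F : G ∣ fermat-difference k n k′ n′) where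
    private
      U V ẋ ẏ ÿ a b s r : A
      U = power-sum n
      V = power-sum k
      ẋ = D X
      ẏ = D Y
      ÿ = D ẏ
      a = X ^ k₁
      b = Y ^ k₁
      s = X ^ h
      r = Y ^ h

      E : A
      E = V * (a * s * ẋ + b * r * ẏ) - U * (a * ẋ + b * ẏ)

      U≡ : U ≡ X * (a * s) + Y * (b * r) - 1#
      U≡ = cong₂ (λ u v → X * u + Y * v - 1#) (^-+ X k₁ h) (^-+ Y k₁ h)

      D-1 : D 1# ≡ 0#
      D-1 = trans (cong D (sym κ-1)) (D-κ F.1#)

      D-power-sum : ∀ m → D (power-sum (suc m)) ≡ nat (suc m) * (X ^ m * ẋ + Y ^ m * ẏ)
      D-power-sum m = begin
        D (X ^ suc m + Y ^ suc m - 1#) ≡⟨ trans (D-+ _ _) (cong₂ _+_ (D-+ _ _) (trans (D-neg 1#) (trans (cong -_ D-1) -0#≈0#))) ⟩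
        D (X ^ suc m) + D (Y ^ suc m) + 0# ≡⟨ trans (+-identityʳ _) (cong₂ _+_ (D-^ X m) (D-^ Y m)) ⟩
        nat (suc m) * (X ^ m * ẋ) + nat (suc m) * (Y ^ m * ẏ) ≡⟨ sym (distribˡ _ _ _) ⟩
        nat (suc m) * (X ^ m * ẋ + Y ^ m * ẏ) ∎

      DU : D U ≡ nat n * (a * s * ẋ + b * r * ẏ)
      DU = trans (D-power-sum (k₁ ℕ.+ h)) (cong₂ (λ u v → nat n * (u * ẋ + v * ẏ)) (^-+ X k₁ h) (^-+ Y k₁ h))

      DV : D V ≡ nat k * (a * ẋ + b * ẏ)
      DV = D-power-sum k₁

      -- E is the logarithmic derivative of U^k′ = V^n′, up to a unit
      E-multiple : InG (U ^ k′ * (nat (k′ ℕ.* n) * E))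
      E-multiple = subst InG eq (InG-- (InG-*ˡ (U * V) (InG-D (return G∣F))) (InG-*ʳ (nat n′ * U * D V) (return G∣F)))
        where
        DF : D (fermat-difference k n k′ n′) ≡ nat k′ * (U ^ k″ * D U) - nat n′ * (V ^ n″ * D V)
        DF = trans (D-+ _ _) (cong₂ _+_ (D-^ U k″) (trans (D-neg _) (cong -_ (D-^ V n″))))
        -- The chosen combination cancels the powers of V; k′ n = n′ k then makes k′ n a common
        -- factor of what remains.
        eq : U * V * D (fermat-difference k n k′ n′) - fermat-difference k n k′ n′ * (nat n′ * U * D V) ≡ U ^ k′ * (nat (k′ ℕ.* n) * E)
        eq = begin
          U * V * D (fermat-difference k n k′ n′) - fermat-difference k n k′ n′ * (nat n′ * U * D V)
            ≡⟨ cong (λ z → U * V * z - fermat-difference k n k′ n′ * (nat n′ * U * D V)) DF ⟩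
          U * V * (nat k′ * (U ^ k″ * D U) - nat n′ * (V ^ n″ * D V)) - (U * U ^ k″ - V * V ^ n″) * (nat n′ * U * D V)
            ≡⟨ solve 8 (λ U V k′ n′ Uk Vn DU DV → U :* V :* (k′ :* (Uk :* DU) :- n′ :* (Vn :* DV)) :- (U :* Uk :- V :* Vn) :* (n′ :* U :* DV)
                 := U :* Uk :* (k′ :* V :* DU :- n′ :* U :* DV)) refl U V (nat k′) (nat n′) (U ^ k″) (V ^ n″) (D U) (D V) ⟩
          U * U ^ k″ * (nat k′ * V * D U - nat n′ * U * D V)
            ≡⟨ cong (U * U ^ k″ *_) (begin
                 nat k′ * V * D U - nat n′ * U * D V ≡⟨ cong₂ (λ u v → nat k′ * V * u - nat n′ * U * v) DU DV ⟩
                 nat k′ * V * (nat n * S) - nat n′ * U * (nat k * T)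
                   ≡⟨ solve 8 (λ k′ V n S n′ U k T → k′ :* V :* (n :* S) :- n′ :* U :* (k :* T) := k′ :* n :* (V :* S) :- n′ :* k :* (U :* T)) refl
                        (nat k′) V (nat n) S (nat n′) U (nat k) T ⟩
                 nat k′ * nat n * (V * S) - nat n′ * nat k * (U * T)
                   ≡⟨ cong₂ (λ u v → u * (V * S) - v * (U * T)) (sym (nat-* k′ n)) (trans (sym (nat-* n′ k)) (cong nat (sym k′n≡n′k))) ⟩
                 nat (k′ ℕ.* n) * (V * S) - nat (k′ ℕ.* n) * (U * T) ≡⟨ solve 3 (λ d u v → d :* u :- d :* v := d :* (u :- v)) refl (nat (k′ ℕ.* n)) (V * S) (U * T) ⟩
                 nat (k′ ℕ.* n) * (V * S - U * T) ∎) ⟩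
          U ^ k′ * (nat (k′ ℕ.* n) * E) ∎
          where
          S = a * s * ẋ + b * r * ẏ
          T = a * ẋ + b * ẏ

    -- One good nonsingular point suffices for statements about the whole component: a polynomial
    -- that is nonzero at Q does not vanish on the curve and can be cancelled.
    module At (Q : Point) (on : OnG Q) (ns : Nonsingular Q) (good : Good k Q) where
      private
        ev-≢0 : ∀ {u} → ev Q u ≢ F.0# → ¬ InG u
        ev-≢0 nz iu = nz (θ-InG 0 on iu)

        nat-∉ : ∀ m → 0 ℕ.< m → m ℕ.< p → ¬ InG (nat m)
        nat-∉ m 0<m m<p = ev-≢0 (λ z → F.nat≢0 m 0<m m<p (trans (sym (trans (cong (ev Q) (sym (nat-κ m))) (ev-κ Q _))) z))

        X^∉ : ∀ m → ¬ InG (X ^ m)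
        X^∉ m = ev-≢0 (λ z → F.^-≢0 m (x≢0 good) (trans (sym (trans (EV.ev-^ Q X m) (cong (F._^ m) (ev-X Q)))) z))

        Y^∉ : ∀ m → ¬ InG (Y ^ m)
        Y^∉ m = ev-≢0 (λ z → F.^-≢0 m (y≢0 good) (trans (sym (trans (EV.ev-^ Q Y m) (cong (F._^ m) (ev-Y Q)))) z))

      X∉ : ¬ InG X
      X∉ = subst (λ z → ¬ InG z) (*-identityʳ X) (X^∉ 1)

      private
        Y∉ : ¬ InG Y
        Y∉ = subst (λ z → ¬ InG z) (*-identityʳ Y) (Y^∉ 1)

        V∉ : ¬ InG V
        V∉ = ev-≢0 (V≢0 good)

        U∉ : ¬ InG (U ^ k′)
        U∉ = ev-≢0 (λ z → F.^-≢0 n′ (V≢0 good) (trans (sym (EV.ev-^ Q V n′)) (trans (sym equal) z)))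
          where
          equal : ev Q (U ^ k′) ≡ ev Q (V ^ n′)
          equal = F.x-y≡0⇒x≡y (trans (sym (trans (EV.ev-+ Q _ _) (cong (ev Q (U ^ k′) F.+_) (EV.ev-- Q _)))) (θ-InG 0 on (return G∣F)))

        k∉ : ¬ InG (nat k)
        k∉ = nat-∉ k (s≤s z≤n) (ℕ.≤-<-trans (s≤s (ℕ.m≤m+n k₁ h)) n<p)

        h∉ : ¬ InG (nat h)
        h∉ = nat-∉ h (s≤s z≤n) (ℕ.≤-<-trans (ℕ.≤-trans (ℕ.m≤n+m h k₁) (ℕ.n≤1+n _)) n<p)

        E∈ : InG E
        E∈ = InG-prime (InG-prime E-multiple U∉) (nat-∉ (k′ ℕ.* n) (s≤s z≤n) d<p)

        -- Otherwise D u = ẋ ∂x u + ẏ ∂y u would vanish at Q for every u, although Q is nonsingular.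
        ẋẏ : InG ẋ → InG ẏ → ⊥
        ẋẏ ix iy = contra ns
          where
          contra : Nonsingular Q → ⊥
          contra (u , _ , Du≢0) = Du≢0 (θ-InG 0 on (subst InG (begin
            ẋ * ∂x u + ẏ * ∂y u ≡⟨ cong₂ (λ v w → v * ∂x u + w * ∂y u) D-X D-Y ⟩
            ∂y G * ∂x u + - ∂x G * ∂y u ≡⟨ solve 4 (λ a b c d → a :* b :+ (:- c) :* d := a :* b :- c :* d) refl (∂y G) (∂x u) (∂x G) (∂y u) ⟩
            D u ∎) (InG-+ (InG-*ʳ (∂x u) ix) (InG-*ʳ (∂y u) iy))))

        D-s : D s ≡ nat h * (X ^ h₁ * ẋ)
        D-s = D-^ X h₁
        D-r : D r ≡ nat h * (Y ^ h₁ * ẏ)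
        D-r = D-^ Y h₁

        U₀ E₀ t₀ : A
        U₀ = X * (a * s) + Y * (b * r) - 1#
        E₀ = V * (a * s * ẋ + b * r * ẏ) - U₀ * (a * ẋ + b * ẏ)
        t₀ = (Y * b - 1#) * s - (Y * (b * r) - 1#)

        E₀∈ : InG E₀
        E₀∈ = subst (λ z → InG (V * (a * s * ẋ + b * r * ẏ) - z * (a * ẋ + b * ẏ))) U≡ E∈

        D-1# : ∀ f → D (f - 1#) ≡ D f
        D-1# f = trans (D-+ f _) (trans (cong (D f +_) (trans (D-neg 1#) (trans (cong -_ D-1) -0#≈0#))) (+-identityʳ _))

        D-Yb : D (Y * b - 1#) ≡ nat k * (b * ẏ)
        D-Yb = trans (D-1# _) (D-^ Y k₁)

        D-Ybr : D (Y * (b * r) - 1#) ≡ nat n * (b * r * ẏ)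
        D-Ybr = trans (D-1# _) (trans (cong (λ z → D (Y * z)) (sym (^-+ Y k₁ h))) (trans (D-^ Y (k₁ ℕ.+ h)) (cong (λ z → nat n * (z * ẏ)) (^-+ Y k₁ h))))

        yk∉ : ¬ InG (Y * b - 1#)
        yk∉ = ev-≢0 (y^k≢1 good)

      -- the curve is not a line Y = y₀, since E₀ would force y₀^k = 1
      ẏ∉ : ¬ InG ẏ
      ẏ∉ iy = yk∉ (InG-prime (InG-prime (InG-prime (subst InG (trans (cong (_- ẏ * c₀) Dt)
            (solve 5 (λ y h x ẋ z → y :* (h :* (x :* ẋ)) :+ z :- z := h :* (x :* (ẋ :* y))) refl (Y * b - 1#) (nat h) (X ^ h₁) ẋ (ẏ * c₀)))
          (InG-- (InG-D t∈) (InG-*ʳ c₀ iy))) h∉) (X^∉ h₁)) ẋ∉)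
        where
        ẋ∉ : ¬ InG ẋ
        ẋ∉ ix = ẋẏ ix iy
        t∈ : InG t₀
        t∈ = InG-prime (InG-prime (subst InG (solve 8 (λ X Y a b s r ẋ ẏ →
                 let V = X :* a :+ Y :* b :- con (ℤ.+ 1); U = X :* (a :* s) :+ Y :* (b :* r) :- con (ℤ.+ 1) in
                 (V :* (a :* s :* ẋ :+ b :* r :* ẏ) :- U :* (a :* ẋ :+ b :* ẏ)) :- ẏ :* (b :* (V :* r :- U))
                 := a :* (ẋ :* ((Y :* b :- con (ℤ.+ 1)) :* s :- (Y :* (b :* r) :- con (ℤ.+ 1))))) refl X Y a b s r ẋ ẏ)
               (InG-- E₀∈ (InG-*ʳ (b * (V * r - U₀)) iy))) (X^∉ k₁)) ẋ∉
        c₀ : A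
        c₀ = nat k * (b * s) - nat n * (b * r)
        Dt : D t₀ ≡ (Y * b - 1#) * (nat h * (X ^ h₁ * ẋ)) + ẏ * c₀
        Dt = begin
          D ((Y * b - 1#) * s - (Y * (b * r) - 1#)) ≡⟨ trans (D-+ _ _) (cong₂ _+_ (D-* _ _) (D-neg _)) ⟩
          D (Y * b - 1#) * s + (Y * b - 1#) * D s - D (Y * (b * r) - 1#)
            ≡⟨ cong₂ _-_ (cong₂ (λ u v → u * s + (Y * b - 1#) * v) D-Yb D-s) D-Ybr ⟩
          nat k * (b * ẏ) * s + (Y * b - 1#) * (nat h * (X ^ h₁ * ẋ)) - nat n * (b * r * ẏ)
            ≡⟨ solve 7 (λ k b ẏ s z n r → k :* (b :* ẏ) :* s :+ z :- n :* (b :* r :* ẏ) := z :+ ẏ :* (k :* (b :* s) :- n :* (b :* r))) refl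
                 (nat k) b ẏ s ((Y * b - 1#) * (nat h * (X ^ h₁ * ẋ))) (nat n) r ⟩
          _ ∎

      private
        -- Sorted by powers of X, the relation E₀ reads h₀ + X^k₁ q₁ = 0, where h₀ = Y^k₁ ẏ (1 -
        -- Y^h). So h₀ is divisible by X^k₁ on the curve, but its degree is of the order of n; `W`
        -- and `T` serve to remove the factor 1 - Y^h.
        module Contact (k₂ : ℕ) (k₁≡ : k₁ ≡ suc k₂) where
          c c′ y₁ q₁ h₀ Z W T q : A
          c  = X ^ k₂
          c′ = Y ^ k₂
          y₁ = Y ^ h₁
          q₁ = ẋ * t₀ + b * ẏ * (X * (r - s))
          h₀ = b * ẏ * (1# - r)
          Z  = h₀ + a * q₁
          T  = Y * ẏ
          W  = (nat k₁ + nat h) * (ẏ * ẏ) + Y * ÿ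
          q  = T * (nat k₁ * (ẋ * q₁) + X * D q₁) - W * (X * q₁)

          Z∈ : InG Z
          Z∈ = subst InG (solve 8 (λ X Y a b s r ẋ ẏ →
                 let V = X :* a :+ Y :* b :- con (ℤ.+ 1); U = X :* (a :* s) :+ Y :* (b :* r) :- con (ℤ.+ 1) in
                 V :* (a :* s :* ẋ :+ b :* r :* ẏ) :- U :* (a :* ẋ :+ b :* ẏ)
                 := b :* ẏ :* (con (ℤ.+ 1) :- r) :+ a :* (ẋ :* ((Y :* b :- con (ℤ.+ 1)) :* s :- (Y :* (b :* r) :- con (ℤ.+ 1))) :+ b :* ẏ :* (X :* (r :- s)))) refl X Y a b s r ẋ ẏ) E₀∈

          a≡ : a ≡ X * c
          a≡ = cong (X ^_) k₁≡
          b≡ : b ≡ Y * c′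
          b≡ = cong (Y ^_) k₁≡
          D-a : D a ≡ nat k₁ * (c * ẋ)
          D-a = trans (cong (λ z → D (X ^ z)) k₁≡) (trans (D-^ X k₂) (cong (λ z → nat z * (c * ẋ)) (sym k₁≡)))
          D-b : D b ≡ nat k₁ * (c′ * ẏ)
          D-b = trans (cong (λ z → D (Y ^ z)) k₁≡) (trans (D-^ Y k₂) (cong (λ z → nat z * (c′ * ẏ)) (sym k₁≡)))

          Dh₀ : D h₀ ≡ (nat k₁ * (c′ * ẏ) * ẏ + b * ÿ) * (1# - r) - b * ẏ * (nat h * (y₁ * ẏ))
          Dh₀ = begin
            D (b * ẏ * (1# - r)) ≡⟨ trans (D-* _ _) (cong₂ (λ u v → u * (1# - r) + b * ẏ * v) (D-* b ẏ) D1r) ⟩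
            (D b * ẏ + b * ÿ) * (1# - r) + b * ẏ * - (nat h * (y₁ * ẏ)) ≡⟨ cong (λ u → (u * ẏ + b * ÿ) * (1# - r) + b * ẏ * - (nat h * (y₁ * ẏ))) D-b ⟩
            (nat k₁ * (c′ * ẏ) * ẏ + b * ÿ) * (1# - r) + b * ẏ * - (nat h * (y₁ * ẏ))
              ≡⟨ solve 3 (λ u v w → u :+ v :* (:- w) := u :- v :* w) refl ((nat k₁ * (c′ * ẏ) * ẏ + b * ÿ) * (1# - r)) (b * ẏ) (nat h * (y₁ * ẏ)) ⟩
            _ ∎
            where
            D1r : D (1# - r) ≡ - (nat h * (y₁ * ẏ))
            D1r = trans (D-+ _ _) (trans (cong₂ _+_ D-1 (trans (D-neg r) (cong -_ D-r))) (+-identityˡ _))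

          -- h₀ is the difference of Y^k₁ ẏ and Y^(k₁ + h) ẏ. The operator W - T D annihilates the
          -- second and multiplies the first by h ẏ².
          I₁ : b * (nat h * (ẏ * ẏ * ẏ)) ≡ W * h₀ - T * D h₀
          I₁ = begin
            b * (nat h * (ẏ * ẏ * ẏ)) ≡⟨ cong (_* (nat h * (ẏ * ẏ * ẏ))) b≡ ⟩
            Y * c′ * (nat h * (ẏ * ẏ * ẏ))
              ≡⟨ solve 7 (λ Y c′ y₁ ẏ ÿ k₁ h → Y :* c′ :* (h :* (ẏ :* ẏ :* ẏ)) :=
                   ((k₁ :+ h) :* (ẏ :* ẏ) :+ Y :* ÿ) :* (Y :* c′ :* ẏ :* (con (ℤ.+ 1) :- Y :* y₁))
                   :- Y :* ẏ :* ((k₁ :* (c′ :* ẏ) :* ẏ :+ Y :* c′ :* ÿ) :* (con (ℤ.+ 1) :- Y :* y₁) :- Y :* c′ :* ẏ :* (h :* (y₁ :* ẏ)))) refl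
                   Y c′ y₁ ẏ ÿ (nat k₁) (nat h) ⟩
            W * (Y * c′ * ẏ * (1# - r)) - T * ((nat k₁ * (c′ * ẏ) * ẏ + Y * c′ * ÿ) * (1# - r) - Y * c′ * ẏ * (nat h * (y₁ * ẏ)))
              ≡⟨ cong (λ z → W * (z * ẏ * (1# - r)) - T * ((nat k₁ * (c′ * ẏ) * ẏ + z * ÿ) * (1# - r) - z * ẏ * (nat h * (y₁ * ẏ)))) (sym b≡) ⟩
            W * h₀ - T * ((nat k₁ * (c′ * ẏ) * ẏ + b * ÿ) * (1# - r) - b * ẏ * (nat h * (y₁ * ẏ)))
              ≡⟨ cong (λ z → W * h₀ - T * z) (sym Dh₀) ⟩
            W * h₀ - T * D h₀ ∎

          I₂ : b * (nat h * (ẏ * ẏ * ẏ)) - c * q ≡ W * Z - T * D Z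
          I₂ = begin
            b * (nat h * (ẏ * ẏ * ẏ)) - c * q ≡⟨ cong (_- c * q) I₁ ⟩
            W * h₀ - T * D h₀ - c * q
              ≡⟨ solve 10 (λ W h₀ T D c X q₁ k ẋ Dq → W :* h₀ :- T :* D :- c :* (T :* (k :* (ẋ :* q₁) :+ X :* Dq) :- W :* (X :* q₁))
                   := W :* (h₀ :+ X :* c :* q₁) :- T :* (D :+ (k :* (c :* ẋ) :* q₁ :+ X :* c :* Dq))) refl
                   W h₀ T (D h₀) c X q₁ (nat k₁) ẋ (D q₁) ⟩
            W * (h₀ + X * c * q₁) - T * (D h₀ + (nat k₁ * (c * ẋ) * q₁ + X * c * D q₁))
              ≡⟨ cong₂ (λ u v → W * (h₀ + u * q₁) - T * (D h₀ + (v * q₁ + u * D q₁))) (sym a≡) (sym D-a) ⟩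
            W * Z - T * (D h₀ + (D a * q₁ + a * D q₁)) ≡⟨ cong (λ z → W * Z - T * z) (sym (trans (D-+ h₀ _) (cong (D h₀ +_) (D-* a q₁)))) ⟩
            W * Z - T * D Z ∎

          -- Applying D to the multiple of X^k₁ costs one power of X, hence k₂ = k₁ - 1; the factor
          -- Y^k₁ is absorbed by inverting Y.
          high-contact : InX k₂ (nat h * (ẏ * ẏ * ẏ))
          high-contact = k₁ , q , subst InG (sym I₂) (InG-- (InG-*ˡ W Z∈) (InG-*ˡ T (InG-D Z∈)))

        Deg-ẋ : Deg≤ e ẋ
        Deg-ẋ = subst (Deg≤ e) (sym D-X) (Deg-mono (ℕ.n≤1+n e) (Deg-∂Y (lm-deg lmG)))
        Deg-ẏ : Deg≤ e ẏ
        Deg-ẏ = subst (Deg≤ e) (sym D-Y) (Deg-- (Deg-mono (ℕ.n≤1+n e) (Deg-∂X (lm-deg lmG))))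

      contact-bound : ∀ k₂ → k₁ ≡ suc k₂ → ∀ {o w} → Width G o w → k₂ ℕ.* w ℕ.≤ e ℕ.* (e ℕ.+ e ℕ.+ e)
      contact-bound k₂ k₁≡ W = divisibility-bound X∉ W k₂ (e ℕ.+ e ℕ.+ e) (nat h * (ẏ * ẏ * ẏ)) (InG-*-≢ h∉ (InG-*-≢ (InG-*-≢ ẏ∉ ẏ∉) ẏ∉))
        (Deg≤-* {0} (Deg-nat h) (Deg≤-* (Deg≤-* Deg-ẏ Deg-ẏ) Deg-ẏ)) (Contact.high-contact k₂ k₁≡)

      private
        V̇ α′ β′ x′ y′ p₁ p₂ P₁ P₂ P₃ q₁ q₃ : A
        V̇  = D V
        x′ = X ^ (k₁ ℕ.+ h)
        y′ = Y ^ (k₁ ℕ.+ h)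
        α′ = X * x′
        β′ = Y * y′
        p₁ = nat k * V * ẋ - X * V̇
        p₂ = nat k * V * ẏ - Y * V̇
        P₁ = Y * p₁
        P₂ = X * p₂
        P₃ = X * (Y * V̇)
        q₁ = P₂ * D P₃ - P₃ * D P₂ - nat n * (P₂ * (X * V̇ * ẏ))
        q₃ = P₁ * D P₂ - P₂ * D P₁ + nat n * (p₁ * p₂ * (X * ẏ - Y * ẋ))

        -- The three terms of the linear relation between X^n, Y^n and 1, with coefficients `P₁`,
        -- `P₂`, `P₃`. The sum is X Y k E₀; the factor X Y raises the exponents n - 1 in E₀ to n.
        A₁ A₂ Sum : A
        A₁ = P₁ * α′
        A₂ = P₂ * β′
        Sum = A₁ + A₂ + P₃

        D-α : D α′ ≡ nat n * (x′ * ẋ)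
        D-α = D-^ X (k₁ ℕ.+ h)
        D-β : D β′ ≡ nat n * (y′ * ẏ)
        D-β = D-^ Y (k₁ ℕ.+ h)

        Sum≡ : Sum ≡ X * (Y * (nat k * E₀))
        Sum≡ = begin
          Y * (nat k * V * ẋ - X * V̇) * (X * x′) + X * (nat k * V * ẏ - Y * V̇) * (Y * y′) + X * (Y * V̇)
            ≡⟨ cong (λ z → Y * (nat k * V * ẋ - X * z) * (X * x′) + X * (nat k * V * ẏ - Y * z) * (Y * y′) + X * (Y * z)) DV ⟩
          Y * (nat k * V * ẋ - X * (nat k * (a * ẋ + b * ẏ))) * (X * x′) + X * (nat k * V * ẏ - Y * (nat k * (a * ẋ + b * ẏ))) * (Y * y′) + X * (Y * (nat k * (a * ẋ + b * ẏ)))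
            ≡⟨ solve 9 (λ X Y k V ẋ ẏ T x′ y′ → Y :* (k :* V :* ẋ :- X :* (k :* T)) :* (X :* x′) :+ X :* (k :* V :* ẏ :- Y :* (k :* T)) :* (Y :* y′) :+ X :* (Y :* (k :* T))
                 := X :* (Y :* (k :* (V :* (x′ :* ẋ :+ y′ :* ẏ) :- (X :* x′ :+ Y :* y′ :- con (ℤ.+ 1)) :* T)))) refl X Y (nat k) V ẋ ẏ (a * ẋ + b * ẏ) x′ y′ ⟩
          X * (Y * (nat k * (V * (x′ * ẋ + y′ * ẏ) - (X * x′ + Y * y′ - 1#) * (a * ẋ + b * ẏ))))
            ≡⟨ cong₂ (λ u v → X * (Y * (nat k * (V * (u * ẋ + v * ẏ) - (X * u + Y * v - 1#) * (a * ẋ + b * ẏ))))) (^-+ X k₁ h) (^-+ Y k₁ h) ⟩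
          X * (Y * (nat k * E₀)) ∎

        Sum∈ : InG Sum
        Sum∈ = subst InG (sym Sum≡) (InG-*ˡ X (InG-*ˡ Y (InG-*ˡ (nat k) E₀∈)))

        -- Three functions with sum zero have equal Wronskians in pairs. One of these carries the
        -- factor Y^n and another X^n Y^n; cancelling Y^n shows that the cofactor `q₁`, of degree
        -- O(k + e), is divisible by X^n.
        W₂₃ W₁₂ W₃₁ : A
        W₂₃ = A₂ * D P₃ - P₃ * D A₂
        W₁₂ = A₁ * D A₂ - A₂ * D A₁
        W₃₁ = P₃ * D A₁ - A₁ * D P₃

        D-Sum : D Sum ≡ D A₁ + D A₂ + D P₃
        D-Sum = trans (D-+ _ _) (cong (_+ D P₃) (D-+ _ _))

        W₂₃-W₁₂ : InG (W₂₃ - W₁₂)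
        W₂₃-W₁₂ = subst InG (trans (cong (λ z → A₂ * z - Sum * D A₂) D-Sum)
            (solve 6 (λ A B C a b c → B :* (a :+ b :+ c) :- (A :+ B :+ C) :* b := (B :* c :- C :* b) :- (A :* b :- B :* a)) refl A₁ A₂ P₃ (D A₁) (D A₂) (D P₃)))
          (InG-- (InG-*ˡ A₂ (InG-D Sum∈)) (InG-*ʳ (D A₂) Sum∈))

        W₂₃-W₃₁ : InG (W₂₃ - W₃₁)
        W₂₃-W₃₁ = subst InG (trans (cong (λ z → Sum * D P₃ - P₃ * z) D-Sum)
            (solve 6 (λ A B C a b c → (A :+ B :+ C) :* c :- C :* (a :+ b :+ c) := (B :* c :- C :* b) :- (C :* a :- A :* c)) refl A₁ A₂ P₃ (D A₁) (D A₂) (D P₃)))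
          (InG-- (InG-*ʳ (D P₃) Sum∈) (InG-*ˡ P₃ (InG-D Sum∈)))

        W₂₃≡ : W₂₃ ≡ β′ * q₁
        W₂₃≡ = begin
          P₂ * β′ * D P₃ - P₃ * D (P₂ * β′) ≡⟨ cong (λ z → P₂ * β′ * D P₃ - P₃ * z) (trans (D-* P₂ β′) (cong (λ z → D P₂ * β′ + P₂ * z) D-β)) ⟩
          P₂ * β′ * D P₃ - P₃ * (D P₂ * β′ + P₂ * (nat n * (y′ * ẏ)))
            ≡⟨ solve 9 (λ P Y y′ D₃ X V̇ D₂ n ẏ → P :* (Y :* y′) :* D₃ :- X :* (Y :* V̇) :* (D₂ :* (Y :* y′) :+ P :* (n :* (y′ :* ẏ)))
                 := Y :* y′ :* (P :* D₃ :- X :* (Y :* V̇) :* D₂ :- n :* (P :* (X :* V̇ :* ẏ)))) refl P₂ Y y′ (D P₃) X V̇ (D P₂) (nat n) ẏ ⟩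
          β′ * q₁ ∎

        W₁₂≡ : W₁₂ ≡ β′ * (α′ * q₃)
        W₁₂≡ = begin
          P₁ * α′ * D (P₂ * β′) - P₂ * β′ * D (P₁ * α′)
            ≡⟨ cong₂ (λ u v → P₁ * α′ * u - P₂ * β′ * v) (trans (D-* P₂ β′) (cong (λ z → D P₂ * β′ + P₂ * z) D-β)) (trans (D-* P₁ α′) (cong (λ z → D P₁ * α′ + P₁ * z) D-α)) ⟩
          P₁ * α′ * (D P₂ * β′ + P₂ * (nat n * (y′ * ẏ))) - P₂ * β′ * (D P₁ * α′ + P₁ * (nat n * (x′ * ẋ)))
            ≡⟨ solve 11 (λ X Y p₁ p₂ x′ y′ D₁ D₂ n ẋ ẏ →
                 Y :* p₁ :* (X :* x′) :* (D₂ :* (Y :* y′) :+ X :* p₂ :* (n :* (y′ :* ẏ))) :- X :* p₂ :* (Y :* y′) :* (D₁ :* (X :* x′) :+ Y :* p₁ :* (n :* (x′ :* ẋ)))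
                 := Y :* y′ :* (X :* x′ :* (Y :* p₁ :* D₂ :- X :* p₂ :* D₁ :+ n :* (p₁ :* p₂ :* (X :* ẏ :- Y :* ẋ))))) refl
                 X Y p₁ p₂ x′ y′ (D P₁) (D P₂) (nat n) ẋ ẏ ⟩
          β′ * (α′ * q₃) ∎

        q₁-contact : InX n q₁
        q₁-contact = 0 , q₃ , subst InG (solve 2 (λ u v → u :- v := con (ℤ.+ 1) :* u :- v) refl q₁ (α′ * q₃))
          (InG-prime (subst InG (trans (cong₂ _-_ W₂₃≡ W₁₂≡) (solve 3 (λ b u v → b :* u :- b :* v := b :* (u :- v)) refl β′ q₁ (α′ * q₃))) W₂₃-W₁₂) (Y^∉ n))

      π : ℕ
      π = suc (k ℕ.+ e)

      private
        Deg-V : Deg≤ k V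
        Deg-V = Deg-+ (Deg-+ (pw Deg-X) (pw Deg-Y)) (Deg-- (Deg-mono (s≤s z≤n) Deg-1))
          where
          pw : ∀ {f} → Deg≤ 1 f → Deg≤ k (f ^ k)
          pw {f} d = subst (λ z → Deg≤ z (f ^ k)) (ℕ.*-identityʳ k) (Deg≤-^ k d)

        Deg-V̇ : Deg≤ (k₁ ℕ.+ e) V̇
        Deg-V̇ = subst (Deg≤ (k₁ ℕ.+ e)) (sym DV) (Deg≤-* {0} (Deg-nat k) (Deg-+ (Deg≤-* (pw Deg-X) Deg-ẋ) (Deg≤-* (pw Deg-Y) Deg-ẏ)))
          where
          pw : ∀ {f} → Deg≤ 1 f → Deg≤ k₁ (f ^ k₁)
          pw {f} d = subst (λ z → Deg≤ z (f ^ k₁)) (ℕ.*-identityʳ k₁) (Deg≤-^ k₁ d)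

        Deg-p : ∀ {f g} → Deg≤ e f → Deg≤ 1 g → Deg≤ (k ℕ.+ e) (nat k * V * f - g * V̇)
        Deg-p df dg = Deg-+ (Deg≤-* (Deg≤-* {0} (Deg-nat k) Deg-V) df) (Deg-- (Deg≤-* dg Deg-V̇))

        Deg-P₁ : Deg≤ π P₁
        Deg-P₁ = Deg≤-* Deg-Y (Deg-p Deg-ẋ Deg-X)
        Deg-P₂ : Deg≤ π P₂
        Deg-P₂ = Deg≤-* Deg-X (Deg-p Deg-ẏ Deg-Y)

      Deg-P₃ : Deg≤ π (X * (Y * D (power-sum k)))
      Deg-P₃ = Deg≤-* Deg-X (Deg≤-* Deg-Y Deg-V̇)

      private
        Deg-q₁ : Deg≤ (π ℕ.+ (e ℕ.+ π)) q₁
        Deg-q₁ = Deg-+ (Deg-+ (Deg≤-* Deg-P₂ (Deg-D Deg-P₃)) (Deg-- (Deg≤-* Deg-P₃ (Deg-D Deg-P₂))))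
          (Deg-- (Deg≤-* {0} (Deg-nat n) (Deg≤-* Deg-P₂ (Deg-mono (s≤s
             (ℕ.≤-trans (ℕ.≤-reflexive (ℕ.+-comm (k ℕ.+ e) e)) (ℕ.+-monoʳ-≤ e (ℕ.n≤1+n (k ℕ.+ e))))) (Deg≤-* (Deg≤-* Deg-X Deg-V̇) Deg-ẏ)))))

        -- an ordinary differential equation A f′ = B f with f(Q) = 0 ≠ A(Q) forces f to vanish to infinite order
        ode : ∀ A B f → InG (A * D f - f * B) → ev Q A ≢ F.0# → ev Q f ≡ F.0# → ∀ m → Ord Q (suc m) f
        ode A B f eq A≢0 f0 zero    zero (s≤s _) = f0
        ode A B f eq A≢0 f0 (suc m) i    i<      = [ (λ q → prev i q) , (λ { refl → next }) ]′ (ℕ.m≤n⇒m<n∨m≡n (ℕ.≤-pred i<))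
          where
          prev : Ord Q (suc m) f
          prev = ode A B f eq A≢0 f0 m
          rhs : θ Q m (f * B) ≡ F.0#
          rhs = Ord-*ʳ B prev m (ℕ.n<1+n m)
          lhs : θ Q m (A * D f) ≡ F.0#
          lhs = begin
            θ Q m (A * D f) ≡⟨ cong (θ Q m) (solve 2 (λ u v → u := (u :- v) :+ v) refl (A * D f) (f * B)) ⟩
            θ Q m ((A * D f - f * B) + f * B) ≡⟨ trans (θ-+ Q m _ _) (cong₂ F._+_ (θ-InG m on eq) rhs) ⟩
            F.0# F.+ F.0# ≡⟨ F.+-identityˡ _ ⟩
            F.0# ∎
          next : θ Q (suc m) f ≡ F.0#
          next = F.*-cancel (F.*-≢0 (F.ch-≢0 0 0 (ℕ.<-trans (s≤s z≤n) F.1<p)) A≢0) (trans (F.*-assoc _ _ _)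
            (trans (sym (θ-exact {a = 0} {b = m} {A} {D f} (λ _ ()) (λ j j<m → prev (suc j) (s≤s j<m)))) lhs))

      -- When n w exceeds Bézout's number for `q₁`, the polynomial `q₁` and all three Wronskians
      -- vanish on the curve. That `P₃` then vanishes on the curve, or fails to vanish at Q, is
      -- refuted. So `P₃` is nonzero on the curve but zero at all its good nonsingular points.
      degenerate : ∀ {o w} → Width G o w → e ℕ.* (π ℕ.+ (e ℕ.+ π)) ℕ.< n ℕ.* w → e ℕ.* (π ℕ.+ n) ℕ.< p →
        InG (X * (Y * D (power-sum k))) ⊎ ev Q (X * (Y * D (power-sum k))) ≢ F.0# → ⊥
      degenerate {o} {w} W big en<p = λ { (inj₁ i) → P₃-case i ; (inj₂ nz) → generic nz }
        where
        q₁∈ : InG q₁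
        q₁∈ ¬q₁ = ℕ.<⇒≱ big (divisibility-bound X∉ W n (π ℕ.+ (e ℕ.+ π)) q₁ (λ x → x ¬q₁) Deg-q₁ q₁-contact)
        W₂₃∈ : InG W₂₃
        W₂₃∈ = subst InG (sym W₂₃≡) (InG-*ˡ β′ q₁∈)
        W₃₁∈ : InG W₃₁
        W₃₁∈ = subst InG (solve 2 (λ u v → u :- (u :- v) := v) refl W₂₃ W₃₁) (InG-- W₂₃∈ W₂₃-W₃₁)
        -- The inequality assumed for `q₁` also excludes a nonzero function of degree at most π that
        -- is divisible by X^n.
        small : ∀ ω → ¬ InG ω → Deg≤ π ω → InX n ω → ⊥
        small ω ¬ω dω c = ℕ.<⇒≱ (ℕ.≤-<-trans (ℕ.*-monoʳ-≤ e (ℕ.m≤m+n π (e ℕ.+ π))) big) (divisibility-bound X∉ W n π ω ¬ω dω c)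
        1-r∉ : ¬ InG (1# - r)
        1-r∉ i = ẏ∉ (InG-prime (InG-prime (subst InG (trans (cong -_ (trans (D-+ _ _) (trans (cong₂ _+_ D-1 (trans (D-neg r) (cong -_ D-r))) (+-identityˡ _)))) (-‿involutive _)) (InG-neg (InG-D i))) h∉) (Y^∉ h₁))

        -- The relations become ẋ (Y^k - 1) = X Y^(k-1) ẏ and ẋ (Y^n - 1) = X Y^(n-1) ẏ. Eliminating
        -- ẋ leaves 1 - Y^h = 0, whose derivative would force ẏ = 0.
        P₁-case : InG P₁ → ⊥
        P₁-case iP₁ = 1-r∉ (InG-prime (InG-prime (InG-prime (subst InG
              (solve 6 (λ X Y b r ẋ ẏ → (ẋ :* (Y :* b :- con (ℤ.+ 1)) :- X :* b :* ẏ) :* (Y :* (b :* r) :- con (ℤ.+ 1)) :- (ẋ :* (Y :* (b :* r) :- con (ℤ.+ 1)) :- X :* (b :* r) :* ẏ) :* (Y :* b :- con (ℤ.+ 1))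
                 := X :* (b :* (ẏ :* (con (ℤ.+ 1) :- r)))) refl X Y b r ẋ ẏ)
              (InG-- (InG-*ʳ (Y * (b * r) - 1#) first) (InG-*ʳ (Y * b - 1#) second))) X∉) (Y^∉ k₁)) ẏ∉)
          where
          ip₁ : InG p₁
          ip₁ = InG-prime iP₁ Y∉
          first : InG (ẋ * (Y * b - 1#) - X * b * ẏ)
          first = InG-prime (subst InG (trans (cong (λ z → nat k * V * ẋ - X * z) DV)
              (solve 7 (λ k X Y a b ẋ ẏ → k :* (X :* a :+ Y :* b :- con (ℤ.+ 1)) :* ẋ :- X :* (k :* (a :* ẋ :+ b :* ẏ)) := k :* (ẋ :* (Y :* b :- con (ℤ.+ 1)) :- X :* b :* ẏ)) refl (nat k) X Y a b ẋ ẏ)) ip₁) k∉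
          rest : InG (P₂ * β′ + P₃)
          rest = subst InG (solve 3 (λ u v w → (u :+ v :+ w) :- u := v :+ w) refl A₁ A₂ P₃) (InG-- Sum∈ (InG-*ʳ α′ iP₁))
          r₂∈ : InG (p₂ * y′ + V̇)
          r₂∈ = InG-prime (InG-prime (subst InG (solve 5 (λ X Y p y v → X :* p :* (Y :* y) :+ X :* (Y :* v) := X :* (Y :* (p :* y :+ v))) refl X Y p₂ y′ V̇) rest) X∉) Y∉
          second : InG (ẋ * (Y * (b * r) - 1#) - X * (b * r) * ẏ)
          second = subst (λ z → InG (ẋ * (Y * z - 1#) - X * z * ẏ)) (^-+ Y k₁ h) (InG-prime (InG-prime (subst InG
              (solve 8 (λ k V X Y z ẋ ẏ v → (k :* V :* ẋ :- X :* v) :* (Y :* z :- con (ℤ.+ 1)) :- X :* ((k :* V :* ẏ :- Y :* v) :* z :+ v)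
                 := k :* (V :* (ẋ :* (Y :* z :- con (ℤ.+ 1)) :- X :* z :* ẏ))) refl (nat k) V X Y y′ ẋ ẏ V̇)
              (InG-- (InG-*ʳ (Y * y′ - 1#) ip₁) (InG-*ˡ X r₂∈))) k∉) V∉)

        -- If V has derivative zero, E₀ gives X^h = Y^h. Differentiating this yields X ẏ = Y ẋ, and
        -- the derivative of V then becomes a multiple of X^k + Y^k, which is nonzero at Q.
        P₃-case : InG P₃ → ⊥
        P₃-case iP₃ = ev-≢0 (x^k+y^k good) (InG-prime (subst InG
            (solve 6 (λ X Y a b ẋ ẏ → X :* (a :* ẋ :+ b :* ẏ) :- b :* (X :* ẏ :- Y :* ẋ) := ẋ :* (X :* a :+ Y :* b)) refl X Y a b ẋ ẏ)
            (InG-- (InG-*ˡ X T∈) (InG-*ˡ b L∈))) ẋ∉)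
          where
          T∈ : InG (a * ẋ + b * ẏ)
          T∈ = InG-prime (subst InG DV (InG-prime (InG-prime iP₃ X∉) Y∉)) k∉
          S∈ : InG (a * s * ẋ + b * r * ẏ)
          S∈ = InG-prime (subst InG (solve 4 (λ V S U T → (V :* S :- U :* T) :+ U :* T := V :* S) refl V (a * s * ẋ + b * r * ẏ) U₀ (a * ẋ + b * ẏ))
                 (InG-+ E₀∈ (InG-*ˡ U₀ T∈))) V∉
          r-s∈ : InG (r - s)
          r-s∈ = InG-prime (InG-prime (subst InG (solve 6 (λ a b s r ẋ ẏ → (a :* s :* ẋ :+ b :* r :* ẏ) :- s :* (a :* ẋ :+ b :* ẏ) := b :* (ẏ :* (r :- s))) refl a b s r ẋ ẏ)
                   (InG-- S∈ (InG-*ˡ s T∈))) (Y^∉ k₁)) ẏ∉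
          L₀∈ : InG (Y ^ h₁ * ẏ - X ^ h₁ * ẋ)
          L₀∈ = InG-prime (subst InG (trans (trans (D-+ _ _) (cong₂ _+_ D-r (trans (D-neg s) (cong -_ D-s))))
                  (solve 3 (λ h u v → h :* u :- h :* v := h :* (u :- v)) refl (nat h) (Y ^ h₁ * ẏ) (X ^ h₁ * ẋ))) (InG-D r-s∈)) h∉
          L∈ : InG (X * ẏ - Y * ẋ)
          L∈ = InG-prime (subst InG (solve 6 (λ X Y y x ẋ ẏ → X :* Y :* (y :* ẏ :- x :* ẋ) :- Y :* ẋ :* (Y :* y :- X :* x) := Y :* y :* (X :* ẏ :- Y :* ẋ)) refl X Y (Y ^ h₁) (X ^ h₁) ẋ ẏ)
                 (InG-- (InG-*ˡ (X * Y) L₀∈) (InG-*ˡ (Y * ẋ) r-s∈))) (Y^∉ h)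
          ẋ∉ : ¬ InG ẋ
          ẋ∉ ix = ẏ∉ (InG-prime (subst InG (solve 2 (λ u v → (u :- v) :+ v := u) refl (X * ẏ) (Y * ẋ)) (InG-+ L∈ (InG-*ˡ Y ix))) X∉)

        -- The vanishing of `W₃₁` is a first-order linear equation satisfied by `A₁` and `P₃`, so
        -- the combination of the two that is zero at Q vanishes to order p, and on the whole curve
        -- as e (π + n) < p. Then either P₁ vanishes on the curve or P₃ is divisible by X^n.
        generic : ev Q P₃ ≢ F.0# → ⊥
        generic nz = decide (c₁ F.≟ F.0#)
          where
          c₁ c₃ : F.Carrier
          c₁ = ev Q A₁
          c₃ = ev Q P₃
          f : A
          f = κ c₃ * A₁ - κ c₁ * P₃
          D-f : D f ≡ κ c₃ * D A₁ - κ c₁ * D P₃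
          D-f = trans (D-+ _ _) (cong₂ _+_ (D-κ* c₃ A₁) (trans (D-neg _) (cong -_ (D-κ* c₁ P₃))))
          f-ode : InG (P₃ * D f - f * D P₃)
          f-ode = subst InG (sym (trans (cong (λ z → P₃ * z - f * D P₃) D-f)
              (solve 6 (λ P A c₁ c₃ a p → P :* (c₃ :* a :- c₁ :* p) :- (c₃ :* A :- c₁ :* P) :* p := c₃ :* (P :* a :- A :* p)) refl P₃ A₁ (κ c₁) (κ c₃) (D A₁) (D P₃))))
            (InG-*ˡ (κ c₃) W₃₁∈)
          ev-f : ev Q f ≡ F.0#
          ev-f = trans (EV.ev-+ Q _ _) (trans (cong₂ F._+_ (trans (EV.ev-* Q _ _) (cong (F._* c₁) (ev-κ Q c₃)))
              (trans (EV.ev-- Q _) (cong F.-_ (trans (EV.ev-* Q _ _) (cong (F._* c₃) (ev-κ Q c₁))))))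
              (F.x≡y⇒x-y≡0 (F.*-comm c₃ c₁)))
          Deg-α : Deg≤ n α′
          Deg-α = subst (λ z → Deg≤ z α′) (ℕ.*-identityʳ n) (Deg≤-^ n Deg-X)
          Deg-f : Deg≤ (π ℕ.+ n) f
          Deg-f = Deg-+ (Deg-κ* c₃ (Deg≤-* Deg-P₁ Deg-α)) (Deg-- (Deg-κ* c₁ (Deg-mono (s≤s (ℕ.m≤m+n π n)) Deg-P₃)))
          f∈ : InG f
          f∈ ¬f = ℕ.<⇒≱ en<p (subst (ℕ._≤ e ℕ.* (π ℕ.+ n)) (ℕ.*-identityˡ p)
            (vanishing-bound p ℕ.≤-refl (Q ∷ []) ([] ∷ []) (on ∷ []) (reach Q ns ∷ []) (π ℕ.+ n) f (λ x → x ¬f) Deg-f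
              ((λ i i<p → ode P₃ (D P₃) f f-ode nz ev-f p i (ℕ.<-trans i<p (ℕ.n<1+n p))) ∷ [])))
          decide : Dec (c₁ ≡ F.0#) → ⊥
          decide (yes z) = P₁-case (InG-prime (subst InG (*-comm P₁ α′) (InG-prime (subst InG
              (trans (cong (λ u → κ c₃ * A₁ - κ u * P₃) z) (trans (cong (λ u → κ c₃ * A₁ - u * P₃) κ-0) (solve 2 (λ u v → u :- con (ℤ.+ 0) :* v := u) refl (κ c₃ * A₁) P₃))) f∈)
              (ev-≢0 (λ q → nz (trans (sym (ev-κ Q c₃)) q))))) (X^∉ n))
          decide (no c₁≢0) = small (κ c₁ * P₃) (ev-≢0 (λ q → F.*-≢0 c₁≢0 nz (trans (sym (trans (EV.ev-* Q _ _) (cong (F._* c₃) (ev-κ Q c₁)))) q)))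
            (Deg-κ* c₁ Deg-P₃)
            (0 , κ c₃ * P₁ , subst InG (solve 5 (λ c₃ P₁ α c₁ P₃ → :- (c₃ :* (P₁ :* α) :- c₁ :* P₃) := con (ℤ.+ 1) :* (c₁ :* P₃) :- α :* (c₃ :* P₁)) refl (κ c₃) P₁ α′ (κ c₁) P₃) (InG-neg f∈))

    -- The right side is Bézout's number for `P₃`, which by `degenerate` is not zero on the curve
    -- and vanishes at every point of the list; order 1 is enough.
    few-points : ∀ Qs → Unique Qs → All OnG Qs → All Nonsingular Qs → All (Good k) Qs →
      ∀ {o w} → Width G o w → e ℕ.* (suc (k ℕ.+ e) ℕ.+ (e ℕ.+ suc (k ℕ.+ e))) ℕ.< n ℕ.* w → e ℕ.* (suc (k ℕ.+ e) ℕ.+ n) ℕ.< p →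
      length Qs ℕ.≤ e ℕ.* suc (k ℕ.+ e)
    few-points []       uQ on ns gd W big en<p = z≤n
    few-points (Q ∷ Qs) uQ (o₁ ∷ on) (n₁ ∷ ns) (g₁ ∷ gd) W big en<p = decidable-stable (_ ℕ.≤? _)
      (¬¬-excluded-middle >>= λ
        { (yes i) → ⊥-elim (At.degenerate Q o₁ n₁ g₁ W big en<p (inj₁ i))
        ; (no ¬i) → return (subst (ℕ._≤ e ℕ.* suc (k ℕ.+ e)) (ℕ.*-identityʳ _)
            (vanishing-bound 1 (ℕ.<⇒≤ F.1<p) (Q ∷ Qs) uQ (o₁ ∷ on) (All.tabulate (λ {Q} _ → reach-1 Q)) (suc (k ℕ.+ e)) _ ¬i (At.Deg-P₃ Q o₁ n₁ g₁)
              (All.tabulate (λ {R} R∈ → λ { zero (s≤s _) → decidable-stable (ev R _ F.≟ F.0#) (λ nz →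
                At.degenerate R (All.lookup (o₁ ∷ on) R∈) (All.lookup (n₁ ∷ ns) R∈) (All.lookup (g₁ ∷ gd) R∈) W big en<p (inj₂ nz)) })))) })

-- Counting points by fibres and by irreducible factors.

length-split : ∀ {X : Set} {Q : X → Set} (Q? : Decidable Q) xs → length xs ≡ length (filter Q? xs) ℕ.+ length (filter (λ x → ¬? (Q? x)) xs)
length-split Q? [] = refl
length-split Q? (x ∷ xs) with Q? x
... | yes _ = cong suc (length-split Q? xs)
... | no  _ = trans (cong suc (length-split Q? xs)) (sym (ℕ.+-suc _ _))

length-filter² : ∀ {X : Set} {Q R : X → Set} (Q? : Decidable Q) (R? : Decidable R) xs → length (filter Q? (filter R? xs)) ℕ.≤ length (filter Q? xs)
length-filter² Q? R? [] = z≤n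
length-filter² Q? R? (x ∷ xs) with R? x
length-filter² Q? R? (x ∷ xs) | yes _ with Q? x
... | yes _ = s≤s (length-filter² Q? R? xs)
... | no  _ = length-filter² Q? R? xs
length-filter² Q? R? (x ∷ xs) | no _ with Q? x
... | yes _ = ℕ.≤-trans (length-filter² Q? R? xs) (ℕ.n≤1+n _)
... | no  _ = length-filter² Q? R? xs

length-filter-⊆ : ∀ {X : Set} {Q R : X → Set} (Q? : Decidable Q) (R? : Decidable R) → (∀ {x} → Q x → R x) →
  ∀ xs → length (filter Q? xs) ℕ.≤ length (filter R? xs)
length-filter-⊆ Q? R? Q⊆R [] = z≤n
length-filter-⊆ Q? R? Q⊆R (x ∷ xs) with Q? x | R? x
... | yes _ | yes _ = s≤s (length-filter-⊆ Q? R? Q⊆R xs)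
... | yes q | no ¬r = ⊥-elim (¬r (Q⊆R q))
... | no _  | yes _ = ℕ.≤-trans (length-filter-⊆ Q? R? Q⊆R xs) (ℕ.n≤1+n _)
... | no _  | no _  = length-filter-⊆ Q? R? Q⊆R xs

fibres : ∀ {X : Set} (f : X → ℕ) N c xs → All (λ x → f x ℕ.< N) xs → (∀ i → length (filter (λ x → f x ℕ.≟ i) xs) ℕ.≤ c) →
  length xs ℕ.≤ N ℕ.* c
fibres f zero    c []       []       _ = z≤n
fibres f (suc N) c xs       bd       h = subst (ℕ._≤ c ℕ.+ N ℕ.* c) (sym (length-split (λ x → f x ℕ.≟ N) xs))
  (ℕ.+-mono-≤ (h N) (fibres f N c (filter (λ x → ¬? (f x ℕ.≟ N)) xs)
    (All.zipWith (λ (ne , lt) → ℕ.≤∧≢⇒< (ℕ.≤-pred lt) ne) (all-filter (λ x → ¬? (f x ℕ.≟ N)) xs , filter⁺ (λ x → ¬? (f x ℕ.≟ N)) bd))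
    (λ i → ℕ.≤-trans (length-filter² (λ x → f x ℕ.≟ i) (λ x → ¬? (f x ℕ.≟ N)) xs) (h i))))

module Counting (K : PrimeField) (P : Plane K) where
  private module F = PrimeField K
  open F using (p)
  open PlaneTheory K P
  open LeadingMonomials K P
  open Widths K P
  open Solver

  LM-degree : ∀ {f α β α′ β′} → LM f α β → LM f α′ β′ → α ℕ.+ β ≡ α′ ℕ.+ β′
  LM-degree a b = ℕ.≤-antisym (le a b) (le b a)
    where
    le : ∀ {f α β α′ β′} → LM f α β → LM f α′ β′ → α ℕ.+ β ℕ.≤ α′ ℕ.+ β′
    le a b = ℕ.≮⇒≥ (λ q → lm-≢0 a (cf≡0 (lm-deg b) _ _ q))

  LM-≢0 : ∀ {f α β} → LM f α β → f ≢ 0#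
  LM-≢0 l e = lm-≢0 l (trans (cong (λ z → cf z _ _) e) (cf-0 _ _))

  Width≤degree : ∀ {f α β o w} → LM f α β → Width f o w → w ℕ.≤ α ℕ.+ β
  Width≤degree {o = o} {w} l W = ℕ.≤-trans (ℕ.m≤n+m w o) (ℕ.≮⇒≥ (λ q → high W (cf≡0 (lm-deg l) 0 (o ℕ.+ w) q)))

  constant-unit : ∀ f → Deg 1 f → f ≢ 0# → Unit f
  constant-unit f d f≢0 = κ (proj₁ inv) , trans (cong (_* κ (proj₁ inv)) f≡) (trans (sym (κ-* _ _)) (trans (cong κ (proj₂ inv)) κ-1))
    where
    f≡ : f ≡ κ (cf f 0 0)
    f≡ = cf-ext go
      where
      go : ∀ a b → cf f a b ≡ cf (κ (cf f 0 0)) a b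
      go zero    zero    = sym (cf-κ-0 _)
      go (suc a) b       = trans (cf≡0 d (suc a) b (s≤s z≤n)) (sym (cf-κ _ (suc a) b (s≤s z≤n)))
      go zero    (suc b) = trans (cf≡0 d zero (suc b) (s≤s z≤n)) (sym (cf-κ _ zero (suc b) (s≤s z≤n)))
    inv = F.inverse (cf f 0 0) (λ z → f≢0 (trans f≡ (trans (cong κ z) κ-0)))

  nonunit-degree : ∀ {f α β} → LM f α β → ¬ Unit f → 0 ℕ.< α ℕ.+ β
  nonunit-degree {f} {α} {β} l nu = ℕ.≰⇒> (λ q → nu (constant-unit f (Deg-mono (s≤s q) (lm-deg l)) (LM-≢0 l)))

  factor-≢0ˡ : ∀ {b c} → b * c ≢ 0# → b ≢ 0#
  factor-≢0ˡ {c = c} n z = n (trans (cong (_* c) z) (zeroˡ c))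

  factor-≢0ʳ : ∀ {b c} → b * c ≢ 0# → c ≢ 0#
  factor-≢0ʳ {b} n z = n (trans (cong (b *_) z) (zeroʳ b))

  evl : ∀ Q x → ev Q (X - κ x) ≡ proj₁ Q F.- x
  evl Q x = trans (Hom.⟦+⟧ (evHom Q) _ _) (cong₂ F._+_ (ev-X Q) (trans (Hom.⟦-⟧ (evHom Q) _) (cong F.-_ (ev-κ Q x))))

  module _ (x₀ : F.Carrier) where
    private
      ℓ : A
      ℓ = X - κ x₀

      cf-X : cf X 1 0 ≡ F.1#
      cf-X = trans (cong (λ z → cf z 1 0) (sym (*-identityʳ X))) (trans (cf-X*-suc 1# 0 0) (trans (cong (λ z → cf z 0 0) (sym κ-1)) (cf-κ-0 F.1#)))

      cf-X-Y : ∀ b → cf X 0 b ≡ F.0#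
      cf-X-Y b = trans (cong (λ z → cf z 0 b) (sym (*-identityʳ X))) (cf-X*-0 1# b)

    LM-line : LM ℓ 1 0
    LM-line = lm (λ z → F.1≢0 (trans (sym (trans (cf-+ X _ 1 0) (trans (cong₂ F._+_ cf-X (trans (cf-- _ 1 0) (trans (cong F.-_ (cf-κ x₀ 1 0 (s≤s z≤n))) F.-0#≈0#))) (F.+-identityʳ _)))) z))
      (Deg-+ Deg-X (Deg-- (Deg-mono (s≤s z≤n) (Deg-κ x₀)))) top
      where
      top : ∀ a b → a ℕ.+ b ≡ 1 → 0 ℕ.< b → cf ℓ a b ≡ F.0#
      top zero    (suc b) q _ = trans (cf-+ X _ 0 (suc b)) (trans (cong₂ F._+_ (cf-X-Y (suc b)) (trans (cf-- _ 0 (suc b)) (trans (cong F.-_ (cf-κ x₀ 0 (suc b) (s≤s z≤n))) F.-0#≈0#))) (F.+-identityʳ _))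
      top (suc zero) zero q ()
      top (suc zero) (suc b) ()
      top (suc (suc a)) b ()

    -- Makes a vertical line a curve of degree 1, so that zeros of a polynomial in one fibre are
    -- counted by `vanishing-bound` too.
    line-irreducible : Irreducible ℓ
    line-irreducible = LM-≢0 LM-line , not-unit , λ b c e ub uc → two b c e ub uc
      where
      not-unit : ¬ Unit ℓ
      not-unit (v , e) = F.1≢0 (trans (sym (Hom.⟦1⟧ (evHom Q))) (trans (cong (ev Q) (sym e)) (trans (Hom.⟦*⟧ (evHom Q) ℓ v)
          (trans (cong (F._* ev Q v) (trans (evl Q x₀) (F.-‿inverseʳ x₀))) (F.zeroˡ _)))))
        where
        Q : Point
        Q = x₀ , F.0#
      two : ∀ b c → ℓ ≡ b * c → ¬ Unit b → ¬ Unit c → ⊥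
      two b c e ub uc = ℕ.<-irrefl refl (ℕ.≤-trans (ℕ.+-mono-≤ (nonunit-degree (proj₂ (proj₂ lb)) ub) (nonunit-degree (proj₂ (proj₂ lc)) uc)) (ℕ.≤-reflexive
          (trans (ℕS.solve 4 (λ a b c d → (a ℕS.:+ b) ℕS.:+ (c ℕS.:+ d) ℕS.:= (a ℕS.:+ c) ℕS.:+ (b ℕS.:+ d)) refl (proj₁ lb) (proj₁ (proj₂ lb)) (proj₁ lc) (proj₁ (proj₂ lc)))
            (LM-degree (LM-* (proj₂ (proj₂ lb)) (proj₂ (proj₂ lc))) (subst (λ z → LM z 1 0) e LM-line)))))
        where
        bc≢0 : b * c ≢ 0#
        bc≢0 z = LM-≢0 LM-line (trans e z)
        lb = LM-exists b (factor-≢0ˡ bc≢0)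
        lc = LM-exists c (factor-≢0ʳ bc≢0)

  fibre : F.Carrier → List Point → List Point
  fibre x Qs = filter (λ Q → proj₁ Q F.≟ x) Qs

  by-fibres : ∀ c Qs → (∀ x → length (fibre x Qs) ℕ.≤ c) → length Qs ℕ.≤ p ℕ.* c
  by-fibres c Qs h = fibres (λ Q → F.index (proj₁ Q)) p c Qs (All.tabulate (λ {Q} _ → F.index<p (proj₁ Q))) bound
    where
    bound : ∀ i → length (filter (λ Q → F.index (proj₁ Q) ℕ.≟ i) Qs) ℕ.≤ c
    bound i = ℕ.≤-trans (length-filter-⊆ (λ Q → F.index (proj₁ Q) ℕ.≟ i) (λ Q → proj₁ Q F.≟ F.nat i) (λ {Q} q → trans (sym (F.nat-index (proj₁ Q))) (cong F.nat q)) Qs) (h (F.nat i))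

  vertical : ∀ (x : F.Carrier) (Qs : List Point) → Unique Qs → All (λ Q → proj₁ Q ≡ x) Qs → length Qs ℕ.≤ p
  vertical x Qs uQ on = subst (length Qs ℕ.≤_) (ℕ.*-identityʳ p)
    (fibres (λ Q → F.index (proj₂ Q)) p 1 Qs (All.tabulate (λ {Q} _ → F.index<p (proj₂ Q)))
      (λ i → at-most-one i (filter (λ Q → F.index (proj₂ Q) ℕ.≟ i) Qs) (Unique.filter⁺ (λ Q → F.index (proj₂ Q) ℕ.≟ i) uQ)
        (filter⁺ (λ Q → F.index (proj₂ Q) ℕ.≟ i) on) (all-filter (λ Q → F.index (proj₂ Q) ℕ.≟ i) Qs)))
    where
    at-most-one : ∀ i Rs → Unique Rs → All (λ Q → proj₁ Q ≡ x) Rs → All (λ Q → F.index (proj₂ Q) ≡ i) Rs → length Rs ℕ.≤ 1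
    at-most-one i []           _             _             _             = z≤n
    at-most-one i (R ∷ [])     _             _             _             = s≤s z≤n
    at-most-one i (R ∷ S ∷ Rs) ((ne ∷ _) ∷ _) (a ∷ b ∷ _) (c ∷ d ∷ _) =
      ⊥-elim (ne (cong₂ _,_ (trans a (sym b)) (F.index-inj (trans c (sym d)))))

  zeros-bound : ∀ δ Ψ → Deg≤ δ Ψ → (∀ x → ∃ λ y → ev (x , y) Ψ ≢ F.0#) → ∀ Qs → Unique Qs → All (λ Q → ev Q Ψ ≡ F.0#) Qs →
    length Qs ℕ.≤ p ℕ.* δ
  zeros-bound δ Ψ d nz Qs uQ zs = by-fibres δ Qs bound
    where
    bound : ∀ x → length (fibre x Qs) ℕ.≤ δ
    bound x = subst₂ ℕ._≤_ (ℕ.*-identityʳ _) (ℕ.*-identityˡ δ)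
      (C.vanishing-bound 1 (ℕ.<⇒≤ F.1<p) (fibre x Qs) (Unique.filter⁺ (λ Q → proj₁ Q F.≟ x) uQ)
        (All.map (λ {Q} e → trans (evl Q x) (F.x≡y⇒x-y≡0 e)) (all-filter (λ Q → proj₁ Q F.≟ x) Qs))
        (All.tabulate (λ {Q} _ → C.reach-1 Q)) δ Ψ
        (λ i → proj₂ (nz x) (C.θ-InG 0 (trans (evl (x , proj₁ (nz x)) x) (F.-‿inverseʳ x)) i)) d
        (All.map (λ { z zero (s≤s _) → z }) (filter⁺ (λ Q → proj₁ Q F.≟ x) zs)))
      where module C = Points K P (X - κ x) (line-irreducible x) 1 0 (LM-line x)

  module OnCurve (G : A) (irr : Irreducible G) (α β : ℕ) (lmG : LM G α β) where
    private module C = Points K P G irr α β lmG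
    open C using (e; InG; OnG; Nonsingular)

    0<e : 0 ℕ.< e
    0<e = nonunit-degree lmG (proj₁ (proj₂ irr))

    -- If some X - x vanishes on the curve, all points lie in one fibre. Otherwise each of the p
    -- fibres is cut out by a line that is nonzero on the curve and has at most e points.
    trivial-bound : ∀ Qs → Unique Qs → All OnG Qs → length Qs ℕ.≤ e ℕ.* p
    trivial-bound Qs uQ on = decidable-stable (_ ℕ.≤? _) (¬¬-excluded-middle {A = ∃ λ x → InG (X - κ x)} >>= λ
      { (yes (x , i)) → return (ℕ.≤-trans (vertical x Qs uQ (All.map (λ {Q} o → F.x-y≡0⇒x≡y (trans (sym (evl Q x)) (C.θ-InG 0 o i))) on))
          (ℕ.≤-trans (ℕ.≤-reflexive (sym (ℕ.*-identityˡ p))) (ℕ.*-monoˡ-≤ p 0<e)))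
      ; (no none) → return (subst (length Qs ℕ.≤_) (ℕ.*-comm p e) (by-fibres e Qs (λ x → subst₂ ℕ._≤_ (ℕ.*-identityʳ _) (ℕ.*-identityʳ e)
          (C.vanishing-bound 1 (ℕ.<⇒≤ F.1<p) (fibre x Qs) (Unique.filter⁺ (λ Q → proj₁ Q F.≟ x) uQ) (filter⁺ (λ Q → proj₁ Q F.≟ x) on)
            (All.tabulate (λ {Q} _ → C.reach-1 Q)) 1 (X - κ x) (λ i → none (x , i)) (Deg-+ Deg-X (Deg-- (Deg-mono (s≤s z≤n) (Deg-κ x))))
            (All.map (λ {Q} q → λ { zero (s≤s _) → trans (evl Q x) (F.x≡y⇒x-y≡0 q) }) (all-filter (λ Q → proj₁ Q F.≟ x) Qs)))))) })

    Singular : Point → Set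
    Singular Q = ev Q (∂y G) ≡ F.0# × ev Q (∂x G) ≡ F.0#

    singular? : ∀ Q → Dec (Singular Q)
    singular? Q = (ev Q (∂y G) F.≟ F.0#) ×-dec (ev Q (∂x G) F.≟ F.0#)

    nonsingular : ∀ Q → ¬ Singular Q → Nonsingular Q
    nonsingular Q ns = go (ev Q (∂y G) F.≟ F.0#)
      where
      D-const : ∀ f c → C.D (f - κ c) ≡ C.D f
      D-const f c = trans (C.D-+ f _) (trans (cong (C.D f +_) (trans (C.D-neg _) (trans (cong -_ (C.D-κ c)) -0#≈0#))) (+-identityʳ _))
      go : Dec (ev Q (∂y G) ≡ F.0#) → Nonsingular Q
      go (no nz)  = X - κ (proj₁ Q) , trans (evl Q _) (F.-‿inverseʳ _) , λ z → nz (trans (cong (ev Q) (sym (trans (D-const X _) C.D-X))) z)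
      go (yes z₁) = Y - κ (proj₂ Q) , trans (trans (Hom.⟦+⟧ (evHom Q) _ _) (cong₂ F._+_ (ev-Y Q) (trans (Hom.⟦-⟧ (evHom Q) _) (cong F.-_ (ev-κ Q _))))) (F.-‿inverseʳ _)
        , λ z → ns (z₁ , F.-x≡0⇒x≡0 (trans (sym (Hom.⟦-⟧ (evHom Q) (∂x G))) (trans (cong (ev Q) (sym (trans (D-const Y _) C.D-Y))) z)))

    -- If both partial derivatives vanished on the curve they would be zero, their degrees being
    -- below e; since e < p this makes `G` constant.
    singular-bound : e ℕ.< p → ∀ Qs → Unique Qs → All OnG Qs → All Singular Qs → length Qs ℕ.≤ e ℕ.* e
    singular-bound e<p Qs uQ on sg = decidable-stable (_ ℕ.≤? _) (¬¬-excluded-middle {A = InG (∂y G)} >>= λ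
      { (no ¬y) → return (use (∂y G) ¬y (Deg-mono (ℕ.n≤1+n e) (Deg-∂Y (lm-deg lmG))) (All.map proj₁ sg))
      ; (yes iy) → ¬¬-excluded-middle {A = InG (∂x G)} >>= λ
        { (no ¬x) → return (use (∂x G) ¬x (Deg-mono (ℕ.n≤1+n e) (Deg-∂X (lm-deg lmG))) (All.map proj₂ sg))
        ; (yes ix) → ⊥-elim (constant (C.InG-Deg _ ix (Deg-∂X (lm-deg lmG))) (C.InG-Deg _ iy (Deg-∂Y (lm-deg lmG)))) } })
      where
      use : ∀ Ψ → ¬ InG Ψ → Deg≤ e Ψ → All (λ Q → ev Q Ψ ≡ F.0#) Qs → length Qs ℕ.≤ e ℕ.* e
      use Ψ ¬Ψ d zs = subst (ℕ._≤ e ℕ.* e) (ℕ.*-identityʳ _)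
        (C.vanishing-bound 1 (ℕ.<⇒≤ F.1<p) Qs uQ on (All.tabulate (λ {Q} _ → C.reach-1 Q)) e Ψ ¬Ψ d (All.map (λ { z zero (s≤s _) → z }) zs))
      constant : ∂x G ≡ 0# → ∂y G ≡ 0# → ⊥
      constant dx dy = proj₁ (proj₂ irr) (constant-unit G (deg zero-cf) (LM-≢0 lmG))
        where
        zero-cf : ∀ a b → 1 ℕ.≤ a ℕ.+ b → cf G a b ≡ F.0#
        zero-cf a b q = go (suc e ℕ.≤? a ℕ.+ b) a b refl refl q
          where
          go : Dec (suc e ℕ.≤ a ℕ.+ b) → ∀ a′ b′ → a′ ≡ a → b′ ≡ b → 1 ℕ.≤ a′ ℕ.+ b′ → cf G a′ b′ ≡ F.0#
          go (yes le) a′ b′ refl refl _ = cf≡0 (lm-deg lmG) a b le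
          go (no nle) (suc a′) b′ refl refl _ = F.*-cancel (F.nat≢0 (suc a′) (s≤s z≤n) (ℕ.≤-<-trans (ℕ.≤-trans (ℕ.m≤m+n (suc a′) b′) (ℕ.≤-pred (ℕ.≰⇒> nle))) e<p))
            (trans (sym (cf-∂X G a′ b′)) (trans (cong (λ z → cf z a′ b′) dx) (cf-0 a′ b′)))
          go (no nle) zero (suc b′) refl refl _ = F.*-cancel (F.nat≢0 (suc b′) (s≤s z≤n) (ℕ.≤-<-trans (ℕ.≤-pred (ℕ.≰⇒> nle)) e<p))
            (trans (sym (cf-∂Y G 0 b′)) (trans (cong (λ z → cf z 0 b′) dy) (cf-0 0 b′)))

  -- A bound that is linear in the degree and in the width passes from the irreducible factors of f to f.
  module Factorise (Q₀ : Point → Set) (c₁ c₂ c₃ : ℕ) (c₂≤c₃ : c₂ ℕ.≤ c₃) where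
    -- The term `w * c₂` is a credit for width. A factor that is narrow for its degree claims little
    -- of it and may have more points; degree and width are additive, so the account balances over
    -- all factors.
    Bound : A → ℕ → ℕ → Set
    Bound f d w = ∀ Qs → Unique Qs → All Q₀ Qs → All (λ Q → ev Q f ≡ F.0#) Qs → length Qs ℕ.* c₁ ℕ.+ w ℕ.* c₂ ℕ.≤ d ℕ.* c₃

    module _ (f₀ : A) (irreducible-bound : ∀ G → Irreducible G → G ∣ f₀ → ∀ α β → LM G α β → ∀ o w → Width G o w → Bound G (α ℕ.+ β) w) where
      private
        factors : ∀ n f → f ∣ f₀ → ∀ α β → LM f α β → α ℕ.+ β ℕ.≤ n → ∀ o w → Width f o w → ¬ ¬ Bound f (α ℕ.+ β) w
        split : ∀ n b c → b * c ∣ f₀ → ∀ α β → LM (b * c) α β → α ℕ.+ β ℕ.≤ suc n → ∀ o w → Width (b * c) o w → ¬ Unit b → ¬ Unit c → ¬ ¬ Bound (b * c) (α ℕ.+ β) w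

        factors zero f f∣ α β l le o w W = return λ { [] _ _ _ → ℕ.*-mono-≤ (Width≤degree l W) c₂≤c₃
                                                  ; (Q ∷ Qs) _ _ (z ∷ _) → ⊥-elim (no-zero Q z) }
          where
          u : Unit f
          u = constant-unit f (Deg-mono (s≤s le) (lm-deg l)) (LM-≢0 l)
          no-zero : ∀ Q → ev Q f ≡ F.0# → ⊥
          no-zero Q z = F.1≢0 (trans (sym (Hom.⟦1⟧ (evHom Q))) (trans (cong (ev Q) (sym (proj₂ u))) (trans (Hom.⟦*⟧ (evHom Q) _ _) (trans (cong (F._* ev Q (proj₁ u)) z) (F.zeroˡ _)))))
        factors (suc n) f f∣ α β l le o w W = ¬¬-excluded-middle {A = Unit f} >>= λ
          { (yes u) → return λ { [] _ _ _ → ℕ.*-mono-≤ (Width≤degree l W) c₂≤c₃ ; (Q ∷ Qs) _ _ (z ∷ _) → ⊥-elim (no-zero u Q z) }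
          ; (no nu) → ¬¬-excluded-middle {A = ∃ λ b → ∃ λ c → f ≡ b * c × ¬ Unit b × ¬ Unit c} >>= λ
            { (yes (b , c , refl , nb , nc)) → split n b c f∣ α β l le o w W nb nc
            ; (no none) → return (irreducible-bound f (LM-≢0 l , nu , λ b c e nb nc → none (b , c , e , nb , nc)) f∣ α β l o w W) } }
          where
          no-zero : Unit f → ∀ Q → ev Q f ≡ F.0# → ⊥
          no-zero u Q z = F.1≢0 (trans (sym (Hom.⟦1⟧ (evHom Q))) (trans (cong (ev Q) (sym (proj₂ u))) (trans (Hom.⟦*⟧ (evHom Q) _ _) (trans (cong (F._* ev Q (proj₁ u)) z) (F.zeroˡ _)))))

        split n b c bc∣ α β l le o w W nb nc = widths (Width-exists b) (Width-exists c)
          where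
          bc≢0 : b * c ≢ 0#
          bc≢0 = LM-≢0 l
          lb = LM-exists b (factor-≢0ˡ bc≢0)
          lc = LM-exists c (factor-≢0ʳ bc≢0)
          db dc : ℕ
          db = proj₁ lb ℕ.+ proj₁ (proj₂ lb)
          dc = proj₁ lc ℕ.+ proj₁ (proj₂ lc)
          degrees : db ℕ.+ dc ≡ α ℕ.+ β
          degrees = trans (ℕS.solve 4 (λ a b c d → (a ℕS.:+ b) ℕS.:+ (c ℕS.:+ d) ℕS.:= (a ℕS.:+ c) ℕS.:+ (b ℕS.:+ d)) refl (proj₁ lb) (proj₁ (proj₂ lb)) (proj₁ lc) (proj₁ (proj₂ lc)))
            (LM-degree (LM-* (proj₂ (proj₂ lb)) (proj₂ (proj₂ lc))) l)
          0<db : 0 ℕ.< db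
          0<db = nonunit-degree (proj₂ (proj₂ lb)) nb
          0<dc : 0 ℕ.< dc
          0<dc = nonunit-degree (proj₂ (proj₂ lc)) nc
          db≤n : db ℕ.≤ n
          db≤n = ℕ.≤-pred (ℕ.≤-trans (ℕ.m<m+n db 0<dc) (ℕ.≤-trans (ℕ.≤-reflexive degrees) le))
          dc≤n : dc ℕ.≤ n
          dc≤n = ℕ.≤-pred (ℕ.≤-trans (ℕ.m<n+m dc 0<db) (ℕ.≤-trans (ℕ.≤-reflexive degrees) le))
          zeroˡ′ : (∀ i → cf b 0 i ≡ F.0#) → ⊥
          zeroˡ′ z = low W (trans (cf-*-line b c o) (F.ad-0 o (λ i j _ → trans (cong (F._* cf c 0 j) (z i)) (F.zeroˡ _))))
          zeroʳ′ : (∀ i → cf c 0 i ≡ F.0#) → ⊥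
          zeroʳ′ z = low W (trans (cf-*-line b c o) (F.ad-0 o (λ i j _ → trans (cong (cf b 0 i F.*_) (z j)) (F.zeroʳ _))))
          widths : (∀ i → cf b 0 i ≡ F.0#) ⊎ (∃ λ o → ∃ λ w → Width b o w) → (∀ i → cf c 0 i ≡ F.0#) ⊎ (∃ λ o → ∃ λ w → Width c o w) → ¬ ¬ Bound (b * c) (α ℕ.+ β) w
          widths (inj₁ z) _ = ⊥-elim (zeroˡ′ z)
          widths (inj₂ _) (inj₁ z) = ⊥-elim (zeroʳ′ z)
          widths (inj₂ (ob , wb , Wb)) (inj₂ (oc , wc , Wc)) =
            factors n b (∣-trans (c , refl) bc∣) _ _ (proj₂ (proj₂ lb)) db≤n ob wb Wb >>= λ Bb →
            factors n c (∣-trans (b , *-comm b c) bc∣) _ _ (proj₂ (proj₂ lc)) dc≤n oc wc Wc >>= λ Bc → return (add Bb Bc)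
            where
            add : Bound b db wb → Bound c dc wc → Bound (b * c) (α ℕ.+ β) w
            add Bb Bc Qs uQ q₀ zs = begin
              length Qs ℕ.* c₁ ℕ.+ w ℕ.* c₂
                ≤⟨ ℕ.+-mono-≤ (ℕ.≤-reflexive (cong (ℕ._* c₁) (length-split on-b? Qs))) (ℕ.*-monoˡ-≤ c₂ (Width-unique (Width-* Wb Wc) W)) ⟩
              (length Rs ℕ.+ length Ss) ℕ.* c₁ ℕ.+ (wb ℕ.+ wc) ℕ.* c₂
                ≡⟨ ℕS.solve 6 (λ r s a b c d → (r ℕS.:+ s) ℕS.:* a ℕS.:+ (b ℕS.:+ c) ℕS.:* d ℕS.:= (r ℕS.:* a ℕS.:+ b ℕS.:* d) ℕS.:+ (s ℕS.:* a ℕS.:+ c ℕS.:* d)) refl (length Rs) (length Ss) c₁ wb wc c₂ ⟩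
              (length Rs ℕ.* c₁ ℕ.+ wb ℕ.* c₂) ℕ.+ (length Ss ℕ.* c₁ ℕ.+ wc ℕ.* c₂)
                ≤⟨ ℕ.+-mono-≤ (Bb Rs (Unique.filter⁺ on-b? uQ) (filter⁺ on-b? q₀) (all-filter on-b? Qs))
                     (Bc Ss (Unique.filter⁺ (λ Q → ¬? (on-b? Q)) uQ) (filter⁺ (λ Q → ¬? (on-b? Q)) q₀)
                       (All.zipWith (λ {Q} (nb , z) → F.*-cancel nb (trans (sym (Hom.⟦*⟧ (evHom Q) b c)) z)) (all-filter (λ Q → ¬? (on-b? Q)) Qs , filter⁺ (λ Q → ¬? (on-b? Q)) zs))) ⟩
              db ℕ.* c₃ ℕ.+ dc ℕ.* c₃ ≡⟨ sym (ℕ.*-distribʳ-+ c₃ db dc) ⟩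
              (db ℕ.+ dc) ℕ.* c₃ ≡⟨ cong (ℕ._* c₃) degrees ⟩
              (α ℕ.+ β) ℕ.* c₃ ∎
              where
              open ℕ.≤-Reasoning
              on-b? : ∀ Q → Dec (ev Q b ≡ F.0#)
              on-b? Q = ev Q b F.≟ F.0#
              Rs = filter on-b? Qs
              Ss = filter (λ Q → ¬? (on-b? Q)) Qs

      factorise : ∀ α β → LM f₀ α β → ∀ o w → Width f₀ o w → ¬ ¬ Bound f₀ (α ℕ.+ β) w
      factorise α β l o w W = factors (α ℕ.+ β) f₀ ∣-refl α β l ℕ.≤-refl o w W

-- Numerical inequalities.

module Arithmetic where
  open import Data.Nat
  open import Data.Nat.Properties
  open ℕS using (solve; _:=_; _:+_; _:*_; con)
  open ≤-Reasoning

  2tri : ∀ m → 2 * tri m ≡ m * suc m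
  2tri zero    = refl
  2tri (suc m) = begin-equality
    2 * (suc m + tri m)      ≡⟨ *-distribˡ-+ 2 (suc m) (tri m) ⟩
    2 * suc m + 2 * tri m    ≡⟨ cong (2 * suc m +_) (2tri m) ⟩
    2 * suc m + m * suc m    ≡⟨ solve 1 (λ m → con 2 :* (con 1 :+ m) :+ m :* (con 1 :+ m) := (con 1 :+ m) :* (con 1 :+ (con 1 :+ m))) refl m ⟩
    suc m * suc (suc m)      ∎

  ≤-*1 : ∀ a {b} → 1 ≤ b → a ≤ a * b
  ≤-*1 a {b} q = ≤-trans (≤-reflexive (sym (*-identityʳ a))) (*-monoʳ-≤ a q)

  -- The auxiliary coefficients have degree of order m⁴ e, the p-th powers degree p m. `large` makes
  -- the former negligible, and this balance limits m to the order of the cube root of p / d. The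
  -- factor 64 leaves room for all constants below.
  module StepanovArithmetic (p m d e : ℕ) (1≤m : 1 ≤ m) (1≤e : 1 ≤ e) (e≤d : e ≤ d) (large : 64 * (m * m * m * d) ≤ p) where
    M : ℕ
    M = m + tri m

    m³e≤ : 64 * (m * m * m * e) ≤ p
    m³e≤ = ≤-trans (*-monoʳ-≤ 64 (*-monoʳ-≤ (m * m * m) e≤d)) large

    1≤m³ : 1 ≤ m * m * m
    1≤m³ = *-mono-≤ (*-mono-≤ 1≤m 1≤m) 1≤m

    me≤ : 64 * (m * e) ≤ p
    me≤ = begin
      64 * (m * e)               ≤⟨ *-monoʳ-≤ 64 (*-monoˡ-≤ e (≤-trans (≤-*1 m (*-mono-≤ 1≤m 1≤m)) (≤-reflexive (sym (*-assoc m m m))))) ⟩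
      64 * (m * m * m * e)       ≤⟨ m³e≤ ⟩
      p                          ∎

    m²≤2M : m * m ≤ 2 * M
    m²≤2M = begin
      m * m                  ≤⟨ *-monoʳ-≤ m (n≤1+n m) ⟩
      m * suc m              ≡⟨ sym (2tri m) ⟩
      2 * tri m              ≤⟨ *-monoʳ-≤ 2 (m≤n+m (tri m) m) ⟩
      2 * M                  ∎

    M≤2m² : M ≤ 2 * (m * m)
    M≤2m² = *-cancelˡ-≤ 2 (begin
      2 * (m + tri m)            ≡⟨ trans (*-distribˡ-+ 2 m (tri m)) (cong (2 * m +_) (2tri m)) ⟩
      2 * m + m * suc m          ≡⟨ solve 1 (λ m → con 2 :* m :+ m :* (con 1 :+ m) := con 3 :* m :+ m :* m) refl m ⟩
      3 * m + m * m              ≤⟨ +-monoˡ-≤ (m * m) (*-monoʳ-≤ 3 (≤-*1 m 1≤m)) ⟩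
      3 * (m * m) + m * m        ≡⟨ solve 1 (λ x → con 3 :* x :+ x := con 2 :* (con 2 :* x)) refl (m * m) ⟩
      2 * (2 * (m * m))          ∎)

    M≤p : M ≤ p
    M≤p = begin
      M                          ≤⟨ M≤2m² ⟩
      2 * (m * m)                ≤⟨ *-mono-≤ {2} {64} (s≤s (s≤s z≤n)) (≤-trans (≤-*1 (m * m) 1≤m) (≤-*1 (m * m * m) 1≤e)) ⟩
      64 * (m * m * m * e)       ≤⟨ m³e≤ ⟩
      p                          ∎

    em<p : e * m < p
    em<p = begin-strict
      e * m                      <⟨ m<m+n (e * m) (≤-trans (*-mono-≤ 1≤e 1≤m) (m≤m*n (e * m) 63)) ⟩
      e * m + e * m * 63         ≡⟨ solve 2 (λ e m → e :* m :+ e :* m :* con 63 := con 64 :* (m :* e)) refl e m ⟩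
      64 * (m * e)               ≤⟨ me≤ ⟩
      p                          ∎

    a₁ : ℕ
    a₁ = M * (m + M * e) + e

    a₁≤ : a₁ ≤ 7 * (m * (m * m * m * e))
    a₁≤ = begin
      M * (m + M * e) + e
        ≤⟨ +-monoˡ-≤ e (*-mono-≤ M≤2m² (+-mono-≤ (≤-trans (≤-*1 m (*-mono-≤ 1≤m 1≤e)) (≤-reflexive (sym (*-assoc m m e)))) (*-monoˡ-≤ e M≤2m²))) ⟩
      2 * (m * m) * (m * m * e + 2 * (m * m) * e) + e
        ≤⟨ +-monoʳ-≤ (2 * (m * m) * (m * m * e + 2 * (m * m) * e)) (≤-trans (≤-*1 e (*-mono-≤ 1≤m 1≤m³)) (≤-reflexive (solve 2 (λ m e → e :* (m :* (m :* m :* m)) := m :* (m :* m :* m :* e)) refl m e))) ⟩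
      2 * (m * m) * (m * m * e + 2 * (m * m) * e) + m * (m * m * m * e)
        ≡⟨ solve 2 (λ m e → con 2 :* (m :* m) :* (m :* m :* e :+ con 2 :* (m :* m) :* e) :+ m :* (m :* m :* m :* e) := con 7 :* (m :* (m :* m :* m :* e))) refl m e ⟩
      7 * (m * (m * m * m * e)) ∎

    -- In the first case M is at least m² / 2, so p m / M is O(p / m). In the second, p - e m is at
    -- least p / 2, which leaves at most m e points.
    stepanov-count : ∀ N → N * M ≤ e * (p * m + a₁) ⊎ N * (p ∸ e * m) ≤ e * a₁ → N * m ≤ 4 * (e * p)
    stepanov-count N (inj₁ q) = *-cancelˡ-≤ m {{>-nonZero 1≤m}} (begin
      m * (N * m)                                ≡⟨ solve 2 (λ m N → m :* (N :* m) := N :* (m :* m)) refl m N ⟩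
      N * (m * m)                                ≤⟨ *-monoʳ-≤ N m²≤2M ⟩
      N * (2 * M)                                ≡⟨ solve 2 (λ N M → N :* (con 2 :* M) := con 2 :* (N :* M)) refl N M ⟩
      2 * (N * M)                                ≤⟨ *-monoʳ-≤ 2 q ⟩
      2 * (e * (p * m + a₁))                     ≤⟨ *-monoʳ-≤ 2 (*-monoʳ-≤ e (+-monoʳ-≤ (p * m) a₁≤)) ⟩
      2 * (e * (p * m + 7 * (m * (m * m * m * e)))) ≡⟨ solve 4 (λ e p m x → con 2 :* (e :* (p :* m :+ con 7 :* (m :* x))) := m :* (con 2 :* (e :* (p :+ con 7 :* x)))) refl e p m (m * m * m * e) ⟩
      m * (2 * (e * (p + 7 * (m * m * m * e))))  ≤⟨ *-monoʳ-≤ m (*-monoʳ-≤ 2 (*-monoʳ-≤ e (+-monoʳ-≤ p (≤-trans (*-monoˡ-≤ (m * m * m * e) {7} {64} (m≤m+n 7 57)) m³e≤)))) ⟩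
      m * (2 * (e * (p + p)))                    ≡⟨ cong (m *_) (solve 2 (λ e p → con 2 :* (e :* (p :+ p)) := con 4 :* (e :* p)) refl e p) ⟩
      m * (4 * (e * p))                          ∎)
    stepanov-count N (inj₂ q) = begin
      N * m                   ≤⟨ *-monoˡ-≤ m N≤me ⟩
      m * e * m               ≡⟨ solve 2 (λ m e → m :* e :* m := e :* (m :* m)) refl m e ⟩
      e * (m * m)             ≤⟨ *-monoʳ-≤ e (≤-trans (≤-trans (≤-trans (≤-*1 (m * m) 1≤m) (≤-*1 (m * m * m) 1≤e)) (m≤n*m (m * m * m * e) 64)) m³e≤) ⟩
      e * p                   ≤⟨ m≤n*m (e * p) 4 ⟩
      4 * (e * p)             ∎
      where
      half : p ≤ 2 * (p ∸ e * m)
      half = +-cancelˡ-≤ (2 * (e * m)) p (2 * (p ∸ e * m)) (begin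
        2 * (e * m) + p                    ≤⟨ +-monoˡ-≤ p (≤-trans (*-mono-≤ {2} {64} (m≤m+n 2 62) (≤-reflexive (*-comm e m))) me≤) ⟩
        p + p                              ≡⟨ solve 1 (λ p → p :+ p := con 2 :* p) refl p ⟩
        2 * p                              ≡⟨ cong (2 *_) (sym (m+[n∸m]≡n (<⇒≤ em<p))) ⟩
        2 * (e * m + (p ∸ e * m))          ≡⟨ *-distribˡ-+ 2 (e * m) _ ⟩
        2 * (e * m) + 2 * (p ∸ e * m)      ∎)
      N≤me : N ≤ m * e
      N≤me = *-cancelʳ-≤ N (m * e) p {{>-nonZero (≤-trans (s≤s z≤n) em<p)}} (begin
        N * p                              ≤⟨ *-monoʳ-≤ N half ⟩
        N * (2 * (p ∸ e * m))              ≡⟨ solve 2 (λ N x → N :* (con 2 :* x) := con 2 :* (N :* x)) refl N (p ∸ e * m) ⟩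
        2 * (N * (p ∸ e * m))              ≤⟨ *-monoʳ-≤ 2 (≤-trans q (*-monoʳ-≤ e a₁≤)) ⟩
        2 * (e * (7 * (m * (m * m * m * e)))) ≡⟨ solve 3 (λ e m x → con 2 :* (e :* (con 7 :* (m :* x))) := m :* e :* (con 14 :* x)) refl e m (m * m * m * e) ⟩
        m * e * (14 * (m * m * m * e))     ≤⟨ *-monoʳ-≤ (m * e) (≤-trans (*-monoˡ-≤ (m * m * m * e) {14} {64} (m≤m+n 14 50)) m³e≤) ⟩
        m * e * p                          ∎)

    singular-count : ∀ N → N ≤ e * e → N * m ≤ e * p
    singular-count N q = begin
      N * m          ≤⟨ *-monoˡ-≤ m q ⟩
      e * e * m      ≡⟨ *-assoc e e m ⟩
      e * (e * m)    ≤⟨ *-monoʳ-≤ e (<⇒≤ em<p) ⟩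
      e * p          ∎

  module SmallArithmetic (p m n d e w k : ℕ) (1≤m : 1 ≤ m) (1≤e : 1 ≤ e) (e≤m : e ≤ m) (n≤d : n ≤ d) (e≤2w : e ≤ 2 * w)
    (large-n : 1600 * (m * m) ≤ n) (large : 64 * (m * m * m * d) ≤ p) where

    -- Half of the degree being covered by the width turns the contact bound, quadratic in e, into a
    -- linear bound for k.
    k₂-small : ∀ k₂ → k₂ * w ≤ e * (e + e + e) → k₂ ≤ 6 * e
    k₂-small k₂ q = *-cancelʳ-≤ k₂ (6 * e) e {{>-nonZero 1≤e}} (begin
      k₂ * e                 ≤⟨ *-monoʳ-≤ k₂ e≤2w ⟩
      k₂ * (2 * w)           ≡⟨ solve 2 (λ k w → k :* (con 2 :* w) := con 2 :* (k :* w)) refl k₂ w ⟩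
      2 * (k₂ * w)           ≤⟨ *-monoʳ-≤ 2 q ⟩
      2 * (e * (e + e + e))  ≡⟨ solve 1 (λ e → con 2 :* (e :* (e :+ e :+ e)) := con 6 :* e :* e) refl e ⟩
      6 * e * e              ∎)

    module _ (k≤ : k ≤ 8 * e) where
      π≤ : suc (k + e) ≤ 10 * e
      π≤ = begin
        suc (k + e)        ≤⟨ +-mono-≤ 1≤e (+-monoˡ-≤ e k≤) ⟩
        e + (8 * e + e)    ≡⟨ solve 1 (λ e → e :+ (con 8 :* e :+ e) := con 10 :* e) refl e ⟩
        10 * e             ∎

      -- The left side is at most 21 e², while 1600 m² ≤ n and e ≤ 2 w give n w at least 800 m² e.
      -- Below √n, up to a constant, m thus meets the hypothesis of `degenerate`.
      big : e * (suc (k + e) + (e + suc (k + e))) < n * w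
      big = *-cancelˡ-< 2 _ _ (begin-strict
        2 * (e * (suc (k + e) + (e + suc (k + e)))) ≤⟨ *-monoʳ-≤ 2 (*-monoʳ-≤ e (+-mono-≤ π≤ (+-monoʳ-≤ e π≤))) ⟩
        2 * (e * (10 * e + (e + 10 * e)))           ≡⟨ solve 1 (λ e → con 2 :* (e :* (con 10 :* e :+ (e :+ con 10 :* e))) := con 42 :* (e :* e)) refl e ⟩
        42 * (e * e)                                <⟨ *-monoˡ-< (e * e) {{>-nonZero (*-mono-≤ 1≤e 1≤e)}} {42} {1600} (m≤m+n 43 1557) ⟩
        1600 * (e * e)                              ≤⟨ *-monoʳ-≤ 1600 (≤-trans (*-monoˡ-≤ e (≤-trans e≤m (≤-*1 m 1≤m))) ≤-refl) ⟩
        1600 * (m * m * e)                          ≡⟨ sym (*-assoc 1600 (m * m) e) ⟩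
        1600 * (m * m) * e                          ≤⟨ *-mono-≤ large-n e≤2w ⟩
        n * (2 * w)                                 ≡⟨ solve 2 (λ n w → n :* (con 2 :* w) := con 2 :* (n :* w)) refl n w ⟩
        2 * (n * w)                                 ∎)

      m²≤n : 10 * m ≤ n
      m²≤n = begin
        10 * m             ≤⟨ *-mono-≤ {10} {1600} (m≤m+n 10 1590) (≤-*1 m 1≤m) ⟩
        1600 * (m * m)     ≤⟨ large-n ⟩
        n                  ∎

      1≤n : 1 ≤ n
      1≤n = ≤-trans (*-mono-≤ {1} {10} (s≤s z≤n) 1≤m) m²≤n

      md≤ : 64 * (m * d) ≤ p
      md≤ = begin
        64 * (m * d)            ≤⟨ *-monoʳ-≤ 64 (*-monoˡ-≤ d (≤-trans (≤-*1 m (*-mono-≤ 1≤m 1≤m)) (≤-reflexive (sym (*-assoc m m m))))) ⟩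
        64 * (m * m * m * d)    ≤⟨ large ⟩
        p                       ∎

      en<p : e * (suc (k + e) + n) < p
      en<p = begin-strict
        e * (suc (k + e) + n)   ≤⟨ *-mono-≤ e≤m (+-monoˡ-≤ n (≤-trans π≤ (≤-trans (*-monoʳ-≤ 10 e≤m) m²≤n))) ⟩
        m * (n + n)             ≤⟨ *-monoʳ-≤ m (+-mono-≤ n≤d n≤d) ⟩
        m * (d + d)             <⟨ m<m+n (m * (d + d)) (≤-trans (*-mono-≤ 1≤m (≤-trans 1≤n n≤d)) (m≤m*n (m * d) 62)) ⟩
        m * (d + d) + m * d * 62 ≡⟨ solve 2 (λ m d → m :* (d :+ d) :+ m :* d :* con 62 := con 64 :* (m :* d)) refl m d ⟩
        64 * (m * d)            ≤⟨ md≤ ⟩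
        p                       ∎

      few-count : ∀ N → N ≤ e * suc (k + e) → N * m ≤ e * p
      few-count N q = begin
        N * m                   ≤⟨ *-monoˡ-≤ m (≤-trans q (*-monoʳ-≤ e π≤)) ⟩
        e * (10 * e) * m        ≡⟨ solve 2 (λ e m → e :* (con 10 :* e) :* m := e :* (con 10 :* (m :* e))) refl e m ⟩
        e * (10 * (m * e))      ≤⟨ *-monoʳ-≤ e (≤-trans (*-mono-≤ {10} {64} (m≤m+n 10 54) (*-monoʳ-≤ m (≤-trans e≤m (≤-trans (m≤n*m m 10) (≤-trans m²≤n n≤d))))) md≤) ⟩
        e * p                   ∎

  combine-good : ∀ p m e w s t → w ≤ e → s * m ≤ e * p → t * m ≤ 4 * (e * p) → (s + t) * m + w * (2 * (p * m)) ≤ e * (6 * p + 2 * (p * m))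
  combine-good p m e w s t w≤e sq tq = begin
    (s + t) * m + w * (2 * (p * m))                ≡⟨ cong (_+ w * (2 * (p * m))) (*-distribʳ-+ m s t) ⟩
    s * m + t * m + w * (2 * (p * m))              ≤⟨ +-mono-≤ (+-mono-≤ sq tq) (*-monoˡ-≤ (2 * (p * m)) w≤e) ⟩
    e * p + 4 * (e * p) + e * (2 * (p * m))        ≤⟨ +-monoˡ-≤ (e * (2 * (p * m))) (m≤n+m (e * p + 4 * (e * p)) (e * p)) ⟩
    e * p + (e * p + 4 * (e * p)) + e * (2 * (p * m)) ≡⟨ solve 3 (λ e p z → e :* p :+ (e :* p :+ con 4 :* (e :* p)) :+ e :* z := e :* (con 6 :* p :+ z)) refl e p (2 * (p * m)) ⟩
    e * (6 * p + 2 * (p * m))                      ∎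

  -- Only the trivial bound is available here; doubling the credit to 2 p m per unit of width makes
  -- a factor with 2 w ≤ e pay for itself.
  combine-bad : ∀ p m e w N → 2 * w ≤ e → N ≤ e * p → N * m + w * (2 * (p * m)) ≤ e * (6 * p + 2 * (p * m))
  combine-bad p m e w N 2w≤e q = begin
    N * m + w * (2 * (p * m))             ≡⟨ cong (N * m +_) (solve 2 (λ w x → w :* (con 2 :* x) := con 2 :* w :* x) refl w (p * m)) ⟩
    N * m + 2 * w * (p * m)               ≤⟨ +-mono-≤ (*-monoˡ-≤ m q) (*-monoˡ-≤ (p * m) 2w≤e) ⟩
    e * p * m + e * (p * m)               ≤⟨ m≤n+m _ (e * (6 * p)) ⟩
    e * (6 * p) + (e * p * m + e * (p * m)) ≡⟨ solve 3 (λ e p m → e :* (con 6 :* p) :+ (e :* p :* m :+ e :* (p :* m)) := e :* (con 6 :* p :+ con 2 :* (p :* m))) refl e p m ⟩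
    e * (6 * p + 2 * (p * m))             ∎

  -- The width of the whole polynomial falls short of d by at most 2 k, so the credit cancels all of
  -- 2 p m d except 4 k p m.
  conclude : ∀ p m d k w D N → D ≤ d → d ≤ w + 2 * k → N * m + w * (2 * (p * m)) ≤ D * (6 * p + 2 * (p * m)) → N * m ≤ 6 * (d * p) + 4 * (k * (p * m))
  conclude p m d k w D N D≤d d≤w q = +-cancelʳ-≤ (w * (2 * (p * m))) _ _ (begin
    N * m + w * (2 * (p * m))                          ≤⟨ ≤-trans q (*-monoˡ-≤ (6 * p + 2 * (p * m)) D≤d) ⟩
    d * (6 * p + 2 * (p * m))                          ≡⟨ solve 3 (λ d p x → d :* (con 6 :* p :+ x) := con 6 :* (d :* p) :+ d :* x) refl d p (2 * (p * m)) ⟩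
    6 * (d * p) + d * (2 * (p * m))                    ≤⟨ +-monoʳ-≤ (6 * (d * p)) (*-monoˡ-≤ (2 * (p * m)) d≤w) ⟩
    6 * (d * p) + (w + 2 * k) * (2 * (p * m))          ≡⟨ solve 4 (λ x w k y → x :+ (w :+ con 2 :* k) :* (con 2 :* y) := x :+ con 4 :* (k :* y) :+ w :* (con 2 :* y)) refl (6 * (d * p)) w k (p * m) ⟩
    6 * (d * p) + 4 * (k * (p * m)) + w * (2 * (p * m)) ∎)

-- Coefficients of powers of Y^n - 1 on the line X = 0.

module LineCoefficients (K : PrimeField) (P : Plane K) where
  private module F = PrimeField K
  open F.Solver
  open PlaneTheory K P
  open Widths K P
  open ≡-Reasoning

  cf-1-suc : ∀ b → 0 ℕ.< b → cf 1# 0 b ≡ F.0#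
  cf-1-suc b q = trans (cong (λ z → cf z 0 b) (sym κ-1)) (cf-κ F.1# 0 b q)

  cf-1-0 : cf 1# 0 0 ≡ F.1#
  cf-1-0 = trans (cong (λ z → cf z 0 0) (sym κ-1)) (cf-κ-0 F.1#)

  line-^ : ∀ {f g} → (∀ b → cf f 0 b ≡ cf g 0 b) → ∀ j b → cf (f ^ j) 0 b ≡ cf (g ^ j) 0 b
  line-^ h zero    b = refl
  line-^ {f} {g} h (suc j) b = trans (cf-*-line f _ b) (trans (F.ad-cong b (λ i i′ _ → cong₂ F._*_ (h i) (line-^ h j i′))) (sym (cf-*-line g _ b)))

  module _ (N : ℕ) where
    Z : A
    Z = Y ^ suc N - 1#

    private
      n = suc N

      rec : ∀ f b → cf (Z * f) 0 b ≡ cf (Y ^ n * f) 0 b F.- cf f 0 b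
      rec f b = trans (cong (λ z → cf z 0 b) (trans (distribʳ f (Y ^ n) _) (cong (Y ^ n * f +_) (trans (sym (-‿distribˡ-* 1# f)) (cong -_ (*-identityˡ f))))))
        (trans (cf-+ _ _ 0 b) (cong (cf (Y ^ n * f) 0 b F.+_) (cf-- f 0 b)))

      rec-high : ∀ f b → cf (Z * f) 0 (n ℕ.+ b) ≡ cf f 0 b F.- cf f 0 (n ℕ.+ b)
      rec-high f b = trans (rec f (n ℕ.+ b)) (cong (F._- cf f 0 (n ℕ.+ b)) (cf-Y^* n f b))

      rec-low : ∀ f b → b ℕ.< n → cf (Z * f) 0 b ≡ F.- cf f 0 b
      rec-low f b q = trans (rec f b) (trans (cong (F._- cf f 0 b) (cf-Y^*-below n f b q)) (F.+-identityˡ _))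

    -- A power of Y^n - 1 is a polynomial in Y^n.
    off-multiples : ∀ j b → ¬ (n ℕ∣.∣ b) → cf (Z ^ j) 0 b ≡ F.0#
    off-multiples zero    zero    q = ⊥-elim (q (n ℕ∣.∣0))
    off-multiples zero    (suc b) q = cf-1-suc (suc b) (s≤s z≤n)
    off-multiples (suc j) b       q = go (b ℕ.<? n)
      where
      go : Dec (b ℕ.< n) → cf (Z ^ suc j) 0 b ≡ F.0#
      go (yes lt) = trans (rec-low (Z ^ j) b lt) (trans (cong F.-_ (off-multiples j b q)) F.-0#≈0#)
      go (no ge)  = subst (λ z → cf (Z ^ suc j) 0 z ≡ F.0#) b≡ (trans (rec-high (Z ^ j) (b ∸ n))
          (trans (cong₂ F._-_ (off-multiples j (b ∸ n) (λ d → q (subst (n ℕ∣.∣_) b≡ (∣m∣n⇒∣m+n ℕ∣.∣-refl d)))) (off-multiples j (n ℕ.+ (b ∸ n)) (λ d → q (subst (n ℕ∣.∣_) b≡ d)))) (F.-‿inverseʳ _)))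
        where
        b≡ : n ℕ.+ (b ∸ n) ≡ b
        b≡ = ℕ.m+[n∸m]≡n (ℕ.≮⇒≥ ge)

    private
      low₀ : ∀ j → cf (Z ^ j) 0 0 ≡ (F.- F.1#) F.^ j
      low₀ zero    = cf-1-0
      low₀ (suc j) = trans (rec-low (Z ^ j) 0 (s≤s z≤n)) (trans (cong F.-_ (low₀ j)) (solve 1 (λ s → :- s := (:- con (ℤ.+ 1)) :* s) refl ((F.- F.1#) F.^ j)))

    low₁ : ∀ j → cf (Z ^ j) 0 n ≡ F.- (F.nat j F.* (F.- F.1#) F.^ j)
    low₁ zero    = trans (cf-1-suc n (s≤s z≤n)) (solve 0 (con (ℤ.+ 0) := :- (con (ℤ.+ 0) :* con (ℤ.+ 1))) refl)
    low₁ (suc j) = begin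
      cf (Z ^ suc j) 0 n ≡⟨ cong (cf (Z ^ suc j) 0) (sym (ℕ.+-identityʳ n)) ⟩
      cf (Z ^ suc j) 0 (n ℕ.+ 0) ≡⟨ rec-high (Z ^ j) 0 ⟩
      cf (Z ^ j) 0 0 F.- cf (Z ^ j) 0 (n ℕ.+ 0) ≡⟨ cong₂ F._-_ (low₀ j) (trans (cong (cf (Z ^ j) 0) (ℕ.+-identityʳ n)) (low₁ j)) ⟩
      s F.- (F.- (F.nat j F.* s)) ≡⟨ solve 2 (λ s j → s :- (:- (j :* s)) := :- ((con (ℤ.+ 1) :+ j) :* ((:- con (ℤ.+ 1)) :* s))) refl s (F.nat j) ⟩
      F.- (F.nat (suc j) F.* (F.- F.1#) F.^ suc j) ∎
      where s = (F.- F.1#) F.^ j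

    private
      above-top : ∀ j b → j ℕ.* n ℕ.< b → cf (Z ^ j) 0 b ≡ F.0#
      above-top zero    b q = cf-1-suc b q
      above-top (suc j) b q = subst (λ z → cf (Z ^ suc j) 0 z ≡ F.0#) b≡ (trans (rec-high (Z ^ j) (b ∸ n))
          (trans (cong₂ F._-_ (above-top j (b ∸ n) (ℕ.+-cancelˡ-< n _ _ (subst (n ℕ.+ j ℕ.* n ℕ.<_) (sym b≡) q)))
                              (above-top j (n ℕ.+ (b ∸ n)) (subst (j ℕ.* n ℕ.<_) (sym b≡) (ℕ.≤-<-trans (ℕ.m≤n+m (j ℕ.* n) n) q)))) (F.-‿inverseʳ _)))
        where
        b≡ : n ℕ.+ (b ∸ n) ≡ b
        b≡ = ℕ.m+[n∸m]≡n (ℕ.≤-trans (ℕ.m≤m+n n (j ℕ.* n)) (ℕ.<⇒≤ q))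

      top : ∀ j → cf (Z ^ j) 0 (j ℕ.* n) ≡ F.1#
      top zero    = cf-1-0
      top (suc j) = trans (rec-high (Z ^ j) (j ℕ.* n)) (trans (cong₂ F._-_ (top j) (above-top j (n ℕ.+ j ℕ.* n) (ℕ.m<n+m (j ℕ.* n) (s≤s z≤n))))
        (solve 0 (con (ℤ.+ 1) :- con (ℤ.+ 0) := con (ℤ.+ 1)) refl))

    second-top : ∀ j → cf (Z ^ suc j) 0 (j ℕ.* n) ≡ F.- F.nat (suc j)
    second-top zero    = trans (rec-low 1# 0 (s≤s z≤n)) (trans (cong F.-_ cf-1-0) (solve 0 (:- con (ℤ.+ 1) := :- (con (ℤ.+ 1) :+ con (ℤ.+ 0))) refl))
    second-top (suc j) = trans (rec-high (Z ^ suc j) (j ℕ.* n)) (trans (cong₂ F._-_ (second-top j) (top (suc j)))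
      (solve 1 (λ x → (:- x) :- con (ℤ.+ 1) := :- (con (ℤ.+ 1) :+ x)) refl (F.nat (suc j))))

open Arithmetic

-- The point count for a given m.

module FermatCurve (K : PrimeField) (P : Plane K) (k₁ h₁ k″ n″ : ℕ) where
  private module F = PrimeField K
  open F using (p)
  open PlaneTheory K P
  open LeadingMonomials K P
  open Widths K P
  open FermatPolynomials K P
  open Counting K P
  open LineCoefficients K P

  k n k′ n′ d : ℕ
  k  = suc k₁
  n  = suc (k₁ ℕ.+ suc h₁)
  k′ = suc k″
  n′ = suc n″
  d  = k′ ℕ.* n

  f₀ : A
  f₀ = fermat-difference k n k′ n′

  module _ (k′n≡n′k : k′ ℕ.* n ≡ n′ ℕ.* k) (d<p : d ℕ.< p) where
    private
      n≤d : n ℕ.≤ d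
      n≤d = ℕ.m≤m+n n (k″ ℕ.* n)

      n<p : n ℕ.< p
      n<p = ℕ.≤-<-trans n≤d d<p

      k<n : k ℕ.< n
      k<n = s≤s (ℕ.m<m+n k₁ (s≤s z≤n))

      n′<p : n′ ℕ.< p
      n′<p = ℕ.≤-<-trans (ℕ.≤-trans (ℕ.m≤m*n n′ k) (ℕ.≤-reflexive (sym k′n≡n′k))) d<p

      on-line : ∀ N b → cf (power-sum (suc N)) 0 b ≡ cf (Z N) 0 b
      on-line N b = trans (cf-+ _ _ 0 b) (trans (cong (F._+ cf (- 1#) 0 b) (trans (cf-+ _ _ 0 b) (trans (cong (F._+ cf (Y ^ suc N) 0 b) (cf-X*-0 _ b)) (F.+-identityˡ _)))) (sym (cf-+ _ _ 0 b)))

      cf-f₀ : ∀ b → cf f₀ 0 b ≡ cf (Z (k₁ ℕ.+ suc h₁) ^ k′) 0 b F.- cf (Z k₁ ^ n′) 0 b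
      cf-f₀ b = trans (cf-+ _ _ 0 b) (cong₂ F._+_ (line-^ (on-line (k₁ ℕ.+ suc h₁)) k′ b) (trans (cf-- _ 0 b) (cong F.-_ (line-^ (on-line k₁) n′ b))))

      n∤k : ¬ (n ℕ∣.∣ k)
      n∤k q = ℕ.<⇒≱ k<n (∣⇒≤ q)

      neg-≢0 : ∀ {x} → x ≢ F.0# → F.- x ≢ F.0#
      neg-≢0 nz z = nz (F.-x≡0⇒x≡0 z)

      minus-≢0 : ∀ {x y} → x ≡ F.0# → y ≢ F.0# → x F.- y ≢ F.0#
      minus-≢0 x0 nz z = neg-≢0 nz (trans (sym (F.+-identityˡ _)) (trans (cong (F._- _) (sym x0)) z))

      -- As k < n, only the power of Y^k - 1 has a term of degree k. Its coefficient is n′ up to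
      -- sign, and n′ ≤ d < p.
      f₀-at-k : cf f₀ 0 k ≢ F.0#
      f₀-at-k z = minus-≢0 (off-multiples (k₁ ℕ.+ suc h₁) k′ k n∤k)
        (λ q → neg-≢0 (F.*-≢0 (F.nat≢0 n′ (s≤s z≤n) n′<p) (F.^-≢0 n′ (neg-≢0 F.1≢0))) (trans (sym (low₁ k₁ n′)) q))
        (trans (sym (cf-f₀ k)) z)

      -- n divides d but not k, hence not d - k = n″ k; again only the power of Y^k - 1 contributes,
      -- with coefficient n′ up to sign.
      f₀-at-top : cf f₀ 0 (n″ ℕ.* k) ≢ F.0#
      f₀-at-top z = minus-≢0 (off-multiples (k₁ ℕ.+ suc h₁) k′ (n″ ℕ.* k) (λ q → n∤k (∣m+n∣m⇒∣n (subst (n ℕ∣.∣_) (trans k′n≡n′k (ℕ.+-comm k (n″ ℕ.* k))) (n∣m*n k′)) q)))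
        (λ q → neg-≢0 (F.nat≢0 n′ (s≤s z≤n) n′<p) (trans (sym (second-top k₁ n″)) q))
        (trans (sym (cf-f₀ (n″ ℕ.* k))) z)

    f₀≢0 : f₀ ≢ 0#
    f₀≢0 z = f₀-at-k (trans (cong (λ u → cf u 0 k) z) (cf-0 0 k))

    f₀-width : ∃ λ o → ∃ λ w → Width f₀ o w × d ℕ.≤ w ℕ.+ 2 ℕ.* k
    f₀-width = [ (λ z → ⊥-elim (f₀-at-k (z k))) , (λ (o , w , W) → o , w , W , wide o w W) ]′ (Width-exists f₀)
      where
      wide : ∀ o w → Width f₀ o w → d ℕ.≤ w ℕ.+ 2 ℕ.* k
      wide o w W = ℕ.≤-trans (ℕ.≤-reflexive k′n≡n′k) (ℕ.≤-trans (ℕ.+-monoʳ-≤ k (ℕ.≤-trans top≤ (ℕ.+-monoˡ-≤ w o≤k)))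
          (ℕ.≤-reflexive (ℕS.solve 2 (λ k w → k ℕS.:+ (k ℕS.:+ w) ℕS.:= w ℕS.:+ ℕS.con 2 ℕS.:* k) refl k w)))
        where
        o≤k : o ℕ.≤ k
        o≤k = ℕ.≮⇒≥ (λ q → f₀-at-k (below W k q))
        top≤ : n″ ℕ.* k ℕ.≤ o ℕ.+ w
        top≤ = ℕ.≮⇒≥ (λ q → f₀-at-top (above W _ q))

    Deg-power-sum : ∀ N → Deg≤ (suc N) (power-sum (suc N))
    Deg-power-sum N = Deg-+ (Deg-+ (pw Deg-X) (pw Deg-Y)) (Deg-- (Deg-mono (s≤s z≤n) Deg-1))
      where
      pw : ∀ {f} → Deg≤ 1 f → Deg≤ (suc N) (f ^ suc N)
      pw {f} q = subst (λ z → Deg≤ z (f ^ suc N)) (ℕ.*-identityʳ (suc N)) (Deg≤-^ (suc N) q)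

    Deg-f₀ : Deg≤ d f₀
    Deg-f₀ = Deg-+ (Deg≤-^ k′ (Deg-power-sum _)) (Deg-- (subst (λ z → Deg≤ z (power-sum k ^ n′)) (sym k′n≡n′k) (Deg≤-^ n′ (Deg-power-sum k₁))))

    LM≤d : ∀ {α β} → LM f₀ α β → α ℕ.+ β ℕ.≤ d
    LM≤d l = ℕ.≮⇒≥ (λ q → lm-≢0 l (cf≡0 Deg-f₀ _ _ q))

    factor≤d : ∀ {G α β} → LM G α β → G ∣ f₀ → α ℕ.+ β ℕ.≤ d
    factor≤d {G} {α} {β} l (c , e) = ℕ.≤-trans (ℕ.≤-trans (ℕ.m≤m+n (α ℕ.+ β) (proj₁ lc ℕ.+ proj₁ (proj₂ lc)))
        (ℕ.≤-reflexive (ℕS.solve 4 (λ a b c d → (a ℕS.:+ b) ℕS.:+ (c ℕS.:+ d) ℕS.:= (a ℕS.:+ c) ℕS.:+ (b ℕS.:+ d)) refl α β (proj₁ lc) (proj₁ (proj₂ lc)))))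
        (LM≤d (subst (λ z → LM z (α ℕ.+ proj₁ lc) (β ℕ.+ proj₁ (proj₂ lc))) (sym e) (LM-* l (proj₂ (proj₂ lc)))))
      where
      lc = LM-exists c (λ z → f₀≢0 (trans e (trans (cong (G *_) z) (zeroʳ G))))

    trivial-count : ∀ Qs → Unique Qs → All (λ Q → ev Q f₀ ≡ F.0#) Qs → length Qs ℕ.≤ d ℕ.* p
    trivial-count Qs uQ zs = decidable-stable (_ ℕ.≤? _) (Fac.factorise f₀ irreducible-case _ _ (proj₂ (proj₂ lf)) _ _ (proj₁ (proj₂ (proj₂ f₀-width))) >>= λ B →
      return (ℕ.≤-trans (ℕ.≤-trans (ℕ.≤-reflexive (sym (trans (cong₂ ℕ._+_ (ℕ.*-identityʳ (length Qs)) (ℕ.*-zeroʳ (proj₁ (proj₂ f₀-width)))) (ℕ.+-identityʳ _))))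
        (B Qs uQ (All.tabulate (λ _ → refl)) zs)) (ℕ.*-monoˡ-≤ p (LM≤d (proj₂ (proj₂ lf))))))
      where
      module Fac = Factorise (λ _ → 0 ≡ 0) 1 0 p z≤n
      lf = LM-exists f₀ f₀≢0
      irreducible-case : ∀ G → Irreducible G → G ∣ f₀ → ∀ α β → LM G α β → ∀ o w → Width G o w → Fac.Bound G (α ℕ.+ β) w
      irreducible-case G irr _ α β l o w W Qs uQ _ on = ℕ.≤-trans (ℕ.≤-reflexive (trans (cong₂ ℕ._+_ (ℕ.*-identityʳ (length Qs)) (ℕ.*-zeroʳ w)) (ℕ.+-identityʳ _)))
        (OnCurve.trivial-bound G irr α β l Qs uQ on)

    module _ (m : ℕ) (1≤m : 1 ℕ.≤ m) (large-n : 1600 ℕ.* (m ℕ.* m) ℕ.≤ n) (large : 64 ℕ.* (m ℕ.* m ℕ.* m ℕ.* d) ℕ.≤ p) where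
      private
        -- Counts are scaled by m. Singular points contribute at most e p and the others at most 4 e
        -- p, which fits into 6 e p; 2 p m is the credit per unit of width.
        module Fac = Factorise (Good k) m (2 ℕ.* (p ℕ.* m)) (6 ℕ.* p ℕ.+ 2 ℕ.* (p ℕ.* m)) (ℕ.m≤n+m _ (6 ℕ.* p))

        module Irreducible-case (G : A) (irr : Irreducible G) (G∣f₀ : G ∣ f₀) (α β : ℕ) (l : LM G α β) (o w : ℕ) (W : Width G o w)
          (Qs : List Point) (uQ : Unique Qs) (good : All (Good k) Qs) (on : All (λ Q → ev Q G ≡ F.0#) Qs) where
          open OnCurve G irr α β l
          private
            module C = Points K P G irr α β l
            module Cm = Component K P G irr α β l k₁ h₁ k″ n″

          e : ℕ
          e = α ℕ.+ β

          e≤d : e ℕ.≤ d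
          e≤d = factor≤d l G∣f₀

          w≤e : w ℕ.≤ e
          w≤e = Width≤degree l W

          open StepanovArithmetic p m d e 1≤m 0<e e≤d large using (M≤p; em<p; stepanov-count; singular-count)

          Sg Ns : List Point
          Sg = filter singular? Qs
          Ns = filter (λ Q → ¬? (singular? Q)) Qs

          Sg-count : length Sg ℕ.* m ℕ.≤ e ℕ.* p
          Sg-count = singular-count (length Sg) (singular-bound (ℕ.≤-<-trans e≤d d<p) Sg (Unique.filter⁺ singular? uQ) (filter⁺ singular? on) (all-filter singular? Qs))

          uN : Unique Ns
          uN = Unique.filter⁺ (λ Q → ¬? (singular? Q)) uQ
          onN : All (λ Q → ev Q G ≡ F.0#) Ns
          onN = filter⁺ (λ Q → ¬? (singular? Q)) on
          goodN : All (Good k) Ns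
          goodN = filter⁺ (λ Q → ¬? (singular? Q)) good
          nsN : All C.Nonsingular Ns
          nsN = All.map (λ {Q} n → nonsingular Q n) (all-filter (λ Q → ¬? (singular? Q)) Qs)

          large-degree : m ℕ.< e → length Ns ℕ.* m ℕ.≤ 4 ℕ.* (e ℕ.* p)
          large-degree m<e = decidable-stable (_ ℕ.≤? _)
            (Stepanov.stepanov K P G irr α β l m m<e Ns uN onN nsN M≤p em<p >>= λ r → return (stepanov-count (length Ns) r))

          small-degree : e ℕ.≤ m → e ℕ.≤ 2 ℕ.* w → length Ns ℕ.* m ℕ.≤ 4 ℕ.* (e ℕ.* p)
          small-degree e≤m e≤2w = ℕ.≤-trans (go Ns uN onN nsN goodN) (ℕ.m≤n*m (e ℕ.* p) 4)
            where
            open SmallArithmetic p m n d e w k 1≤m 0<e e≤m n≤d e≤2w large-n large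
            go : ∀ Ns → Unique Ns → All (λ Q → ev Q G ≡ F.0#) Ns → All C.Nonsingular Ns → All (Good k) Ns → length Ns ℕ.* m ℕ.≤ e ℕ.* p
            go [] _ _ _ _ = z≤n
            -- A point of the list is what yields the contact bound, and with it k ≤ 8 e; an empty
            -- list needs no bound.
            go (Q ∷ Rs) u (o₁ ∷ os) (n₁ ∷ ns) (g₁ ∷ gs) = few-count k≤8e (length (Q ∷ Rs))
                (Cm.few-points k′n≡n′k d<p n<p G∣f₀ (Q ∷ Rs) u (o₁ ∷ os) (n₁ ∷ ns) (g₁ ∷ gs) W (big k≤8e) (en<p k≤8e))
              where
              -- There is no k₂ when k = 1. Otherwise k = k₂ + 2, with k₂ ≤ 6 e from the contact
              -- bound and 2 ≤ 2 e.
              bound : ∀ j → k₁ ≡ j → suc j ℕ.≤ 8 ℕ.* e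
              bound zero     _ = ℕ.≤-trans 0<e (ℕ.m≤n*m e 8)
              bound (suc k₂) q = ℕ.≤-trans (ℕ.+-mono-≤ (ℕ.*-monoʳ-≤ 2 0<e) (k₂-small k₂ (Cm.At.contact-bound k′n≡n′k d<p n<p G∣f₀ Q o₁ n₁ g₁ k₂ q W)))
                (ℕ.≤-reflexive (ℕS.solve 1 (λ e → ℕS.con 2 ℕS.:* e ℕS.:+ ℕS.con 6 ℕS.:* e ℕS.:= ℕS.con 8 ℕS.:* e) refl e))
              k≤8e : k ℕ.≤ 8 ℕ.* e
              k≤8e = bound k₁ refl

          result : length Qs ℕ.* m ℕ.+ w ℕ.* (2 ℕ.* (p ℕ.* m)) ℕ.≤ e ℕ.* (6 ℕ.* p ℕ.+ 2 ℕ.* (p ℕ.* m))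
          result = wide? (e ℕ.≤? 2 ℕ.* w)
            where
            wide? : Dec (e ℕ.≤ 2 ℕ.* w) → length Qs ℕ.* m ℕ.+ w ℕ.* (2 ℕ.* (p ℕ.* m)) ℕ.≤ e ℕ.* (6 ℕ.* p ℕ.+ 2 ℕ.* (p ℕ.* m))
            wide? (no q)  = combine-bad p m e w (length Qs) (ℕ.<⇒≤ (ℕ.≰⇒> q)) (trivial-bound Qs uQ on)
            wide? (yes q) = subst (λ z → z ℕ.* m ℕ.+ w ℕ.* (2 ℕ.* (p ℕ.* m)) ℕ.≤ e ℕ.* (6 ℕ.* p ℕ.+ 2 ℕ.* (p ℕ.* m))) (sym (length-split singular? Qs))
              (combine-good p m e w (length Sg) (length Ns) w≤e Sg-count (degree? (m ℕ.<? e)))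
              where
              degree? : Dec (m ℕ.< e) → length Ns ℕ.* m ℕ.≤ 4 ℕ.* (e ℕ.* p)
              degree? (yes m<e) = large-degree m<e
              degree? (no m≮e)  = small-degree (ℕ.≮⇒≥ m≮e) q

      good-count : ∀ Qs → Unique Qs → All (Good k) Qs → All (λ Q → ev Q f₀ ≡ F.0#) Qs → length Qs ℕ.* m ℕ.≤ 6 ℕ.* (d ℕ.* p) ℕ.+ 4 ℕ.* (k ℕ.* (p ℕ.* m))
      good-count Qs uQ good zs = decidable-stable (_ ℕ.≤? _)
        (Fac.factorise f₀ (λ G irr G∣ α β l o w W Qs uQ good on → Irreducible-case.result G irr G∣ α β l o w W Qs uQ good on) _ _ (proj₂ (proj₂ lf)) _ w (proj₁ (proj₂ (proj₂ f₀-width))) >>= λ B →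
          return (conclude p m d k w (proj₁ lf ℕ.+ proj₁ (proj₂ lf)) (length Qs) (LM≤d (proj₂ (proj₂ lf))) (proj₂ (proj₂ (proj₂ f₀-width))) (B Qs uQ good zs)))
        where
        lf = LM-exists f₀ f₀≢0
        w = proj₁ (proj₂ f₀-width)

      private
        -- Removes the points that violate a `Good` condition. The line X = 0 is a single fibre;
        -- each of the other four polynomials has at most as many zeros in a fibre as its degree, as
        -- it is not constant there. The total is at most 5 k p.
        module Peel (Qs : List Point) (uQ : Unique Qs) (zs : All (λ Q → ev Q f₀ ≡ F.0#) Qs) where
          x? y? V? yk? xy? : ∀ (Q : Point) → Dec _
          x?  Q = proj₁ Q F.≟ F.0#
          y?  Q = ev Q Y F.≟ F.0#
          V?  Q = ev Q (power-sum k) F.≟ F.0#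
          yk? Q = ev Q (Y ^ k - 1#) F.≟ F.0#
          xy? Q = ev Q (X ^ k + Y ^ k) F.≟ F.0#

          L₁ L₂ L₃ L₄ L₅ : List Point
          L₁ = filter (λ Q → ¬? (x? Q)) Qs
          L₂ = filter (λ Q → ¬? (y? Q)) L₁
          L₃ = filter (λ Q → ¬? (V? Q)) L₂
          L₄ = filter (λ Q → ¬? (yk? Q)) L₃
          L₅ = filter (λ Q → ¬? (xy? Q)) L₄
          u₁ : Unique L₁
          u₁ = Unique.filter⁺ (λ Q → ¬? (x? Q)) uQ
          u₂ : Unique L₂
          u₂ = Unique.filter⁺ (λ Q → ¬? (y? Q)) u₁
          u₃ : Unique L₃
          u₃ = Unique.filter⁺ (λ Q → ¬? (V? Q)) u₂
          u₄ : Unique L₄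
          u₄ = Unique.filter⁺ (λ Q → ¬? (yk? Q)) u₃
          u₅ : Unique L₅
          u₅ = Unique.filter⁺ (λ Q → ¬? (xy? Q)) u₄

          evY^ : ∀ x y → ev (x , y) (Y ^ k) ≡ y F.^ k
          evY^ x y = trans (Hom.⟦^⟧ (evHom (x , y)) Y k) (cong (F._^ k) (ev-Y (x , y)))

          -- Y^k + g with g independent of Y takes different values at y = 0 and y = 1
          not-constant : ∀ Ψ → (∀ x → ∃ λ c → ∀ y → ev (x , y) Ψ ≡ y F.^ k F.+ c) → ∀ x → ∃ λ y → ev (x , y) Ψ ≢ F.0#
          not-constant Ψ h x = choose (ev (x , F.0#) Ψ F.≟ F.0#)
            where
            choose : Dec (ev (x , F.0#) Ψ ≡ F.0#) → ∃ λ y → ev (x , y) Ψ ≢ F.0#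
            choose (no nz) = F.0# , nz
            choose (yes z) = F.1# , λ z′ → F.1≢0 (begin
              F.1# ≡⟨ F.Solver.solve 2 (λ o c → o F.Solver.:= (o F.Solver.:+ c) F.Solver.:- (F.Solver.con (ℤ.+ 0) F.Solver.:+ c)) refl F.1# (proj₁ (h x)) ⟩
              (F.1# F.+ proj₁ (h x)) F.- (F.0# F.+ proj₁ (h x))
                ≡⟨ cong₂ F._-_ (trans (cong (F._+ proj₁ (h x)) (sym (F.1^ k))) (trans (sym (proj₂ (h x) F.1#)) z′))
                               (trans (cong (F._+ proj₁ (h x)) (sym (F.zeroˡ _))) (trans (sym (proj₂ (h x) F.0#)) z)) ⟩
              F.0# F.- F.0# ≡⟨ F.-‿inverseʳ _ ⟩
              F.0# ∎)
              where open ≡-Reasoning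

          peel : ∀ {Q₁ : Point → Set} (q? : ∀ Q → Dec (Q₁ Q)) Rs c → (∀ Ss → Unique Ss → All Q₁ Ss → length Ss ℕ.≤ c) → Unique Rs →
            length Rs ℕ.≤ c ℕ.+ length (filter (λ Q → ¬? (q? Q)) Rs)
          peel q? Rs c h u = ℕ.≤-trans (ℕ.≤-reflexive (length-split q? Rs)) (ℕ.+-monoˡ-≤ _ (h (filter q? Rs) (Unique.filter⁺ q? u) (all-filter q? Rs)))

          pw : ∀ {f} → Deg≤ 1 f → Deg≤ k (f ^ k)
          pw {f} q = subst (λ z → Deg≤ z (f ^ k)) (ℕ.*-identityʳ k) (Deg≤-^ k q)

          b₁ : length Qs ℕ.≤ p ℕ.+ length L₁
          b₁ = peel x? Qs p (λ Ss u a → vertical F.0# Ss u a) uQ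
          b₂ : length L₁ ℕ.≤ p ℕ.* 1 ℕ.+ length L₂
          b₂ = peel y? L₁ (p ℕ.* 1) (zeros-bound 1 Y Deg-Y (λ x → F.1# , λ z → F.1≢0 (trans (sym (ev-Y (x , F.1#))) z))) u₁
          b₃ : length L₂ ℕ.≤ p ℕ.* k ℕ.+ length L₃
          b₃ = peel V? L₂ (p ℕ.* k) (zeros-bound k (power-sum k) (Deg-power-sum k₁) (not-constant (power-sum k) (λ x → ev (x , F.0#) (X ^ k) F.- F.1# , λ y →
                 value x y))) u₂
            where
            value : ∀ x y → ev (x , y) (power-sum k) ≡ y F.^ k F.+ (ev (x , F.0#) (X ^ k) F.- F.1#)
            value x y = trans (Hom.⟦+⟧ (evHom (x , y)) _ _) (trans (cong₂ F._+_ (trans (Hom.⟦+⟧ (evHom (x , y)) _ _) (cong₂ F._+_ (evX x y) (evY^ x y))) (trans (Hom.⟦-⟧ (evHom (x , y)) 1#) (cong F.-_ (Hom.⟦1⟧ (evHom (x , y))))))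
              (F.Solver.solve 3 (λ a b c → (a F.Solver.:+ b) F.Solver.:- c F.Solver.:= b F.Solver.:+ (a F.Solver.:- c)) refl (ev (x , F.0#) (X ^ k)) (y F.^ k) F.1#))
              where
              evX : ∀ x y → ev (x , y) (X ^ k) ≡ ev (x , F.0#) (X ^ k)
              evX x y = trans (Hom.⟦^⟧ (evHom (x , y)) X k) (trans (cong (F._^ k) (trans (ev-X (x , y)) (sym (ev-X (x , F.0#))))) (sym (Hom.⟦^⟧ (evHom (x , F.0#)) X k)))
          b₄ : length L₃ ℕ.≤ p ℕ.* k ℕ.+ length L₄
          b₄ = peel yk? L₃ (p ℕ.* k) (zeros-bound k (Y ^ k - 1#) (Deg-+ (pw Deg-Y) (Deg-- (Deg-mono (s≤s z≤n) Deg-1))) (not-constant (Y ^ k - 1#) (λ x → F.- F.1# , λ y →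
                 trans (Hom.⟦+⟧ (evHom (x , y)) _ _) (cong₂ F._+_ (evY^ x y) (trans (Hom.⟦-⟧ (evHom (x , y)) 1#) (cong F.-_ (Hom.⟦1⟧ (evHom (x , y))))))))) u₃
          b₅ : length L₄ ℕ.≤ p ℕ.* k ℕ.+ length L₅
          b₅ = peel xy? L₄ (p ℕ.* k) (zeros-bound k (X ^ k + Y ^ k) (Deg-+ (pw Deg-X) (pw Deg-Y)) (not-constant (X ^ k + Y ^ k) (λ x → ev (x , F.0#) (X ^ k) , λ y →
                 trans (Hom.⟦+⟧ (evHom (x , y)) _ _) (trans (cong₂ F._+_ (evX x y) (evY^ x y)) (F.+-comm _ _))))) u₄
            where
            evX : ∀ x y → ev (x , y) (X ^ k) ≡ ev (x , F.0#) (X ^ k)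
            evX x y = trans (Hom.⟦^⟧ (evHom (x , y)) X k) (trans (cong (F._^ k) (trans (ev-X (x , y)) (sym (ev-X (x , F.0#))))) (sym (Hom.⟦^⟧ (evHom (x , F.0#)) X k)))

          good : All (Good k) L₅
          good = All.map (λ {Q} ((((a , b) , c) , d) , e) → record { x≢0 = a ; y≢0 = λ z → b (trans (ev-Y Q) z) ; V≢0 = c ; y^k≢1 = d ; x^k+y^k = e })
            (All.zip (All.zip (All.zip (All.zip (
              filter⁺ (λ Q → ¬? (xy? Q)) (filter⁺ (λ Q → ¬? (yk? Q)) (filter⁺ (λ Q → ¬? (V? Q)) (filter⁺ (λ Q → ¬? (y? Q)) (all-filter (λ Q → ¬? (x? Q)) Qs))))
              , filter⁺ (λ Q → ¬? (xy? Q)) (filter⁺ (λ Q → ¬? (yk? Q)) (filter⁺ (λ Q → ¬? (V? Q)) (all-filter (λ Q → ¬? (y? Q)) L₁))))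
              , filter⁺ (λ Q → ¬? (xy? Q)) (filter⁺ (λ Q → ¬? (yk? Q)) (all-filter (λ Q → ¬? (V? Q)) L₂)))
              , filter⁺ (λ Q → ¬? (xy? Q)) (all-filter (λ Q → ¬? (yk? Q)) L₃))
              , all-filter (λ Q → ¬? (xy? Q)) L₄))

          zs₅ : All (λ Q → ev Q f₀ ≡ F.0#) L₅
          zs₅ = filter⁺ (λ Q → ¬? (xy? Q)) (filter⁺ (λ Q → ¬? (yk? Q)) (filter⁺ (λ Q → ¬? (V? Q)) (filter⁺ (λ Q → ¬? (y? Q)) (filter⁺ (λ Q → ¬? (x? Q)) zs))))

          total : length Qs ℕ.≤ 5 ℕ.* (k ℕ.* p) ℕ.+ length L₅
          total = begin
            length Qs ≤⟨ ℕ.≤-trans b₁ (ℕ.+-monoʳ-≤ p (ℕ.≤-trans b₂ (ℕ.+-monoʳ-≤ (p ℕ.* 1) (ℕ.≤-trans b₃ (ℕ.+-monoʳ-≤ (p ℕ.* k) (ℕ.≤-trans b₄ (ℕ.+-monoʳ-≤ (p ℕ.* k) b₅))))))) ⟩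
            p ℕ.+ (p ℕ.* 1 ℕ.+ (p ℕ.* k ℕ.+ (p ℕ.* k ℕ.+ (p ℕ.* k ℕ.+ length L₅))))
              ≤⟨ ℕ.+-mono-≤ (≤-*1 p (s≤s z≤n)) (ℕ.+-monoˡ-≤ _ (ℕ.*-monoʳ-≤ p (s≤s z≤n))) ⟩
            p ℕ.* k ℕ.+ (p ℕ.* k ℕ.+ (p ℕ.* k ℕ.+ (p ℕ.* k ℕ.+ (p ℕ.* k ℕ.+ length L₅))))
              ≡⟨ ℕS.solve 3 (λ p k l → p ℕS.:* k ℕS.:+ (p ℕS.:* k ℕS.:+ (p ℕS.:* k ℕS.:+ (p ℕS.:* k ℕS.:+ (p ℕS.:* k ℕS.:+ l)))) ℕS.:= ℕS.con 5 ℕS.:* (k ℕS.:* p) ℕS.:+ l) refl p k (length L₅) ⟩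
            5 ℕ.* (k ℕ.* p) ℕ.+ length L₅ ∎
            where open ℕ.≤-Reasoning

      count : ∀ Qs → Unique Qs → All (λ Q → ev Q f₀ ≡ F.0#) Qs → length Qs ℕ.* m ℕ.≤ 6 ℕ.* (d ℕ.* p) ℕ.+ 9 ℕ.* (k ℕ.* (p ℕ.* m))
      count Qs uQ zs = begin
        length Qs ℕ.* m ≤⟨ ℕ.*-monoˡ-≤ m total ⟩
        (5 ℕ.* (k ℕ.* p) ℕ.+ length L₅) ℕ.* m ≡⟨ ℕ.*-distribʳ-+ m (5 ℕ.* (k ℕ.* p)) (length L₅) ⟩
        5 ℕ.* (k ℕ.* p) ℕ.* m ℕ.+ length L₅ ℕ.* m ≤⟨ ℕ.+-monoʳ-≤ (5 ℕ.* (k ℕ.* p) ℕ.* m) (good-count L₅ u₅ good zs₅) ⟩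
        5 ℕ.* (k ℕ.* p) ℕ.* m ℕ.+ (6 ℕ.* (d ℕ.* p) ℕ.+ 4 ℕ.* (k ℕ.* (p ℕ.* m)))
          ≡⟨ ℕS.solve 4 (λ k p m x → ℕS.con 5 ℕS.:* (k ℕS.:* p) ℕS.:* m ℕS.:+ (x ℕS.:+ ℕS.con 4 ℕS.:* (k ℕS.:* (p ℕS.:* m))) ℕS.:= x ℕS.:+ ℕS.con 9 ℕS.:* (k ℕS.:* (p ℕS.:* m))) refl k p m (6 ℕ.* (d ℕ.* p)) ⟩
        6 ℕ.* (d ℕ.* p) ℕ.+ 9 ℕ.* (k ℕ.* (p ℕ.* m)) ∎
        where
        open ℕ.≤-Reasoning
        open Peel Qs uQ zs

-- The choice of m.

open import Defs
open import Data.Nat using (_+_; _*_; _^_; _≤_; _<_; _%_; _/_)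
open import Data.Nat.Properties
open import Data.Nat.Divisibility using (_∣_)
open import Data.Nat.DivMod using (m≡m%n+[m/n]*n; m/n*n≡m)
open import Data.Nat.GCD using (gcd; gcd[m,n]∣m; gcd[m,n]∣n; gcd[m,n]≡0⇒m≡0)
open import Data.Sum using () renaming (map to map⊎)

open ℕS using (solve; _:=_; _:+_; _:*_; con)

maximal : (Φ : ℕ → Set) → (∀ m → Dec (Φ m)) → ∀ B → (∀ m → Φ m → m ≤ B) → Φ 0 → ∃ λ m → Φ m × ¬ Φ (suc m)
maximal Φ Φ? B bd z = go B 0 z (≤-reflexive (sym (+-identityʳ B)))
  where
  go : ∀ t m → Φ m → B ≤ t + m → ∃ λ m → Φ m × ¬ Φ (suc m)
  go zero    m φ q = m , φ , λ φ′ → <⇒≱ (s≤s q) (bd (suc m) φ′)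
  go (suc t) m φ q = next (Φ? (suc m))
    where
    next : Dec (Φ (suc m)) → ∃ λ m → Φ m × ¬ Φ (suc m)
    next (yes φ′) = go t (suc m) φ′ (≤-trans q (≤-reflexive (sym (+-suc t m))))
    next (no ¬φ)  = m , φ , ¬φ

*-small : ∀ m r n → m * m ≤ n → r * r ≤ n → m * r ≤ n
*-small m r n a b = [ (λ m≤r → ≤-trans (*-monoˡ-≤ r m≤r) b) , (λ r≤m → ≤-trans (*-monoʳ-≤ m r≤m) a) ]′ (≤-total m r)

-- The largest admissible m fails one condition at m + 1. Failure of a m² ≤ n means that m is of
-- order √n and yields the first alternative; failure of b m³ d ≤ p means that m is of order (p /
-- d)^(1/3) and yields the second.
module Optimisation (a b c p k n d r N₀ : ℕ) (1≤a : 1 ≤ a) (1≤p : 1 ≤ p) (1≤n : 1 ≤ n) (1≤r : 1 ≤ r) (rd≡kn : r * d ≡ k * n) (r-small : 4 * (r * r) ≤ n)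
  (c-large₁ : 4 * a * (15 * 15) ≤ c) (c-large₂ : 8 * b * (15 * 15 * 15) ≤ c) (1≤c : 1 ≤ c)
  (all-points : N₀ ≤ p * p) (trivial : d < p → N₀ ≤ d * p)
  (count : d < p → ∀ m → 1 ≤ m → a * (m * m) ≤ n → b * (m * m * m * d) ≤ p → N₀ * m ≤ 6 * (d * p) + 9 * (k * (p * m))) where
  private
    Φ : ℕ → Set
    Φ m = a * (m * m) ≤ n × b * (m * m * m * d) ≤ p

    Φ? : ∀ m → Dec (Φ m)
    Φ? m = (a * (m * m) ≤? n) ×-dec (b * (m * m * m * d) ≤? p)

    m≤m² : ∀ m → m ≤ m * m
    m≤m² zero    = z≤n
    m≤m² (suc m) = m≤n*m (suc m) (suc m)

    square≤ : ∀ m → a * (m * m) ≤ n → m * m ≤ n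
    square≤ m q = ≤-trans (m≤n*m (m * m) a {{ℕ.>-nonZero 1≤a}}) q

    Φ-0 : Φ 0
    Φ-0 = ≤-trans (≤-reflexive (*-zeroʳ a)) z≤n , ≤-trans (≤-reflexive (*-zeroʳ b)) z≤n

    -- M is the factor gained over the trivial bound d p.
    Saving : Set
    Saving = ∃ λ M → N₀ * M ≤ 15 * (d * p) × (n ≤ 4 * a * (M * M) ⊎ p ≤ 8 * b * (M * M * M * d))

    open ≤-Reasoning

    next : ∀ m → ¬ Φ (suc m) → n ≤ a * (suc m * suc m) ⊎ p ≤ b * (suc m * suc m * suc m * d)
    next m ¬φ = test (a * (suc m * suc m) ≤? n)
      where
      test : Dec (a * (suc m * suc m) ≤ n) → n ≤ a * (suc m * suc m) ⊎ p ≤ b * (suc m * suc m * suc m * d)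
      test (no q)  = inj₁ (<⇒≤ (≰⇒> q))
      test (yes q) = inj₂ (<⇒≤ (≰⇒> (λ q′ → ¬φ (q , q′))))

    double : ∀ m M → suc m ≤ 2 * M → n ≤ a * (suc m * suc m) ⊎ p ≤ b * (suc m * suc m * suc m * d) → n ≤ 4 * a * (M * M) ⊎ p ≤ 8 * b * (M * M * M * d)
    double m M le (inj₁ q) = inj₁ (≤-trans q (begin
      a * (suc m * suc m)                  ≤⟨ *-monoʳ-≤ a (*-mono-≤ le le) ⟩
      a * (2 * M * (2 * M))                ≡⟨ solve 2 (λ a M → a :* (con 2 :* M :* (con 2 :* M)) := con 4 :* a :* (M :* M)) refl a M ⟩
      4 * a * (M * M)                      ∎))
    double m M le (inj₂ q) = inj₂ (≤-trans q (begin
      b * (suc m * suc m * suc m * d)      ≤⟨ *-monoʳ-≤ b (*-monoˡ-≤ d (*-mono-≤ (*-mono-≤ le le) le)) ⟩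
      b * (2 * M * (2 * M) * (2 * M) * d)  ≡⟨ solve 3 (λ b M d → b :* (con 2 :* M :* (con 2 :* M) :* (con 2 :* M) :* d) := con 8 :* b :* (M :* M :* M :* d)) refl b M d ⟩
      8 * b * (M * M * M * d)              ∎))

    saving : d < p → Saving
    saving d<p = choose (maximal Φ Φ? n (λ m φ → ≤-trans (m≤m² m) (square≤ m (proj₁ φ))) Φ-0)
      where
      choose : (∃ λ m → Φ m × ¬ Φ (suc m)) → Saving
      -- If not even m = 1 is admissible, the trivial bound d p counts as a saving by the factor 1.
      choose (zero , _ , ¬φ) = 1 , (begin
          N₀ * 1               ≡⟨ *-identityʳ N₀ ⟩
          N₀                   ≤⟨ trivial d<p ⟩
          d * p                ≤⟨ m≤n*m (d * p) 15 ⟩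
          15 * (d * p)         ∎) , double 0 1 (s≤s z≤n) (next 0 ¬φ)
      choose (suc m′ , (φ₁ , φ₂) , ¬φ) = m , (begin
          N₀ * m                                      ≤⟨ count d<p m (s≤s z≤n) φ₁ φ₂ ⟩
          6 * (d * p) + 9 * (k * (p * m))             ≡⟨ cong (λ z → 6 * (d * p) + 9 * z) (solve 3 (λ k p m → k :* (p :* m) := k :* m :* p) refl k p m) ⟩
          6 * (d * p) + 9 * (k * m * p)               ≤⟨ +-monoʳ-≤ (6 * (d * p)) (*-monoʳ-≤ 9 (*-monoˡ-≤ p km≤d)) ⟩
          6 * (d * p) + 9 * (d * p)                   ≡⟨ sym (*-distribʳ-+ (d * p) 6 9) ⟩
          15 * (d * p)                                ∎) , double m m sm≤2m (next m ¬φ)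
        where
        m : ℕ
        m = suc m′
        sm≤2m : suc m ≤ 2 * m
        sm≤2m = ≤-trans (+-monoˡ-≤ m (s≤s z≤n)) (≤-reflexive (cong (m +_) (sym (+-identityʳ m))))
        mr≤n : m * r ≤ n
        mr≤n = *-small m r n (square≤ m φ₁) (≤-trans (m≤n*m (r * r) 4) r-small)
        -- Here the smallness of r enters: m and r are both at most √n, so m r ≤ n, and k n = r d.
        -- The term 9 k p m thus joins 6 d p, which gives the factor 15.
        km≤d : k * m ≤ d
        km≤d = *-cancelˡ-≤ r {{ℕ.>-nonZero 1≤r}} (begin
          r * (k * m)     ≡⟨ solve 3 (λ r k m → r :* (k :* m) := k :* (m :* r)) refl r k m ⟩
          k * (m * r)     ≤⟨ *-monoʳ-≤ k mr≤n ⟩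
          k * n           ≡⟨ sym rd≡kn ⟩
          r * d           ∎)

    Result : Set
    Result = r * r * (N₀ * N₀) ≤ c * (k * k * n * (p * p)) ⊎ r * r * (r * r) * (N₀ * N₀ * N₀) ≤ c * ((k * n) * (k * n) * ((k * n) * (k * n)) * (p * p))

    second : N₀ * N₀ * N₀ ≤ c * (d * d * (d * d) * (p * p)) → Result
    second q = inj₂ (begin
      r * r * (r * r) * (N₀ * N₀ * N₀)                            ≤⟨ *-monoʳ-≤ (r * r * (r * r)) q ⟩
      r * r * (r * r) * (c * (d * d * (d * d) * (p * p)))         ≡⟨ rearrange r d (p * p) c ⟩
      c * ((r * d) * (r * d) * ((r * d) * (r * d)) * (p * p))     ≡⟨ cong (λ z → c * (z * z * (z * z) * (p * p))) rd≡kn ⟩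
      c * ((k * n) * (k * n) * ((k * n) * (k * n)) * (p * p))     ∎)
      where
      rearrange : ∀ r d q c → r * r * (r * r) * (c * (d * d * (d * d) * q)) ≡ c * ((r * d) * (r * d) * ((r * d) * (r * d)) * q)
      rearrange = solve 4 (λ r d q c → r :* r :* (r :* r) :* (c :* (d :* d :* (d :* d) :* q)) := c :* ((r :* d) :* (r :* d) :* ((r :* d) :* (r :* d)) :* q)) refl

    from-saving : Saving → Result
    from-saving (M , NM , inj₁ q) = inj₁ (*-cancelˡ-≤ n {{ℕ.>-nonZero 1≤n}} (begin
      n * (r * r * (N₀ * N₀))                              ≤⟨ *-monoˡ-≤ (r * r * (N₀ * N₀)) q ⟩
      4 * a * (M * M) * (r * r * (N₀ * N₀))                ≡⟨ e₁ (4 * a) M r N₀ ⟩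
      4 * a * (r * r * ((N₀ * M) * (N₀ * M)))              ≤⟨ *-monoʳ-≤ (4 * a) (*-monoʳ-≤ (r * r) (*-mono-≤ NM NM)) ⟩
      4 * a * (r * r * (15 * (d * p) * (15 * (d * p))))    ≡⟨ e₂ (4 * a) 15 r d p ⟩
      4 * a * (15 * 15) * ((r * d) * (r * d) * (p * p))    ≤⟨ *-monoˡ-≤ _ c-large₁ ⟩
      c * ((r * d) * (r * d) * (p * p))                    ≡⟨ cong (λ z → c * (z * z * (p * p))) rd≡kn ⟩
      c * ((k * n) * (k * n) * (p * p))                    ≡⟨ e₃ c k n p ⟩
      n * (c * (k * k * n * (p * p)))                      ∎))
      where
      e₁ : ∀ c M r N → c * (M * M) * (r * r * (N * N)) ≡ c * (r * r * ((N * M) * (N * M)))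
      e₁ = solve 4 (λ c M r N → c :* (M :* M) :* (r :* r :* (N :* N)) := c :* (r :* r :* ((N :* M) :* (N :* M)))) refl
      e₂ : ∀ c f r d p → c * (r * r * (f * (d * p) * (f * (d * p)))) ≡ c * (f * f) * ((r * d) * (r * d) * (p * p))
      e₂ = solve 5 (λ c f r d p → c :* (r :* r :* (f :* (d :* p) :* (f :* (d :* p)))) := c :* (f :* f) :* ((r :* d) :* (r :* d) :* (p :* p))) refl
      e₃ : ∀ c k n p → c * ((k * n) * (k * n) * (p * p)) ≡ n * (c * (k * k * n * (p * p)))
      e₃ = solve 4 (λ c k n p → c :* ((k :* n) :* (k :* n) :* (p :* p)) := n :* (c :* (k :* k :* n :* (p :* p)))) refl
    from-saving (M , NM , inj₂ q) = second (*-cancelˡ-≤ p {{ℕ.>-nonZero 1≤p}} (begin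
      p * (N₀ * N₀ * N₀)                                                ≤⟨ *-monoˡ-≤ (N₀ * N₀ * N₀) q ⟩
      8 * b * (M * M * M * d) * (N₀ * N₀ * N₀)                          ≡⟨ e₁ (8 * b) M d N₀ ⟩
      8 * b * (d * ((N₀ * M) * (N₀ * M) * (N₀ * M)))                    ≤⟨ *-monoʳ-≤ (8 * b) (*-monoʳ-≤ d (*-mono-≤ (*-mono-≤ NM NM) NM)) ⟩
      8 * b * (d * (15 * (d * p) * (15 * (d * p)) * (15 * (d * p))))    ≡⟨ e₂ (8 * b) 15 d p ⟩
      p * (8 * b * (15 * 15 * 15) * (d * d * (d * d) * (p * p)))        ≤⟨ *-monoʳ-≤ p (*-monoˡ-≤ _ c-large₂) ⟩
      p * (c * (d * d * (d * d) * (p * p)))                             ∎))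
      where
      e₁ : ∀ c M d N → c * (M * M * M * d) * (N * N * N) ≡ c * (d * ((N * M) * (N * M) * (N * M)))
      e₁ = solve 4 (λ c M d N → c :* (M :* M :* M :* d) :* (N :* N :* N) := c :* (d :* ((N :* M) :* (N :* M) :* (N :* M)))) refl
      e₂ : ∀ c f d p → c * (d * (f * (d * p) * (f * (d * p)) * (f * (d * p)))) ≡ p * (c * (f * f * f) * (d * d * (d * d) * (p * p)))
      e₂ = solve 4 (λ c f d p → c :* (d :* (f :* (d :* p) :* (f :* (d :* p)) :* (f :* (d :* p)))) := p :* (c :* (f :* f :* f) :* (d :* d :* (d :* d) :* (p :* p)))) refl

  bound : r * r * (N₀ * N₀) ≤ c * (k * k * n * (p * p)) ⊎ r * r * (r * r) * (N₀ * N₀ * N₀) ≤ c * ((k * n) * (k * n) * ((k * n) * (k * n)) * (p * p))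
  bound = go (d <? p)
    where
    go : Dec (d < p) → Result
    go (yes q) = from-saving (saving q)
    -- For p ≤ d the whole plane has few enough points: p⁶ ≤ d⁴ p².
    go (no q)  = second (begin
      N₀ * N₀ * N₀                          ≤⟨ *-mono-≤ (*-mono-≤ all-points all-points) all-points ⟩
      p * p * (p * p) * (p * p)             ≤⟨ *-monoˡ-≤ (p * p) (*-mono-≤ (*-mono-≤ p≤d p≤d) (*-mono-≤ p≤d p≤d)) ⟩
      d * d * (d * d) * (p * p)             ≤⟨ m≤n*m _ c {{ℕ.>-nonZero 1≤c}} ⟩
      c * (d * d * (d * d) * (p * p))       ∎)
      where
      p≤d : p ≤ d
      p≤d = ≮⇒≥ q

-- From congruences between natural numbers to points of the plane.

unique-map : ∀ {A B : Set} (f : A → B) xs → (∀ {x y} → x ∈ xs → y ∈ xs → f x ≡ f y → x ≡ y) → Unique xs → Unique (map f xs)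
unique-map f []       inj []       = []
unique-map f (x ∷ xs) inj (n ∷ u) = map⁺ (All.tabulate (λ {y} y∈ e → All.lookup n y∈ (inj (here refl) (there y∈) e))) ∷ unique-map f xs (λ a b → inj (there a) (there b)) u

Equation : (p k n k′ n′ : ℕ) → ℕ × ℕ → Set
Equation p k n k′ n′ (x , y) = ((x ^ n + y ^ n + (p ∸ 1)) ^ k′) mod p ≡ ((x ^ k + y ^ k + (p ∸ 1)) ^ n′) mod p

module Reduction (K : PrimeField) (P : Plane K) where
  private module F = PrimeField K
  open F using (p)
  open PlaneTheory K P using (ev; evHom; ev-X; ev-Y; Point; X; Y) renaming (_^_ to _^A_)
  open FermatPolynomials K P
  open ≡-Reasoning

  toPoint : ℕ × ℕ → Point
  toPoint (x , y) = F.nat x , F.nat y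

  nat-^ : ∀ x j → F.nat (x ^ j) ≡ F.nat x F.^ j
  nat-^ x zero    = F.nat-1
  nat-^ x (suc j) = trans (F.nat-* x (x ^ j)) (cong (F.nat x F.*_) (nat-^ x j))

  nat-p∸1 : F.nat (p ∸ 1) ≡ F.- F.1#
  nat-p∸1 = F.x-y≡0⇒x≡y (begin
    F.nat (p ∸ 1) F.- (F.- F.1#)   ≡⟨ cong (F.nat (p ∸ 1) F.+_) (trans (F.-‿involutive F.1#) (sym F.nat-1)) ⟩
    F.nat (p ∸ 1) F.+ F.nat 1      ≡⟨ sym (F.nat-+ (p ∸ 1) 1) ⟩
    F.nat (p ∸ 1 + 1)              ≡⟨ cong F.nat (m∸n+n≡m (<⇒≤ F.1<p)) ⟩
    F.nat p                        ≡⟨ F.nat-p ⟩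
    F.0#                           ∎)

  nat-mod : ∀ a → F.nat (a mod p) ≡ F.nat a
  nat-mod a = at p refl
    where
    at : ∀ q → p ≡ q → F.nat (a mod q) ≡ F.nat a
    at zero    _ = refl
    at (suc q) e = sym (begin
      F.nat a                                                        ≡⟨ cong F.nat (m≡m%n+[m/n]*n a (suc q)) ⟩
      F.nat (a % suc q + (a / suc q) * suc q)                        ≡⟨ trans (F.nat-+ (a % suc q) _) (cong (F.nat (a % suc q) F.+_) (F.nat-* (a / suc q) (suc q))) ⟩
      F.nat (a % suc q) F.+ F.nat (a / suc q) F.* F.nat (suc q)      ≡⟨ cong (λ z → F.nat (a % suc q) F.+ F.nat (a / suc q) F.* z) (trans (cong F.nat (sym e)) F.nat-p) ⟩
      F.nat (a % suc q) F.+ F.nat (a / suc q) F.* F.0#               ≡⟨ trans (cong (F.nat (a % suc q) F.+_) (F.zeroʳ _)) (F.+-identityʳ _) ⟩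
      F.nat (a % suc q)                                              ∎)

  ev-power-sum : ∀ N x y → ev (toPoint (x , y)) (power-sum N) ≡ F.nat (x ^ N + y ^ N + (p ∸ 1))
  ev-power-sum N x y = begin
    ev Q (power-sum N) ≡⟨ trans (H.⟦+⟧ _ _) (cong₂ F._+_ (H.⟦+⟧ _ _) (trans (H.⟦-⟧ _) (cong F.-_ H.⟦1⟧))) ⟩
    (ev Q (X ^A N) F.+ ev Q (Y ^A N)) F.- F.1#
      ≡⟨ cong₂ F._+_ (cong₂ F._+_ (trans (H.⟦^⟧ X N) (trans (cong (F._^ N) (ev-X Q)) (sym (nat-^ x N)))) (trans (H.⟦^⟧ Y N) (trans (cong (F._^ N) (ev-Y Q)) (sym (nat-^ y N))))) (sym nat-p∸1) ⟩
    (F.nat (x ^ N) F.+ F.nat (y ^ N)) F.+ F.nat (p ∸ 1) ≡⟨ sym (trans (F.nat-+ (x ^ N + y ^ N) (p ∸ 1)) (cong (F._+ F.nat (p ∸ 1)) (F.nat-+ (x ^ N) (y ^ N)))) ⟩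
    F.nat (x ^ N + y ^ N + (p ∸ 1)) ∎
    where
    Q = toPoint (x , y)
    module H = Hom (evHom Q)

  ev-zero : ∀ k n k′ n′ xy → Equation p k n k′ n′ xy → ev (toPoint xy) (fermat-difference k n k′ n′) ≡ F.0#
  ev-zero k n k′ n′ (x , y) eq = begin
    ev Q (fermat-difference k n k′ n′) ≡⟨ trans (H.⟦+⟧ _ _) (cong (ev Q (power-sum n ^A k′) F.+_) (H.⟦-⟧ _)) ⟩
    ev Q (power-sum n ^A k′) F.- ev Q (power-sum k ^A n′) ≡⟨ cong₂ F._-_ (side n k′) (side k n′) ⟩
    F.nat (s n ^ k′) F.- F.nat (s k ^ n′)
      ≡⟨ F.x≡y⇒x-y≡0 (trans (sym (nat-mod (s n ^ k′))) (trans (cong F.nat eq) (nat-mod (s k ^ n′)))) ⟩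
    F.0# ∎
    where
    Q = toPoint (x , y)
    module H = Hom (evHom Q)
    s : ℕ → ℕ
    s N = x ^ N + y ^ N + (p ∸ 1)
    side : ∀ N j → ev Q (power-sum N ^A j) ≡ F.nat (s N ^ j)
    side N j = trans (H.⟦^⟧ (power-sum N) j) (trans (cong (F._^ j) (ev-power-sum N x y)) (sym (nat-^ (s N) j)))

  equation-bound : ∀ c → 4 * 1600 * (15 * 15) ≤ c → 8 * 64 * (15 * 15 * 15) ≤ c → 1 ≤ c →
    ∀ k n k′ n′ r → k < n → 1 ≤ k → 1 ≤ k′ → 1 ≤ n′ → k′ * r ≡ k → n′ * r ≡ n → 4 * (r * r) ≤ n →
    (xs : List (ℕ × ℕ)) → Unique xs → (∀ {xy} → xy ∈ xs → proj₁ xy < p × proj₂ xy < p) → All (Equation p k n k′ n′) xs → length xs ≤ p * p →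
    r * r * (length xs * length xs) ≤ c * (k * k * n * (p * p))
      ⊎ r * r * (r * r) * (length xs * length xs * length xs) ≤ c * ((k * n) * (k * n) * ((k * n) * (k * n)) * (p * p))
  equation-bound c c₁ c₂ 1≤c (suc k₁) n (suc k″) (suc n″) r k<n _ _ _ k′r n′r r-small xs uxs in-range eqs len =
      at (n ∸ suc (suc k₁)) (trans (cong suc (+-suc k₁ (n ∸ suc (suc k₁)))) (m+[n∸m]≡n k<n))
    where
    Bound : ℕ → Set
    Bound n = r * r * (length xs * length xs) ≤ c * (suc k₁ * suc k₁ * n * (p * p))
      ⊎ r * r * (r * r) * (length xs * length xs * length xs) ≤ c * ((suc k₁ * n) * (suc k₁ * n) * ((suc k₁ * n) * (suc k₁ * n)) * (p * p))
    at : ∀ h₁ → suc (k₁ + suc h₁) ≡ n → Bound n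
    at h₁ refl = Optimisation.bound 1600 64 c p M.k M.n M.d r (length xs) (s≤s z≤n) (<⇒≤ F.1<p) (s≤s z≤n) (positive r k′r) rd≡kn r-small c₁ c₂ 1≤c len
        (λ d<p → subst (_≤ M.d * p) len≡ (M.trivial-count k′n≡n′k d<p Qs uQs zs))
        (λ d<p m 1≤m a b → subst (λ z → z * m ≤ 6 * (M.d * p) + 9 * (M.k * (p * m))) len≡ (M.count k′n≡n′k d<p m 1≤m a b Qs uQs zs))
      where
      module M = FermatCurve K P k₁ h₁ k″ n″
      positive : ∀ r → suc k″ * r ≡ suc k₁ → 1 ≤ r
      positive zero    e with trans (sym (*-zeroʳ (suc k″))) e
      ... | ()
      positive (suc r) e = s≤s z≤n
      k′n≡n′k : M.k′ * M.n ≡ M.n′ * M.k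
      k′n≡n′k = trans (cong (M.k′ *_) (sym n′r)) (trans (ℕS.solve 3 (λ a b r → a ℕS.:* (b ℕS.:* r) ℕS.:= b ℕS.:* (a ℕS.:* r)) refl M.k′ M.n′ r) (cong (M.n′ *_) k′r))
      rd≡kn : r * M.d ≡ M.k * M.n
      rd≡kn = trans (sym (*-assoc r M.k′ M.n)) (cong (_* M.n) (trans (*-comm r M.k′) k′r))
      Qs : List Point
      Qs = map toPoint xs
      len≡ : length Qs ≡ length xs
      len≡ = length-map toPoint xs
      uQs : Unique Qs
      uQs = unique-map toPoint xs (λ a b e → cong₂ _,_
        (F.nat-inj (proj₁ (in-range a)) (proj₁ (in-range b)) (cong proj₁ e)) (F.nat-inj (proj₂ (in-range a)) (proj₂ (in-range b)) (cong proj₂ e))) uxs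
      zs : All (λ Q → ev Q M.f₀ ≡ F.0#) Qs
      zs = map⁺ (All.map (λ {xy} → ev-zero M.k M.n M.k′ M.n′ xy) eqs)

-- The exponents k / r and n / r, and the exchange of k and n.

÷-*-cancel : ∀ m r → r ≢ 0 → r ∣ m → (m ÷ r) * r ≡ m
÷-*-cancel m zero    r≢0 _ = ⊥-elim (r≢0 refl)
÷-*-cancel m (suc r) _   q = m/n*n≡m q

factor-positive : ∀ {m} a b → 1 ≤ m → a * b ≡ m → 1 ≤ a
factor-positive zero    b q e = ⊥-elim (n≮0 (subst (1 ≤_) (sym e) q))
factor-positive (suc a) b q e = s≤s z≤n

length-cartesianProduct : ∀ {A B : Set} (xs : List A) (ys : List B) → length (cartesianProduct xs ys) ≡ length xs * length ys
length-cartesianProduct []       ys = refl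
length-cartesianProduct (x ∷ xs) ys = trans (length-++ (map (x ,_) ys)) (cong₂ _+_ (length-map (x ,_) ys) (length-cartesianProduct xs ys))

module Exponents (c : ℕ) (c₁ : 4 * 1600 * (15 * 15) ≤ c) (c₂ : 8 * 64 * (15 * 15 * 15) ≤ c) (1≤c : 1 ≤ c)
  (p k n : ℕ) (pr : Prime p) (1≤k : 1 ≤ k) (1≤n : 1 ≤ n) (r-small : 4 * (gcd k n * gcd k n) ≤ n) where
  private
    K = Residues.primeField p pr
    r = gcd k n
    xs : List (ℕ × ℕ)
    xs = filter (isZero? p k n) (cartesianProduct (upTo p) (upTo p))
    N₀ = length xs

    uxs : Unique xs
    uxs = Unique.filter⁺ (isZero? p k n) (Unique.cartesianProduct⁺ (Unique.upTo⁺ p) (Unique.upTo⁺ p))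

    in-range : ∀ {xy} → xy ∈ xs → proj₁ xy < p × proj₂ xy < p
    in-range {xy} i = ∈-upTo⁻ (proj₁ ij) , ∈-upTo⁻ (proj₂ ij)
      where
      ij : proj₁ xy ∈ upTo p × proj₂ xy ∈ upTo p
      ij = ∈-cartesianProduct⁻ (upTo p) (upTo p) (proj₁ (∈-filter⁻ (isZero? p k n) {xs = cartesianProduct (upTo p) (upTo p)} i))

    len : N₀ ≤ p * p
    len = ≤-trans (length-filter (isZero? p k n) (cartesianProduct (upTo p) (upTo p)))
      (≤-reflexive (trans (length-cartesianProduct (upTo p) (upTo p)) (cong₂ _*_ (length-upTo p) (length-upTo p))))

    zeros : All (IsZero p k n) xs
    zeros = all-filter (isZero? p k n) (cartesianProduct (upTo p) (upTo p))

    r≢0 : r ≢ 0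
    r≢0 e = <⇒≢ 1≤k (sym (gcd[m,n]≡0⇒m≡0 e))

    k′r : (k ÷ r) * r ≡ k
    k′r = ÷-*-cancel k r r≢0 (gcd[m,n]∣m k n)

    n′r : (n ÷ r) * r ≡ n
    n′r = ÷-*-cancel n r r≢0 (gcd[m,n]∣n k n)

    1≤k′ : 1 ≤ k ÷ r
    1≤k′ = factor-positive (k ÷ r) r 1≤k k′r

    1≤n′ : 1 ≤ n ÷ r
    1≤n′ = factor-positive (n ÷ r) r 1≤n n′r

  Bound : Set
  Bound = r * r * (N₀ * N₀) ≤ c * (k * k * n * (p * p))
    ⊎ r * r * (r * r) * (N₀ * N₀ * N₀) ≤ c * ((k * n) * (k * n) * ((k * n) * (k * n)) * (p * p))

  k<n-case : k < n → Bound
  k<n-case k<n = Reduction.equation-bound K (plane K) c c₁ c₂ 1≤c k n (k ÷ r) (n ÷ r) r k<n 1≤k 1≤k′ 1≤n′ k′r n′r r-small xs uxs in-range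
    (All.map (λ z → z) zeros) len

  n<k-case : n < k → Bound
  n<k-case n<k = map⊎
    (λ q → ≤-trans q (*-monoʳ-≤ c (*-monoˡ-≤ (p * p) nnk≤kkn)))
    (λ q → ≤-trans q (≤-reflexive (cong (λ z → c * (z * z * (z * z) * (p * p))) (*-comm n k))))
    (Reduction.equation-bound K (plane K) c c₁ c₂ 1≤c n k (n ÷ r) (k ÷ r) r n<k 1≤n 1≤n′ 1≤k′ n′r k′r (≤-trans r-small (<⇒≤ n<k)) xs uxs in-range
      (All.map (λ z → sym z) zeros) len)
    where
    -- The first alternative is not symmetric in k and n; for n < k the exchanged form is the
    -- stronger one.
    nnk≤kkn : n * n * k ≤ k * k * n
    nnk≤kkn = begin
      n * n * k  ≡⟨ ℕS.solve 2 (λ n k → n ℕS.:* n ℕS.:* k ℕS.:= n ℕS.:* k ℕS.:* n) refl n k ⟩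
      n * k * n  ≤⟨ *-monoˡ-≤ n (*-monoˡ-≤ k (<⇒≤ n<k)) ⟩
      k * k * n  ∎
      where open ≤-Reasoning

  bound : k ≢ n → Bound
  bound k≢n = cmp (<-cmp k n)
    where
    cmp : Tri (k < n) (k ≡ n) (n < k) → Bound
    cmp (tri< k<n _ _) = k<n-case k<n
    cmp (tri≈ _ k≡n _) = ⊥-elim (k≢n k≡n)
    cmp (tri> _ _ n<k) = n<k-case n<k

square : ∀ a → a ^ 2 ≡ a * a
square a = cong (a *_) (*-identityʳ a)

cube : ∀ a → a ^ 3 ≡ a * a * a
cube a = trans (cong (a *_) (square a)) (sym (*-assoc a a a))

fourth : ∀ a → a ^ 4 ≡ a * a * (a * a)
fourth a = trans (cong (λ z → a * (a * z)) (square a)) (sym (*-assoc a a (a * a)))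

-- Up to the constant, a bound by a sum of two terms is a bound by one of them. Squaring the first
-- alternative clears √n and cubing the second clears the exponents 4/3 and 2/3; 4 r² ≤ n stands for
-- r ≤ 0.5 √n.
theorem2p6 : ∃ λ (c : ℕ) →
    ∀ (p k n : ℕ) → Prime p →
    1 ≤ k → k < p → 1 ≤ n → n < p → ¬ (k ≡ n) →
    4 * (gcd k n ^ 2) ≤ n →
    (gcd k n ^ 2 * N p k n ^ 2 ≤ c * (k ^ 2 * n * p ^ 2))
      ⊎ (gcd k n ^ 4 * N p k n ^ 3 ≤ c * ((k * n) ^ 4 * p ^ 2))
theorem2p6 = constant , λ p k n pr 1≤k _ 1≤n _ k≢n small → map⊎
    (λ q → subst₂ _≤_ (sym (cong₂ _*_ (square (gcd k n)) (square (N p k n)))) (sym (cong₂ (λ a b → constant * (a * n * b)) (square k) (square p))) q)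
    (λ q → subst₂ _≤_ (sym (cong₂ _*_ (fourth (gcd k n)) (cube (N p k n)))) (sym (cong₂ (λ a b → constant * (a * b)) (fourth (k * n)) (square p))) q)
    (Exponents.bound constant (≤ᵇ⇒≤ _ _ tt) (≤ᵇ⇒≤ _ _ tt) (s≤s z≤n) p k n pr 1≤k 1≤n (subst (λ z → 4 * z ≤ n) (square (gcd k n)) small) k≢n)
  where
  -- This is 8 · 64 · 15³ = 120³, which also exceeds 4 · 1600 · 15², the value required by the first
  -- alternative.
  constant : ℕ
  constant = 1728000
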